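{- For each integer $s\ge 5$ there exists a real number $\beta_0(s)$ such that there is no tight $2s$-$(v,k,\lambda)$ design whose parameters satisfy $\beta > \beta_0(s)$, where $\beta = \dfrac{(v-k-s)\sqrt{(k-s+1)(k-s)}}{(v-2s+1)^{3/2}}$.
   Context: A $t$-$(v,k,\lambda)$ design (with $v\ge k\ge t$ positive integers and $\lambda\ge0$ an integer) is a pair $(V,\mathcal B)$ where $V$ is a $v$-set and $\mathcal B$ is a collection of $k$-subsets of $V$ (blocks) such that every $t$-subset of $V$ lies in exactly $\lambda$ blocks. For a positive integer $s$, a tight $2s$-design is a $2s$-$(v,k,\lambda)$ design with $v\ge k+s$ having exactly $\binom{v}{s}$ blocks. Equivalently, with $\alpha=\frac{(k-s+1)(k-s)}{v-2s+1}$ and $t=\frac{v-2s+1}{k-s+1}$, one has $\beta=(1-\frac1t)\sqrt{\alpha}$. -}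

module Defs where

open import Data.Nat using (ℕ; zero; suc; _+_; _*_; _∸_; _^_; _≤_; _<_)
open import Data.Nat.Combinatorics using (_C_)
open import Data.Fin.Subset using (Subset; _⊆_; ∣_∣)
open import Data.Fin.Subset.Properties using (_⊆?_)
open import Data.List using (List; length; filter)
open import Data.List.Membership.Propositional using (_∈_)
open import Relation.Binary.PropositionalEquality using (_≡_)

blocksContaining : ∀ {v} → Subset v → List (Subset v) → ℕ
blocksContaining T ℬ = length (filter (T ⊆?_) ℬ)

record IsDesign (t v k lam : ℕ) (ℬ : List (Subset v)) : Set where
  field
    t-pos    : 1 ≤ t
    t≤k      : t ≤ k
    k≤v      : k ≤ v
    blockSize : ∀ {B} → B ∈ ℬ → ∣ B ∣ ≡ k
    balanced : ∀ (T : Subset v) → ∣ T ∣ ≡ t → blocksContaining T ℬ ≡ lam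

record IsTightDesign (s v k lam : ℕ) (ℬ : List (Subset v)) : Set where
  field
    design : IsDesign (2 * s) v k lam ℬ
    v≥k+s  : k + s ≤ v
    size   : length ℬ ≡ v C s

-- β = (v-k-s) √((k-s+1)(k-s)) / (v-2s+1)^{3/2}.  For a natural b,
-- "β > b" ⇔ b² (v-2s+1)³ < (v-k-s)² (k-s+1)(k-s)  (both sides nonnegative;
-- all truncated subtractions are genuine since v ≥ k+s and k ≥ 2s).
βExceeds : ℕ → ℕ → ℕ → ℕ → Set
βExceeds b s v k =
  b * b * (v ∸ 2 * s + 1) ^ 3 < (v ∸ k ∸ s) * (v ∸ k ∸ s) * ((k ∸ s + 1) * (k ∸ s))

{-# OPTIONS --safe #-}
module Submission where

-- Fix a block B₀ of a tight 2s-design. The factorial moments of the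
-- intersection numbers |B₀ ∩ B| are prescribed up to order 2s, and Wilson's
-- kernel polynomial of degree s vanishes at all of them except k, so that they
-- take exactly s values x₁ < … < xₛ other than k. The moments satisfy
--   Σ_B (k - x)² G(x) = Σ_B x (v - 2k + x) G(x - 1),   x = |B₀ ∩ B|,
-- for polynomials G of low degree. Testing this on products of linear factors
-- gives a Bethe equation: at every root x of p = Π (X - xᵢ),
--   (k - x)(k - 1 - x) p(x + 1) + x (v - 2k + x) p(x - 1) = 0.
-- Centred at k (k - 1) / (v - 1), the roots grow like the standard deviation
-- R of the hypergeometric distribution, which is large when β is. Divided by R
-- they tend to the zeros of a Hermite polynomial (in the form of Stieltjes'
-- relations Σ_{j ≠ i} 1 / (yᵢ - yⱼ) ~ yᵢ), and the sums W of opposite roots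
-- tend to an affine function, of slope at most 1/3, of the squares of these
-- zeros. But differences of the W are integers. If they are not all 0, the
-- squares of the positive zeros are spaced by at least 3, which Stieltjes'
-- relations exclude for s ≥ 5 (for s = 6 one needs that, in addition, the ratio
-- of the two gaps is a ratio of small integers). So the roots are symmetric
-- once R is large. Then the two coefficients of the Bethe equation are
-- exchanged by the symmetry, and comparing their zeros gives |v - 2k| = 1.
-- Finally, v - s and v - s - 1 divide k (k - 1) ⋯ (k - 2s + 1), which bounds v
-- if |v - 2k| ≤ 1.

open import Defs
open import Data.Bool.Base using (true; false; if_then_else_)
open import Data.Empty using (⊥; ⊥-elim)
open import Data.Fin.Base using (Fin; zero; suc)
open import Data.Fin.Subset using (Subset; Side; inside; outside; _∩_) renaming (∣_∣ to card; ⊥ to empty)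
open import Data.Fin.Subset.Properties using (_⊆?_; ∣⊥∣≡0; ∣p∩q∣≤∣p∣; ∩-idem)
import Data.Integer.Base as ℤ
import Data.Integer.Properties as ℤ
import Data.Integer.Tactic.RingSolver as ℤ-Solver
open import Data.List.Base using (List; []; _∷_; length)
open import Data.List.Membership.Propositional using (_∈_; lose; find)
open import Data.List.Relation.Unary.Any using (Any; here; there; any?)
open import Data.Nat.Base as ℕ using (ℕ; zero; suc; s≤s; z≤n; _!)
open import Data.Nat.Combinatorics using (nCk≡n!/k![n-k]!; k![n∸k]!∣n!)
import Data.Nat.Combinatorics.Base as ℕ using (_C_)
open import Data.Nat.Combinatorics.Base using (_P′_)
open import Data.Nat.Divisibility using (∣⇒≤; divides; _∣_; ∣-trans; m∣m*n; n∣m*n)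
open import Data.Nat.DivMod using (m/n*n≡m)
import Data.Nat.Properties as ℕ
import Data.Nat.Tactic.RingSolver as ℕ-Solver
open import Data.Product using (∃; Σ; _×_; _,_; proj₁; proj₂)
open import Data.Rational.Base as ℚ
  using (ℚ; 0ℚ; 1ℚ; ½; _+_; _*_; _-_; -_; 1/_; ∣_∣; _≤_; _<_; nonNegative; positive; ≢-nonZero)
import Data.Rational.Properties as ℚ
import Data.Rational.Unnormalised.Base as ℚᵘ
import Data.Rational.Unnormalised.Properties as ℚᵘ
open import Data.Sum using (_⊎_; inj₁; inj₂; [_,_]′)
open import Data.Vec.Base using ([]; _∷_; lookup; _[_]≔_)
open import Function.Base using (_∘_; id)
open import Level using (0ℓ)
open import Relation.Binary.Definitions using (tri<; tri≈; tri>)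
open import Relation.Binary.PropositionalEquality
  using (_≡_; _≢_; refl; sym; trans; cong; cong₂; subst; subst₂; module ≡-Reasoning)
open import Relation.Nullary using (¬_; Dec; yes; no; contradiction)
open import Relation.Nullary.Decidable using (dec⇒maybe; does; from-yes)
open import Tactic.RingSolver using (solve-∀)
open import Tactic.RingSolver.Core.AlmostCommutativeRing using (AlmostCommutativeRing; fromCommutativeRing)

-- To leading order the nodes imitate the zeros of a Hermite polynomial. These are symmetric for all
-- parameters, so the leading order alone rules out nothing. The information sits one order below:
-- the Bethe equation carries a skewness `lam` = ((v - 2k)² - 1) / (v - 1)², which shifts the sum
-- `W` of two opposite nodes by an amount of order 1, exactly the scale on which integrality is
-- felt. To compute the shift, the linearised Stieltjes relations must be inverted. A maximum
-- principle bounds the inverse, and the equation for `W` has a closed solution because, to leading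
-- order, Y² and the constants span an invariant space, with eigenvalue 3 κ on Y² modulo constants;
-- this is the origin of the slope `lam` / 3. No limit is ever taken. Every remainder is an explicit
-- rational expression, bounded uniformly in v and k once R is large. Uniformity matters because
-- `lam` may be arbitrarily small: whether the shifts vanish or not has to be decided by
-- integrality, not by the size of `lam`.

module Rationals where

  -- Rational arithmetic, a total reciprocal, finite sums and products

  ℚ-ring : AlmostCommutativeRing 0ℓ 0ℓ
  ℚ-ring = fromCommutativeRing ℚ.+-*-commutativeRing (λ p → dec⇒maybe (0ℚ ℚ.≟ p))

  ι : ℕ → ℚ
  ι zero    = 0ℚ
  ι (suc n) = 1ℚ + ι n

  private
    variable
      a b c d x y : ℚ
      n : ℕ

  ≤-by : 0ℚ ≤ x → b ≡ a + x → a ≤ b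
  ≤-by {x = x} {a = a} h refl = subst (_≤ a + x) (ℚ.+-identityʳ a) (ℚ.+-monoʳ-≤ a h)

  <-by : 0ℚ < x → b ≡ a + x → a < b
  <-by {x = x} {a = a} h refl = subst (_< a + x) (ℚ.+-identityʳ a) (ℚ.+-monoʳ-< a h)

  0≤- : a ≤ b → 0ℚ ≤ b - a
  0≤- {a} {b} h = subst (_≤ b - a) (ℚ.+-inverseʳ a) (ℚ.+-monoˡ-≤ (- a) h)

  0<- : a < b → 0ℚ < b - a
  0<- {a} {b} h = subst (_< b - a) (ℚ.+-inverseʳ a) (ℚ.+-monoˡ-< (- a) h)

  0≤+ : 0ℚ ≤ a → 0ℚ ≤ b → 0ℚ ≤ a + b
  0≤+ h k = ℚ.+-mono-≤ h k

  0<+ : 0ℚ < a → 0ℚ ≤ b → 0ℚ < a + b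
  0<+ h k = ℚ.+-mono-<-≤ h k

  0≤* : 0ℚ ≤ a → 0ℚ ≤ b → 0ℚ ≤ a * b
  0≤* {a} {b} h k = ℚ.nonNegative⁻¹ (a * b)
    {{ℚ.nonNeg*nonNeg⇒nonNeg a {{nonNegative h}} b {{nonNegative k}}}}

  0<* : 0ℚ < a → 0ℚ < b → 0ℚ < a * b
  0<* {a} {b} h k = ℚ.positive⁻¹ (a * b) {{ℚ.pos*pos⇒pos a {{positive h}} b {{positive k}}}}

  0≤² : ∀ a → 0ℚ ≤ a * a
  0≤² a with ℚ.≤-total 0ℚ a
  ... | inj₁ h = 0≤* h h
  ... | inj₂ h = subst (0ℚ ≤_) (neg² a) (0≤* (ℚ.neg-antimono-≤ h) (ℚ.neg-antimono-≤ h))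
    where
    neg² : ∀ a → - a * - a ≡ a * a
    neg² = solve-∀ ℚ-ring

  *-monoˡ : 0ℚ ≤ c → a ≤ b → c * a ≤ c * b
  *-monoˡ {c} h = ℚ.*-monoˡ-≤-nonNeg c {{nonNegative h}}

  *-monoʳ : 0ℚ ≤ c → a ≤ b → a * c ≤ b * c
  *-monoʳ {c} h = ℚ.*-monoʳ-≤-nonNeg c {{nonNegative h}}

  *-mono : 0ℚ ≤ a → 0ℚ ≤ d → a ≤ b → c ≤ d → a * c ≤ b * d
  *-mono 0≤a 0≤d a≤b c≤d = ℚ.≤-trans (*-monoˡ 0≤a c≤d) (*-monoʳ 0≤d a≤b)

  *-cancelˡ : 0ℚ < c → c * a ≤ c * b → a ≤ b
  *-cancelˡ {c} h = ℚ.*-cancelˡ-≤-pos c {{positive h}}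

  0≤1 : 0ℚ ≤ 1ℚ
  0≤1 = from-yes (0ℚ ℚ.≤? 1ℚ)

  0<1 : 0ℚ < 1ℚ
  0<1 = from-yes (0ℚ ℚ.<? 1ℚ)

  0≤ι : ∀ n → 0ℚ ≤ ι n
  0≤ι zero    = ℚ.≤-refl
  0≤ι (suc n) = 0≤+ 0≤1 (0≤ι n)

  0<ι : ∀ n → 0ℚ < ι (suc n)
  0<ι n = 0<+ 0<1 (0≤ι n)

  ι-+ : ∀ m n → ι (m ℕ.+ n) ≡ ι m + ι n
  ι-+ zero    n = sym (ℚ.+-identityˡ (ι n))
  ι-+ (suc m) n = trans (cong (1ℚ +_) (ι-+ m n)) (sym (ℚ.+-assoc 1ℚ (ι m) (ι n)))

  ι-* : ∀ m n → ι (m ℕ.* n) ≡ ι m * ι n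
  ι-* zero    n = sym (ℚ.*-zeroˡ (ι n))
  ι-* (suc m) n = trans (ι-+ n (m ℕ.* n)) (trans (cong (ι n +_) (ι-* m n)) (eq (ι m) (ι n)))
    where
    eq : ∀ a b → b + a * b ≡ (1ℚ + a) * b
    eq = solve-∀ ℚ-ring

  ι-∸ : ∀ {m n} → n ℕ.≤ m → ι (m ℕ.∸ n) ≡ ι m - ι n
  ι-∸ {m} {n} h = trans (eq (ι (m ℕ.∸ n)) (ι n))
    (cong (_- ι n) (trans (sym (ι-+ (m ℕ.∸ n) n)) (cong ι (ℕ.m∸n+n≡m h))))
    where
    eq : ∀ a b → a ≡ a + b - b
    eq = solve-∀ ℚ-ring

  ι-mono : ∀ {m n} → m ℕ.≤ n → ι m ≤ ι n
  ι-mono {m} {n} h = ≤-by (0≤ι (n ℕ.∸ m)) (trans (cong ι (sym (ℕ.m+[n∸m]≡n h))) (ι-+ m (n ℕ.∸ m)))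

  ι-mono-< : ∀ {m n} → m ℕ.< n → ι m + 1ℚ ≤ ι n
  ι-mono-< {m} h = subst (_≤ _) (ℚ.+-comm 1ℚ (ι m)) (ι-mono h)

  <⇒≢ : a < b → a ≢ b
  <⇒≢ h refl = ℚ.<-irrefl refl h

  ≤⇒≯ : a ≤ b → ¬ (b < a)
  ≤⇒≯ h k = ℚ.<-irrefl refl (ℚ.≤-<-trans h k)

  -≡0⇒≡ : ∀ a b → a - b ≡ 0ℚ → a ≡ b
  -≡0⇒≡ a b e = trans (eq a b) (trans (cong (_+ b) e) (ℚ.+-identityˡ b))
    where
    eq : ∀ a b → a ≡ a - b + b
    eq = solve-∀ ℚ-ring

  ≤∧≢⇒< : a ≤ b → a ≢ b → a < b
  ≤∧≢⇒< {a} {b} a≤b a≢b with ℚ.<-cmp a b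
  ... | tri< h _ _ = h
  ... | tri≈ _ e _ = contradiction e a≢b
  ... | tri> _ _ h = ⊥-elim (≤⇒≯ a≤b h)

  0<⇒ι< : ∀ {m n} → m ℕ.< n → ι m < ι n
  0<⇒ι< {m} h = ℚ.<-≤-trans (<-by 0<1 (refl {x = ι m + 1ℚ})) (ι-mono-< h)

  ι-cancel-≤ : ∀ {m n} → ι m ≤ ι n → m ℕ.≤ n
  ι-cancel-≤ {m} {n} h with m ℕ.≤? n
  ... | yes p = p
  ... | no ¬p = ⊥-elim (≤⇒≯ h (0<⇒ι< (ℕ.≰⇒> ¬p)))

  ι-injective : ∀ {m n} → ι m ≡ ι n → m ≡ n
  ι-injective h = ℕ.≤-antisym (ι-cancel-≤ (ℚ.≤-reflexive h)) (ι-cancel-≤ (ℚ.≤-reflexive (sym h)))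

  -- The reciprocal is total, with value 0 at 0, so that sums over all j of
  -- reciprocals of differences may include the diagonal term.
  opaque
    inv : ℚ → ℚ
    inv p with p ℚ.≟ 0ℚ
    ... | yes _ = 0ℚ
    ... | no p≢0 = (1/ p) {{≢-nonZero p≢0}}

    inv-0 : inv 0ℚ ≡ 0ℚ
    inv-0 = refl

    *-inv : a ≢ 0ℚ → a * inv a ≡ 1ℚ
    *-inv {a} a≢0 with a ℚ.≟ 0ℚ
    ... | yes a≡0 = contradiction a≡0 a≢0
    ... | no  a≢0 = ℚ.*-inverseʳ a {{≢-nonZero a≢0}}

    0<inv : 0ℚ < a → 0ℚ < inv a
    0<inv {a} h with a ℚ.≟ 0ℚ
    ... | yes a≡0 = contradiction (sym a≡0) (<⇒≢ h)
    ... | no  a≢0 = ℚ.positive⁻¹ _ {{ℚ.1/pos⇒pos a {{positive h}}}}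

  *-inv⁺ : 0ℚ < a → a * inv a ≡ 1ℚ
  *-inv⁺ h = *-inv (λ e → <⇒≢ h (sym e))

  0≤inv : 0ℚ ≤ a → 0ℚ ≤ inv a
  0≤inv {a} h with a ℚ.≟ 0ℚ
  ... | yes refl = ℚ.≤-reflexive (sym inv-0)
  ... | no  a≢0  = ℚ.<⇒≤ (0<inv (≤∧≢⇒< h (λ e → a≢0 (sym e))))

  *-cancel-≢0 : c ≢ 0ℚ → c * a ≡ c * b → a ≡ b
  *-cancel-≢0 {c} {a} {b} c≢0 h = begin
    a                 ≡⟨ eq a ⟩
    1ℚ * a            ≡⟨ cong (_* a) (*-inv c≢0) ⟨
    c * inv c * a     ≡⟨ swap c (inv c) a ⟩
    inv c * (c * a)   ≡⟨ cong (inv c *_) h ⟩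
    inv c * (c * b)   ≡⟨ swap c (inv c) b ⟨
    c * inv c * b     ≡⟨ cong (_* b) (*-inv c≢0) ⟩
    1ℚ * b            ≡⟨ eq b ⟨
    b                 ∎
    where
    open ≡-Reasoning
    eq : ∀ a → a ≡ 1ℚ * a
    eq = solve-∀ ℚ-ring
    swap : ∀ c d a → c * d * a ≡ d * (c * a)
    swap = solve-∀ ℚ-ring

  *-≢0 : a ≢ 0ℚ → b ≢ 0ℚ → a * b ≢ 0ℚ
  *-≢0 {a} {b} a≢0 b≢0 e = b≢0 (*-cancel-≢0 a≢0 (trans e (sym (ℚ.*-zeroʳ a))))

  inv-unique : a * b ≡ 1ℚ → inv a ≡ b
  inv-unique {a} {b} h = *-cancel-≢0 a≢0 (trans (*-inv a≢0) (sym h))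
    where
    a≢0 : a ≢ 0ℚ
    a≢0 refl = contradiction (trans (sym (ℚ.*-zeroˡ b)) h) (<⇒≢ 0<1)

  inv-neg : ∀ a → inv (- a) ≡ - inv a
  inv-neg a with a ℚ.≟ 0ℚ
  ... | yes refl = trans inv-0 (sym (cong -_ inv-0))
  ... | no  a≢0  = inv-unique (trans (eq a (inv a)) (*-inv a≢0))
    where
    eq : ∀ a b → - a * - b ≡ a * b
    eq = solve-∀ ℚ-ring

  inv-* : ∀ a b → inv (a * b) ≡ inv a * inv b
  inv-* a b with a ℚ.≟ 0ℚ | b ℚ.≟ 0ℚ
  ... | yes refl | _        = trans (cong inv (ℚ.*-zeroˡ b)) (trans inv-0 (sym (trans (cong (_* inv b) inv-0) (ℚ.*-zeroˡ (inv b)))))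
  ... | no  _    | yes refl = trans (cong inv (ℚ.*-zeroʳ a)) (trans inv-0 (sym (trans (cong (inv a *_) inv-0) (ℚ.*-zeroʳ (inv a)))))
  ... | no  a≢0  | no  b≢0  = inv-unique (trans (eq a b (inv a) (inv b)) (cong₂ _*_ (*-inv a≢0) (*-inv b≢0)))
    where
    eq : ∀ a b c d → a * b * (c * d) ≡ a * c * (b * d)
    eq = solve-∀ ℚ-ring

  inv-antimono : 0ℚ < a → a ≤ b → inv b ≤ inv a
  inv-antimono {a} {b} 0<a a≤b = subst₂ _≤_ (eq₁ b a (inv a) (inv b) (*-inv⁺ 0<a)) (eq₁ a b (inv b) (inv a) (*-inv⁺ 0<b))
    (≤-by (0≤* (0≤- a≤b) (0≤* (0≤inv (ℚ.<⇒≤ 0<a)) (0≤inv (ℚ.<⇒≤ 0<b)))) (eq₂ a b (inv a) (inv b)))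
    where
    0<b = ℚ.<-≤-trans 0<a a≤b
    eq₁ : ∀ b a u v → a * u ≡ 1ℚ → a * u * v ≡ v
    eq₁ b a u v e = trans (cong (_* v) e) (ℚ.*-identityˡ v)
    eq₂ : ∀ a b u v → b * v * u ≡ a * u * v + (b - a) * (u * v)
    eq₂ = solve-∀ ℚ-ring

  inv-≤ : 0ℚ < a → 1ℚ ≤ b * a → inv a ≤ b
  inv-≤ {a} {b} 0<a h = *-cancelˡ 0<a (subst₂ _≤_ (sym (*-inv⁺ 0<a)) (ℚ.*-comm b a) h)

  ≤-inv : 0ℚ < b → a * b ≤ 1ℚ → a ≤ inv b
  ≤-inv {b} {a} 0<b h = *-cancelˡ 0<b (subst₂ _≤_ (ℚ.*-comm a b) (sym (*-inv⁺ 0<b)) h)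

  x≤∣x∣ : ∀ a → a ≤ ∣ a ∣
  x≤∣x∣ a with ℚ.≤-total 0ℚ a
  ... | inj₁ h = ℚ.≤-reflexive (sym (ℚ.0≤p⇒∣p∣≡p h))
  ... | inj₂ h = ℚ.≤-trans h (ℚ.0≤∣p∣ a)

  -x≤∣x∣ : ∀ a → - a ≤ ∣ a ∣
  -x≤∣x∣ a = subst (- a ≤_) (ℚ.∣-p∣≡∣p∣ a) (x≤∣x∣ (- a))

  ∣∣≤ : a ≤ b → - a ≤ b → ∣ a ∣ ≤ b
  ∣∣≤ {a} h k with ℚ.∣p∣≡p∨∣p∣≡-p a
  ... | inj₁ e = subst (_≤ _) (sym e) h
  ... | inj₂ e = subst (_≤ _) (sym e) k

  Σ< : ℕ → (ℕ → ℚ) → ℚ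
  Σ< zero    f = 0ℚ
  Σ< (suc n) f = Σ< n f + f n

  Π< : ℕ → (ℕ → ℚ) → ℚ
  Π< zero    f = 1ℚ
  Π< (suc n) f = Π< n f * f n

  +-swap₄ : ∀ a b c d → (a + b) + (c + d) ≡ (a + c) + (b + d)
  +-swap₄ = solve-∀ ℚ-ring

  *-swap₄ : ∀ a b c d → (a * b) * (c * d) ≡ (a * c) * (b * d)
  *-swap₄ = solve-∀ ℚ-ring

  Σ-cong : ∀ n {f g : ℕ → ℚ} → (∀ i → i ℕ.< n → f i ≡ g i) → Σ< n f ≡ Σ< n g
  Σ-cong zero    h = refl
  Σ-cong (suc n) h = cong₂ _+_ (Σ-cong n (λ i i<n → h i (ℕ.m<n⇒m<1+n i<n))) (h n ℕ.≤-refl)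

  Σ-+ : ∀ n (f g : ℕ → ℚ) → Σ< n (λ i → f i + g i) ≡ Σ< n f + Σ< n g
  Σ-+ zero    f g = refl
  Σ-+ (suc n) f g = trans (cong (_+ (f n + g n)) (Σ-+ n f g)) (+-swap₄ (Σ< n f) (Σ< n g) (f n) (g n))

  Σ-*ˡ : ∀ n c (f : ℕ → ℚ) → Σ< n (λ i → c * f i) ≡ c * Σ< n f
  Σ-*ˡ zero    c f = sym (ℚ.*-zeroʳ c)
  Σ-*ˡ (suc n) c f = trans (cong (_+ c * f n) (Σ-*ˡ n c f)) (sym (ℚ.*-distribˡ-+ c (Σ< n f) (f n)))

  Σ-neg : ∀ n (f : ℕ → ℚ) → Σ< n (λ i → - f i) ≡ - Σ< n f
  Σ-neg zero    f = refl
  Σ-neg (suc n) f = trans (cong (_+ - f n) (Σ-neg n f)) (sym (ℚ.neg-distrib-+ (Σ< n f) (f n)))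

  Σ-- : ∀ n (f g : ℕ → ℚ) → Σ< n (λ i → f i - g i) ≡ Σ< n f - Σ< n g
  Σ-- n f g = trans (Σ-+ n f (λ i → - g i)) (cong (Σ< n f +_) (Σ-neg n g))

  Σ-zero : ∀ n {f : ℕ → ℚ} → (∀ i → i ℕ.< n → f i ≡ 0ℚ) → Σ< n f ≡ 0ℚ
  Σ-zero zero    h = refl
  Σ-zero (suc n) h = cong₂ _+_ (Σ-zero n (λ i i<n → h i (ℕ.m<n⇒m<1+n i<n))) (h n ℕ.≤-refl)

  Σ-const : ∀ n c → Σ< n (λ _ → c) ≡ ι n * c
  Σ-const zero    c = sym (ℚ.*-zeroˡ c)
  Σ-const (suc n) c = trans (cong (_+ c) (Σ-const n c)) (eq (ι n) c)
    where
    eq : ∀ a c → a * c + c ≡ (1ℚ + a) * c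
    eq = solve-∀ ℚ-ring

  Σ-mono : ∀ n {f g : ℕ → ℚ} → (∀ i → i ℕ.< n → f i ≤ g i) → Σ< n f ≤ Σ< n g
  Σ-mono zero    h = ℚ.≤-refl
  Σ-mono (suc n) h = ℚ.+-mono-≤ (Σ-mono n (λ i i<n → h i (ℕ.m<n⇒m<1+n i<n))) (h n ℕ.≤-refl)

  Σ-0≤ : ∀ n {f : ℕ → ℚ} → (∀ i → i ℕ.< n → 0ℚ ≤ f i) → 0ℚ ≤ Σ< n f
  Σ-0≤ zero    h = ℚ.≤-refl
  Σ-0≤ (suc n) h = 0≤+ (Σ-0≤ n (λ i i<n → h i (ℕ.m<n⇒m<1+n i<n))) (h n ℕ.≤-refl)

  Σ-term≤ : ∀ n {f : ℕ → ℚ} → (∀ i → i ℕ.< n → 0ℚ ≤ f i) → ∀ i → i ℕ.< n → f i ≤ Σ< n f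
  Σ-term≤ (suc n) {f} h i i<1+n with ℕ.m<1+n⇒m<n∨m≡n i<1+n
  ... | inj₁ i<n  = ≤-by (0≤+ (0≤- (Σ-term≤ n (λ j j<n → h j (ℕ.m<n⇒m<1+n j<n)) i i<n)) (h n ℕ.≤-refl))
                         (eq (f i) (Σ< n f) (f n))
    where
    eq : ∀ a b c → b + c ≡ a + (b - a + c)
    eq = solve-∀ ℚ-ring
  ... | inj₂ refl = ≤-by (Σ-0≤ n (λ j j<n → h j (ℕ.m<n⇒m<1+n j<n))) (ℚ.+-comm (Σ< n f) (f n))

  Σ-single : ∀ n {f : ℕ → ℚ} i → i ℕ.< n → (∀ j → j ℕ.< n → j ≢ i → f j ≡ 0ℚ) → Σ< n f ≡ f i
  Σ-single (suc n) {f} i i<1+n h with ℕ.m<1+n⇒m<n∨m≡n i<1+n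
  ... | inj₁ i<n  = trans (cong₂ _+_ (Σ-single n i i<n (λ j j<n → h j (ℕ.m<n⇒m<1+n j<n)))
                                     (h n ℕ.≤-refl (λ e → ℕ.<-irrefl (sym e) i<n)))
                          (ℚ.+-identityʳ (f i))
  ... | inj₂ refl = trans (cong (_+ f n) (Σ-zero n (λ j j<n → h j (ℕ.m<n⇒m<1+n j<n) (ℕ.<⇒≢ j<n))))
                          (ℚ.+-identityˡ (f n))

  Σ-swap : ∀ m n (f : ℕ → ℕ → ℚ) → Σ< m (λ i → Σ< n (f i)) ≡ Σ< n (λ j → Σ< m (λ i → f i j))
  Σ-swap zero    n f = sym (Σ-zero n (λ _ _ → refl))
  Σ-swap (suc m) n f = trans (cong (_+ Σ< n (f m)) (Σ-swap m n f)) (sym (Σ-+ n (λ j → Σ< m (λ i → f i j)) (f m)))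

  Σ-split : ∀ m n (f : ℕ → ℚ) → Σ< (m ℕ.+ n) f ≡ Σ< m f + Σ< n (λ i → f (m ℕ.+ i))
  Σ-split m zero    f = trans (cong (λ k → Σ< k f) (ℕ.+-identityʳ m)) (sym (ℚ.+-identityʳ (Σ< m f)))
  Σ-split m (suc n) f = trans (cong (λ k → Σ< k f) (ℕ.+-suc m n))
    (trans (cong (_+ f (m ℕ.+ n)) (Σ-split m n f)) (ℚ.+-assoc (Σ< m f) (Σ< n (λ i → f (m ℕ.+ i))) (f (m ℕ.+ n))))

  Σ-head : ∀ n (f : ℕ → ℚ) → Σ< (suc n) f ≡ f 0 + Σ< n (f ∘ suc)
  Σ-head n f = trans (Σ-split 1 n f) (cong (_+ Σ< n (f ∘ suc)) (ℚ.+-identityˡ (f 0)))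

  -- The index of the opposite node: nodes increase with their index, so a reflection of the line
  -- reverses the indices.
  opp : ℕ → ℕ → ℕ
  opp n i = n ℕ.∸ suc i

  opp< : ∀ {n i} → i ℕ.< n → opp n i ℕ.< n
  opp< {suc n} {i} _ = s≤s (ℕ.m∸n≤m n i)

  opp-anti : ∀ {n i j} → i ℕ.< j → j ℕ.< n → opp n j ℕ.< opp n i
  opp-anti {suc n} {i} {j} i<j (s≤s j≤n) = ℕ.∸-monoʳ-< i<j j≤n

  opp-opp : ∀ {n i} → i ℕ.< n → opp n (opp n i) ≡ i
  opp-opp {suc n} {i} (s≤s i≤n) = ℕ.m∸[m∸n]≡n i≤n

  Σ-rev : ∀ n (f : ℕ → ℚ) → Σ< n (f ∘ opp n) ≡ Σ< n f
  Σ-rev zero    f = refl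
  Σ-rev (suc n) f = begin
    Σ< (suc n) (f ∘ opp (suc n))        ≡⟨ Σ-head n (f ∘ opp (suc n)) ⟩
    f n + Σ< n (f ∘ opp n)              ≡⟨ cong (f n +_) (Σ-rev n f) ⟩
    f n + Σ< n f                        ≡⟨ ℚ.+-comm (f n) (Σ< n f) ⟩
    Σ< n f + f n                        ∎
    where open ≡-Reasoning

  ∣Σ∣≤ : ∀ n (f : ℕ → ℚ) → ∣ Σ< n f ∣ ≤ Σ< n (λ i → ∣ f i ∣)
  ∣Σ∣≤ zero    f = ℚ.≤-refl
  ∣Σ∣≤ (suc n) f = ℚ.≤-trans (ℚ.∣p+q∣≤∣p∣+∣q∣ (Σ< n f) (f n)) (ℚ.+-monoˡ-≤ ∣ f n ∣ (∣Σ∣≤ n f))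

  Π-cong : ∀ n {f g : ℕ → ℚ} → (∀ i → i ℕ.< n → f i ≡ g i) → Π< n f ≡ Π< n g
  Π-cong zero    h = refl
  Π-cong (suc n) h = cong₂ _*_ (Π-cong n (λ i i<n → h i (ℕ.m<n⇒m<1+n i<n))) (h n ℕ.≤-refl)

  Π-* : ∀ n (f g : ℕ → ℚ) → Π< n (λ i → f i * g i) ≡ Π< n f * Π< n g
  Π-* zero    f g = refl
  Π-* (suc n) f g = trans (cong (_* (f n * g n)) (Π-* n f g)) (*-swap₄ (Π< n f) (Π< n g) (f n) (g n))

  Π-head : ∀ n (f : ℕ → ℚ) → Π< (suc n) f ≡ f 0 * Π< n (f ∘ suc)
  Π-head zero    f = ℚ.*-comm 1ℚ (f 0)
  Π-head (suc n) f = trans (cong (_* f (suc n)) (Π-head n f)) (ℚ.*-assoc (f 0) (Π< n (f ∘ suc)) (f (suc n)))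

  Π-rev : ∀ n (f : ℕ → ℚ) → Π< n (f ∘ opp n) ≡ Π< n f
  Π-rev zero    f = refl
  Π-rev (suc n) f = trans (Π-head n (f ∘ opp (suc n))) (trans (cong (f n *_) (Π-rev n f)) (ℚ.*-comm (f n) (Π< n f)))

  Π-0< : ∀ n {f : ℕ → ℚ} → (∀ i → i ℕ.< n → 0ℚ < f i) → 0ℚ < Π< n f
  Π-0< zero    h = 0<1
  Π-0< (suc n) h = 0<* (Π-0< n (λ i i<n → h i (ℕ.m<n⇒m<1+n i<n))) (h n ℕ.≤-refl)

  Π-0≤ : ∀ n {f : ℕ → ℚ} → (∀ i → i ℕ.< n → 0ℚ ≤ f i) → 0ℚ ≤ Π< n f
  Π-0≤ zero    h = 0≤1
  Π-0≤ (suc n) h = 0≤* (Π-0≤ n (λ i i<n → h i (ℕ.m<n⇒m<1+n i<n))) (h n ℕ.≤-refl)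

  Π-mono : ∀ n {f g : ℕ → ℚ} → (∀ i → i ℕ.< n → 0ℚ ≤ f i) → (∀ i → i ℕ.< n → f i ≤ g i) → Π< n f ≤ Π< n g
  Π-mono zero    h k = ℚ.≤-refl
  Π-mono (suc n) h k =
    *-mono (Π-0≤ n h′) (ℚ.≤-trans (h n ℕ.≤-refl) (k n ℕ.≤-refl)) (Π-mono n h′ (λ i i<n → k i (ℕ.m<n⇒m<1+n i<n))) (k n ℕ.≤-refl)
    where h′ = λ i i<n → h i (ℕ.m<n⇒m<1+n i<n)

  Π-≡0 : ∀ n {f : ℕ → ℚ} i → i ℕ.< n → f i ≡ 0ℚ → Π< n f ≡ 0ℚ
  Π-≡0 (suc n) {f} i i<1+n h with ℕ.m<1+n⇒m<n∨m≡n i<1+n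
  ... | inj₁ i<n  = trans (cong (_* f n) (Π-≡0 n i i<n h)) (ℚ.*-zeroˡ (f n))
  ... | inj₂ refl = trans (cong (Π< n f *_) h) (ℚ.*-zeroʳ (Π< n f))

  Π-≢0 : ∀ n {f : ℕ → ℚ} → (∀ i → i ℕ.< n → f i ≢ 0ℚ) → Π< n f ≢ 0ℚ
  Π-≢0 zero    h = λ e → <⇒≢ 0<1 (sym e)
  Π-≢0 (suc n) h = *-≢0 (Π-≢0 n (λ i i<n → h i (ℕ.m<n⇒m<1+n i<n))) (h n ℕ.≤-refl)

open Rationals

-- One-sided estimates from a single Bethe equation

Π-one≤ : ∀ n {f : ℕ → ℚ} {c η} → 0ℚ ≤ c → 0ℚ ≤ η → (∀ i → i ℕ.< n → c ≤ f i) →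
         ∀ k → k ℕ.< n → c * (1ℚ + η) ≤ f k → Π< n (λ _ → c) * (1ℚ + η) ≤ Π< n f
Π-one≤ (suc n) {f} {c} {η} 0≤c 0≤η h k k<1+n hk with ℕ.m<1+n⇒m<n∨m≡n k<1+n
... | inj₁ k<n  = subst (_≤ Π< n f * f n) (eq (Π< n (λ _ → c)) η c)
    (*-mono (0≤* (Π-0≤ n (λ _ _ → 0≤c)) (0≤+ 0≤1 0≤η)) (ℚ.≤-trans 0≤c (h n ℕ.≤-refl))
            (Π-one≤ n 0≤c 0≤η (λ i i<n → h i (ℕ.m<n⇒m<1+n i<n)) k k<n hk) (h n ℕ.≤-refl))
  where
  eq : ∀ p η c → p * (1ℚ + η) * c ≡ p * c * (1ℚ + η)
  eq = solve-∀ ℚ-ring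
... | inj₂ refl = subst (_≤ Π< n f * f n) (sym (ℚ.*-assoc (Π< n (λ _ → c)) c (1ℚ + η)))
    (*-mono (Π-0≤ n (λ _ _ → 0≤c)) (ℚ.≤-trans 0≤c (h n ℕ.≤-refl))
            (Π-mono n (λ _ _ → 0≤c) (λ i i<n → h i (ℕ.m<n⇒m<1+n i<n))) hk)

-- The power (1 - β)^n enters squared: once as a lower bound for the product on the right of the
-- Bethe equation, once to compensate the upper bound (1 + β)^n for the product on the left.
bernoulli : ∀ n {β} → 0ℚ ≤ β → β ≤ 1ℚ →
            1ℚ - ι 2 * ι n * β ≤ Π< n (λ _ → 1ℚ - β) * Π< n (λ _ → 1ℚ - β)
bernoulli zero    {β} h k = ℚ.≤-reflexive (eq β)
  where
  eq : ∀ β → 1ℚ - ι 2 * ι 0 * β ≡ 1ℚ * 1ℚ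
  eq = solve-∀ ℚ-ring
bernoulli (suc n) {β} h k = ℚ.≤-trans
  (≤-by (0≤+ (0≤+ (0≤² β) (0≤* (0≤* (0≤ι 2) (0≤ι n)) (0≤² β))) (0≤* (0≤* (0≤* (0≤ι 2) (0≤ι n)) (0≤² β)) (0≤- k)))
        (eq₁ (ι n) β))
  (ℚ.≤-trans (*-monoʳ (0≤² (1ℚ - β)) (bernoulli n h k))
             (ℚ.≤-reflexive (eq₂ (Π< n (λ _ → 1ℚ - β)) (1ℚ - β))))
  where
  eq₁ : ∀ n β → (1ℚ - ι 2 * n * β) * ((1ℚ - β) * (1ℚ - β)) ≡
        1ℚ - ι 2 * (1ℚ + n) * β + (β * β + ι 2 * n * (β * β) + ι 2 * n * (β * β) * (1ℚ - β))
  eq₁ = solve-∀ ℚ-ring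
  eq₂ : ∀ p b → p * p * (b * b) ≡ p * b * (p * b)
  eq₂ = solve-∀ ℚ-ring

-- Used at a node: a lists the reciprocal distances to the other nodes,
-- and factors which only help are replaced by the bound β.
bethe-bound : ∀ n {a : ℕ → ℚ} {β η q y} → 0ℚ ≤ β → β ≤ 1ℚ → 0ℚ ≤ η → 0ℚ ≤ q - y → 0ℚ ≤ q + y →
  (∀ j → j ℕ.< n → - 1ℚ ≤ a j) → (∀ j → j ℕ.< n → a j ≤ β) →
  Π< n (λ _ → 1ℚ - β) * (1ℚ + η) ≤ Π< n (λ j → 1ℚ - a j) →
  (q - y) * Π< n (λ j → 1ℚ + a j) ≡ (q + y) * Π< n (λ j → 1ℚ - a j) →
  (q + y) * (1ℚ - ι 2 * ι n * β) * (1ℚ + η) ≤ q - y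
bethe-bound n {a} {β} {η} {q} {y} 0≤β β≤1 0≤η 0≤q-y 0≤q+y -1≤a a≤β lower bethe = begin
  (q + y) * (1ℚ - ι 2 * ι n * β) * (1ℚ + η)       ≤⟨ *-monoʳ (0≤+ 0≤1 0≤η) (*-monoˡ 0≤q+y (bernoulli n 0≤β β≤1)) ⟩
  (q + y) * (P⁻ * P⁻) * (1ℚ + η)                  ≡⟨ eq₁ (q + y) P⁻ (1ℚ + η) ⟩
  P⁻ * ((q + y) * (P⁻ * (1ℚ + η)))                ≤⟨ *-monoˡ 0≤P⁻ (*-monoˡ 0≤q+y lower) ⟩
  P⁻ * ((q + y) * Π< n (λ j → 1ℚ - a j))          ≡⟨ cong (P⁻ *_) bethe ⟨
  P⁻ * ((q - y) * Π< n (λ j → 1ℚ + a j))          ≤⟨ *-monoˡ 0≤P⁻ (*-monoˡ 0≤q-y (Π-mono n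
                                                       (λ j j<n → ≤-by (0≤- (-1≤a j j<n)) (eq₂ (a j)))
                                                       (λ j j<n → ℚ.+-monoʳ-≤ 1ℚ (a≤β j j<n)))) ⟩
  P⁻ * ((q - y) * P⁺)                             ≡⟨ eq₃ P⁻ (q - y) P⁺ ⟩
  (q - y) * (P⁺ * P⁻)                             ≤⟨ *-monoˡ 0≤q-y P⁺P⁻≤1 ⟩
  (q - y) * 1ℚ                                    ≡⟨ ℚ.*-identityʳ (q - y) ⟩
  q - y                                           ∎
  where
  open ℚ.≤-Reasoning
  P⁻ = Π< n (λ _ → 1ℚ - β)
  P⁺ = Π< n (λ _ → 1ℚ + β)
  0≤P⁻ : 0ℚ ≤ P⁻
  0≤P⁻ = Π-0≤ n (λ _ _ → 0≤- β≤1)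
  eq₁ : ∀ q p e → q * (p * p) * e ≡ p * (q * (p * e))
  eq₁ = solve-∀ ℚ-ring
  eq₂ : ∀ a → 1ℚ + a ≡ 0ℚ + (a - - 1ℚ)
  eq₂ = solve-∀ ℚ-ring
  eq₃ : ∀ p q r → p * (q * r) ≡ q * (r * p)
  eq₃ = solve-∀ ℚ-ring
  eq₄ : ∀ β → 1ℚ ≡ (1ℚ + β) * (1ℚ - β) + β * β
  eq₄ = solve-∀ ℚ-ring
  Π-1 : ∀ n → Π< n (λ _ → 1ℚ) ≡ 1ℚ
  Π-1 zero    = refl
  Π-1 (suc n) = cong (_* 1ℚ) (Π-1 n)
  P⁺P⁻≤1 : P⁺ * P⁻ ≤ 1ℚ
  P⁺P⁻≤1 = ℚ.≤-trans (ℚ.≤-reflexive (sym (Π-* n (λ _ → 1ℚ + β) (λ _ → 1ℚ - β))))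
    (ℚ.≤-trans (Π-mono n (λ _ _ → 0≤* (0≤+ 0≤1 0≤β) (0≤- β≤1)) (λ _ _ → ≤-by (0≤² β) (eq₄ β)))
               (ℚ.≤-reflexive (Π-1 n)))

-- The nodes of a tight design, centred and abstracted: with the weights
-- B = S (q - y) / 2 and D = S (q + y) / 2, bethe is the equation
-- B(x) p(x + 1) + D(x) p(x - 1) = 0 at the zeros x of p.
record Config (s : ℕ) : Set where
  field
    S V lam R : ℚ
    y : ℕ → ℚ
  q : ℕ → ℚ
  q i = ι 2 * V + lam * y i + ι 2 * (y i * y i * inv S)
  field
    1≤s   : 1 ℕ.≤ s
    step  : ∀ i j → i ℕ.< j → j ℕ.< s → y i + 1ℚ ≤ y j
    lam≤1 : lam ≤ 1ℚ
    -lam≤1 : - lam ≤ 1ℚ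
    -- `V` is a variance and `R` a rational substitute for its square root; agreement up to a factor
    -- 2 is all that is asked.
    1≤R   : 1ℚ ≤ R
    R²≤V  : R * R ≤ V
    V≤4R² : V ≤ ι 4 * (R * R)
    V≤S   : V ≤ S
    y≤S   : ∀ i → i ℕ.< s → y i ≤ S
    -y≤S  : ∀ i → i ℕ.< s → - y i ≤ S
    y≤q   : ∀ i → i ℕ.< s → y i ≤ q i
    -y≤q  : ∀ i → i ℕ.< s → - y i ≤ q i
    bethe : ∀ i → i ℕ.< s → (q i - y i) * Π< s (λ j → 1ℚ + inv (y i - y j)) ≡
                            (q i + y i) * Π< s (λ j → 1ℚ - inv (y i - y j))

  0<R : 0ℚ < R
  0<R = ℚ.<-≤-trans 0<1 1≤R

  0≤R : 0ℚ ≤ R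
  0≤R = ℚ.<⇒≤ 0<R

  0<V : 0ℚ < V
  0<V = ℚ.<-≤-trans (0<* 0<R 0<R) R²≤V

  0<S : 0ℚ < S
  0<S = ℚ.<-≤-trans 0<V V≤S

  mono : ∀ {i j} → i ℕ.< j → j ℕ.< s → y i < y j
  mono {i} {j} h k = ℚ.<-≤-trans (<-by 0<1 (refl {x = y i + 1ℚ})) (step i j h k)

  -1≤a : ∀ i j → i ℕ.< s → j ℕ.< s → - 1ℚ ≤ inv (y i - y j)
  -1≤a i j i<s j<s with ℕ.<-cmp i j
  ... | tri< i<j _ _ = subst (- 1ℚ ≤_) (trans (sym (inv-neg (y j - y i))) (cong inv (eq (y i) (y j))))
        (ℚ.neg-antimono-≤ (inv-≤ {b = 1ℚ} (0<- (mono i<j j<s)) (≤-by (0≤- (step i j i<j j<s)) (eq′ (y i) (y j)))))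
    where
    eq : ∀ a b → - (b - a) ≡ a - b
    eq = solve-∀ ℚ-ring
    eq′ : ∀ a b → 1ℚ * (b - a) ≡ 1ℚ + (b - (a + 1ℚ))
    eq′ = solve-∀ ℚ-ring
  ... | tri≈ _ refl _ = subst (- 1ℚ ≤_) (trans (sym inv-0) (cong inv (sym (ℚ.+-inverseʳ (y i))))) (ℚ.neg-antimono-≤ 0≤1)
  ... | tri> _ _ j<i = ℚ.≤-trans (ℚ.neg-antimono-≤ 0≤1) (0≤inv (ℚ.<⇒≤ (0<- (mono j<i i<s))))

  -- reciprocal distances to nodes further up are negative
  a≤ : ∀ i {β} → i ℕ.< s → 0ℚ ≤ β → (∀ j → j ℕ.< i → inv (y i - y j) ≤ β) →
       ∀ j → j ℕ.< s → inv (y i - y j) ≤ β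
  a≤ i i<s 0≤β below j j<s with ℕ.<-cmp i j
  ... | tri< i<j _ _ = ℚ.≤-trans (subst (_≤ 0ℚ) (trans (sym (inv-neg (y j - y i))) (cong inv (eq (y i) (y j))))
        (ℚ.neg-antimono-≤ (0≤inv (ℚ.<⇒≤ (0<- (mono i<j j<s)))))) 0≤β
    where
    eq : ∀ a b → - (b - a) ≡ a - b
    eq = solve-∀ ℚ-ring
  ... | tri≈ _ refl _ = subst (_≤ _) (trans (sym inv-0) (cong inv (sym (ℚ.+-inverseʳ (y i))))) 0≤β
  ... | tri> _ _ j<i = below j j<i

  0≤q-y : ∀ i → i ℕ.< s → 0ℚ ≤ q i - y i
  0≤q-y i i<s = 0≤- (y≤q i i<s)

  0≤q+y : ∀ i → i ℕ.< s → 0ℚ ≤ q i + y i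
  0≤q+y i i<s = subst (0ℚ ≤_) (eq (q i) (y i)) (0≤- (-y≤q i i<s))
    where
    eq : ∀ a b → a - - b ≡ a + b
    eq = solve-∀ ℚ-ring

  bound : ∀ i {β η} → i ℕ.< s → 0ℚ ≤ β → β ≤ 1ℚ → 0ℚ ≤ η →
          (∀ j → j ℕ.< i → inv (y i - y j) ≤ β) →
          Π< s (λ _ → 1ℚ - β) * (1ℚ + η) ≤ Π< s (λ j → 1ℚ - inv (y i - y j)) →
          (q i + y i) * (1ℚ - ι 2 * ι s * β) * (1ℚ + η) ≤ q i - y i
  bound i i<s 0≤β β≤1 0≤η below h =
    bethe-bound s {q = q i} {y = y i} 0≤β β≤1 0≤η (0≤q-y i i<s) (0≤q+y i i<s)
      (λ j → -1≤a i j i<s) (a≤ i i<s 0≤β below) h (bethe i i<s)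

-- Turning the line around exchanges the two weights B and D and hence the sign of `lam`. Thus an
-- upper bound proved for all configurations is a lower bound as well.
reflect : ∀ {s} → Config s → Config s
reflect {s} c = record
  { S = S ; V = V ; lam = - lam ; R = R ; y = λ i → - y (opp s i)
  ; 1≤s = 1≤s
  ; step = λ i j i<j j<s → subst (_≤ - y (opp s j)) (eq₁ (y (opp s i)))
      (ℚ.neg-antimono-≤ (≤-by (0≤- (step (opp s j) (opp s i) (opp-anti i<j j<s) (opp< (ℕ.<-trans i<j j<s)))) (eq₂ (y (opp s i)) (y (opp s j)))))
  ; lam≤1 = -lam≤1 ; -lam≤1 = subst (_≤ 1ℚ) (eq₃ lam) lam≤1
  ; 1≤R = 1≤R ; R²≤V = R²≤V ; V≤4R² = V≤4R² ; V≤S = V≤S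
  ; y≤S = λ i i<s → -y≤S (opp s i) (opp< i<s)
  ; -y≤S = λ i i<s → subst (_≤ S) (eq₃ (y (opp s i))) (y≤S (opp s i) (opp< i<s))
  ; y≤q = λ i i<s → subst (- y (opp s i) ≤_) (eq₄ V lam (y (opp s i)) (inv S)) (-y≤q (opp s i) (opp< i<s))
  ; -y≤q = λ i i<s → subst₂ _≤_ (eq₃ (y (opp s i))) (eq₄ V lam (y (opp s i)) (inv S)) (y≤q (opp s i) (opp< i<s))
  ; bethe = λ i i<s → begin
      (ι 2 * V + - lam * - y (opp s i) + ι 2 * (- y (opp s i) * - y (opp s i) * inv S) - - y (opp s i)) *
        Π< s (λ j → 1ℚ + inv (- y (opp s i) - - y (opp s j)))
        ≡⟨ cong₂ _*_ (trans (cong (_- - y (opp s i)) (sym (eq₄ V lam (y (opp s i)) (inv S)))) (eq₅ (q (opp s i)) (y (opp s i))))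
             (trans (Π-cong s (λ j _ → cong (1ℚ +_) (inv-sub (y (opp s i)) (y (opp s j)))))
                    (Π-rev s (λ j → 1ℚ - inv (y (opp s i) - y j)))) ⟩
      (q (opp s i) + y (opp s i)) * Π< s (λ j → 1ℚ - inv (y (opp s i) - y j))
        ≡⟨ bethe (opp s i) (opp< i<s) ⟨
      (q (opp s i) - y (opp s i)) * Π< s (λ j → 1ℚ + inv (y (opp s i) - y j))
        ≡⟨ cong₂ _*_ (cong (_+ - y (opp s i)) (eq₄ V lam (y (opp s i)) (inv S)))
             (trans (sym (Π-rev s (λ j → 1ℚ + inv (y (opp s i) - y j))))
                    (Π-cong s (λ j _ → cong (1ℚ +_) (trans (eq₃ (inv (y (opp s i) - y (opp s j)))) (cong -_ (sym (inv-sub (y (opp s i)) (y (opp s j))))))))) ⟩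
      (ι 2 * V + - lam * - y (opp s i) + ι 2 * (- y (opp s i) * - y (opp s i) * inv S) + - y (opp s i)) *
        Π< s (λ j → 1ℚ - inv (- y (opp s i) - - y (opp s j))) ∎
  }
  where
  open Config c
  open ≡-Reasoning
  eq₁ : ∀ a → - (a - 1ℚ) ≡ - a + 1ℚ
  eq₁ = solve-∀ ℚ-ring
  eq₂ : ∀ a b → a - 1ℚ ≡ b + (a - (b + 1ℚ))
  eq₂ = solve-∀ ℚ-ring
  eq₃ : ∀ a → a ≡ - - a
  eq₃ = solve-∀ ℚ-ring
  eq₄ : ∀ V l y z → ι 2 * V + l * y + ι 2 * (y * y * z) ≡ ι 2 * V + - l * - y + ι 2 * (- y * - y * z)
  eq₄ = solve-∀ ℚ-ring
  eq₅ : ∀ a b → a - - b ≡ a + b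
  eq₅ = solve-∀ ℚ-ring
  inv-sub : ∀ a b → inv (- a - - b) ≡ - inv (a - b)
  inv-sub a b = trans (cong inv (eq a b)) (inv-neg (a - b))
    where
    eq : ∀ a b → - a - - b ≡ - (a - b)
    eq = solve-∀ ℚ-ring

≡≤ : ∀ {a b c} → a ≡ b → b ≤ c → a ≤ c
≡≤ refl h = h

≤≡ : ∀ {a b c} → a ≤ b → b ≡ c → a ≤ c
≤≡ h refl = h

-- Inconsistent inequalities are refuted by a certificate: a combination of them with nonnegative
-- coefficients, plus a positive remainder, which ring arithmetic identifies with 0.
absurd : ∀ {a b} → 0ℚ ≤ a → 0ℚ < b → a + b ≡ 0ℚ → ⊥
absurd {a} {b} h k e = ℚ.<-irrefl (sym e) (subst (0ℚ <_) (ℚ.+-comm b a) (0<+ k h))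

-- The ring solver knows nothing of reciprocals. A relation such as S * inv S = 1 is therefore
-- carried through an identity as a multiple of S * inv S - 1, which is removed here.
drop₁ : ∀ {e} a c → e ≡ 1ℚ → a + c * (e - 1ℚ) ≡ a
drop₁ a c refl = eq a c
  where
  eq : ∀ a c → a + c * (1ℚ - 1ℚ) ≡ a
  eq = solve-∀ ℚ-ring

1≤ι : ∀ {s} → 1 ℕ.≤ s → 1ℚ ≤ ι s
1≤ι h = ι-mono h

-- The nodes are O(R)

module Range {s} (c : Config s) where
  open Config c

  Δ : ℚ
  Δ = ι 6 * ι s * R

  private
    6R≤Δ : ι 6 * R ≤ Δ
    6R≤Δ = ≤-by (0≤* (0≤* (0≤ι 6) (0≤- (1≤ι 1≤s))) 0≤R) (eq (ι s) R)
      where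
      eq : ∀ s R → ι 6 * s * R ≡ ι 6 * R + ι 6 * (s - 1ℚ) * R
      eq = solve-∀ ℚ-ring

    1≤Δ : 1ℚ ≤ Δ
    1≤Δ = ℚ.≤-trans 1≤R (ℚ.≤-trans (≤-by (0≤* (0≤ι 5) 0≤R) (eq R)) 6R≤Δ)
      where
      eq : ∀ R → ι 6 * R ≡ R + ι 5 * R
      eq = solve-∀ ℚ-ring

    0<Δ : 0ℚ < Δ
    0<Δ = ℚ.<-≤-trans 0<1 1≤Δ

    -- Without a node within Δ below, the products in the Bethe equation cannot make up for a marked
    -- imbalance of the weights: 2 y ≤ (q + y) / (3 R). But q ≤ 8 R² + 3 y, so 6 R y ≤ 8 R² + 4 y,
    -- which fails for y > 6 R. The factor 6 in Δ is chosen for this.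
    far : ∀ i → i ℕ.< s → (∀ j → j ℕ.< i → Δ ≤ y i - y j) → Δ < y i → ⊥
    far i i<s gap Δ<y = absurd {a = A} {b = B} A≥0 B>0 (eqAB (y i) R)
      where
      β = inv Δ
      b = ι s * β
      z = inv S
      Y = y i
      0≤β = 0≤inv (ℚ.<⇒≤ 0<Δ)
      6Rb≡1 : ι 6 * R * b ≡ 1ℚ
      6Rb≡1 = trans (eq (ι s) R β) (*-inv⁺ 0<Δ)
        where
        eq : ∀ s R β → ι 6 * R * (s * β) ≡ ι 6 * s * R * β
        eq = solve-∀ ℚ-ring
      0≤Y = ℚ.<⇒≤ (ℚ.<-trans 0<Δ Δ<y)
      main : (q i + Y) * (1ℚ - ι 2 * ι s * β) * (1ℚ + 0ℚ) ≤ q i - Y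
      main = bound i i<s 0≤β (inv-≤ {b = 1ℚ} 0<Δ (subst (1ℚ ≤_) (sym (ℚ.*-identityˡ Δ)) 1≤Δ)) ℚ.≤-refl below
        (≡≤ (ℚ.*-identityʳ (Π< s (λ _ → 1ℚ - β)))
          (Π-mono s (λ _ _ → 0≤- (inv-≤ {b = 1ℚ} 0<Δ (subst (1ℚ ≤_) (sym (ℚ.*-identityˡ Δ)) 1≤Δ)))
                    (λ j j<s → ≤-by (0≤- (a≤ i i<s 0≤β below j j<s)) (eq β (inv (y i - y j))))))
        where
        below : ∀ j → j ℕ.< i → inv (y i - y j) ≤ β
        below j j<i = inv-antimono 0<Δ (gap j j<i)
        eq : ∀ b a → 1ℚ - a ≡ 1ℚ - b + (b - a)
        eq = solve-∀ ℚ-ring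
      A = - (ι 6 * R * Y) + ι 8 * (R * R) + ι 4 * Y
      B = ι 4 * Y * (R - 1ℚ) + ι 2 * R * (Y - ι 4 * R)
      A≥0 : 0ℚ ≤ A
      A≥0 = subst (0ℚ ≤_)
        (trans (eq V lam Y z (ι s) β R S)
          (trans (drop₁ _ (ι 2 * Y) (*-inv⁺ 0<S)) (drop₁ A (q i + Y) 6Rb≡1)))
        (0≤+ (0≤* (0≤* (0≤ι 3) 0≤R) (0≤- main)) (0≤+ (0≤* (0≤- lam≤1) 0≤Y)
          (0≤+ (0≤* (0≤* (0≤* (0≤ι 2) 0≤Y) (0≤- (y≤S i i<s))) (0≤inv (ℚ.<⇒≤ 0<S))) (0≤* (0≤ι 2) (0≤- V≤4R²)))))
        where
        eq : ∀ V l Y z s β R S → let q = ι 2 * V + l * Y + ι 2 * (Y * Y * z) in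
          ι 3 * R * (q - Y - (q + Y) * (1ℚ - ι 2 * s * β) * (1ℚ + 0ℚ)) + ((1ℚ - l) * Y +
            (ι 2 * Y * (S - Y) * z + ι 2 * (ι 4 * (R * R) - V))) ≡
          - (ι 6 * R * Y) + ι 8 * (R * R) + ι 4 * Y + (q + Y) * (ι 6 * R * (s * β) - 1ℚ) + ι 2 * Y * (S * z - 1ℚ)
        eq = solve-∀ ℚ-ring
      B>0 : 0ℚ < B
      B>0 = subst (0ℚ <_) (ℚ.+-comm (ι 2 * R * (Y - ι 4 * R)) _)
        (0<+ (0<* (0<* (0<ι 1) 0<R) (ℚ.<-≤-trans (0<* (0<ι 1) 0<R) (≤-by (0≤+ (0≤- (ℚ.<⇒≤ Δ<y)) (0≤- 6R≤Δ)) (eq Y R Δ))))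
             (0≤* (0≤* (0≤ι 4) 0≤Y) (0≤- 1≤R)))
        where
        eq : ∀ Y R Δ → Y - ι 4 * R ≡ ι 2 * R + (Y - Δ + (Δ - ι 6 * R))
        eq = solve-∀ ℚ-ring
      eqAB : ∀ Y R → - (ι 6 * R * Y) + ι 8 * (R * R) + ι 4 * Y + (ι 4 * Y * (R - 1ℚ) + ι 2 * R * (Y - ι 4 * R)) ≡ 0ℚ
      eqAB = solve-∀ ℚ-ring

  -- Induction from the bottom. If y j exceeded (j + 1) Δ while the lower nodes are at most j Δ, a
  -- gap of length Δ would open below it, contrary to `far`.
  upper : ∀ i j → j ℕ.< i → j ℕ.< s → y j ≤ ι i * Δ
  upper (suc i) j j<1+i j<s with ℕ.m<1+n⇒m<n∨m≡n j<1+i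
  ... | inj₁ j<i = ≤-by (0≤+ (ℚ.<⇒≤ 0<Δ) (0≤- (upper i j j<i j<s))) (eq (ι i) Δ (y j))
    where
    eq : ∀ i Δ y → (1ℚ + i) * Δ ≡ y + (Δ + (i * Δ - y))
    eq = solve-∀ ℚ-ring
  ... | inj₂ refl with y j ℚ.≤? ι (suc j) * Δ
  ... | yes h = h
  ... | no ¬h = ⊥-elim (far j j<s
      (λ k k<j → ≤-by (0≤+ (ℚ.<⇒≤ (0<- (ℚ.≰⇒> ¬h))) (0≤- (upper j k k<j (ℕ.<-trans k<j j<s)))) (eq (ι j) Δ (y j) (y k)))
      (ℚ.≤-<-trans (≤-by (0≤* (0≤ι j) (ℚ.<⇒≤ 0<Δ)) (eq′ (ι j) Δ)) (ℚ.≰⇒> ¬h)))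
    where
    eq : ∀ i Δ y x → y - x ≡ Δ + (y - (1ℚ + i) * Δ + (i * Δ - x))
    eq = solve-∀ ℚ-ring
    eq′ : ∀ i Δ → (1ℚ + i) * Δ ≡ Δ + i * Δ
    eq′ = solve-∀ ℚ-ring

rangeConst : ℕ → ℚ
rangeConst s = ι s * (ι 6 * ι s)

range : ∀ {s} (c : Config s) → let open Config c in ∀ i → i ℕ.< s → ∣ y i ∣ ≤ rangeConst s * R
range {s} c i i<s = ∣∣≤ (le (Range.upper c s i i<s i<s))
  (le (subst (λ k → - y k ≤ ι s * Range.Δ c) (opp-opp i<s) (Range.upper (reflect c) s (opp s i) (opp< i<s) (opp< i<s))))
  where
  open Config c
  eq : ∀ s R → s * (ι 6 * s * R) ≡ s * (ι 6 * s) * R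
  eq = solve-∀ ℚ-ring
  le : ∀ {a} → a ≤ ι s * Range.Δ c → a ≤ rangeConst s * R
  le = subst (_ ≤_) (eq (ι s) R)

-- Gaps between nodes

-- If the nodes below node i keep a distance R / K from it, its Bethe equation yields R / (4 C + 4 s
-- K) for the gap above it, where C R bounds the nodes; hence the recursion.
gapConst : ℕ → ℕ → ℚ
gapConst s zero    = 1ℚ
gapConst s (suc i) = ι 4 * rangeConst s + ι 4 * ι s * gapConst s i

0≤rangeConst : ∀ s → 0ℚ ≤ rangeConst s
0≤rangeConst s = 0≤* (0≤ι s) (0≤* (0≤ι 6) (0≤ι s))

0≤gapConst : ∀ s i → 0ℚ ≤ gapConst s i
0≤gapConst s zero    = 0≤1
0≤gapConst s (suc i) = 0≤+ (0≤* (0≤ι 4) (0≤rangeConst s)) (0≤* (0≤* (0≤ι 4) (0≤ι s)) (0≤gapConst s i))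

module Gap {s} (c : Config s) where
  open Config c

  private
    C = rangeConst s
    r = inv R
    rR≡1 : r * R ≡ 1ℚ
    rR≡1 = trans (ℚ.*-comm r R) (*-inv⁺ 0<R)
    0≤r = 0≤inv 0≤R

    K-mono : ∀ i → gapConst s i ≤ gapConst s (suc i)
    K-mono i = ≤-by (0≤+ (0≤* (0≤ι 4) (0≤rangeConst s)) (0≤+ (0≤* (0≤ι 3) (0≤gapConst s i))
      (0≤* (0≤* (0≤ι 4) (0≤- (1≤ι 1≤s))) (0≤gapConst s i)))) (eq C (ι s) (gapConst s i))
      where
      eq : ∀ C s K → ι 4 * C + ι 4 * s * K ≡ K + (ι 4 * C + (ι 3 * K + ι 4 * (s - 1ℚ) * K))
      eq = solve-∀ ℚ-ring

    mono≤ : ∀ {i j} → i ℕ.≤ j → j ℕ.< s → y i ≤ y j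
    mono≤ {i} {j} i≤j j<s with ℕ.m≤n⇒m<n∨m≡n i≤j
    ... | inj₁ i<j  = ℚ.<⇒≤ (mono i<j j<s)
    ... | inj₂ refl = ℚ.≤-refl

    -- The node just above i enters with its own factor 1 + η, η being the reciprocal of the gap. As
    -- 2 s β ≤ 1/2 and Q ≥ R², the Bethe equation gives η ≤ 4 s β + 4 C / R: too small a gap would
    -- make the right side too large.
    next : ∀ i K → 0ℚ ≤ K → K ≤ R → ι 4 * C + ι 4 * ι s * K ≤ R → suc i ℕ.< s →
           (∀ j → j ℕ.< i → R ≤ K * (y i - y j)) →
           R ≤ (ι 4 * C + ι 4 * ι s * K) * (y (suc i) - y i)
    next i K 0≤K K≤R K′≤R 1+i<s gap =
      ≤-by (0≤* (0≤* 0≤R (0≤- η≤)) (ℚ.<⇒≤ 0<δ))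
        (trans (sym (trans (drop₁ _ (- R) (*-inv⁺ 0<δ)) (drop₁ (K′ * δ) (K′ * δ) rR≡1))) (eq₀ K′ r R δ η))
      where
      i<s = ℕ.<-trans (ℕ.n<1+n i) 1+i<s
      K′ = ι 4 * C + ι 4 * ι s * K
      δ = y (suc i) - y i
      0<δ : 0ℚ < δ
      0<δ = 0<- (mono (ℕ.n<1+n i) 1+i<s)
      η = inv δ
      0≤η = 0≤inv (ℚ.<⇒≤ 0<δ)
      β = K * r
      0≤β = 0≤* 0≤K 0≤r
      β≤1 : β ≤ 1ℚ
      β≤1 = ≤≡ (*-monoʳ 0≤r K≤R) (trans (ℚ.*-comm R r) rR≡1)
      below : ∀ j → j ℕ.< i → inv (y i - y j) ≤ β
      below j j<i = inv-≤ (0<- (mono j<i i<s)) (≡≤ (sym rR≡1) (≤≡ (*-monoˡ 0≤r (gap j j<i)) (eq r K (y i - y j))))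
        where
        eq : ∀ r K d → r * (K * d) ≡ K * r * d
        eq = solve-∀ ℚ-ring
      next≡ : inv (y i - y (suc i)) ≡ - η
      next≡ = trans (cong inv (eq (y i) (y (suc i)))) (inv-neg δ)
        where
        eq : ∀ a b → a - b ≡ - (b - a)
        eq = solve-∀ ℚ-ring
      Y = y i
      Q = q i + Y
      z = inv S
      main : Q * (1ℚ - ι 2 * ι s * β) * (1ℚ + η) ≤ q i - Y
      main = bound i i<s 0≤β β≤1 0≤η below (Π-one≤ s (0≤- β≤1) 0≤η
        (λ j j<s → ≤-by (0≤- (a≤ i i<s 0≤β below j j<s)) (eq₁ β (inv (y i - y j)))) (suc i) 1+i<s
        (≤≡ (≤-by (0≤* 0≤β (0≤+ 0≤1 0≤η)) (eq₂ β η)) (cong (λ x → 1ℚ - x) (sym next≡))))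
        where
        eq₁ : ∀ b a → 1ℚ - a ≡ 1ℚ - b + (b - a)
        eq₁ = solve-∀ ℚ-ring
        eq₂ : ∀ b e → 1ℚ - - e ≡ (1ℚ - b) * (1ℚ + e) + b * (1ℚ + e)
        eq₂ = solve-∀ ℚ-ring
      -CR≤Y : 0ℚ ≤ Y + C * R
      -CR≤Y = subst (0ℚ ≤_) (eq Y (C * R)) (0≤- (ℚ.≤-trans (-x≤∣x∣ Y) (range c i i<s)))
        where
        eq : ∀ a b → b - - a ≡ a + b
        eq = solve-∀ ℚ-ring
      R²≤Q : R * R ≤ Q
      R²≤Q = ≤-by (0≤+ (0≤+ (0≤* (0≤- -lam≤1) -CR≤Y) (0≤* (0≤- lam≤1) (0≤* (0≤rangeConst s) 0≤R)))
        (0≤+ (0≤+ (0≤* (0≤ι 2) (0≤- R²≤V)) (0≤* 0≤R (0≤- K′≤R))) (0≤+ (0≤* 0≤R (0≤+ (0≤* (0≤ι 2) (0≤rangeConst s)) (0≤* (0≤* (0≤ι 4) (0≤ι s)) 0≤K)))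
           (0≤* (0≤ι 2) (0≤* (0≤² Y) (0≤inv (ℚ.<⇒≤ 0<S))))))) (eq V lam Y z R C (ι s) K)
        where
        eq : ∀ V l Y z R C s K → ι 2 * V + l * Y + ι 2 * (Y * Y * z) + Y ≡
          R * R + ((1ℚ - - l) * (Y + C * R) + (1ℚ - l) * (C * R) + (ι 2 * (V - R * R) + R * (R - (ι 4 * C + ι 4 * s * K)) +
            (R * (ι 2 * C + ι 4 * s * K) + ι 2 * (Y * Y * z))))
        eq = solve-∀ ℚ-ring
      0<Q = ℚ.<-≤-trans (0<* 0<R 0<R) R²≤Q
      η≤ : η ≤ K′ * r
      η≤ = *-cancelˡ 0<Q (≤-by (0≤+ (0≤+ (0≤* (0≤ι 2) (0≤- main))
             (0≤* (0≤* 0≤r (0≤- K′≤R)) (0≤* 0≤η 0≤Q))) (0≤+ (0≤* (0≤* (0≤* (0≤ι 4) (0≤rangeConst s)) 0≤r) (0≤* 0≤η 0≤Q))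
             (0≤+ (0≤* (0≤ι 4) -CR≤Y) (0≤* (0≤* (0≤* (0≤ι 4) (0≤rangeConst s)) 0≤r) (0≤- R²≤Q)))))
             (trans (sym (drop₁ (Q * (K′ * r)) (Q * η - ι 4 * C * R) rR≡1)) (eq (q i) Y η r R C (ι s) K)))
        where
        0≤Q = ℚ.<⇒≤ 0<Q
        eq : ∀ q Y η r R C s K → (q + Y) * ((ι 4 * C + ι 4 * s * K) * r) + ((q + Y) * η - ι 4 * C * R) * (r * R - 1ℚ) ≡
          (q + Y) * η + (ι 2 * (q - Y - (q + Y) * (1ℚ - ι 2 * s * (K * r)) * (1ℚ + η)) + r * (R - (ι 4 * C + ι 4 * s * K)) * (η * (q + Y))
             + (ι 4 * C * r * (η * (q + Y)) + (ι 4 * (Y + C * R) + ι 4 * C * r * (q + Y - R * R))))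
        eq = solve-∀ ℚ-ring
      eq₀ : ∀ K r R δ η → K * δ + K * δ * (r * R - 1ℚ) + - R * (δ * η - 1ℚ) ≡ R + R * (K * r - η) * δ
      eq₀ = solve-∀ ℚ-ring

    step-gap : ∀ i → gapConst s i ≤ R → ∀ j → j ℕ.< i → suc j ℕ.< s → R ≤ gapConst s i * (y (suc j) - y j)
    step-gap (suc i) K≤R j j<1+i 1+j<s with ℕ.m<1+n⇒m<n∨m≡n j<1+i
    ... | inj₁ j<i  = ℚ.≤-trans (step-gap i (ℚ.≤-trans (K-mono i) K≤R) j j<i 1+j<s)
                                (*-monoʳ (ℚ.<⇒≤ (0<- (mono (ℕ.n<1+n j) 1+j<s))) (K-mono i))
    ... | inj₂ refl = next i (gapConst s i) (0≤gapConst s i) (ℚ.≤-trans (K-mono i) K≤R) K≤R 1+j<s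
        (λ k k<i → ℚ.≤-trans (step-gap i (ℚ.≤-trans (K-mono i) K≤R) k k<i (ℕ.≤-<-trans k<i (ℕ.<-trans (ℕ.n<1+n i) 1+j<s)))
           (*-monoˡ (0≤gapConst s i) (ℚ.+-monoˡ-≤ (- y k) (mono≤ k<i (ℕ.<-trans (ℕ.n<1+n i) 1+j<s)))))

  gap : gapConst s s ≤ R → ∀ i j → i ℕ.< j → j ℕ.< s → R ≤ gapConst s s * (y j - y i)
  gap K≤R i j i<j j<s = ℚ.≤-trans (step-gap s K≤R i (ℕ.<-trans i<j j<s) (ℕ.≤-<-trans i<j j<s))
    (*-monoˡ (0≤gapConst s s) (ℚ.+-monoˡ-≤ (- y i) (mono≤ i<j j<s)))

-- Asymptotics as R → ∞

ε-of : ∀ {s} → Config s → ℚ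
ε-of c = inv (Config.R c)

-- Bdd f says that f is O(1) as R → ∞, uniformly in everything but s.
module Asymptotics (s : ℕ) where

  -- Two indices are allowed throughout, so that scalars, functions of a node and functions of a
  -- pair of nodes share one calculus.
  Family : Set
  Family = Config s → ℕ → ℕ → ℚ

  Bdd : Family → Set
  Bdd f = ∃ λ K → 0ℚ ≤ K × (∀ c → K ≤ Config.R c → ∀ i j → i ℕ.< s → j ℕ.< s → ∣ f c i j ∣ ≤ K)

  Eventually : (Config s → Set) → Set
  Eventually P = ∃ λ K → 0ℚ ≤ K × (∀ c → K ≤ Config.R c → P c)

  _≈_ : Family → Family → Set
  f ≈ g = Eventually (λ c → ∀ i j → i ℕ.< s → j ℕ.< s → f c i j ≡ g c i j)

  private
    ≤-sumˡ : ∀ {a b c} → 0ℚ ≤ b → a + b ≤ c → a ≤ c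
    ≤-sumˡ {a} {b} h k = ℚ.≤-trans (≤-by h refl) k

    ≤-sumʳ : ∀ {a b c} → 0ℚ ≤ a → a + b ≤ c → b ≤ c
    ≤-sumʳ {a} {b} h k = ℚ.≤-trans (≤-by h (ℚ.+-comm a b)) k

  _and_ : ∀ {P Q : Config s → Set} → Eventually P → Eventually Q → Eventually (λ c → P c × Q c)
  (K , 0≤K , p) and (L , 0≤L , q) =
    K + L , 0≤+ 0≤K 0≤L , λ c h → p c (≤-sumˡ 0≤L h) , q c (≤-sumʳ 0≤K h)

  infixr 4 _and_

  ev-map : ∀ {P Q : Config s → Set} → (∀ c → P c → Q c) → Eventually P → Eventually Q
  ev-map f (K , 0≤K , p) = K , 0≤K , λ c h → f c (p c h)

  bdd-≈ : ∀ {f g} → f ≈ g → Bdd g → Bdd f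
  bdd-≈ (K , 0≤K , e) (L , 0≤L , b) = K + L , 0≤+ 0≤K 0≤L , λ c h i j i<s j<s →
    ≡≤ (cong ∣_∣ (e c (≤-sumˡ 0≤L h) i j i<s j<s))
       (ℚ.≤-trans (b c (≤-sumʳ 0≤K h) i j i<s j<s) (≤-by 0≤K (ℚ.+-comm K L)))

  bdd-≡ : ∀ {f g} → (∀ c i j → i ℕ.< s → j ℕ.< s → f c i j ≡ g c i j) → Bdd g → Bdd f
  bdd-≡ e = bdd-≈ (0ℚ , ℚ.≤-refl , λ c _ → e c)

  bdd-const : ∀ k → Bdd (λ _ _ _ → k)
  bdd-const k = ∣ k ∣ , ℚ.0≤∣p∣ k , λ _ _ _ _ _ _ → ℚ.≤-refl

  bdd-+ : ∀ {f g} → Bdd f → Bdd g → Bdd (λ c i j → f c i j + g c i j)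
  bdd-+ {f} {g} (K , 0≤K , p) (L , 0≤L , q) = K + L , 0≤+ 0≤K 0≤L , λ c h i j i<s j<s →
    ℚ.≤-trans (ℚ.∣p+q∣≤∣p∣+∣q∣ (f c i j) (g c i j)) (ℚ.+-mono-≤ (p c (≤-sumˡ 0≤L h) i j i<s j<s) (q c (≤-sumʳ 0≤K h) i j i<s j<s))

  bdd-* : ∀ {f g} → Bdd f → Bdd g → Bdd (λ c i j → f c i j * g c i j)
  bdd-* {f} {g} (K , 0≤K , p) (L , 0≤L , q) = K * L + (K + L) , 0≤+ (0≤* 0≤K 0≤L) (0≤+ 0≤K 0≤L) , λ c h i j i<s j<s →
    let h′ = ≤-sumʳ (0≤* 0≤K 0≤L) h in
    ≡≤ (ℚ.∣p*q∣≡∣p∣*∣q∣ (f c i j) (g c i j)) (ℚ.≤-trans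
      (*-mono (ℚ.0≤∣p∣ _) 0≤L (p c (≤-sumˡ 0≤L h′) i j i<s j<s) (q c (≤-sumʳ 0≤K h′) i j i<s j<s))
      (≤-by (0≤+ 0≤K 0≤L) refl))

  bdd-neg : ∀ {f} → Bdd f → Bdd (λ c i j → - f c i j)
  bdd-neg (K , 0≤K , p) = K , 0≤K , λ c h i j i<s j<s → ≡≤ (ℚ.∣-p∣≡∣p∣ _) (p c h i j i<s j<s)

  bdd-- : ∀ {f g} → Bdd f → Bdd g → Bdd (λ c i j → f c i j - g c i j)
  bdd-- p q = bdd-+ p (bdd-neg q)

  bdd-re : ∀ {f} (φ ψ : ℕ → ℕ → ℕ) → (∀ {i j} → i ℕ.< s → j ℕ.< s → φ i j ℕ.< s) →
           (∀ {i j} → i ℕ.< s → j ℕ.< s → ψ i j ℕ.< s) → Bdd f → Bdd (λ c i j → f c (φ i j) (ψ i j))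
  bdd-re φ ψ hφ hψ (K , 0≤K , p) = K , 0≤K , λ c h i j i<s j<s → p c h _ _ (hφ i<s j<s) (hψ i<s j<s)

  bdd-snd : ∀ {f} → Bdd f → Bdd (λ c i j → f c j j)
  bdd-snd = bdd-re (λ _ j → j) (λ _ j → j) (λ _ h → h) (λ _ h → h)

  bdd-opp : ∀ {f} → Bdd f → Bdd (λ c i j → f c (opp s i) (opp s j))
  bdd-opp = bdd-re (λ i _ → opp s i) (λ _ j → opp s j) (λ h _ → opp< h) (λ _ h → opp< h)

  bdd-Σ : ∀ {f} → Bdd f → Bdd (λ c i _ → Σ< s (λ k → f c i k))
  bdd-Σ {f} (K , 0≤K , p) = ι s * K + K , 0≤+ (0≤* (0≤ι s) 0≤K) 0≤K , λ c h i j i<s j<s →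
    ℚ.≤-trans (∣Σ∣≤ s (f c i)) (ℚ.≤-trans (Σ-mono s (λ k k<s → p c (≤-sumʳ (0≤* (0≤ι s) 0≤K) h) i k i<s k<s))
      (≡≤ (Σ-const s K) (≤-by 0≤K refl)))

  bdd-Σ< : ∀ {f} n → n ℕ.≤ s → Bdd f → Bdd (λ c i _ → Σ< n (λ k → f c i k))
  bdd-Σ< zero    _   b = bdd-const 0ℚ
  bdd-Σ< (suc n) n<s b = bdd-+ (bdd-Σ< n (ℕ.<⇒≤ n<s) b) (bdd-re (λ i _ → i) (λ _ _ → n) (λ h _ → h) (λ _ _ → n<s) b)

  bdd-∣∣≤ : ∀ {f g} → Bdd g → Eventually (λ c → ∀ i j → i ℕ.< s → j ℕ.< s → ∣ f c i j ∣ ≤ ∣ g c i j ∣) → Bdd f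
  bdd-∣∣≤ (K , 0≤K , p) (L , 0≤L , q) = K + L , 0≤+ 0≤K 0≤L , λ c h i j i<s j<s →
    ℚ.≤-trans (q c (≤-sumʳ 0≤K h) i j i<s j<s) (ℚ.≤-trans (p c (≤-sumˡ 0≤L h) i j i<s j<s) (≤-by 0≤L refl))

  bdd-01 : ∀ {f} → (∀ c i j → i ℕ.< s → j ℕ.< s → 0ℚ ≤ f c i j × f c i j ≤ 1ℚ) → Bdd f
  bdd-01 h = 1ℚ , 0≤1 , λ c _ i j i<s j<s →
    let (l , u) = h c i j i<s j<s in ∣∣≤ u (ℚ.≤-trans (ℚ.neg-antimono-≤ l) 0≤1)

  εR≡1 : ∀ c → ε-of c * Config.R c ≡ 1ℚ
  εR≡1 c = trans (ℚ.*-comm (ε-of {s} c) (Config.R c)) (*-inv⁺ (Config.0<R c))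

  0≤ε : ∀ (c : Config s) → 0ℚ ≤ ε-of c
  0≤ε c = 0≤inv (Config.0≤R c)

  -- R ≥ K / δ makes K / R ≤ δ. In this way error terms drop below any prescribed constant.
  small : ∀ {f δ} → Bdd f → 0ℚ < δ → Eventually (λ c → ∀ i j → i ℕ.< s → j ℕ.< s → ∣ ε-of c * f c i j ∣ ≤ δ)
  small {f} {δ} (K , 0≤K , p) 0<δ = K + K * inv δ , 0≤+ 0≤K (0≤* 0≤K (0≤inv (ℚ.<⇒≤ 0<δ))) , λ c h i j i<s j<s →
    ≡≤ (trans (ℚ.∣p*q∣≡∣p∣*∣q∣ (ε-of c) (f c i j)) (cong (_* ∣ f c i j ∣) (ℚ.0≤p⇒∣p∣≡p (0≤ε c))))
      (ℚ.≤-trans (*-monoˡ (0≤ε c) (p c (≤-sumˡ (0≤* 0≤K (0≤inv (ℚ.<⇒≤ 0<δ))) h) i j i<s j<s))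
        (≤-by (0≤* (0≤* (0≤ε c) (ℚ.<⇒≤ 0<δ)) (0≤- (≤-sumʳ 0≤K h)))
          (trans (sym (drop₁ δ δ (εR≡1 c))) (trans (eq (ε-of c) K δ (inv δ) (Config.R c)) (drop₁ _ (ε-of c * K) (*-inv⁺ 0<δ))))))
    where
    eq : ∀ e K d i R → d + d * (e * R - 1ℚ) ≡ e * K + e * d * (R - K * i) + e * K * (d * i - 1ℚ)
    eq = solve-∀ ℚ-ring

  bdd-ε : Bdd (λ c _ _ → ε-of c)
  bdd-ε = bdd-01 (λ c _ _ _ _ → 0≤ε c , inv-≤ {b = 1ℚ} (Config.0<R c) (≤≡ (Config.1≤R c) (sym (ℚ.*-identityˡ (Config.R c)))))

  bdd-lam : Bdd (λ c _ _ → Config.lam c)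
  bdd-lam = 1ℚ , 0≤1 , λ c _ _ _ _ _ → ∣∣≤ (Config.lam≤1 c) (Config.-lam≤1 c)

  Y : Config s → ℕ → ℚ
  Y c i = ε-of c * Config.y c i

  A : Config s → ℕ → ℕ → ℚ
  A c i j = inv (Y c i - Y c j)

  εA : ∀ c i j → inv (Config.y c i - Config.y c j) ≡ ε-of c * A c i j
  εA c i j = trans (eq (ε-of c) R (inv (y i - y j)) (εR≡1 c))
    (cong (ε-of c *_) (trans (cong (_* inv (y i - y j)) (sym (inv-unique (εR≡1 c))))
      (trans (sym (inv-* (ε-of c) (y i - y j))) (cong inv (eq′ (ε-of c) (y i) (y j))))))
    where
    open Config c
    eq : ∀ e R a → e * R ≡ 1ℚ → a ≡ e * (R * a)
    eq e R a h = trans (sym (ℚ.*-identityˡ a)) (trans (cong (_* a) (sym h)) (ℚ.*-assoc e R a))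
    eq′ : ∀ e a b → e * (a - b) ≡ e * a - e * b
    eq′ = solve-∀ ℚ-ring

  RY : ∀ c i → Config.y c i ≡ Config.R c * Y c i
  RY c i = sym (trans (eq (ε-of c) (Config.R c) (Config.y c i)) (trans (cong (_* Config.y c i) (εR≡1 c)) (ℚ.*-identityˡ (Config.y c i))))
    where
    eq : ∀ e R y → R * (e * y) ≡ e * R * y
    eq = solve-∀ ℚ-ring

  bdd-Y : Bdd (λ c i _ → Y c i)
  bdd-Y = rangeConst s , 0≤rangeConst s , λ c _ i _ i<s _ →
    ≡≤ (trans (ℚ.∣p*q∣≡∣p∣*∣q∣ (ε-of c) (Config.y c i)) (cong (_* ∣ Config.y c i ∣) (ℚ.0≤p⇒∣p∣≡p (0≤ε c))))
      (ℚ.≤-trans (*-monoˡ (0≤ε c) (range c i i<s))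
        (ℚ.≤-reflexive (trans (eq (ε-of c) (rangeConst s) (Config.R c)) (trans (cong (rangeConst s *_) (εR≡1 c)) (ℚ.*-identityʳ (rangeConst s))))))
    where
    eq : ∀ e K R → e * (K * R) ≡ K * (e * R)
    eq = solve-∀ ℚ-ring

  Y-gap : Eventually (λ c → ∀ i j → i ℕ.< j → j ℕ.< s → 1ℚ ≤ gapConst s s * (Y c j - Y c i))
  Y-gap = gapConst s s , 0≤gapConst s s , λ c h i j i<j j<s →
    ≡≤ (sym (εR≡1 c)) (≤≡ (*-monoˡ (0≤ε c) (Gap.gap c h i j i<j j<s)) (eq (ε-of c) (gapConst s s) (Config.y c i) (Config.y c j)))
    where
    eq : ∀ e K a b → e * (K * (b - a)) ≡ K * (e * b - e * a)
    eq = solve-∀ ℚ-ring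

  bdd-inv-gap : ∀ {f : Config s → ℕ → ℚ} {K} → 0ℚ ≤ K →
    Eventually (λ c → ∀ i j → i ℕ.< j → j ℕ.< s → 1ℚ ≤ K * (f c j - f c i)) →
    Bdd (λ c i j → inv (f c i - f c j))
  bdd-inv-gap {f} {K} 0≤K (L , 0≤L , g) = K + L , 0≤+ 0≤K 0≤L , λ c h i j i<s j<s →
    ℚ.≤-trans (bd c (≤-sumʳ 0≤K h) i j i<s j<s) (≤-by 0≤L refl)
    where
    pos : ∀ {d} → 1ℚ ≤ K * d → 0ℚ < d
    pos {d} h with d ℚ.≤? 0ℚ
    ... | yes d≤0 = ⊥-elim (≤⇒≯ (ℚ.≤-trans h (≤≡ (*-monoˡ 0≤K d≤0) (ℚ.*-zeroʳ K))) 0<1)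
    ... | no  d≰0 = ℚ.≰⇒> d≰0
    inv-pos : ∀ {d} → 1ℚ ≤ K * d → ∣ inv d ∣ ≤ K
    inv-pos {d} h = ≡≤ (ℚ.0≤p⇒∣p∣≡p (ℚ.<⇒≤ (0<inv (pos h)))) (inv-≤ (pos h) h)
    bd : ∀ c → L ≤ Config.R c → ∀ i j → i ℕ.< s → j ℕ.< s → ∣ inv (f c i - f c j) ∣ ≤ K
    bd c h i j i<s j<s with ℕ.<-cmp i j
    ... | tri< i<j _ _ = ≡≤ (trans (cong ∣_∣ (trans (cong inv (eq (f c i) (f c j))) (inv-neg (f c j - f c i)))) (ℚ.∣-p∣≡∣p∣ _))
                            (inv-pos (g c h i j i<j j<s))
      where
      eq : ∀ a b → a - b ≡ - (b - a)
      eq = solve-∀ ℚ-ring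
    ... | tri≈ _ refl _ = ≡≤ (cong ∣_∣ (trans (cong inv (ℚ.+-inverseʳ (f c i))) inv-0)) 0≤K
    ... | tri> _ _ j<i = inv-pos (g c h j i j<i i<s)

  bdd-A : Bdd A
  bdd-A = bdd-inv-gap {f = Y} (0≤gapConst s s) Y-gap

-- Stieltjes relations to second order

evenPart oddPart : (ℕ → ℚ) → ℚ → ℕ → ℚ
evenPart A ε zero    = 0ℚ
evenPart A ε (suc n) = evenPart A ε n + A n * (Σ< n A + ε * ε * oddPart A ε n)
oddPart A ε zero    = 0ℚ
oddPart A ε (suc n) = oddPart A ε n + A n * evenPart A ε n

-- Reversing the sign σ only affects the odd part. Both products of the Bethe equation therefore
-- share the same remainders `evenPart` and `oddPart`, and their sum and difference are explicit.
Π-expand : ∀ (A : ℕ → ℚ) ε σ → σ * σ ≡ 1ℚ → ∀ n → Π< n (λ k → 1ℚ + σ * (ε * A k)) ≡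
  1ℚ + ε * ε * evenPart A ε n + σ * (ε * (Σ< n A + ε * ε * oddPart A ε n))
Π-expand A ε σ h zero    = eq ε σ
  where
  eq : ∀ ε σ → 1ℚ ≡ 1ℚ + ε * ε * 0ℚ + σ * (ε * (0ℚ + ε * ε * 0ℚ))
  eq = solve-∀ ℚ-ring
Π-expand A ε σ h (suc n) = trans (cong (_* (1ℚ + σ * (ε * A n))) (Π-expand A ε σ h n))
  (trans (eq ε σ (A n) (Σ< n A) (evenPart A ε n) (oddPart A ε n)) (drop₁ _ (ε * A n * (ε * (Σ< n A + ε * ε * oddPart A ε n))) h))
  where
  eq : ∀ ε σ a S e o → (1ℚ + ε * ε * e + σ * (ε * (S + ε * ε * o))) * (1ℚ + σ * (ε * a)) ≡
    1ℚ + ε * ε * (e + a * (S + ε * ε * o)) + σ * (ε * (S + a + ε * ε * (o + a * e))) + ε * a * (ε * (S + ε * ε * o)) * (σ * σ - 1ℚ)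
  eq = solve-∀ ℚ-ring

module Stieltjes (s : ℕ) where
  open Asymptotics s public

  bdd-even : ∀ n → n ℕ.≤ s → Bdd (λ c i _ → evenPart (A c i) (ε-of c) n)
  bdd-odd  : ∀ n → n ℕ.≤ s → Bdd (λ c i _ → oddPart (A c i) (ε-of c) n)

  private
    bdd-An : ∀ n → n ℕ.< s → Bdd (λ c i _ → A c i n)
    bdd-An n n<s = bdd-re (λ i _ → i) (λ _ _ → n) (λ h _ → h) (λ _ _ → n<s) bdd-A

  bdd-even zero    _   = bdd-const 0ℚ
  bdd-even (suc n) n<s = bdd-+ (bdd-even n (ℕ.<⇒≤ n<s))
    (bdd-* (bdd-An n n<s) (bdd-+ (bdd-Σ< n (ℕ.<⇒≤ n<s) bdd-A) (bdd-* (bdd-* bdd-ε bdd-ε) (bdd-odd n (ℕ.<⇒≤ n<s)))))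
  bdd-odd zero    _   = bdd-const 0ℚ
  bdd-odd (suc n) n<s = bdd-+ (bdd-odd n (ℕ.<⇒≤ n<s)) (bdd-* (bdd-An n n<s) (bdd-even n (ℕ.<⇒≤ n<s)))

  -- `ν` is the variance in units of R², which lies between 1 and 4 because R is only comparable to
  -- the standard deviation. `κ` is the constant of the limiting relation Σ 1 / (Yᵢ - Yⱼ) = κ Yᵢ.
  ν κ σ : Config s → ℚ
  ν c = Config.V c * (ε-of c * ε-of c)
  κ c = inv (ι 2 * ν c)
  σ c = Config.R c * Config.R c * inv (Config.S c)

  private
    ε²R²≡1 : ∀ (c : Config s) → Config.R c * Config.R c * (ε-of c * ε-of c) ≡ 1ℚ
    ε²R²≡1 c = trans (eq (Config.R c) (ε-of c)) (trans (cong₂ _*_ (εR≡1 c) (εR≡1 c)) (ℚ.*-identityˡ 1ℚ))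
      where
      eq : ∀ R e → R * R * (e * e) ≡ (e * R) * (e * R)
      eq = solve-∀ ℚ-ring

  1≤ν : ∀ c → 1ℚ ≤ ν c
  1≤ν c = ≡≤ (sym (ε²R²≡1 c)) (*-monoʳ (0≤² (ε-of c)) (Config.R²≤V c))

  ν≤4 : ∀ c → ν c ≤ ι 4
  ν≤4 c = ≤≡ (*-monoʳ (0≤² (ε-of c)) (Config.V≤4R² c))
    (trans (ℚ.*-assoc (ι 4) (Config.R c * Config.R c) (ε-of c * ε-of c)) (trans (cong (ι 4 *_) (ε²R²≡1 c)) (ℚ.*-identityʳ (ι 4))))

  1≤2ν : ∀ c → 1ℚ ≤ ι 2 * ν c
  1≤2ν c = ≤-by (0≤+ (0≤* (0≤ι 2) (0≤- (1≤ν c))) 0≤1) (eq (ν c))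
    where
    eq : ∀ n → ι 2 * n ≡ 1ℚ + (ι 2 * (n - 1ℚ) + 1ℚ)
    eq = solve-∀ ℚ-ring

  0<2ν : ∀ c → 0ℚ < ι 2 * ν c
  0<2ν c = ℚ.<-≤-trans 0<1 (1≤2ν c)

  2νκ≡1 : ∀ c → ι 2 * ν c * κ c ≡ 1ℚ
  2νκ≡1 c = *-inv⁺ (0<2ν c)

  0<κ : ∀ c → 0ℚ < κ c
  0<κ c = 0<inv (0<2ν c)

  bdd-κ : Bdd (λ c _ _ → κ c)
  bdd-κ = bdd-01 (λ c _ _ _ _ → ℚ.<⇒≤ (0<κ c) , inv-≤ {b = 1ℚ} (0<2ν c) (≤≡ (1≤2ν c) (sym (ℚ.*-identityˡ (ι 2 * ν c)))))

  bdd-σ : Bdd (λ c _ _ → σ c)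
  bdd-σ = bdd-01 (λ c _ _ _ _ → 0≤* (0≤² (Config.R c)) (0≤inv (ℚ.<⇒≤ (Config.0<S c))) ,
    ≤≡ (*-monoʳ (0≤inv (ℚ.<⇒≤ (Config.0<S c))) (ℚ.≤-trans (Config.R²≤V c) (Config.V≤S c))) (*-inv⁺ (Config.0<S c)))

  private
    -- `h` is q in units of R², split into its limit 2 ν and a correction ε θ. `G` collects all that
    -- is of order ε² in the expansion of the sum of the `A c i`.
    θ h H G : Config s → ℕ → ℚ
    θ c i = Config.lam c * Y c i + ι 2 * (ε-of c * σ c) * (Y c i * Y c i)
    h c i = ι 2 * ν c + ε-of c * θ c i
    H c i = inv (h c i)
    e o : Config s → ℕ → ℚ
    e c i = evenPart (A c i) (ε-of c) s
    o c i = oddPart (A c i) (ε-of c) s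
    G c i = - (ι 2 * σ c * (κ c * κ c) * (Y c i * Y c i * Y c i)) + κ c * κ c * (Y c i * (θ c i * θ c i)) * H c i
            + Y c i * e c i * H c i - o c i

    bdd-θ : Bdd (λ c i _ → θ c i)
    bdd-θ = bdd-+ (bdd-* bdd-lam bdd-Y) (bdd-* (bdd-* (bdd-const (ι 2)) (bdd-* bdd-ε bdd-σ)) (bdd-* bdd-Y bdd-Y))

    1≤h : Eventually (λ c → ∀ i j → i ℕ.< s → j ℕ.< s → 1ℚ ≤ h c i)
    1≤h = ev-map (λ c b i j i<s j<s → ≤-by (0≤+ (0≤* (0≤ι 2) (0≤- (1≤ν c))) (0≤- (ℚ.≤-trans (-x≤∣x∣ (ε-of c * θ c i)) (b i j i<s j<s))))
        (eq (ν c) (ε-of c * θ c i))) (small bdd-θ 0<1)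
      where
      eq : ∀ n t → ι 2 * n + t ≡ 1ℚ + (ι 2 * (n - 1ℚ) + (1ℚ - - t))
      eq = solve-∀ ℚ-ring

    bdd-H : Bdd (λ c i _ → H c i)
    bdd-H = bdd-∣∣≤ {g = λ _ _ _ → 1ℚ} (bdd-const 1ℚ) (ev-map (λ c 1≤h i j i<s j<s →
      let 0<h = ℚ.<-≤-trans 0<1 (1≤h i j i<s j<s) in
      ≡≤ (ℚ.0≤p⇒∣p∣≡p (0≤inv (ℚ.<⇒≤ 0<h))) (inv-≤ {b = 1ℚ} 0<h (≤≡ (1≤h i j i<s j<s) (sym (ℚ.*-identityˡ (h c i)))))) 1≤h)

    bdd-G : Bdd (λ c i _ → G c i)
    bdd-G = bdd-- (bdd-+ (bdd-+
        (bdd-neg (bdd-* (bdd-* (bdd-* (bdd-const (ι 2)) bdd-σ) (bdd-* bdd-κ bdd-κ)) (bdd-* (bdd-* bdd-Y bdd-Y) bdd-Y)))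
        (bdd-* (bdd-* (bdd-* bdd-κ bdd-κ) (bdd-* bdd-Y (bdd-* bdd-θ bdd-θ))) bdd-H))
        (bdd-* (bdd-* bdd-Y (bdd-even s ℕ.≤-refl)) bdd-H)) (bdd-odd s ℕ.≤-refl)

    ΣA : Config s → ℕ → ℚ
    ΣA c i = Σ< s (A c i)

    -- the Bethe equation splits into its even and odd parts
    balance : ∀ c i → i ℕ.< s → h c i * (ΣA c i + ε-of c * ε-of c * o c i) ≡ Y c i * (1ℚ + ε-of c * ε-of c * e c i)
    balance c i i<s = begin
      h c i * T                 ≡⟨ cong (_* T) h≡ ⟩
      ε * ε * q i * T           ≡⟨ eq₁ ε (q i) T ⟩
      ε * (q i * (ε * T))       ≡⟨ cong (ε *_) qT≡yE ⟩
      ε * (y i * E)             ≡⟨ ℚ.*-assoc ε (y i) E ⟨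
      Y c i * E                 ∎
      where
      open Config c
      open ≡-Reasoning
      ε = ε-of c
      T = ΣA c i + ε * ε * o c i
      E = 1ℚ + ε * ε * e c i
      lhs : Π< s (λ j → 1ℚ + inv (y i - y j)) ≡ E + 1ℚ * (ε * T)
      lhs = trans (Π-cong s (λ j _ → cong (1ℚ +_) (trans (εA c i j) (sym (ℚ.*-identityˡ (ε * A c i j))))))
                  (Π-expand (A c i) ε 1ℚ refl s)
      rhs : Π< s (λ j → 1ℚ - inv (y i - y j)) ≡ E + - 1ℚ * (ε * T)
      rhs = trans (Π-cong s (λ j _ → cong (1ℚ +_) (trans (cong -_ (εA c i j)) (neg1 (ε * A c i j)))))
                  (Π-expand (A c i) ε (- 1ℚ) refl s)
        where
        neg1 : ∀ a → - a ≡ - 1ℚ * a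
        neg1 = solve-∀ ℚ-ring
      difference : (q i - y i) * (E + 1ℚ * (ε * T)) ≡ (q i + y i) * (E + - 1ℚ * (ε * T))
      difference = trans (cong ((q i - y i) *_) (sym lhs)) (trans (bethe i i<s) (cong ((q i + y i) *_) rhs))
      qT≡yE : q i * (ε * T) ≡ y i * E
      qT≡yE = trans (eq (q i) (y i) E (ε * T)) (trans (cong (λ x → y i * E + ½ * (x - (q i + y i) * (E + - 1ℚ * (ε * T)))) difference)
                (eq′ (y i * E) ((q i + y i) * (E + - 1ℚ * (ε * T)))))
        where
        eq : ∀ q y E t → q * t ≡ y * E + ½ * ((q - y) * (E + 1ℚ * t) - (q + y) * (E + - 1ℚ * t))
        eq = solve-∀ ℚ-ring
        eq′ : ∀ a x → a + ½ * (x - x) ≡ a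
        eq′ = solve-∀ ℚ-ring
      h≡ : h c i ≡ ε * ε * q i
      h≡ = trans (eq V lam ε R (inv S) (y i)) (drop₁ (ε * ε * q i) (ι 2 * (ε * ε * (y i * y i * inv S))) (ε²R²≡1 c))
        where
        eq : ∀ V l e R z y → ι 2 * (V * (e * e)) + e * (l * (e * y) + ι 2 * (e * (R * R * z)) * (e * y * (e * y))) ≡
          e * e * (ι 2 * V + l * y + ι 2 * (y * y * z)) + ι 2 * (e * e * (y * y * z)) * (R * R * (e * e) - 1ℚ)
        eq = solve-∀ ℚ-ring
      eq₁ : ∀ e q t → e * e * q * t ≡ e * (q * (e * t))
      eq₁ = solve-∀ ℚ-ring

    expansion : Eventually (λ c → ∀ i j → i ℕ.< s → j ℕ.< s →
      ΣA c i ≡ κ c * Y c i - ε-of c * Config.lam c * (κ c * κ c) * (Y c i * Y c i) + ε-of c * ε-of c * G c i)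
    expansion = ev-map (λ c 1≤h i j i<s j<s →
      let ε = ε-of c ; k = κ c
          hH≡1 = *-inv⁺ (ℚ.<-≤-trans 0<1 (1≤h i j i<s j<s))
          H≡ : H c i ≡ k - ε * k * θ c i * H c i
          H≡ = trans (sym (trans (drop₁ _ (- k) hH≡1) (drop₁ (H c i) (H c i) (2νκ≡1 c)))) (eq₁ (ν c) k ε (θ c i) (H c i))
          -- Substituting the formula for 1 / h into itself exposes the term of first order. The
          -- remaining `H` then occurs with a factor ε², and it is bounded.
          H≡′ : H c i ≡ k - ε * k * θ c i * (k - ε * k * θ c i * H c i)
          H≡′ = trans H≡ (cong (λ x → k - ε * k * θ c i * x) H≡)
      in trans (sym (drop₁ (ΣA c i) (ΣA c i) hH≡1))
         (trans (eq₂ (ΣA c i) (h c i) (H c i) ε (o c i))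
         (trans (cong (λ x → x * H c i - ε * ε * (o c i * (h c i * H c i))) (balance c i i<s))
         (trans (eq₃ (Y c i) ε (e c i) (o c i) (h c i) (H c i))
         (trans (cong₂ (λ a b → Y c i * a + ε * ε * (Y c i * e c i * H c i - o c i * b)) H≡′ hH≡1)
            (eq₄ (Y c i) ε k (Config.lam c) (σ c) (e c i) (o c i) (H c i))))))) 1≤h
      where
      eq₁ : ∀ n k e t H → H + H * (ι 2 * n * k - 1ℚ) + - k * ((ι 2 * n + e * t) * H - 1ℚ) ≡ k - e * k * t * H
      eq₁ = solve-∀ ℚ-ring
      eq₂ : ∀ S h H e o → S + S * (h * H - 1ℚ) ≡ h * (S + e * e * o) * H - e * e * (o * (h * H))
      eq₂ = solve-∀ ℚ-ring
      eq₃ : ∀ Y e E o h H → Y * (1ℚ + e * e * E) * H - e * e * (o * (h * H)) ≡ Y * H + e * e * (Y * E * H - o * (h * H))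
      eq₃ = solve-∀ ℚ-ring
      eq₄ : ∀ Y e k l σ E o H → let t = l * Y + ι 2 * (e * σ) * (Y * Y) in
        Y * (k - e * k * t * (k - e * k * t * H)) + e * e * (Y * E * H - o * 1ℚ) ≡
        k * Y - e * l * (k * k) * (Y * Y) + e * e * (- (ι 2 * σ * (k * k) * (Y * Y * Y)) + k * k * (Y * (t * t)) * H + Y * E * H - o)
      eq₄ = solve-∀ ℚ-ring

  -- the remainder in the second order Stieltjes relation
  rem : Config s → ℕ → ℚ
  rem c i = Config.R c * Config.R c *
    (Σ< s (A c i) - (κ c * Y c i - ε-of c * Config.lam c * (κ c * κ c) * (Y c i * Y c i)))

  bdd-rem : Bdd (λ c i _ → rem c i)
  bdd-rem = bdd-≈ (ev-map (λ c e i j i<s j<s → trans (cong (λ x → Config.R c * Config.R c * (x - (m c i))) (e i j i<s j<s))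
      (trans (eq (Config.R c) (m c i) (ε-of c) (G c i)) (trans (cong (_* G c i) (ε²R²≡1 c)) (ℚ.*-identityˡ (G c i))))) expansion) bdd-G
    where
    m : Config s → ℕ → ℚ
    m c i = κ c * Y c i - ε-of c * Config.lam c * (κ c * κ c) * (Y c i * Y c i)
    eq : ∀ R m e g → R * R * (m + e * e * g - m) ≡ R * R * (e * e) * g
    eq = solve-∀ ℚ-ring

  stieltjes : ∀ c i → Σ< s (A c i) ≡
    κ c * Y c i - ε-of c * Config.lam c * (κ c * κ c) * (Y c i * Y c i) + ε-of c * ε-of c * rem c i
  stieltjes c i = trans (sym (drop₁ (Σ< s (A c i)) (Σ< s (A c i) - m) (ε²R²≡1 c))) (eq (Config.R c) (ε-of c) (Σ< s (A c i)) m)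
    where
    m = κ c * Y c i - ε-of c * Config.lam c * (κ c * κ c) * (Y c i * Y c i)
    eq : ∀ R e S m → S + (S - m) * (R * R * (e * e) - 1ℚ) ≡ m + e * e * (R * R * (S - m))
    eq = solve-∀ ℚ-ring

-- Opposite nodes: the linearised operator and the sums W

max-index : ∀ n (f : ℕ → ℚ) → ∃ λ m → m ℕ.< suc n × (∀ j → j ℕ.< suc n → f j ≤ f m)
max-index zero    f = 0 , s≤s z≤n , λ { zero _ → ℚ.≤-refl ; (suc _) (s≤s ()) }
max-index (suc n) f with max-index n f
... | m , m<1+n , h with ℚ.≤-total (f m) (f (suc n))
... | inj₁ fm≤fn = suc n , ℕ.≤-refl , λ j j<2+n → [ (λ j<1+n → ℚ.≤-trans (h j j<1+n) fm≤fn) , (λ { refl → ℚ.≤-refl }) ]′ (ℕ.m<1+n⇒m<n∨m≡n j<2+n)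
... | inj₂ fn≤fm = m , ℕ.m<n⇒m<1+n m<1+n , λ j j<2+n → [ h j , (λ { refl → fn≤fm }) ]′ (ℕ.m<1+n⇒m<n∨m≡n j<2+n)

-- The partial fraction decomposition makes the linearisation exact: a difference of two Stieltjes
-- relations becomes a linear expression in a - b without any error term. The hypotheses cover the
-- diagonal, where both reciprocals are 0 by convention.
inv-diff : ∀ a b → (a ≡ 0ℚ → b ≡ 0ℚ) → (b ≡ 0ℚ → a ≡ 0ℚ) → (a - b) * (inv a * inv b) ≡ inv b - inv a
inv-diff a b h k with a ℚ.≟ 0ℚ
... | yes refl = trans (cong (λ x → (0ℚ - x) * (inv 0ℚ * inv x)) (h refl))
                 (trans (ℚ.*-zeroˡ (inv 0ℚ * inv 0ℚ)) (sym (trans (cong (λ x → inv x - inv 0ℚ) (h refl)) (ℚ.+-inverseʳ (inv 0ℚ)))))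
... | no  a≢0  = trans (eq a b (inv a) (inv b))
                 (cong₂ _-_ (trans (cong (_* inv b) (*-inv a≢0)) (ℚ.*-identityˡ (inv b)))
                            (trans (cong (_* inv a) (*-inv (a≢0 ∘ k))) (ℚ.*-identityˡ (inv a))))
  where
  eq : ∀ a b u v → (a - b) * (u * v) ≡ a * u * v - b * v * u
  eq = solve-∀ ℚ-ring

module Pairing (s : ℕ) where
  open Stieltjes s public

  private
    _′ : ℕ → ℕ
    i ′ = opp s i

  Y-≢ : ∀ c {i j} → i ℕ.< s → j ℕ.< s → Y c i - Y c j ≡ 0ℚ → i ≡ j
  Y-≢ c {i} {j} i<s j<s e with ℕ.<-cmp i j
  ... | tri≈ _ i≡j _ = i≡j
  ... | tri< i<j _ _ = ⊥-elim (<⇒≢ (0<* (0<inv (Config.0<R c)) (0<- (Config.mono c i<j j<s)))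
      (trans (sym (cong -_ e)) (eq (ε-of c) (Config.y c i) (Config.y c j))))
    where
    eq : ∀ e a b → - (e * a - e * b) ≡ e * (b - a)
    eq = solve-∀ ℚ-ring
  ... | tri> _ _ j<i = ⊥-elim (<⇒≢ (0<* (0<inv (Config.0<R c)) (0<- (Config.mono c j<i i<s)))
      (trans (sym e) (eq (ε-of c) (Config.y c i) (Config.y c j))))
    where
    eq : ∀ e a b → e * a - e * b ≡ e * (a - b)
    eq = solve-∀ ℚ-ring

  Y-diag : ∀ c {i j} → i ≡ j → Y c i - Y c j ≡ 0ℚ
  Y-diag c {i} refl = ℚ.+-inverseʳ (Y c i)

  -- The difference of two nodes and that of their mirror images, oriented so that the two agree for
  -- a symmetric configuration.
  a b : Config s → ℕ → ℕ → ℚ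
  a c i j = Y c i - Y c j
  b c i j = Y c (j ′) - Y c (i ′)

  a⇒b : ∀ c {i j} → i ℕ.< s → j ℕ.< s → a c i j ≡ 0ℚ → b c i j ≡ 0ℚ
  a⇒b c i<s j<s e = Y-diag c (cong (opp s) (sym (Y-≢ c i<s j<s e)))

  b⇒a : ∀ c {i j} → i ℕ.< s → j ℕ.< s → b c i j ≡ 0ℚ → a c i j ≡ 0ℚ
  b⇒a c i<s j<s e = Y-diag c (trans (sym (opp-opp i<s)) (trans (cong (opp s) (sym (Y-≢ c (opp< j<s) (opp< i<s) e))) (opp-opp j<s)))

  M : Config s → ℕ → ℕ → ℚ
  M c i j = inv (a c i j) * inv (b c i j)

  -- Passing to opposite indices reverses the order, and so does the orientation of `b`; hence `a`
  -- and `b` have the same sign. This positivity is what gives L a maximum principle.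
  0≤M : ∀ c i j → i ℕ.< s → j ℕ.< s → 0ℚ ≤ M c i j
  0≤M c i j i<s j<s with ℕ.<-cmp i j
  ... | tri< i<j _ _ = ≤≡ (0≤* (pos i<j j<s) (pos (opp-anti i<j j<s) (opp< i<s)))
      (trans (cong₂ _*_ (neg i j) (neg (j ′) (i ′))) (eq (inv (a c i j)) (inv (b c i j))))
    where
    pos : ∀ {i j} → i ℕ.< j → j ℕ.< s → 0ℚ ≤ inv (Y c j - Y c i)
    pos {i} {j} i<j j<s = 0≤inv (≤≡ (0≤* (0≤ε c) (ℚ.<⇒≤ (0<- (Config.mono c i<j j<s)))) (eq′ (ε-of c) (Config.y c i) (Config.y c j)))
      where
      eq′ : ∀ e a b → e * (b - a) ≡ e * b - e * a
      eq′ = solve-∀ ℚ-ring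
    neg : ∀ i j → inv (Y c j - Y c i) ≡ - inv (Y c i - Y c j)
    neg i j = trans (cong inv (eq′ (Y c i) (Y c j))) (inv-neg (Y c i - Y c j))
      where
      eq′ : ∀ a b → b - a ≡ - (a - b)
      eq′ = solve-∀ ℚ-ring
    eq : ∀ a b → - a * - b ≡ a * b
    eq = solve-∀ ℚ-ring
  ... | tri≈ _ refl _ = ℚ.≤-reflexive (sym (trans (cong (_* inv (b c i i)) (trans (cong inv (Y-diag c {i} refl)) inv-0)) (ℚ.*-zeroˡ (inv (b c i i)))))
  ... | tri> _ _ j<i = 0≤* (pos j<i i<s) (pos (opp-anti j<i i<s) (opp< j<s))
    where
    pos : ∀ {i j} → i ℕ.< j → j ℕ.< s → 0ℚ ≤ inv (Y c j - Y c i)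
    pos {i} {j} i<j j<s = 0≤inv (≤≡ (0≤* (0≤ε c) (ℚ.<⇒≤ (0<- (Config.mono c i<j j<s)))) (eq′ (ε-of c) (Config.y c i) (Config.y c j)))
      where
      eq′ : ∀ e a b → e * (b - a) ≡ e * b - e * a
      eq′ = solve-∀ ℚ-ring

  -- the linearisation of the Stieltjes relations about a symmetric configuration
  L : Config s → (ℕ → ℚ) → ℕ → ℚ
  L c f i = κ c * f i + Σ< s (λ j → (f i - f j) * M c i j)

  L-linear : ∀ c (f g : ℕ → ℚ) α β γ i → L c (λ j → α * f j + β * g j + γ) i ≡ α * L c f i + β * L c g i + κ c * γ
  L-linear c f g α β γ i = trans (cong (κ c * (α * f i + β * g i + γ) +_) (trans (Σ-cong s (λ j _ → eq₁ α β γ (f i) (f j) (g i) (g j) (M c i j)))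
    (trans (Σ-+ s _ _) (cong₂ _+_ (Σ-*ˡ s α _) (Σ-*ˡ s β _))))) (eq₂ (κ c) α β γ (f i) (g i) _ _)
    where
    eq₁ : ∀ α β γ f f′ g g′ m → (α * f + β * g + γ - (α * f′ + β * g′ + γ)) * m ≡ α * ((f - f′) * m) + β * ((g - g′) * m)
    eq₁ = solve-∀ ℚ-ring
    eq₂ : ∀ k α β γ f g S T → k * (α * f + β * g + γ) + (α * S + β * T) ≡ α * (k * f + S) + β * (k * g + T) + k * γ
    eq₂ = solve-∀ ℚ-ring

  -- At an index where f is largest, every term (f i - f j) M of L is nonnegative, so that κ f is at
  -- most L f there.
  max-principle : ∀ c (f : ℕ → ℚ) ρ → (∀ i → i ℕ.< s → L c f i ≤ ρ) → ∀ i → i ℕ.< s → κ c * f i ≤ ρ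
  max-principle c f ρ h i i<s =
    let (m , m<s , top) = maximum (Config.1≤s c) in
    ℚ.≤-trans (*-monoˡ (ℚ.<⇒≤ (0<κ c)) (top i i<s)) (ℚ.≤-trans
      (≤-by (Σ-0≤ s (λ j j<s → 0≤* (0≤- (top j j<s)) (0≤M c m j m<s j<s))) refl) (h m m<s))
    where
    maximum : ∀ {n} → 1 ℕ.≤ n → ∃ λ m → m ℕ.< n × (∀ j → j ℕ.< n → f j ≤ f m)
    maximum {suc n} _ = max-index n f

  -- The maximum principle for f and for - f bounds the inverse of L by 1 / κ = 2 ν ≤ 8, whatever
  -- the position of the nodes.
  bdd-L⁻¹ : ∀ {f : Config s → ℕ → ℚ} → Bdd (λ c i _ → L c (f c) i) → Bdd (λ c i _ → f c i)
  bdd-L⁻¹ {f} (K , 0≤K , p) = ι 8 * K + K , 0≤+ (0≤* (0≤ι 8) 0≤K) 0≤K , λ c h i j i<s j<s →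
    let b = λ k k<s → p c (ℚ.≤-trans (≤-by (0≤* (0≤ι 8) 0≤K) (ℚ.+-comm (ι 8 * K) K)) h) k k k<s k<s
        up = max-principle c (f c) K (λ k k<s → ℚ.≤-trans (x≤∣x∣ (L c (f c) k)) (b k k<s)) i i<s
        dn = max-principle c (λ k → - 1ℚ * f c k + 0ℚ * f c k + 0ℚ) K (λ k k<s →
               ≡≤ (trans (L-linear c (f c) (f c) (- 1ℚ) 0ℚ 0ℚ k) (eq₁ (L c (f c) k) (κ c)))
                  (ℚ.≤-trans (-x≤∣x∣ (L c (f c) k)) (b k k<s))) i i<s
    in ∣∣≤ (bd c (f c i) up) (bd c (- f c i) (≡≤ (cong (κ c *_) (eq₂ (f c i))) dn))
    where
    eq₁ : ∀ l k → - 1ℚ * l + 0ℚ * l + k * 0ℚ ≡ - l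
    eq₁ = solve-∀ ℚ-ring
    eq₂ : ∀ x → - x ≡ - 1ℚ * x + 0ℚ * x + 0ℚ
    eq₂ = solve-∀ ℚ-ring
    bd : ∀ c x → κ c * x ≤ K → x ≤ ι 8 * K + K
    bd c x h = ≤-by (0≤+ (0≤+ (0≤* (ℚ.<⇒≤ (0<2ν c)) (0≤- h)) (0≤* (0≤* (0≤ι 2) (0≤- (ν≤4 c))) 0≤K)) 0≤K)
      (trans (eq (ν c) (κ c) K x) (drop₁ _ x (2νκ≡1 c)))
      where
      eq : ∀ n k K x → ι 8 * K + K ≡ x + (ι 2 * n * (K - k * x) + ι 2 * (ι 4 - n) * K + K) + x * (ι 2 * n * k - 1ℚ)
      eq = solve-∀ ℚ-ring

  -- `W` is kept in the original units, where its differences are integers for a design. `Q` plays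
  -- the role of Y²: it equals Y² for a symmetric configuration, and L acts on it in closed form.
  W Q : Config s → ℕ → ℚ
  W c i = Config.y c i + Config.y c (i ′)
  Q c i = - (Y c i * Y c (i ′))

  W≡ : ∀ c i → W c i ≡ Config.R c * (Y c i + Y c (i ′))
  W≡ c i = trans (cong₂ _+_ (RY c i) (RY c (i ′))) (sym (ℚ.*-distribˡ-+ (Config.R c) (Y c i) (Y c (i ′))))

  Σ-inv-b : ∀ c i → Σ< s (λ j → inv (b c i j)) ≡ - Σ< s (A c (i ′))
  Σ-inv-b c i = trans (Σ-cong s (λ j _ → trans (cong inv (eq (Y c (j ′)) (Y c (i ′)))) (inv-neg (Y c (i ′) - Y c (j ′)))))
    (trans (Σ-neg s (λ j → A c (i ′) (j ′))) (cong -_ (Σ-rev s (A c (i ′)))))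
    where
    eq : ∀ a b → a - b ≡ - (b - a)
    eq = solve-∀ ℚ-ring

  private
    S₁ S₂ : Config s → ℕ → ℚ
    S₁ c i = Σ< s (A c i)
    S₂ c i = Σ< s (A c (i ′))

    P₂ P₃ : Config s → ℕ → ℚ
    P₂ c i = Y c i * Y c i + Y c (i ′) * Y c (i ′)
    P₃ c i = Y c i * Y c i * Y c i + Y c (i ′) * Y c (i ′) * Y c (i ′)

  -- Add the Stieltjes relations at i and at its opposite. Their linear parts make up L, the skew
  -- terms add up instead of cancelling, and the factor R turns their order ε into order 1.
  L-W : ∀ c i → i ℕ.< s → L c (W c) i ≡ Config.lam c * (κ c * κ c) * P₂ c i - ε-of c * (rem c i + rem c (i ′))
  L-W c i i<s = begin
    κ c * W c i + Σ< s (λ j → (W c i - W c j) * M c i j)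
      ≡⟨ cong₂ _+_ (cong (κ c *_) (W≡ c i)) (Σ-cong s (λ j j<s → trans (cong (_* M c i j) (W-diff j))
           (trans (ℚ.*-assoc R (a c i j - b c i j) (M c i j)) (cong (R *_) (inv-diff (a c i j) (b c i j) (a⇒b c i<s j<s) (b⇒a c i<s j<s)))))) ⟩
    κ c * (R * (Y c i + Y c (i ′))) + Σ< s (λ j → R * (inv (b c i j) - A c i j))
      ≡⟨ cong (κ c * (R * (Y c i + Y c (i ′))) +_) (trans (Σ-*ˡ s R _) (cong (R *_) (trans (Σ-- s _ _) (cong (_- S₁ c i) (Σ-inv-b c i))))) ⟩
    κ c * (R * (Y c i + Y c (i ′))) + R * (- S₂ c i - S₁ c i)
      ≡⟨ cong₂ (λ x z → κ c * (R * (Y c i + Y c (i ′))) + R * (- x - z)) (stieltjes c (i ′)) (stieltjes c i) ⟩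
    κ c * (R * (Y c i + Y c (i ′))) + R * (- (κ c * Y c (i ′) - ε-of c * lam * (κ c * κ c) * (Y c (i ′) * Y c (i ′)) + ε-of c * ε-of c * rem c (i ′))
       - (κ c * Y c i - ε-of c * lam * (κ c * κ c) * (Y c i * Y c i) + ε-of c * ε-of c * rem c i))
      ≡⟨ eq (κ c) R (Y c i) (Y c (i ′)) (ε-of c) lam (rem c i) (rem c (i ′)) ⟩
    lam * (κ c * κ c) * P₂ c i - ε-of c * (rem c i + rem c (i ′)) + (lam * (κ c * κ c) * P₂ c i - ε-of c * (rem c i + rem c (i ′))) * (ε-of c * R - 1ℚ)
      ≡⟨ drop₁ _ (lam * (κ c * κ c) * P₂ c i - ε-of c * (rem c i + rem c (i ′))) (εR≡1 c) ⟩
    lam * (κ c * κ c) * P₂ c i - ε-of c * (rem c i + rem c (i ′)) ∎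
    where
    open Config c
    open ≡-Reasoning
    W-diff : ∀ j → W c i - W c j ≡ R * (a c i j - b c i j)
    W-diff j = trans (cong₂ _-_ (W≡ c i) (W≡ c j)) (eq′ R (Y c i) (Y c (i ′)) (Y c j) (Y c (j ′)))
      where
      eq′ : ∀ R p p′ q q′ → R * (p + p′) - R * (q + q′) ≡ R * (p - q - (q′ - p′))
      eq′ = solve-∀ ℚ-ring
    eq : ∀ k R Y Z e l u v → k * (R * (Y + Z)) + R * (- (k * Z - e * l * (k * k) * (Z * Z) + e * e * v) - (k * Y - e * l * (k * k) * (Y * Y) + e * e * u)) ≡
      l * (k * k) * (Y * Y + Z * Z) - e * (u + v) + (l * (k * k) * (Y * Y + Z * Z) - e * (u + v)) * (e * R - 1ℚ)
    eq = solve-∀ ℚ-ring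

  private
    bdd-Y′ : Bdd (λ c i _ → Y c (i ′))
    bdd-Y′ = bdd-opp bdd-Y

    bdd-rem′ : Bdd (λ c i _ → rem c (i ′))
    bdd-rem′ = bdd-opp bdd-rem

    bdd-P₂ : Bdd (λ c i _ → P₂ c i)
    bdd-P₂ = bdd-+ (bdd-* bdd-Y bdd-Y) (bdd-* bdd-Y′ bdd-Y′)

  bdd-W : Bdd (λ c i _ → W c i)
  bdd-W = bdd-L⁻¹ {f = W} (bdd-≡ (λ c i _ i<s _ → L-W c i i<s)
    (bdd-- (bdd-* (bdd-* bdd-lam (bdd-* bdd-κ bdd-κ)) bdd-P₂) (bdd-* bdd-ε (bdd-+ bdd-rem bdd-rem′))))

  count : ∀ c i → i ℕ.< s → Σ< s (λ j → a c i j * inv (a c i j)) ≡ ι s - 1ℚ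
  count c i i<s = trans (Σ-cong s (λ j _ → eq (a c i j * inv (a c i j))))
    (trans (Σ-- s (λ _ → 1ℚ) (λ j → 1ℚ - a c i j * inv (a c i j)))
      (cong₂ _-_ (trans (Σ-const s 1ℚ) (ℚ.*-identityʳ (ι s)))
        (trans (Σ-single s i i<s (λ j j<s j≢i → trans (cong (λ x → 1ℚ - x) (*-inv (λ e → j≢i (sym (Y-≢ c i<s j<s e))))) refl))
          (trans (cong (λ x → 1ℚ - x * inv x) (Y-diag c {i} refl)) (trans (cong (λ x → 1ℚ - x) (ℚ.*-zeroˡ (inv 0ℚ))) refl)))))
    where
    eq : ∀ x → x ≡ 1ℚ - (1ℚ - x)
    eq = solve-∀ ℚ-ring

  -- To leading order L Q = 3 κ Q - (s - 1), while L maps the constant 1 to κ. Since L W is about 2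
  -- lam κ² Q, solving within the span of Q and 1 is possible and determines W.
  L-Q : ∀ c i → i ℕ.< s → L c (Q c) i ≡ ι 3 * κ c * Q c i + κ c * (ε-of c * ε-of c * (W c i * W c i)) - (ι s - 1ℚ)
    + ε-of c * (ε-of c * (Y c i * rem c i + Y c (i ′) * rem c (i ′)) - Config.lam c * (κ c * κ c) * P₃ c i)
  L-Q c i i<s = begin
    κ c * Q c i + Σ< s (λ j → (Q c i - Q c j) * M c i j)
      ≡⟨ cong (κ c * Q c i +_) (trans (Σ-cong s term) (trans (Σ-- s (λ j → Y c i * A c i j + - Y c (i ′) * inv (b c i j)) (λ j → a c i j * inv (a c i j))) (cong₂ _-_ (trans (Σ-+ s (λ j → Y c i * A c i j) (λ j → - Y c (i ′) * inv (b c i j))) (cong₂ _+_ (Σ-*ˡ s (Y c i) (A c i)) (Σ-*ˡ s (- Y c (i ′)) (λ j → inv (b c i j))))) (count c i i<s)))) ⟩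
    κ c * Q c i + (Y c i * S₁ c i + - Y c (i ′) * Σ< s (λ j → inv (b c i j)) - (ι s - 1ℚ))
      ≡⟨ cong (λ x → κ c * Q c i + (Y c i * S₁ c i + - Y c (i ′) * x - (ι s - 1ℚ))) (Σ-inv-b c i) ⟩
    κ c * Q c i + (Y c i * S₁ c i + - Y c (i ′) * - S₂ c i - (ι s - 1ℚ))
      ≡⟨ cong₂ (λ x z → κ c * Q c i + (Y c i * x + - Y c (i ′) * - z - (ι s - 1ℚ))) (stieltjes c i) (stieltjes c (i ′)) ⟩
    κ c * Q c i + (Y c i * (κ c * Y c i - ε * lam * (κ c * κ c) * (Y c i * Y c i) + ε * ε * rem c i)
       + - Y c (i ′) * - (κ c * Y c (i ′) - ε * lam * (κ c * κ c) * (Y c (i ′) * Y c (i ′)) + ε * ε * rem c (i ′)) - (ι s - 1ℚ))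
      ≡⟨ eq (κ c) (Y c i) (Y c (i ′)) ε lam (rem c i) (rem c (i ′)) (ι s - 1ℚ) ⟩
    ι 3 * κ c * Q c i + κ c * ((Y c i + Y c (i ′)) * (Y c i + Y c (i ′))) - (ι s - 1ℚ)
      + ε * (ε * (Y c i * rem c i + Y c (i ′) * rem c (i ′)) - lam * (κ c * κ c) * P₃ c i)
      ≡⟨ cong (λ x → ι 3 * κ c * Q c i + κ c * x - (ι s - 1ℚ) + ε * (ε * (Y c i * rem c i + Y c (i ′) * rem c (i ′)) - lam * (κ c * κ c) * P₃ c i)) (eq′ ε y₁ y₂) ⟩
    ι 3 * κ c * Q c i + κ c * (ε * ε * (W c i * W c i)) - (ι s - 1ℚ)
      + ε * (ε * (Y c i * rem c i + Y c (i ′) * rem c (i ′)) - lam * (κ c * κ c) * P₃ c i) ∎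
    where
    open Config c
    open ≡-Reasoning
    ε = ε-of c
    y₁ = y i
    y₂ = y (i ′)
    eq′ : ∀ e p q → (e * p + e * q) * (e * p + e * q) ≡ e * e * ((p + q) * (p + q))
    eq′ = solve-∀ ℚ-ring
    term : ∀ j → j ℕ.< s → (Q c i - Q c j) * M c i j ≡
      Y c i * A c i j + - Y c (i ′) * inv (b c i j) - a c i j * inv (a c i j)
    term j j<s with a c i j ℚ.≟ 0ℚ
    ... | no a≢0 = trans (eq₁ (Y c i) (Y c (i ′)) (Y c j) (Y c (j ′)) (inv (a c i j)) (inv (b c i j)))
        (trans (drop₁ _ (Y c i * inv (a c i j) - a c i j * inv (a c i j)) (*-inv (a≢0 ∘ b⇒a c i<s j<s)))
          (drop₁ _ (- Y c (i ′) * inv (b c i j)) (*-inv a≢0)))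
      where
      eq₁ : ∀ p p′ q q′ u v → (- (p * p′) - - (q * q′)) * (u * v) ≡
        p * u + - p′ * v - (p - q) * u + - p′ * v * ((p - q) * u - 1ℚ) + (p * u - (p - q) * u) * ((q′ - p′) * v - 1ℚ)
      eq₁ = solve-∀ ℚ-ring
    ... | yes a≡0 = trans (cong₂ (λ x z → (Q c i - Q c j) * (x * z)) A≡0 B≡0)
        (trans (eq₀ (Q c i - Q c j) (Y c i) (- Y c (i ′)) (a c i j)) (sym (cong₂ (λ x z → Y c i * x + - Y c (i ′) * z - a c i j * x) A≡0 B≡0)))
      where
      A≡0 : inv (a c i j) ≡ 0ℚ
      A≡0 = trans (cong inv a≡0) inv-0
      B≡0 : inv (b c i j) ≡ 0ℚ
      B≡0 = trans (cong inv (a⇒b c i<s j<s a≡0)) inv-0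
      eq₀ : ∀ x p q a → x * (0ℚ * 0ℚ) ≡ p * 0ℚ + q * 0ℚ - a * 0ℚ
      eq₀ = solve-∀ ℚ-ring
    eq : ∀ k Y Z e l u v n → k * - (Y * Z) + (Y * (k * Y - e * l * (k * k) * (Y * Y) + e * e * u) + - Z * - (k * Z - e * l * (k * k) * (Z * Z) + e * e * v) - n) ≡
      ι 3 * k * - (Y * Z) + k * ((Y + Z) * (Y + Z)) - n + e * (e * (Y * u + Z * v) - l * (k * k) * (Y * Y * Y + Z * Z * Z))
    eq = solve-∀ ℚ-ring

  -- R times the defect in 3 W = 2 lam (κ Q + s - 1), the solution found in the span of Q and 1.
  -- Under L all terms of order R cancel, so `U` is bounded and the defect is O(1 / R).
  U : Config s → ℕ → ℚ
  U c i = ι 3 * Config.R c * W c i + - (ι 2 * Config.lam c * κ c * Config.R c) * Q c i + - (ι 2 * Config.lam c * (ι s - 1ℚ) * Config.R c)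

  bdd-U : Bdd (λ c i _ → U c i)
  bdd-U = bdd-L⁻¹ {f = U} (bdd-≡ {g = λ c i _ → G c i} (λ c i _ i<s _ → eq c i i<s)
    (bdd-- (bdd-+ (bdd-- (bdd-* (bdd-* bdd-lam (bdd-* bdd-κ bdd-κ)) (bdd-* bdd-ε (bdd-* bdd-W bdd-W)))
                         (bdd-* (bdd-const (ι 3)) (bdd-+ bdd-rem bdd-rem′)))
                  (bdd-* (bdd-* (bdd-const (ι 2)) (bdd-* (bdd-* bdd-lam bdd-lam) (bdd-* bdd-κ (bdd-* bdd-κ bdd-κ)))) bdd-P₃))
           (bdd-* (bdd-* (bdd-const (ι 2)) (bdd-* bdd-lam bdd-κ)) (bdd-* bdd-ε (bdd-+ (bdd-* bdd-Y bdd-rem) (bdd-* bdd-Y′ bdd-rem′))))))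
    where
    bdd-P₃ : Bdd (λ c i _ → P₃ c i)
    bdd-P₃ = bdd-+ (bdd-* (bdd-* bdd-Y bdd-Y) bdd-Y) (bdd-* (bdd-* bdd-Y′ bdd-Y′) bdd-Y′)
    G : Config s → ℕ → ℚ
    G c i = let l = Config.lam c ; k = κ c in
      l * (k * k) * (ε-of c * (W c i * W c i)) - ι 3 * (rem c i + rem c (i ′)) + ι 2 * (l * l * (k * (k * k))) * P₃ c i
      - ι 2 * (l * k) * (ε-of c * (Y c i * rem c i + Y c (i ′) * rem c (i ′)))
    eq : ∀ c i → i ℕ.< s → L c (U c) i ≡ G c i
    eq c i i<s = trans (L-linear c (W c) (Q c) (ι 3 * R) (- (ι 2 * lam * κ c * R)) (- (ι 2 * lam * (ι s - 1ℚ) * R)) i)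
      (trans (cong₂ (λ x z → ι 3 * R * x + - (ι 2 * lam * κ c * R) * z + κ c * - (ι 2 * lam * (ι s - 1ℚ) * R))
        (trans (L-W c i i<s) (cong (λ x → lam * (κ c * κ c) * x - ε-of c * (rem c i + rem c (i ′))) (eq₁ (ε-of c) (y i) (y (i ′))))) (L-Q c i i<s))
        (trans (eq₂ R lam (κ c) (ε-of c) (Q c i) (W c i) (rem c i + rem c (i ′)) (Y c i * rem c i + Y c (i ′) * rem c (i ′)) (P₃ c i) (ι s - 1ℚ))
          (drop₁ (G c i) (G c i) (εR≡1 c))))
      where
      open Config c
      eq₁ : ∀ e p q → e * p * (e * p) + e * q * (e * q) ≡ e * e * ((p + q) * (p + q)) + ι 2 * - (e * p * (e * q))
      eq₁ = solve-∀ ℚ-ring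
      eq₂ : ∀ R l k e Q W u v P n → ι 3 * R * (l * (k * k) * (e * e * (W * W) + ι 2 * Q) - e * u) +
        - (ι 2 * l * k * R) * (ι 3 * k * Q + k * (e * e * (W * W)) - n + e * (e * v - l * (k * k) * P)) + k * - (ι 2 * l * n * R) ≡
        l * (k * k) * (e * (W * W)) - ι 3 * u + ι 2 * (l * l * (k * (k * k))) * P - ι 2 * (l * k) * (e * v) +
        (l * (k * k) * (e * (W * W)) - ι 3 * u + ι 2 * (l * l * (k * (k * k))) * P - ι 2 * (l * k) * (e * v)) * (e * R - 1ℚ)
      eq₂ = solve-∀ ℚ-ring

  -- In the limit W is an affine function of Y², with slope λ / 3 V.
  W-relation : ∀ c i → ι 3 * W c i ≡ ι 2 * Config.lam c * (κ c * Q c i + (ι s - 1ℚ)) + ε-of c * U c i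
  W-relation c i = trans (sym (drop₁ _ (ι 3 * W c i - ι 2 * Config.lam c * (κ c * Q c i + (ι s - 1ℚ))) (εR≡1 c)))
    (eq (W c i) (Q c i) (Config.lam c) (κ c) (ι s - 1ℚ) (ε-of c) (Config.R c))
    where
    eq : ∀ W Q l k n e R → ι 3 * W + (ι 3 * W - ι 2 * l * (k * Q + n)) * (e * R - 1ℚ) ≡
      ι 2 * l * (k * Q + n) + e * (ι 3 * R * W + - (ι 2 * l * k * R) * Q + - (ι 2 * l * n * R))
    eq = solve-∀ ℚ-ring

-- Symmetrised nodes and their squares

Σ-pair : ∀ n {f : ℕ → ℚ} i k → i ℕ.< n → k ℕ.< n → i ≢ k → (∀ j → j ℕ.< n → j ≢ i → j ≢ k → f j ≡ 0ℚ) →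
         Σ< n f ≡ f i + f k
Σ-pair n {f} i k i<n k<n i≢k h = trans (Σ-cong n (λ j _ → split j)) (trans (Σ-+ n f₁ f₂)
  (cong₂ _+_ (trans (Σ-single n i i<n (λ j _ → off₁ j)) on₁) (trans (Σ-single n k k<n off₂) on₂)))
  where
  f₁ f₂ : ℕ → ℚ
  f₁ j with j ℕ.≟ i
  ... | yes _ = f j
  ... | no  _ = 0ℚ
  f₂ j with j ℕ.≟ i
  ... | yes _ = 0ℚ
  ... | no  _ = f j
  split : ∀ j → f j ≡ f₁ j + f₂ j
  split j with j ℕ.≟ i
  ... | yes _ = sym (ℚ.+-identityʳ (f j))
  ... | no  _ = sym (ℚ.+-identityˡ (f j))
  off₁ : ∀ j → j ≢ i → f₁ j ≡ 0ℚ
  off₁ j j≢i with j ℕ.≟ i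
  ... | yes j≡i = contradiction j≡i j≢i
  ... | no  _   = refl
  on₁ : f₁ i ≡ f i
  on₁ with i ℕ.≟ i
  ... | yes _   = refl
  ... | no  i≢i = contradiction refl i≢i
  off₂ : ∀ j → j ℕ.< n → j ≢ k → f₂ j ≡ 0ℚ
  off₂ j j<n j≢k with j ℕ.≟ i
  ... | yes _   = refl
  ... | no  j≢i = h j j<n j≢i j≢k
  on₂ : f₂ k ≡ f k
  on₂ with k ℕ.≟ i
  ... | yes k≡i = contradiction (sym k≡i) i≢k
  ... | no  _   = refl

module Symmetrised (s : ℕ) where
  open Pairing s public

  private
    _′ : ℕ → ℕ
    i ′ = opp s i

  -- `X` is odd under reflection by construction, so opposite indices have equal squares. `τ` is the
  -- square in units of the variance and approaches the square of a zero of the Hermite polynomial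
  -- for the weight exp(- y² / 2).
  X τ : Config s → ℕ → ℚ
  X c i = ½ * (Y c i - Y c (i ′))
  τ c i = ι 2 * κ c * (X c i * X c i)

  B : Config s → ℕ → ℕ → ℚ
  B c i j = inv (X c i - X c j)

  X-opp : ∀ c {i} → i ℕ.< s → X c (i ′) ≡ - X c i
  X-opp c {i} i<s = trans (cong (λ k → ½ * (Y c (i ′) - Y c k)) (opp-opp i<s)) (eq (Y c i) (Y c (i ′)))
    where
    eq : ∀ a b → ½ * (b - a) ≡ - (½ * (a - b))
    eq = solve-∀ ℚ-ring

  Y-mono : ∀ c {i j} → i ℕ.< j → j ℕ.< s → Y c i < Y c j
  Y-mono c {i} {j} i<j j<s = <-by (0<* (0<inv (Config.0<R c)) (0<- (Config.mono c i<j j<s))) (eq (ε-of c) (Config.y c i) (Config.y c j))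
    where
    eq : ∀ e a b → e * b ≡ e * a + e * (b - a)
    eq = solve-∀ ℚ-ring

  private
    0<½ : 0ℚ < ½
    0<½ = from-yes (0ℚ ℚ.<? ½)

    X-diff : ∀ c i j → X c j - X c i ≡ ½ * (Y c j - Y c i) + ½ * (Y c (i ′) - Y c (j ′))
    X-diff c i j = eq (Y c i) (Y c (i ′)) (Y c j) (Y c (j ′))
      where
      eq : ∀ p p′ q q′ → ½ * (q - q′) - ½ * (p - p′) ≡ ½ * (q - p) + ½ * (p′ - q′)
      eq = solve-∀ ℚ-ring

  X-mono : ∀ c {i j} → i ℕ.< j → j ℕ.< s → X c i < X c j
  X-mono c {i} {j} i<j j<s = <-by
    (0<+ (0<* 0<½ (0<- (Y-mono c i<j j<s))) (0≤* (ℚ.<⇒≤ 0<½) (0≤- (ℚ.<⇒≤ (Y-mono c (opp-anti i<j j<s) (opp< (ℕ.<-trans i<j j<s)))))))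
    (trans (eq (X c i) (X c j)) (cong (X c i +_) (X-diff c i j)))
    where
    eq : ∀ a b → b ≡ a + (b - a)
    eq = solve-∀ ℚ-ring

  X-≡ : ∀ c {i j} → i ℕ.< s → j ℕ.< s → X c i ≡ X c j → i ≡ j
  X-≡ c {i} {j} i<s j<s e with ℕ.<-cmp i j
  ... | tri≈ _ i≡j _ = i≡j
  ... | tri< i<j _ _ = contradiction e (<⇒≢ (X-mono c i<j j<s))
  ... | tri> _ _ j<i = contradiction (sym e) (<⇒≢ (X-mono c j<i i<s))

  X-gap : Eventually (λ c → ∀ i j → i ℕ.< j → j ℕ.< s → 1ℚ ≤ gapConst s s * (X c j - X c i))
  X-gap = ev-map (λ c g i j i<j j<s → ≤-by
      (0≤+ (0≤* (ℚ.<⇒≤ 0<½) (0≤- (g i j i<j j<s))) (0≤* (ℚ.<⇒≤ 0<½) (0≤- (g (j ′) (i ′) (opp-anti i<j j<s) (opp< (ℕ.<-trans i<j j<s))))))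
      (trans (cong (gapConst s s *_) (X-diff c i j)) (eq (gapConst s s) (Y c j - Y c i) (Y c (i ′) - Y c (j ′))))) Y-gap
    where
    eq : ∀ K p q → K * (½ * p + ½ * q) ≡ 1ℚ + (½ * (K * p - 1ℚ) + ½ * (K * q - 1ℚ))
    eq = solve-∀ ℚ-ring

  bdd-B : Bdd B
  bdd-B = bdd-inv-gap {f = X} (0≤gapConst s s) X-gap

  bdd-X : Bdd (λ c i _ → X c i)
  bdd-X = bdd-* (bdd-const ½) (bdd-- bdd-Y (bdd-opp bdd-Y))

  bdd-ν : Bdd (λ c _ _ → ν c)
  bdd-ν = ι 4 , 0≤ι 4 , λ c _ _ _ _ _ → ≡≤ (ℚ.0≤p⇒∣p∣≡p (ℚ.≤-trans 0≤1 (1≤ν c))) (ν≤4 c)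

  Y≡X+W : ∀ c i → Y c i ≡ X c i + ε-of c * (½ * W c i)
  Y≡X+W c i = trans (sym (drop₁ (Y c i) (½ * (Y c i + Y c (i ′))) (εR≡1 c)))
    (trans (eq (ε-of c) (Config.R c) (Y c i) (Y c (i ′))) (cong (λ x → X c i + ε-of c * (½ * x)) (sym (W≡ c i))))
    where
    eq : ∀ e R p q → p + ½ * (p + q) * (e * R - 1ℚ) ≡ ½ * (p - q) + e * (½ * (R * (p + q)))
    eq = solve-∀ ℚ-ring

  private
    r₁ : Config s → ℕ → ℚ
    r₁ c i = ½ * Σ< s (λ j → (W c i - W c j) * (A c i j * B c i j)) + κ c * (½ * W c i)
             - Config.lam c * (κ c * κ c) * (Y c i * Y c i) + ε-of c * rem c i

    bdd-r₁ : Bdd (λ c i _ → r₁ c i)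
    bdd-r₁ = bdd-+ (bdd-- (bdd-+ (bdd-* (bdd-const ½) (bdd-Σ (bdd-* (bdd-- bdd-W (bdd-snd bdd-W)) (bdd-* bdd-A bdd-B))))
        (bdd-* bdd-κ (bdd-* (bdd-const ½) bdd-W)))
        (bdd-* (bdd-* bdd-lam (bdd-* bdd-κ bdd-κ)) (bdd-* bdd-Y bdd-Y))) (bdd-* bdd-ε bdd-rem)

    -- Passing from `Y` to `X` moves each node by ε W / 2 with W bounded, which alters the Stieltjes
    -- relation at order ε only.
    ΣB : ∀ c i → i ℕ.< s → Σ< s (B c i) ≡ κ c * X c i + ε-of c * r₁ c i
    ΣB c i i<s = begin
      Σ< s (B c i)
        ≡⟨ Σ-cong s (λ j j<s → term j j<s) ⟩
      Σ< s (λ j → A c i j + ε-of c * ½ * ((W c i - W c j) * (A c i j * B c i j)))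
        ≡⟨ trans (Σ-+ s (A c i) _) (cong (Σ< s (A c i) +_) (Σ-*ˡ s (ε-of c * ½) _)) ⟩
      Σ< s (A c i) + ε-of c * ½ * Σ< s (λ j → (W c i - W c j) * (A c i j * B c i j))
        ≡⟨ cong (_+ ε-of c * ½ * Σ< s (λ j → (W c i - W c j) * (A c i j * B c i j))) (trans (stieltjes c i)
             (cong (λ x → κ c * x - ε-of c * lam * (κ c * κ c) * (Y c i * Y c i) + ε-of c * ε-of c * rem c i) (Y≡X+W c i))) ⟩
      κ c * (X c i + ε-of c * (½ * W c i)) - ε-of c * lam * (κ c * κ c) * (Y c i * Y c i) + ε-of c * ε-of c * rem c i
        + ε-of c * ½ * Σ< s (λ j → (W c i - W c j) * (A c i j * B c i j))
        ≡⟨ eq (κ c) (X c i) (ε-of c) (W c i) lam (Y c i * Y c i) (rem c i) _ ⟩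
      κ c * X c i + ε-of c * r₁ c i ∎
      where
      open Config c
      open ≡-Reasoning
      eq : ∀ k x e w l y r S → k * (x + e * (½ * w)) - e * l * (k * k) * y + e * e * r + e * ½ * S ≡
        k * x + e * (½ * S + k * (½ * w) - l * (k * k) * y + e * r)
      eq = solve-∀ ℚ-ring
      term : ∀ j → j ℕ.< s → B c i j ≡ A c i j + ε-of c * ½ * ((W c i - W c j) * (A c i j * B c i j))
      term j j<s = trans (eq₁ (A c i j) (B c i j)) (cong (A c i j +_)
        (trans (sym (inv-diff (Y c i - Y c j) (X c i - X c j)
            (λ e → trans (cong (λ k → X c i - X c k) (sym (Y-≢ c i<s j<s e))) (ℚ.+-inverseʳ (X c i)))
            (λ e → Y-diag c (X-≡ c i<s j<s (x-y≡0 (X c i) (X c j) e)))))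
          (trans (cong₂ (λ p q → (p - q - (X c i - X c j)) * (A c i j * B c i j)) (Y≡X+W c i) (Y≡X+W c j))
            (eq₂ (X c i) (X c j) (ε-of c) (W c i) (W c j) (A c i j * B c i j)))))
        where
        eq₁ : ∀ a b → b ≡ a + (b - a)
        eq₁ = solve-∀ ℚ-ring
        eq₂ : ∀ x x′ e w w′ m → (x + e * (½ * w) - (x′ + e * (½ * w′)) - (x - x′)) * m ≡ e * ½ * ((w - w′) * m)
        eq₂ = solve-∀ ℚ-ring
        x-y≡0 : ∀ x y → x - y ≡ 0ℚ → x ≡ y
        x-y≡0 x y e = trans (eq₃ x y) (trans (cong (_+ y) e) (ℚ.+-identityˡ y))
          where
          eq₃ : ∀ x y → x ≡ x - y + y
          eq₃ = solve-∀ ℚ-ring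

  inv-X : ∀ c i → inv (X c i) ≡ ι 2 * A c i (i ′)
  inv-X c i = trans (inv-* ½ (Y c i - Y c (i ′))) (cong (_* A c i (i ′)) (inv-unique {½} {ι 2} refl))

  inv-τ : ∀ c i → inv (τ c i) ≡ ν c * (inv (X c i) * inv (X c i))
  inv-τ c i = trans (inv-* (ι 2 * κ c) (X c i * X c i)) (cong₂ _*_
    (inv-unique (trans (eq (κ c) (ν c)) (2νκ≡1 c))) (inv-* (X c i) (X c i)))
    where
    eq : ∀ k n → ι 2 * k * n ≡ ι 2 * n * k
    eq = solve-∀ ℚ-ring

  bdd-inv-τ : Bdd (λ c i _ → inv (τ c i))
  bdd-inv-τ = bdd-≡ (λ c i _ _ _ → trans (inv-τ c i) (cong (λ x → ν c * (x * x)) (inv-X c i)))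
    (bdd-* bdd-ν (bdd-* (bdd-* (bdd-const (ι 2)) bdd-A′) (bdd-* (bdd-const (ι 2)) bdd-A′)))
    where
    bdd-A′ : Bdd (λ c i _ → A c i (i ′))
    bdd-A′ = bdd-re (λ i _ → i) (λ i _ → i ′) (λ h _ → h) (λ h _ → opp< h) bdd-A

  r₂ : Config s → ℕ → ℚ
  r₂ c i = X c i * r₁ c i * inv (τ c i)

  bdd-r₂ : Bdd (λ c i _ → r₂ c i)
  bdd-r₂ = bdd-* (bdd-* bdd-X bdd-r₁) bdd-inv-τ

  -- Pair j with its opposite: x (1 / (x - z) + 1 / (x + z)) = 2 x² / (x² - z²). The exceptional
  -- indices i and `opp s i` contribute ½ each, which is the origin of the term with `inv (τ c i)`.
  -- The middle node has to be excluded because τ vanishes there.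
  τ-relation : ∀ c i → i ℕ.< s → i ≢ i ′ → Σ< s (λ j → inv (τ c i - τ c j)) ≡ ½ - ½ * inv (τ c i) + ε-of c * r₂ c i
  τ-relation c i i<s i≢i′ = begin
    T                                            ≡⟨ trans (sym (drop₁ T T ττ⁻¹)) (eq₁ T t (inv t)) ⟩
    (t * T) * inv t                              ≡⟨ cong (_* inv t) tT ⟩
    (½ * t - ½ + ε-of c * (x * r₁ c i)) * inv t  ≡⟨ eq₂ t (inv t) (ε-of c) (x * r₁ c i) ⟩
    ½ - ½ * inv t + ε-of c * r₂ c i + ½ * (t * inv t - 1ℚ) ≡⟨ drop₁ _ ½ ττ⁻¹ ⟩
    ½ - ½ * inv t + ε-of c * r₂ c i ∎
    where
    open ≡-Reasoning
    x = X c i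
    t = τ c i
    k = ι 2 * κ c
    T = Σ< s (λ j → inv (t - τ c j))
    x≢0 : x ≢ 0ℚ
    x≢0 e = i≢i′ (X-≡ c i<s (opp< i<s) (trans e (sym (trans (X-opp c i<s) (cong -_ e)))))
    k≢0 : k ≢ 0ℚ
    k≢0 e = <⇒≢ (0<* (0<ι 1) (0<κ c)) (sym e)
    ττ⁻¹ : t * inv t ≡ 1ℚ
    ττ⁻¹ = *-inv (*-≢0 k≢0 (*-≢0 x≢0 x≢0))
    eq₁ : ∀ T t u → T + T * (t * u - 1ℚ) ≡ t * T * u
    eq₁ = solve-∀ ℚ-ring
    eq₂ : ∀ t u e r → (½ * t - ½ + e * r) * u ≡ ½ - ½ * u + e * (r * u) + ½ * (t * u - 1ℚ)
    eq₂ = solve-∀ ℚ-ring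
    f : ℕ → ℚ
    f j = x * (B c i j + B c i (j ′)) - ι 2 * (t * inv (t - τ c j))
    B-opp : ∀ {j} → j ℕ.< s → B c i (j ′) ≡ inv (x + X c j)
    B-opp {j} j<s = cong inv (trans (cong (λ z → x - z) (X-opp c j<s)) (eq x (X c j)))
      where
      eq : ∀ a b → a - - b ≡ a + b
      eq = solve-∀ ℚ-ring
    2x≢0 : x + x ≢ 0ℚ
    2x≢0 e = x≢0 (*-cancel-≢0 {c = ι 2} {b = 0ℚ} (λ e → <⇒≢ (0<ι 1) (sym e)) (trans (eq x) (trans e refl)))
      where
      eq : ∀ x → ι 2 * x ≡ x + x
      eq = solve-∀ ℚ-ring
    x/2x : x * inv (x + x) ≡ ½
    x/2x = trans (eq x (inv (x + x))) (trans (cong (½ *_) (*-inv 2x≢0)) (ℚ.*-identityʳ ½))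
      where
      eq : ∀ x u → x * u ≡ ½ * ((x + x) * u)
      eq = solve-∀ ℚ-ring
    f-off : ∀ j → j ℕ.< s → j ≢ i → j ≢ i ′ → f j ≡ 0ℚ
    f-off j j<s j≢i j≢i′ = begin
      x * (B c i j + B c i (j ′)) - ι 2 * (t * inv (t - τ c j))
        ≡⟨ cong₂ (λ p q → x * (B c i j + p) - ι 2 * (t * q)) (B-opp j<s) inv-t ⟩
      x * (inv u + inv v) - ι 2 * (k * (x * x) * (inv k * (inv u * inv v)))
        ≡⟨ eq k (inv k) x (X c j) (inv u) (inv v) ⟩
      x * (inv u * (1ℚ - v * inv v) + inv v * (1ℚ - u * inv u)) + ι 2 * (x * x) * (inv u * inv v) * (1ℚ - k * inv k)
        ≡⟨ cong₂ (λ p q → x * (inv u * (1ℚ - p) + inv v * (1ℚ - u * inv u)) + ι 2 * (x * x) * (inv u * inv v) * (1ℚ - q)) (*-inv v≢0) (*-inv k≢0) ⟩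
      x * (inv u * (1ℚ - 1ℚ) + inv v * (1ℚ - u * inv u)) + ι 2 * (x * x) * (inv u * inv v) * (1ℚ - 1ℚ)
        ≡⟨ cong (λ p → x * (inv u * (1ℚ - 1ℚ) + inv v * (1ℚ - p)) + ι 2 * (x * x) * (inv u * inv v) * (1ℚ - 1ℚ)) (*-inv u≢0) ⟩
      x * (inv u * (1ℚ - 1ℚ) + inv v * (1ℚ - 1ℚ)) + ι 2 * (x * x) * (inv u * inv v) * (1ℚ - 1ℚ)
        ≡⟨ eq₀ x (inv u) (inv v) ⟩
      0ℚ ∎
      where
      u = x - X c j
      v = x + X c j
      u≢0 : u ≢ 0ℚ
      u≢0 e = j≢i (sym (X-≡ c i<s j<s (trans (eq′ x (X c j)) (trans (cong (_+ X c j) e) (ℚ.+-identityˡ (X c j))))))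
        where
        eq′ : ∀ a b → a ≡ a - b + b
        eq′ = solve-∀ ℚ-ring
      v≢0 : v ≢ 0ℚ
      v≢0 e = j≢i′ (X-≡ c j<s (opp< i<s) (trans (eq′ x (X c j)) (trans (cong (_- x) e) (trans (ℚ.+-identityˡ (- x)) (sym (X-opp c i<s))))))
        where
        eq′ : ∀ a b → b ≡ a + b - a
        eq′ = solve-∀ ℚ-ring
      inv-t : inv (t - τ c j) ≡ inv k * (inv u * inv v)
      inv-t = trans (cong inv (eq″ k x (X c j))) (trans (inv-* k (u * v)) (cong (inv k *_) (inv-* u v)))
        where
        eq″ : ∀ k x z → k * (x * x) - k * (z * z) ≡ k * ((x - z) * (x + z))
        eq″ = solve-∀ ℚ-ring
      eq : ∀ k l x z u v → x * (u + v) - ι 2 * (k * (x * x) * (l * (u * v))) ≡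
        x * (u * (1ℚ - (x + z) * v) + v * (1ℚ - (x - z) * u)) + ι 2 * (x * x) * (u * v) * (1ℚ - k * l)
      eq = solve-∀ ℚ-ring
      eq₀ : ∀ x u v → x * (u * (1ℚ - 1ℚ) + v * (1ℚ - 1ℚ)) + ι 2 * (x * x) * (u * v) * (1ℚ - 1ℚ) ≡ 0ℚ
      eq₀ = solve-∀ ℚ-ring
    self : ∀ z → z * z ≡ x * x → x * (inv (x - z) + inv (x + z)) ≡ ½ → x * (inv (x - z) + inv (x + z)) - ι 2 * (t * inv (t - k * (z * z))) ≡ ½
    self z e h = trans (cong₂ (λ p q → p - ι 2 * (t * q)) h (trans (cong (λ q → inv (t - k * q)) e) (trans (cong inv (ℚ.+-inverseʳ t)) inv-0))) (eq t)
      where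
      eq : ∀ t → ½ - ι 2 * (t * 0ℚ) ≡ ½
      eq = solve-∀ ℚ-ring
    f-i : f i ≡ ½
    f-i = trans (cong (λ p → x * (B c i i + p) - ι 2 * (t * inv (t - τ c i))) (B-opp i<s))
      (self x refl (trans (cong (λ p → x * (p + inv (x + x))) (trans (cong inv (ℚ.+-inverseʳ x)) inv-0)) (trans (cong (x *_) (ℚ.+-identityˡ (inv (x + x)))) x/2x)))
    f-i′ : f (i ′) ≡ ½
    f-i′ = trans (cong (λ p → x * (B c i (i ′) + p) - ι 2 * (t * inv (t - τ c (i ′)))) (B-opp (opp< i<s)))
      (trans (cong (λ z → x * (inv (x - z) + inv (x + z)) - ι 2 * (t * inv (t - k * (z * z)))) (X-opp c i<s))
        (self (- x) (eq x) (trans (cong₂ (λ p q → x * (inv p + q)) (eq′ x) (trans (cong inv (ℚ.+-inverseʳ x)) inv-0))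
          (trans (cong (x *_) (ℚ.+-identityʳ (inv (x + x)))) x/2x))))
      where
      eq : ∀ x → - x * - x ≡ x * x
      eq = solve-∀ ℚ-ring
      eq′ : ∀ x → x - - x ≡ x + x
      eq′ = solve-∀ ℚ-ring
    Σf : Σ< s f ≡ ι 2 * (x * Σ< s (B c i)) - ι 2 * (t * T)
    Σf = trans (Σ-- s (λ j → x * (B c i j + B c i (j ′))) (λ j → ι 2 * (t * inv (t - τ c j)))) (cong₂ _-_
      (trans (Σ-*ˡ s x (λ j → B c i j + B c i (j ′))) (trans (cong (x *_) (trans (Σ-+ s (B c i) (λ j → B c i (j ′))) (cong (Σ< s (B c i) +_) (Σ-rev s (B c i))))) (eq x (Σ< s (B c i)))))
      (trans (Σ-*ˡ s (ι 2) (λ j → t * inv (t - τ c j))) (cong (ι 2 *_) (Σ-*ˡ s t (λ j → inv (t - τ c j))))))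
      where
      eq : ∀ x S → x * (S + S) ≡ ι 2 * (x * S)
      eq = solve-∀ ℚ-ring
    tT : t * T ≡ ½ * t - ½ + ε-of c * (x * r₁ c i)
    tT = trans (eq x (Σ< s (B c i)) (t * T)) (trans (cong₂ (λ p q → x * p - ½ * q) (ΣB c i i<s) (trans (sym Σf) (trans
       (Σ-pair s i (i ′) i<s (opp< i<s) i≢i′ f-off) (cong₂ _+_ f-i f-i′)))) (eq₃ x (κ c) (ε-of c) (r₁ c i)))
      where
      eq : ∀ x S z → z ≡ x * S - ½ * (ι 2 * (x * S) - ι 2 * z)
      eq = solve-∀ ℚ-ring
      eq₃ : ∀ x k e r → x * (k * x + e * r) - ½ * (½ + ½) ≡ ½ * (ι 2 * k * (x * x)) - ½ + e * (x * r)
      eq₃ = solve-∀ ℚ-ring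

  r₃ : Config s → ℕ → ℕ → ℚ
  r₃ c i j = U c i - U c j - ½ * (Config.lam c * κ c) * (ε-of c * (W c i * W c i - W c j * W c j))

  bdd-r₃ : Bdd r₃
  bdd-r₃ = bdd-- (bdd-- bdd-U (bdd-snd bdd-U)) (bdd-* (bdd-* (bdd-const ½) (bdd-* bdd-lam bdd-κ))
    (bdd-* bdd-ε (bdd-- (bdd-* bdd-W bdd-W) (bdd-* (bdd-snd bdd-W) (bdd-snd bdd-W)))))

  -- `Q` differs from X² by the square of ε W / 2 only, so the affine relation between W and Q
  -- passes to τ.
  W-τ : ∀ c i j → i ℕ.< s → j ℕ.< s → ι 3 * (W c i - W c j) ≡ Config.lam c * (τ c i - τ c j) + ε-of c * r₃ c i j
  W-τ c i j i<s j<s = trans (eq₁ (W c i) (W c j)) (trans (cong₂ _-_ (W-relation c i) (W-relation c j))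
    (trans (cong₂ (λ p q → ι 2 * lam * (κ c * p + (ι s - 1ℚ)) + ε-of c * U c i - (ι 2 * lam * (κ c * q + (ι s - 1ℚ)) + ε-of c * U c j)) (Q≡ i i<s) (Q≡ j j<s))
      (eq₂ lam (κ c) (X c i) (X c j) (ε-of c) (W c i) (W c j) (ι s - 1ℚ) (U c i) (U c j))))
    where
    open Config c
    eq₁ : ∀ a b → ι 3 * (a - b) ≡ ι 3 * a - ι 3 * b
    eq₁ = solve-∀ ℚ-ring
    W-opp : ∀ i → i ℕ.< s → W c (i ′) ≡ W c i
    W-opp i i<s = trans (cong (λ k → y (i ′) + y k) (opp-opp i<s)) (ℚ.+-comm (y (i ′)) (y i))
    Q≡ : ∀ i → i ℕ.< s → Q c i ≡ X c i * X c i - ε-of c * (½ * W c i) * (ε-of c * (½ * W c i))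
    Q≡ i i<s = trans (cong₂ (λ p q → - (p * q)) (Y≡X+W c i) (trans (Y≡X+W c (i ′)) (cong₂ (λ p q → p + ε-of c * (½ * q)) (X-opp c i<s) (W-opp i i<s))))
      (eq (X c i) (ε-of c * (½ * W c i)))
      where
      eq : ∀ x w → - ((x + w) * (- x + w)) ≡ x * x - w * w
      eq = solve-∀ ℚ-ring
    eq₂ : ∀ l k x z e w v n p q → ι 2 * l * (k * (x * x - e * (½ * w) * (e * (½ * w))) + n) + e * p - (ι 2 * l * (k * (z * z - e * (½ * v) * (e * (½ * v))) + n) + e * q) ≡
      l * (ι 2 * k * (x * x) - ι 2 * k * (z * z)) + e * (p - q - ½ * (l * k) * (e * (w * w - v * v)))
    eq₂ = solve-∀ ℚ-ring

-- Squares of the zeros of Hermite polynomials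

-- Thousandths, with which the numerical comparisons below are decided by evaluation.
dec : ℕ → ℚ
dec n = ℤ.+ n ℚ./ 1000

inv-≥-scale : ∀ {a b} p r → 0ℚ < a → 0ℚ < b → 0ℚ ≤ r → b ≤ p * a → p * r ≤ 1ℚ → r * inv a ≤ inv b
inv-≥-scale {a} {b} p r 0<a 0<b 0≤r h k = ≤-inv 0<b (ℚ.≤-trans
  (≤-by (0≤* (0≤* 0≤r (0≤inv (ℚ.<⇒≤ 0<a))) (0≤- h)) (eq a b p r (inv a)))
  (ℚ.≤-trans (ℚ.≤-reflexive (trans (cong (λ x → p * r * x) (*-inv⁺ 0<a)) (ℚ.*-identityʳ (p * r)))) k))
  where
  eq : ∀ a b p r u → p * r * (a * u) ≡ r * u * b + r * u * (p * a - b)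
  eq = solve-∀ ℚ-ring

inv-≤-scale : ∀ {a b} p r → 0ℚ < a → 0ℚ < b → 0ℚ ≤ r → p * a ≤ b → 1ℚ ≤ p * r → inv b ≤ r * inv a
inv-≤-scale {a} {b} p r 0<a 0<b 0≤r h k = inv-≤ 0<b (ℚ.≤-trans k
  (≡≤ (sym (trans (cong (λ x → p * r * x) (*-inv⁺ 0<a)) (ℚ.*-identityʳ (p * r))))
  (≤-by (0≤* (0≤* 0≤r (0≤inv (ℚ.<⇒≤ 0<a))) (0≤- h)) (eq a b p r (inv a)))))
  where
  eq : ∀ a b p r u → r * u * b ≡ p * r * (a * u) + r * u * (b - p * a)
  eq = solve-∀ ℚ-ring

-- The limit shape of the squared nodes: t solves the Stieltjes relations of a
-- Laguerre polynomial up to η (ω = 1 for even and ω = 3 for odd s).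
record Spread (m : ℕ) (t : ℕ → ℚ) (ω η : ℚ) : Set where
  field
    mono : ∀ i j → i ℕ.< j → j ℕ.< m → t i < t j
    pos  : ∀ i → i ℕ.< m → 0ℚ < t i
    lo   : ∀ r → r ℕ.< m → 1ℚ - ω * inv (t r) - η ≤ ι 4 * Σ< m (λ l → inv (t r - t l))
    hi   : ∀ r → r ℕ.< m → ι 4 * Σ< m (λ l → inv (t r - t l)) ≤ 1ℚ - ω * inv (t r) + η

  -- The repulsion exerted on the least square by the others. Up to η, the relation at index 0 reads
  -- 4 G₀ = ω / t₀ - 1.
  G₀ : ℚ
  G₀ = Σ< m (λ l → inv (t l - t 0))

  0≤terms : ∀ l → l ℕ.< m → 0ℚ ≤ inv (t l - t 0)
  0≤terms zero    _   = 0≤inv (ℚ.≤-reflexive (sym (ℚ.+-inverseʳ (t 0))))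
  0≤terms (suc l) l<m = 0≤inv (ℚ.<⇒≤ (0<- (mono 0 (suc l) (s≤s z≤n) l<m)))

  ΣG₀ : Σ< m (λ l → inv (t 0 - t l)) ≡ - G₀
  ΣG₀ = trans (Σ-cong m (λ l _ → trans (cong inv (eq (t 0) (t l))) (inv-neg (t l - t 0)))) (Σ-neg m _)
    where
    eq : ∀ a b → a - b ≡ - (b - a)
    eq = solve-∀ ℚ-ring

-- Odd s: the least square t₀ lies below 3 by a definite amount.
odd-contradiction : ∀ {m t K} → 1ℚ ≤ K → Spread m t (ι 3) (inv K) → 2 ℕ.≤ m → t 1 ≤ K → ι 3 - inv K ≤ t 0 → ⊥
odd-contradiction {m} {t} {K} 1≤K sp 2≤m t₁≤K h = absurd
  (0≤+ (0≤+ (0≤* 0≤t₀ (0≤- (≤≡ (lo 0 0<m) (cong (ι 4 *_) ΣG₀)))) (0≤* (0≤* (0≤ι 4) 0≤t₀) (0≤- η≤G)))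
       (0≤* (0≤+ 0≤1 (0≤* (0≤ι 3) 0≤η)) (0≤- h)))
  (0<+ (0<* (0<ι 4) 0<η) (0≤* (0≤* (0≤ι 3) 0≤η) (0≤- η≤1)))
  (trans (eq (t 0) (inv (t 0)) η G₀) (trans (cong (λ x → ι 3 * (x - 1ℚ)) (*-inv⁺ (pos 0 0<m))) refl))
  where
  open Spread sp
  η = inv K
  0<m = ℕ.<⇒≤ 2≤m
  0<η = 0<inv (ℚ.<-≤-trans 0<1 1≤K)
  0≤η = ℚ.<⇒≤ 0<η
  0≤t₀ = ℚ.<⇒≤ (pos 0 0<m)
  η≤1 : η ≤ 1ℚ
  η≤1 = inv-≤ {b = 1ℚ} (ℚ.<-≤-trans 0<1 1≤K) (≤≡ 1≤K (sym (ℚ.*-identityˡ K)))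
  -- The second square alone, at a distance of at most K from the least one, contributes as much as
  -- the error η; with the factor 4 of the relation it outweighs that error.
  η≤G : η ≤ G₀
  η≤G = ℚ.≤-trans (inv-antimono (0<- (mono 0 1 (s≤s z≤n) 2≤m)) (ℚ.≤-trans (≤-by 0≤t₀ (eq (t 0) (t 1))) t₁≤K))
                  (Σ-term≤ m 0≤terms 1 2≤m)
    where
    eq : ∀ a b → b ≡ b - a + a
    eq = solve-∀ ℚ-ring
  eq : ∀ t u e G → t * (ι 4 * - G - (1ℚ - ι 3 * u - e)) + ι 4 * t * (G - e) + (1ℚ + ι 3 * e) * (t - (ι 3 - e)) +
    (ι 5 * e + ι 3 * e * (1ℚ - e)) ≡ ι 3 * (t * u - 1ℚ)
  eq = solve-∀ ℚ-ring

η₀ : ℚ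
η₀ = dec 1

module Even {n : ℕ} {t : ℕ → ℚ} (sp : Spread (suc n) t 1ℚ η₀) where
  open Spread sp public

  private
    m = suc n
    u : ℕ → ℚ
    u r = inv (t r)

  0≤u : ∀ r → r ℕ.< m → 0ℚ ≤ u r
  0≤u r r<m = 0≤inv (ℚ.<⇒≤ (pos r r<m))

  private
    ΣΣ≡0 : Σ< m (λ r → Σ< m (λ l → inv (t r - t l))) ≡ 0ℚ
    ΣΣ≡0 = half (trans (Σ-swap m m (λ r l → inv (t r - t l)))
      (trans (Σ-cong m (λ l _ → trans (Σ-cong m (λ r _ → trans (cong inv (eq (t r) (t l))) (inv-neg (t l - t r)))) (Σ-neg m _))) (Σ-neg m _)))
      where
      eq : ∀ a b → a - b ≡ - (b - a)
      eq = solve-∀ ℚ-ring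
      half : ∀ {x} → x ≡ - x → x ≡ 0ℚ
      half {x} e = trans (eq′ x) (trans (cong (λ z → ½ * (x + z)) e) (trans (cong (½ *_) (ℚ.+-inverseʳ x)) refl))
        where
        eq′ : ∀ x → x ≡ ½ * (x + x)
        eq′ = solve-∀ ℚ-ring

    -- Adding all relations kills the antisymmetric double sum of 1 / (tᵣ - tₗ). What remains says
    -- that the reciprocals of the squares have sum about m.
    Σu-lower : ι m - Σ< m u - ι m * η₀ ≤ 0ℚ
    Σu-lower = ℚ.≤-trans (ℚ.≤-reflexive (sym (trans (Σ-- m (λ r → 1ℚ - 1ℚ * u r) (λ _ → η₀))
        (cong₂ _-_ (trans (Σ-- m (λ _ → 1ℚ) (λ r → 1ℚ * u r)) (cong₂ _-_ (trans (Σ-const m 1ℚ) (ℚ.*-identityʳ (ι m))) (Σ-cong m (λ r _ → ℚ.*-identityˡ (u r)))))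
          (Σ-const m η₀)))))
      (ℚ.≤-trans (Σ-mono m lo) (ℚ.≤-reflexive (trans (Σ-*ˡ m (ι 4) _) (trans (cong (ι 4 *_) ΣΣ≡0) (ℚ.*-zeroʳ (ι 4))))))

    Σu-upper : Σ< m u ≤ u 0 + G₀
    Σu-upper = ≡≤ (Σ-head n u) (ℚ.+-monoʳ-≤ (u 0) (ℚ.≤-trans
      (Σ-mono n (λ r r<n → inv-antimono (0<- (mono 0 (suc r) (s≤s z≤n) (s≤s r<n)))
        (≤-by (ℚ.<⇒≤ (pos 0 (s≤s z≤n))) (eq (t 0) (t (suc r))))))
      (≤-by (0≤terms 0 (s≤s z≤n)) (trans (Σ-head n (λ l → inv (t l - t 0))) (ℚ.+-comm (inv (t 0 - t 0)) _)))))
      where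
      eq : ∀ a b → b ≡ b - a + a
      eq = solve-∀ ℚ-ring

  u₀-upper : u 0 ≤ 1ℚ + ι 4 * G₀ + η₀
  u₀-upper = ≤-by (0≤- (≡≤ (sym (cong (ι 4 *_) ΣG₀)) (hi 0 (s≤s z≤n)))) (eq (u 0) G₀ η₀)
    where
    eq : ∀ u G η₀ → 1ℚ + ι 4 * G + η₀ ≡ u + (1ℚ - 1ℚ * u + η₀ - ι 4 * - G)
    eq = solve-∀ ℚ-ring

  -- Errors aside: Σ 1 / tᵣ = m, 1 / tᵣ ≤ 1 / (tᵣ - t₀) for r > 0, and 1 / t₀ = 1 + 4 G₀. Hence G₀ ≥
  -- n / 5 with n = m - 1, whereas squares spaced by 3 keep G₀ below a third of the n-th harmonic
  -- number.
  G₀-lower : ι n ≤ ι 5 * G₀ + (ι n + ι 2) * η₀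
  G₀-lower = ≤-by (0≤+ (0≤+ (0≤- Σu-lower) (0≤- Σu-upper)) (0≤- u₀-upper)) (eq (ι n) (Σ< m u) (u 0) G₀ η₀)
    where
    eq : ∀ n S u G η₀ → ι 5 * G + (n + ι 2) * η₀ ≡ n + (0ℚ - (1ℚ + n - S - (1ℚ + n) * η₀) + (u + G - S) + (1ℚ + ι 4 * G + η₀ - u))
    eq = solve-∀ ℚ-ring

  G₀-head : G₀ ≡ Σ< n (λ r → inv (t (suc r) - t 0))
  G₀-head = trans (Σ-head n (λ l → inv (t l - t 0))) (trans (cong (_+ Σ< n (λ r → inv (t (suc r) - t 0)))
    (trans (cong inv (ℚ.+-inverseʳ (t 0))) inv-0)) (ℚ.+-identityˡ _))

  module _ (spacing : ∀ r → suc r ℕ.< m → ι 3 - η₀ ≤ t (suc r) - t r) where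

    d : ℚ
    d = ι 3 - η₀

    spaced : ∀ r → r ℕ.< m → ι r * d ≤ t r - t 0
    spaced zero    _   = ℚ.≤-reflexive (eq (t 0) d)
      where
      eq : ∀ a d → 0ℚ * d ≡ a - a
      eq = solve-∀ ℚ-ring
    spaced (suc r) r<m = ≤-by (0≤+ (0≤- (spaced r (ℕ.<-trans (ℕ.n<1+n r) r<m))) (0≤- (spacing r r<m))) (eq (ι r) (t 0) (t r) (t (suc r)) d)
      where
      eq : ∀ r a b c d → c - a ≡ (1ℚ + r) * d + (b - a - r * d + (c - b - d))
      eq = solve-∀ ℚ-ring

    -- 0.334 > 1 / (3 - η₀) and 2.084 > 1 + 1/2 + 1/3 + 1/4
    inv-spaced : ∀ r → suc r ℕ.< m → inv (t (suc r) - t 0) ≤ dec 334 * inv (ι (suc r))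
    inv-spaced r r<m = inv-≤-scale d (dec 334) (0<ι r) (0<- (mono 0 (suc r) (s≤s z≤n) r<m)) (from-yes (0ℚ ℚ.≤? dec 334))
      (≡≤ (ℚ.*-comm d (ι (suc r))) (spaced (suc r) r<m)) (from-yes (1ℚ ℚ.≤? d * dec 334))

    -- From the fifth on, each term is at most 1/5; against a lower bound for G₀ that grows linearly
    -- such a crude bound is enough.
    harmonic : ∀ k → Σ< (4 ℕ.+ k) (λ r → inv (ι (suc r))) ≤ dec 2084 + dec 200 * ι k
    harmonic zero    = ≡≤ (cong₂ _+_ (cong₂ _+_ (cong₂ _+_ (cong₂ _+_ (refl {x = 0ℚ}) (inv-unique {ι 1} {1ℚ} refl)) (inv-unique {ι 2} {½} refl))
      (inv-unique {ι 3} {ℤ.+ 1 ℚ./ 3} refl)) (inv-unique {ι 4} {dec 250} refl)) (from-yes (0ℚ + 1ℚ + ½ + ℤ.+ 1 ℚ./ 3 + dec 250 ℚ.≤? dec 2084 + dec 200 * ι 0))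
    harmonic (suc k) = ≤≡ (ℚ.+-mono-≤ (harmonic k) (ℚ.≤-trans (inv-antimono (0<ι 4) (ι-mono (ℕ.m≤m+n 5 k))) (ℚ.≤-reflexive (inv-unique {ι 5} {dec 200} refl)))) (eq (dec 2084) (dec 200) (ι k))
      where
      eq : ∀ b h k → b + h * k + h ≡ b + h * (1ℚ + k)
      eq = solve-∀ ℚ-ring

  -- The comparison of n / 5 with a third of the harmonic number is decisive from n = 4 on, where it
  -- reads 0.8 against 0.694. For n = 3 it just fails, with 0.6 against 0.611.
  large : ∀ k → n ≡ 4 ℕ.+ k → (∀ r → suc r ℕ.< m → ι 3 - η₀ ≤ t (suc r) - t r) → ⊥
  large k refl spacing = absurd (0≤+ (0≤+ (0≤- G₀-lower) (0≤* (0≤ι 5) (0≤- G₀≤))) (0≤* (from-yes (0ℚ ℚ.≤? 1ℚ - ι 5 * dec 334 * dec 200 - η₀)) (0≤ι k)))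
    (from-yes (0ℚ ℚ.<? ι 4 - ι 5 * dec 334 * dec 2084 - ι 6 * η₀)) (eq (ι k) G₀ η₀ (dec 334) (dec 2084) (dec 200))
    where
    G₀≤ : G₀ ≤ dec 334 * (dec 2084 + dec 200 * ι k)
    G₀≤ = ≡≤ G₀-head (ℚ.≤-trans (Σ-mono n (λ r r<n → inv-spaced spacing r (s≤s r<n)))
      (≡≤ (Σ-*ˡ n (dec 334) (λ r → inv (ι (suc r)))) (*-monoˡ (from-yes (0ℚ ℚ.≤? dec 334)) (harmonic spacing k))))
    eq : ∀ k G e a b h → let n = 1ℚ + (1ℚ + (1ℚ + (1ℚ + k))) in
      ι 5 * G + (n + ι 2) * e - n + ι 5 * (a * (b + h * k) - G) + (1ℚ - ι 5 * a * h - e) * k +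
      (ι 4 - ι 5 * a * b - ι 6 * e) ≡ 0ℚ
    eq = solve-∀ ℚ-ring

  -- four positive squares: the top relation bounds the last gap from below,
  -- G₀-lower bounds it from above
  medium : n ≡ 3 → (∀ r → suc r ℕ.< m → ι 3 - η₀ ≤ t (suc r) - t r) → ⊥
  medium refl spacing = absurd
    (0≤+ (0≤+ (0≤* 0≤p (0≤* (0≤- v≤) 0≤c)) (0≤* 0≤r (0≤+ (0≤* (0≤- p≤w) 0≤T) (0≤* 0≤p (0≤- (spaced spacing 2 2<4))))))
       (ℚ.≤-refl {0ℚ}))
    (from-yes (0ℚ ℚ.<? p - r * (1ℚ - p * (ι 2 * (ι 3 - η₀)))))
    (trans (eq p r v w (t 0) (t 2) (t 3) (ι 3 - η₀)) (trans (cong₂ (λ x z → r * (x - 1ℚ) - p * (z - 1ℚ)) (*-inv⁺ (0<- 0<3)) (*-inv⁺ (0<- 2<3))) (eq₀ r p)))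
    where
    2<4 : 2 ℕ.< 4
    2<4 = s≤s (s≤s (s≤s z≤n))
    3<4 : 3 ℕ.< 4
    3<4 = ℕ.≤-refl
    0<3 = mono 0 3 (s≤s z≤n) 3<4
    2<3 = mono 2 3 (s≤s (s≤s (s≤s z≤n))) 3<4
    1<3 = mono 1 3 (s≤s (s≤s z≤n)) 3<4
    -- Ideally w ≥ 3/5 - 1/3 - 1/6 = 1/10, and the top relation then gives v ≤ 1/4 - 1/10 = 0.15.
    -- `p` and `r` are these two values with room for the errors.
    p = dec 98
    r = dec 153
    0≤p = from-yes (0ℚ ℚ.≤? p)
    0≤r = from-yes (0ℚ ℚ.≤? r)
    w = inv (t 3 - t 0)
    x = inv (t 3 - t 1)
    v = inv (t 3 - t 2)
    0≤c = ℚ.<⇒≤ (0<- 2<3)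
    0≤T = ℚ.<⇒≤ (0<- 0<3)
    p≤w : p ≤ w
    p≤w = *-cancelˡ (0<ι 4) (≤-by (0≤+ (0≤+ (0≤+ (0≤- (≤≡ G₀-lower (cong (λ g → ι 5 * g + (ι 3 + ι 2) * η₀) G₀-head)))
        (0≤* (0≤ι 5) (0≤- (≤≡ (inv-spaced spacing 0 (s≤s (s≤s z≤n))) (cong (dec 334 *_) (inv-unique {ι 1} {1ℚ} refl))))))
        (0≤* (0≤ι 5) (0≤- (≤≡ (inv-spaced spacing 1 2<4) (cong (dec 334 *_) (inv-unique {ι 2} {½} refl))))))
        (from-yes (0ℚ ℚ.≤? ι 3 - ι 5 * p - ι 5 * η₀ - ι 5 * (dec 334 * 1ℚ + dec 334 * ½))))
        (eq′ p w (inv (t 1 - t 0)) (inv (t 2 - t 0)) η₀ (dec 334 * 1ℚ) (dec 334 * ½)))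
      where
      eq′ : ∀ p w a b e k l → ι 5 * w ≡ ι 5 * p + (ι 5 * (0ℚ + a + b + w) + (ι 3 + ι 2) * e - ι 3 + ι 5 * (k - a) + ι 5 * (l - b) +
        (ι 3 - ι 5 * p - ι 5 * e - ι 5 * (k + l)))
      eq′ = solve-∀ ℚ-ring
    v≤ : v ≤ r
    v≤ = *-cancelˡ (0<ι 3) (≤-by (0≤+ (0≤+ (0≤+ (0≤- (hi 3 3<4)) (0≤u 3 3<4)) (0≤+ (0≤* (0≤ι 4) (0≤- p≤w))
        (0≤* (0≤ι 4) (0≤+ (0≤inv (ℚ.<⇒≤ (0<- 1<3))) (0≤inv (ℚ.≤-reflexive (sym (ℚ.+-inverseʳ (t 3)))))))))
        (from-yes (0ℚ ℚ.≤? ι 4 * r + ι 4 * p - 1ℚ - η₀))) (eq′ v r w x (inv (t 3 - t 3)) p η₀ (u 3)))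
      where
      eq′ : ∀ v r w x z p e u → ι 4 * r ≡ ι 4 * v + (1ℚ - 1ℚ * u + e - ι 4 * (0ℚ + w + x + v + z) + u + (ι 4 * (w - p) + ι 4 * (x + z)) +
        (ι 4 * r + ι 4 * p - 1ℚ - e))
      eq′ = solve-∀ ℚ-ring
    eq : ∀ p r v w a b c d → p * ((r - v) * (c - b)) + r * ((w - p) * (c - a) + p * (b - a - ι 2 * d)) + 0ℚ + (p - r * (1ℚ - p * (ι 2 * d))) ≡
      r * ((c - a) * w - 1ℚ) - p * ((c - b) * v - 1ℚ)
    eq = solve-∀ ℚ-ring
    eq₀ : ∀ r p → r * (1ℚ - 1ℚ) - p * (1ℚ - 1ℚ) ≡ 0ℚ
    eq₀ = solve-∀ ℚ-ring

  -- Three positive squares: spacing alone is not contradictory, but the ratio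
  -- of the two gaps is close to the ratio of two integers.
  small : n ≡ 2 → ∀ μ k₁ k₂ → 0ℚ < μ → ι 3 * μ ≤ 1ℚ → 1 ℕ.≤ k₁ → 1 ℕ.≤ k₂ →
          ∣ μ * (t 1 - t 0) - ι k₁ ∣ ≤ η₀ → ∣ μ * (t 2 - t 1) - ι k₂ ∣ ≤ η₀ → ⊥
  small refl μ k₁ k₂ 0<μ 3μ≤1 1≤k₁ 1≤k₂ near₁ near₂ = cases (k₂ ℕ.≤? k₁) (3 ℕ.* k₁ ℕ.≤? k₂)
    where
    e = η₀
    a = t 1 - t 0
    b = t 2 - t 1
    D = t 2 - t 0
    u₀ = inv a
    v = inv b
    w = inv D
    T = inv (t 2)
    x = μ * a
    z = μ * b
    0<a = 0<- (mono 0 1 (s≤s z≤n) (s≤s (s≤s z≤n)))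
    0<b = 0<- (mono 1 2 (s≤s (s≤s z≤n)) ℕ.≤-refl)
    0<D = 0<- (mono 0 2 (s≤s z≤n) ℕ.≤-refl)
    0≤w = 0≤inv (ℚ.<⇒≤ 0<D)
    0≤T = 0≤u 2 ℕ.≤-refl
    au≡1 = *-inv⁺ 0<a

    x≤ : x ≤ ι k₁ + e
    x≤ = ≤-by (0≤- (ℚ.≤-trans (x≤∣x∣ _) near₁)) (eq x (ι k₁) e)
      where
      eq : ∀ x k e → k + e ≡ x + (e - (x - k))
      eq = solve-∀ ℚ-ring
    ≤x : ι k₁ ≤ x + e
    ≤x = ≤-by (0≤- (ℚ.≤-trans (-x≤∣x∣ _) near₁)) (eq x (ι k₁) e)
      where
      eq : ∀ x k e → x + e ≡ k + (e - - (x - k))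
      eq = solve-∀ ℚ-ring
    z≤ : z ≤ ι k₂ + e
    z≤ = ≤-by (0≤- (ℚ.≤-trans (x≤∣x∣ _) near₂)) (eq z (ι k₂) e)
      where
      eq : ∀ x k e → k + e ≡ x + (e - (x - k))
      eq = solve-∀ ℚ-ring
    ≤z : ι k₂ ≤ z + e
    ≤z = ≤-by (0≤- (ℚ.≤-trans (-x≤∣x∣ _) near₂)) (eq z (ι k₂) e)
      where
      eq : ∀ x k e → x + e ≡ k + (e - - (x - k))
      eq = solve-∀ ℚ-ring
    1≤x+e : 1ℚ ≤ x + e
    1≤x+e = ℚ.≤-trans (ι-mono 1≤k₁) ≤x

    -- 1 ≤ x + η₀, so integer multiples of η₀ are small multiples of x
    absorb : ∀ c θ → 0ℚ ≤ θ → c * e ≤ θ * (1ℚ - e) → c * e ≤ θ * x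
    absorb c θ 0≤θ h = ≤-by (0≤+ (0≤- h) (0≤* 0≤θ (0≤- 1≤x+e))) (eq (c * e) θ x e)
      where
      eq : ∀ c θ x e → θ * x ≡ c + (θ * (1ℚ - e) - c + θ * (x + e - 1ℚ))
      eq = solve-∀ ℚ-ring
    b≤ : ∀ p → z ≤ p * x → b ≤ p * a
    b≤ p h = *-cancelˡ 0<μ (≤≡ h (eq p μ a))
      where
      eq : ∀ p m a → p * (m * a) ≡ m * (p * a)
      eq = solve-∀ ℚ-ring
    ≤b : ∀ p → p * x ≤ z → p * a ≤ b
    ≤b p h = *-cancelˡ 0<μ (≡≤ (eq p μ a) h)
      where
      eq : ∀ p m a → m * (p * a) ≡ p * (m * a)
      eq = solve-∀ ℚ-ring
    D≤ : ∀ p → b ≤ p * a → D ≤ (p + 1ℚ) * a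
    D≤ p h = ≤-by (0≤- h) (eq p (t 0) (t 1) (t 2))
      where
      eq : ∀ p a b c → (p + 1ℚ) * (b - a) ≡ c - a + (p * (b - a) - (c - b))
      eq = solve-∀ ℚ-ring
    ≤D : ∀ p → p * a ≤ b → (p + 1ℚ) * a ≤ D
    ≤D p h = ≤-by (0≤- h) (eq p (t 0) (t 1) (t 2))
      where
      eq : ∀ p a b c → c - a ≡ (p + 1ℚ) * (b - a) + (c - b - p * (b - a))
      eq = solve-∀ ℚ-ring
    3x≤a : ι 3 * x ≤ a
    3x≤a = ≡≤ (eq μ a) (≤≡ (*-monoʳ (ℚ.<⇒≤ 0<a) 3μ≤1) (ℚ.*-identityˡ a))
      where
      eq : ∀ m a → ι 3 * (m * a) ≡ ι 3 * m * a
      eq = solve-∀ ℚ-ring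

    G-lower : ι 2 ≤ ι 5 * (u₀ + w) + ι 4 * e
    G-lower = ≤≡ G₀-lower (trans (cong (λ g → ι 5 * g + (ι 2 + ι 2) * e) G₀-head) (eq u₀ w e))
      where
      eq : ∀ u w e → ι 5 * (0ℚ + u + w) + (ι 2 + ι 2) * e ≡ ι 5 * (u + w) + ι 4 * e
      eq = solve-∀ ℚ-ring
    top : ι 4 * Σ< 3 (λ l → inv (t 2 - t l)) ≡ ι 4 * (w + v)
    top = trans (cong (λ s → ι 4 * (0ℚ + w + v + s)) (trans (cong inv (ℚ.+-inverseʳ (t 2))) inv-0)) (eq w v)
      where
      eq : ∀ w v → ι 4 * (0ℚ + w + v + 0ℚ) ≡ ι 4 * (w + v)
      eq = solve-∀ ℚ-ring
    top-hi : ι 4 * (w + v) ≤ 1ℚ - 1ℚ * T + e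
    top-hi = ≡≤ (sym top) (hi 2 ℕ.≤-refl)
    top-lo : 1ℚ - 1ℚ * T - e ≤ ι 4 * (w + v)
    top-lo = ≤≡ (lo 2 ℕ.≤-refl) top

    -- With b at most about a, v is at least about u₀, and 4 (w + v) reaches 4 (w + u₀) ≥ 8/5,
    -- whereas the top relation keeps it below 1.
    case-≤ : k₂ ℕ.≤ k₁ → ⊥
    case-≤ k₂≤k₁ = absurd
      (0≤+ (0≤+ (0≤- top-hi) (0≤* (0≤ι 4) (0≤- v≥))) (0≤+ (0≤+ 0≤T (0≤* (0≤* (0≤ι 4) (from-yes (0ℚ ℚ.≤? 1ℚ - p))) 0≤w)) (0≤* (from-yes (0ℚ ℚ.≤? ι 4 * inv5 * p)) (0≤- G-lower))))
      (from-yes (0ℚ ℚ.<? ι 4 * inv5 * p * (ι 2 - ι 4 * e) - 1ℚ - e)) (eq u₀ v w T e p inv5 refl)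
      where
      p = dec 997
      inv5 = dec 200
      z≤px : z ≤ dec 1003 * x
      z≤px = ≤-by (0≤+ (0≤+ (0≤- z≤) (0≤- (ι-mono k₂≤k₁))) (0≤+ (0≤- ≤x) (0≤- (absorb (ι 2) (dec 3) (from-yes (0ℚ ℚ.≤? dec 3)) (from-yes (ι 2 * e ℚ.≤? dec 3 * (1ℚ - e)))))))
        (trans (cong (_* x) (refl {x = dec 1003})) (eq′ x z (ι k₁) (ι k₂) e (dec 3)))
        where
        eq′ : ∀ x z k l e d → (1ℚ + d) * x ≡ z + (l + e - z + (k - l) + (x + e - k + (d * x - ι 2 * e)))
        eq′ = solve-∀ ℚ-ring
      v≥ : p * u₀ ≤ v
      v≥ = inv-≥-scale (dec 1003) p 0<a 0<b (from-yes (0ℚ ℚ.≤? p)) (b≤ (dec 1003) z≤px) (from-yes (dec 1003 * p ℚ.≤? 1ℚ))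
      eq : ∀ u v w T e p f → ι 5 * f ≡ 1ℚ → 1ℚ - 1ℚ * T + e - ι 4 * (w + v) + ι 4 * (v - p * u) + (T + ι 4 * (1ℚ - p) * w + ι 4 * f * p * (ι 5 * (u + w) + ι 4 * e - ι 2)) +
        (ι 4 * f * p * (ι 2 - ι 4 * e) - 1ℚ - e) ≡ 0ℚ
      eq u v w T e p f h = trans (eq′ u v w T e p f) (trans (cong (λ y → ι 4 * p * (u + w) * (y - 1ℚ)) h) (eq″ p u w))
        where
        eq′ : ∀ u v w T e p f → 1ℚ - 1ℚ * T + e - ι 4 * (w + v) + ι 4 * (v - p * u) + (T + ι 4 * (1ℚ - p) * w + ι 4 * f * p * (ι 5 * (u + w) + ι 4 * e - ι 2)) +
          (ι 4 * f * p * (ι 2 - ι 4 * e) - 1ℚ - e) ≡ ι 4 * p * (u + w) * (ι 5 * f - 1ℚ)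
        eq′ = solve-∀ ℚ-ring
        eq″ : ∀ p u w → ι 4 * p * (u + w) * (1ℚ - 1ℚ) ≡ 0ℚ
        eq″ = solve-∀ ℚ-ring

    -- With b at least about 3 a, w ≤ u₀ / 4 and v ≤ u₀ / 3, while a ≥ 3 k₁ ≥ 3. Then T + 4 (w + v)
    -- ≤ 5 w + 4 v ≤ 31/36, up to errors, but the top relation demands about 1.
    case-≥ : 3 ℕ.* k₁ ℕ.≤ k₂ → ⊥
    case-≥ 3k₁≤k₂ = absurd
      (0≤+ (0≤+ (0≤- top-lo) (0≤- T≤w)) (0≤+ (0≤+ (0≤* (0≤ι 5) (0≤- w≤)) (0≤* (0≤ι 4) (0≤- v≤))) (0≤* (from-yes (0ℚ ℚ.≤? ι 5 * dec 251 + ι 4 * dec 335)) (0≤- u≤))))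
      (from-yes (0ℚ ℚ.<? 1ℚ - e - (ι 5 * dec 251 + ι 4 * dec 335) * dec 334)) (eq u₀ v w T e (dec 251) (dec 335) (dec 334))
      where
      px≤z : dec 2990 * x ≤ z
      px≤z = ≤-by (0≤+ (0≤+ (0≤- ≤z) (0≤- (≡≤ (sym (ι-* 3 k₁)) (ι-mono 3k₁≤k₂)))) (0≤+ (0≤* (0≤ι 3) (0≤- x≤)) (0≤- (absorb (ι 4) (dec 10) (from-yes (0ℚ ℚ.≤? dec 10)) (from-yes (ι 4 * e ℚ.≤? dec 10 * (1ℚ - e)))))))
        (trans (eq′ x z (ι k₁) (ι k₂) e (dec 10)) refl)
        where
        eq′ : ∀ x z k l e d → z ≡ (ι 3 - d) * x + (z + e - l + (l - ι 3 * k) + (ι 3 * (k + e - x) + (d * x - ι 4 * e)))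
        eq′ = solve-∀ ℚ-ring
      h = ≤b (dec 2990) px≤z
      v≤ : v ≤ dec 335 * u₀
      v≤ = inv-≤-scale (dec 2990) (dec 335) 0<a 0<b (from-yes (0ℚ ℚ.≤? dec 335)) h (from-yes (1ℚ ℚ.≤? dec 2990 * dec 335))
      w≤ : w ≤ dec 251 * u₀
      w≤ = inv-≤-scale (dec 3990) (dec 251) 0<a 0<D (from-yes (0ℚ ℚ.≤? dec 251)) (≤D (dec 2990) h) (from-yes (1ℚ ℚ.≤? dec 3990 * dec 251))
      T≤w : T ≤ w
      T≤w = inv-antimono 0<D (≤-by (ℚ.<⇒≤ (pos 0 (s≤s z≤n))) (eq′ (t 0) (t 2)))
        where
        eq′ : ∀ a b → b ≡ b - a + a
        eq′ = solve-∀ ℚ-ring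
      u≤ : u₀ ≤ dec 334
      u≤ = inv-≤ 0<a (ℚ.≤-trans (from-yes (1ℚ ℚ.≤? dec 334 * (ι 3 * (1ℚ - e)))) (*-monoˡ (from-yes (0ℚ ℚ.≤? dec 334))
        (ℚ.≤-trans (*-monoˡ (0≤ι 3) (≤-by (0≤- 1≤x+e) (eq′ x e))) 3x≤a)))
        where
        eq′ : ∀ x e → x ≡ 1ℚ - e + (x + e - 1ℚ)
        eq′ = solve-∀ ℚ-ring
      eq : ∀ u v w T e p q r → ι 4 * (w + v) - (1ℚ - 1ℚ * T - e) + (w - T) + (ι 5 * (p * u - w) + ι 4 * (q * u - v) + (ι 5 * p + ι 4 * q) * (r - u)) +
        (1ℚ - e - (ι 5 * p + ι 4 * q) * r) ≡ 0ℚ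
      eq = solve-∀ ℚ-ring

    -- Here b is about 2 a, so w = u₀ / 3, v = u₀ / 2 and u₀ ≥ 0.3 nearly. Then 4 (w + v) uses up
    -- the whole of the top relation, forcing T ≤ 0.01, that is t₂ ≥ 100. But t₀ ≤ 1 and D is at
    -- most about 3 a ≤ 12.
    case-12 : k₁ ≡ 1 → k₂ ≡ 2 → ⊥
    case-12 refl refl = absurd
      (0≤+ (0≤* 0≤T₂ (0≤- T≤)) (0≤* (from-yes (0ℚ ℚ.≤? dec 10)) (0≤+ (0≤- t₀≤1) (0≤+ (0≤- (D≤ (dec 2010) b≤2a)) (0≤* (from-yes (0ℚ ℚ.≤? dec 3010)) (0≤- a≤))))))
      (from-yes (0ℚ ℚ.<? 1ℚ - dec 10 * (1ℚ + dec 3010 * ι 4)))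
      (trans (eq (t 0) (t 1) (t 2) T (dec 10) (dec 3010)) (trans (cong (λ y → 1ℚ - y) (*-inv⁺ (pos 2 ℕ.≤-refl))) refl))
      where
      0≤T₂ = ℚ.<⇒≤ (pos 2 ℕ.≤-refl)
      b≤2a : b ≤ dec 2010 * a
      b≤2a = b≤ (dec 2010) (≤-by (0≤+ (0≤+ (0≤- z≤) (0≤* (0≤ι 2) (0≤- ≤x))) (0≤- (absorb (ι 3) (dec 10) (from-yes (0ℚ ℚ.≤? dec 10)) (from-yes (ι 3 * e ℚ.≤? dec 10 * (1ℚ - e))))))
        (trans (eq′ x z e (dec 10)) refl))
        where
        eq′ : ∀ x z e d → (ι 2 + d) * x ≡ z + (ι 2 + e - z + ι 2 * (x + e - ι 1) + (d * x - ι 3 * e))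
        eq′ = solve-∀ ℚ-ring
      2a≤b : dec 1990 * a ≤ b
      2a≤b = ≤b (dec 1990) (≤-by (0≤+ (0≤+ (0≤- ≤z) (0≤* (0≤ι 2) (0≤- x≤))) (0≤- (absorb (ι 3) (dec 10) (from-yes (0ℚ ℚ.≤? dec 10)) (from-yes (ι 3 * e ℚ.≤? dec 10 * (1ℚ - e))))))
        (trans (eq′ x z e (dec 10)) refl))
        where
        eq′ : ∀ x z e d → z ≡ (ι 2 - d) * x + (z + e - ι 2 + ι 2 * (ι 1 + e - x) + (d * x - ι 3 * e))
        eq′ = solve-∀ ℚ-ring
      w≤ : w ≤ dec 335 * u₀
      w≤ = inv-≤-scale (dec 2990) (dec 335) 0<a 0<D (from-yes (0ℚ ℚ.≤? dec 335)) (≤D (dec 1990) 2a≤b) (from-yes (1ℚ ℚ.≤? dec 2990 * dec 335))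
      w≥ : dec 332 * u₀ ≤ w
      w≥ = inv-≥-scale (dec 3010) (dec 332) 0<a 0<D (from-yes (0ℚ ℚ.≤? dec 332)) (D≤ (dec 2010) b≤2a) (from-yes (dec 3010 * dec 332 ℚ.≤? 1ℚ))
      v≥ : dec 497 * u₀ ≤ v
      v≥ = inv-≥-scale (dec 2010) (dec 497) 0<a 0<b (from-yes (0ℚ ℚ.≤? dec 497)) b≤2a (from-yes (dec 2010 * dec 497 ℚ.≤? 1ℚ))
      u≥ : dec 299 ≤ u₀
      u≥ = *-cancelˡ {c = ι 5 * (1ℚ + dec 335)} (from-yes (0ℚ ℚ.<? ι 5 * (1ℚ + dec 335))) (≤-by (0≤+ (0≤+ (0≤- G-lower) (0≤* (0≤ι 5) (0≤- w≤))) (from-yes (0ℚ ℚ.≤? ι 2 - ι 4 * e - ι 5 * (1ℚ + dec 335) * dec 299)))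
        (eq′ u₀ w e (dec 335) (dec 299)))
        where
        eq′ : ∀ u w e p r → ι 5 * (1ℚ + p) * u ≡ ι 5 * (1ℚ + p) * r + (ι 5 * (u + w) + ι 4 * e - ι 2 + ι 5 * (p * u - w) + (ι 2 - ι 4 * e - ι 5 * (1ℚ + p) * r))
        eq′ = solve-∀ ℚ-ring
      a≤ : a ≤ ι 4
      a≤ = *-cancelˡ {c = dec 299} (from-yes (0ℚ ℚ.<? dec 299)) (ℚ.≤-trans (*-monoʳ (ℚ.<⇒≤ 0<a) u≥)
        (≡≤ (trans (ℚ.*-comm u₀ a) au≡1) (from-yes (1ℚ ℚ.≤? dec 299 * ι 4))))
      T≤ : T ≤ dec 10
      T≤ = ≤-by (0≤+ (0≤+ (0≤- top-hi) (0≤* (0≤ι 4) (0≤+ (0≤- w≥) (0≤- v≥)))) (0≤+ (0≤* (from-yes (0ℚ ℚ.≤? ι 4 * (dec 332 + dec 497))) (0≤- u≥))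
          (from-yes (0ℚ ℚ.≤? dec 10 - 1ℚ - e + ι 4 * (dec 332 + dec 497) * dec 299)))) (eq′ u₀ v w T e (dec 332) (dec 497) (dec 299) (dec 10))
        where
        eq′ : ∀ u v w T e p q r d → d ≡ T + (1ℚ - 1ℚ * T + e - ι 4 * (w + v) + ι 4 * (w - p * u + (v - q * u)) + (ι 4 * (p + q) * (u - r) + (d - 1ℚ - e + ι 4 * (p + q) * r)))
        eq′ = solve-∀ ℚ-ring
      t₀≤1 : t 0 ≤ 1ℚ
      t₀≤1 = *-cancelˡ (0<inv (pos 0 (s≤s z≤n))) (≡≤ (trans (ℚ.*-comm (u 0) (t 0)) (*-inv⁺ (pos 0 (s≤s z≤n)))) (≤≡ 1≤u (sym (ℚ.*-identityʳ (u 0)))))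
        where
        1≤u : 1ℚ ≤ u 0
        1≤u = ≤-by (0≤+ (0≤+ (0≤- (≤≡ (lo 0 (s≤s z≤n)) (cong (ι 4 *_) ΣG₀))) (0≤* (0≤ι 4) (0≤- (Σ-term≤ 3 0≤terms 1 (s≤s (s≤s z≤n)))))) (0≤+ (0≤* (0≤ι 4) (0≤- u≥)) (from-yes (0ℚ ℚ.≤? ι 4 * dec 299 - e))))
           (eq′ (u 0) u₀ G₀ e (dec 299))
          where
          eq′ : ∀ u v G e r → u ≡ 1ℚ + (ι 4 * - G - (1ℚ - 1ℚ * u - e) + ι 4 * (G - v) + (ι 4 * (v - r) + (ι 4 * r - e)))
          eq′ = solve-∀ ℚ-ring
      eq : ∀ a b c T d p → c * (d - T) + d * (1ℚ - a + (p * (b - a) - (c - a) + p * (ι 4 - (b - a)))) + (1ℚ - d * (1ℚ + p * ι 4)) ≡ 1ℚ - c * T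
      eq = solve-∀ ℚ-ring

    -- b ≥ a makes w ≤ u₀ / 2, so `G-lower` gives u₀ ≥ 4/15 nearly and a ≤ 4. On the other hand μ ≤
    -- 1/3 makes a at least about 3 k₁.
    k₁<2 : k₁ ℕ.< k₂ → k₁ ℕ.< 2
    k₁<2 k₁<k₂ = ℕ.≰⇒> (λ 2≤k₁ → absurd
      (0≤+ (0≤+ (0≤* (0≤ι 3) (0≤- (ℚ.≤-trans (ι-mono 2≤k₁) ≤x))) (0≤- 3x≤a)) (0≤- a≤))
      (from-yes (0ℚ ℚ.<? ι 6 - ι 3 * e - ι 4)) (eq x a e))
      where
      eq : ∀ x a e → ι 3 * (x + e - ι 2) + (a - ι 3 * x) + (ι 4 - a) + (ι 6 - ι 3 * e - ι 4) ≡ 0ℚ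
      eq = solve-∀ ℚ-ring
      a≤b : 1ℚ * a ≤ b
      a≤b = ≤b 1ℚ (≤-by (0≤+ (0≤+ (0≤- ≤z) (0≤- (ι-mono k₁<k₂))) (0≤+ (0≤- x≤) (from-yes (0ℚ ℚ.≤? 1ℚ - ι 2 * e)))) (eq′ x z (ι k₁) (ι k₂) e))
        where
        eq′ : ∀ x z k l e → z ≡ 1ℚ * x + (z + e - l + (l - (1ℚ + k)) + (k + e - x + (1ℚ - ι 2 * e)))
        eq′ = solve-∀ ℚ-ring
      w≤ : w ≤ ½ * u₀
      w≤ = inv-≤-scale (1ℚ + 1ℚ) ½ 0<a 0<D (from-yes (0ℚ ℚ.≤? ½)) (≤D 1ℚ a≤b) (from-yes (1ℚ ℚ.≤? (1ℚ + 1ℚ) * ½))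
      u≥ : dec 266 ≤ u₀
      u≥ = *-cancelˡ {c = ι 5 * (1ℚ + ½)} (from-yes (0ℚ ℚ.<? ι 5 * (1ℚ + ½))) (≤-by (0≤+ (0≤+ (0≤- G-lower) (0≤* (0≤ι 5) (0≤- w≤))) (from-yes (0ℚ ℚ.≤? ι 2 - ι 4 * e - ι 5 * (1ℚ + ½) * dec 266)))
        (eq′ u₀ w e ½ (dec 266)))
        where
        eq′ : ∀ u w e p r → ι 5 * (1ℚ + p) * u ≡ ι 5 * (1ℚ + p) * r + (ι 5 * (u + w) + ι 4 * e - ι 2 + ι 5 * (p * u - w) + (ι 2 - ι 4 * e - ι 5 * (1ℚ + p) * r))
        eq′ = solve-∀ ℚ-ring
      a≤ : a ≤ ι 4
      a≤ = *-cancelˡ {c = dec 266} (from-yes (0ℚ ℚ.<? dec 266)) (ℚ.≤-trans (*-monoʳ (ℚ.<⇒≤ 0<a) u≥)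
        (≡≤ (trans (ℚ.*-comm u₀ a) au≡1) (from-yes (1ℚ ℚ.≤? dec 266 * ι 4))))

    cases : Dec (k₂ ℕ.≤ k₁) → Dec (3 ℕ.* k₁ ℕ.≤ k₂) → ⊥
    cases (yes h) _       = case-≤ h
    cases (no _)  (yes h) = case-≥ h
    cases (no h)  (no g)  = case-12 k₁≡1 (k₂≡2 k₁≡1)
      where
      k₁≡1 : k₁ ≡ 1
      k₁≡1 = ℕ.≤-antisym (ℕ.≤-pred (k₁<2 (ℕ.≰⇒> h))) 1≤k₁
      k₂≡2 : k₁ ≡ 1 → k₂ ≡ 2
      k₂≡2 refl = ℕ.≤-antisym (ℕ.≤-pred (ℕ.≰⇒> g)) (ℕ.≰⇒> h)

even-small : ∀ {m t} → Spread m t 1ℚ η₀ → m ≡ 3 → ∀ μ k₁ k₂ → 0ℚ < μ → ι 3 * μ ≤ 1ℚ → 1 ℕ.≤ k₁ → 1 ℕ.≤ k₂ →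
             ∣ μ * (t 1 - t 0) - ι k₁ ∣ ≤ η₀ → ∣ μ * (t 2 - t 1) - ι k₂ ∣ ≤ η₀ → ⊥
even-small sp refl = Even.small sp refl

even-large : ∀ {m t} → Spread m t 1ℚ η₀ → 4 ℕ.≤ m → (∀ r → suc r ℕ.< m → ι 3 - η₀ ≤ t (suc r) - t r) → ⊥
even-large {suc (suc (suc (suc zero)))}    sp _ = Even.medium sp refl
even-large {suc (suc (suc (suc (suc k))))} sp _ = Even.large sp k refl
even-large {suc (suc (suc zero))} sp (s≤s (s≤s (s≤s ())))
even-large {suc (suc zero)} sp (s≤s (s≤s ()))
even-large {suc zero} sp (s≤s ())

-- Rigidity of large configurations

int-sign : ∀ a b → - 1ℚ < ι a - ι b → (ι a - ι b ≡ 0ℚ) ⊎ (∃ λ k → 1 ℕ.≤ k × ι a - ι b ≡ ι k)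
int-sign a b h with ℕ.<-cmp a b
... | tri≈ _ refl _ = inj₁ (ℚ.+-inverseʳ (ι a))
... | tri> _ _ b<a  = inj₂ (a ℕ.∸ b , ℕ.m<n⇒0<n∸m b<a , sym (ι-∸ (ℕ.<⇒≤ b<a)))
... | tri< a<b _ _  = ⊥-elim (≤⇒≯ (≤-by (0≤- (ι-mono-< a<b)) (eq (ι a) (ι b))) h)
  where
  eq : ∀ a b → - 1ℚ ≡ a - b + (b - (a + 1ℚ))
  eq = solve-∀ ℚ-ring

Σ-symmetric : ∀ m n (f : ℕ → ℚ) → (∀ i → i ℕ.< m ℕ.+ n → f (opp (m ℕ.+ n) i) ≡ f i) →
              Σ< (m ℕ.+ n) f ≡ Σ< m (λ r → f (n ℕ.+ r)) + Σ< n (λ r → f (m ℕ.+ r))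
Σ-symmetric m n f h = trans (Σ-split m n f) (cong (_+ Σ< n (λ r → f (m ℕ.+ r)))
  (trans (Σ-cong m (λ i i<m → trans (sym (h i (ℕ.<-≤-trans i<m (ℕ.m≤m+n m n)))) (cong f (opp≡ i i<m)))) (Σ-rev m (λ r → f (n ℕ.+ r)))))
  where
  opp≡ : ∀ i → i ℕ.< m → opp (m ℕ.+ n) i ≡ n ℕ.+ opp m i
  opp≡ i i<m = trans (cong (ℕ._∸ suc i) (ℕ.+-comm m n)) (ℕ.+-∸-assoc n i<m)

-- s = m + n with m the least index in the upper half
module UpperHalf (m n : ℕ) (m≤n : m ℕ.≤ n) (n≤1+m : n ℕ.≤ suc m) where
  s = m ℕ.+ n
  open Symmetrised s public

  opp≤ : ∀ {i} → m ℕ.≤ i → opp s i ℕ.≤ i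
  opp≤ {i} m≤i = ℕ.m≤n+o⇒m∸n≤o s (suc i) (≤-swap (ℕ.+-mono-≤ m≤i (ℕ.≤-trans n≤1+m (s≤s m≤i))))
    where
    ≤-swap : m ℕ.+ n ℕ.≤ i ℕ.+ suc i → m ℕ.+ n ℕ.≤ suc i ℕ.+ i
    ≤-swap = subst (m ℕ.+ n ℕ.≤_) (ℕ.+-suc i i)

  0≤X : ∀ c {i} → m ℕ.≤ i → i ℕ.< s → 0ℚ ≤ X c i
  0≤X c {i} m≤i i<s with ℕ.m≤n⇒m<n∨m≡n (opp≤ m≤i)
  ... | inj₁ i′<i = 0≤* (from-yes (0ℚ ℚ.≤? ½)) (0≤- (ℚ.<⇒≤ (Y-mono c i′<i i<s)))
  ... | inj₂ i′≡i = ℚ.≤-reflexive (sym (trans (cong (λ k → ½ * (Y c i - Y c k)) i′≡i) (trans (cong (½ *_) (ℚ.+-inverseʳ (Y c i))) refl)))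

  0<τ : ∀ c {i} → opp s i ℕ.< i → i ℕ.< s → 0ℚ < τ c i
  0<τ c i′<i i<s = 0<* (0<* (0<ι 1) (0<κ c)) (0<* 0<X 0<X)
    where
    0<X = 0<* (from-yes (0ℚ ℚ.<? ½)) (0<- (Y-mono c i′<i i<s))

  0≤τ : ∀ c i → 0ℚ ≤ τ c i
  0≤τ c i = 0≤* (0≤* (0≤ι 2) (ℚ.<⇒≤ (0<κ c))) (0≤² (X c i))

  τ-opp : ∀ c {i} → i ℕ.< s → τ c (opp s i) ≡ τ c i
  τ-opp c {i} i<s = trans (cong (λ x → ι 2 * κ c * (x * x)) (X-opp c i<s)) (eq (ι 2 * κ c) (X c i))
    where
    eq : ∀ k x → k * (- x * - x) ≡ k * (x * x)
    eq = solve-∀ ℚ-ring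

  -- In the upper half a gap d of `X` changes τ by at least 2 κ d², and 2 κ = 1 / ν ≥ 1/4; this
  -- accounts for the 4 and the square. The summand 1 keeps the constant at least 1.
  K₁-of : ℚ
  K₁-of = 1ℚ + ι 4 * (gapConst s s * gapConst s s)

  τ-mono : ∀ c {i j} → m ℕ.≤ i → i ℕ.< j → j ℕ.< s → τ c i < τ c j
  τ-mono c {i} {j} m≤i i<j j<s = <-by (0<* (0<* (0<ι 1) (0<κ c)) (0<+ (0<* 0<d 0<d) (0≤* (0≤* (0≤ι 2) (0≤X c m≤i (ℕ.<-trans i<j j<s))) (ℚ.<⇒≤ 0<d))))
    (eq (ι 2 * κ c) (X c i) (X c j))
    where
    0<d = 0<- (X-mono c i<j j<s)
    eq : ∀ k x z → k * (z * z) ≡ k * (x * x) + k * ((z - x) * (z - x) + ι 2 * x * (z - x))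
    eq = solve-∀ ℚ-ring

  τ-gap : Eventually (λ c → ∀ i j → m ℕ.≤ i → i ℕ.< j → j ℕ.< s → 1ℚ ≤ K₁-of * (τ c j - τ c i))
  τ-gap = ev-map (λ c g i j m≤i i<j j<s →
      let K = gapConst s s
          0<d = 0<- (X-mono c i<j j<s)
          h = g i j i<j j<s
          0≤κ = ℚ.<⇒≤ (0<κ c) in
      ≤-by (0≤+ (0≤+ (0≤- (ℚ.<⇒≤ (τ-mono c m≤i i<j j<s)))
                (0≤* (0≤* (0≤ι 16) (0≤* (0≤² K) 0≤κ)) (0≤* (0≤X c m≤i (ℕ.<-trans i<j j<s)) (ℚ.<⇒≤ 0<d))))
           (0≤+ (0≤* (0≤* (0≤ι 8) 0≤κ) (0≤* (0≤- h) (0≤+ (0≤- h) (0≤ι 2))))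
                (0≤* (0≤* (0≤ι 2) (0≤- (ν≤4 c))) 0≤κ)))
        (trans (sym (drop₁ _ (- 1ℚ) (2νκ≡1 c))) (eq K (κ c) (ν c) (X c i) (X c j)))) X-gap
    where
    eq : ∀ K k n x z → let d = z - x ; t = ι 2 * k * (z * z) - ι 2 * k * (x * x) in
      (1ℚ + ι 4 * (K * K)) * t + - 1ℚ * (ι 2 * n * k - 1ℚ) ≡
      1ℚ + (t + ι 16 * (K * K * k) * (x * d) + (ι 8 * k * ((K * d - 1ℚ) * (K * d - 1ℚ + ι 2)) + ι 2 * (ι 4 - n) * k))
    eq = solve-∀ ℚ-ring

  bdd-τ : Bdd (λ c i _ → τ c i)
  bdd-τ = bdd-* (bdd-* (bdd-const (ι 2)) bdd-κ) (bdd-* bdd-X bdd-X)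

  -- All that the final argument needs to know about a configuration with large R. `err₂` allows
  -- only half of δ because the relation for τ is doubled before use.
  record Facts (K₁ K₂ δ : ℚ) (c : Config s) : Set where
    field
      gap  : ∀ i j → m ℕ.≤ i → i ℕ.< j → j ℕ.< s → 1ℚ ≤ K₁ * (τ c j - τ c i)
      top  : ∀ i → i ℕ.< s → τ c i ≤ K₂
      err₃ : ∀ i j → i ℕ.< s → j ℕ.< s → ∣ ε-of c * r₃ c i j ∣ ≤ δ
      err₂ : ∀ i j → i ℕ.< s → j ℕ.< s → ∣ ε-of c * r₂ c i ∣ ≤ ½ * δ

  K₂-of : ℚ
  K₂-of = 1ℚ + proj₁ bdd-τ

  1≤K₂-of : 1ℚ ≤ K₂-of
  1≤K₂-of = ≤-by (proj₁ (proj₂ bdd-τ)) refl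

  facts : ∀ {δ} → 0ℚ < δ → Eventually (Facts K₁-of K₂-of δ)
  facts 0<δ = ev-map (λ { c (g , t , e₃ , e₂) → record { gap = g ; top = t ; err₃ = e₃ ; err₂ = e₂ } })
    (τ-gap and (proj₁ bdd-τ , proj₁ (proj₂ bdd-τ) , (λ c h i i<s → ℚ.≤-trans (x≤∣x∣ (τ c i))
      (ℚ.≤-trans (proj₂ (proj₂ bdd-τ) c h i i i<s i<s) (≤-by 0≤1 (ℚ.+-comm 1ℚ (proj₁ bdd-τ))))))
    and small bdd-r₃ 0<δ and small bdd-r₂ (0<* (from-yes (0ℚ ℚ.<? ½)) 0<δ))

  Integral : Config s → Set
  Integral c = ∀ i j → i ℕ.< s → j ℕ.< s → ∃ λ a → ∃ λ b → W c i - W c j ≡ ι a - ι b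

  1≤K₁-of : 1ℚ ≤ K₁-of
  1≤K₁-of = ≤-by (0≤* (0≤ι 4) (0≤² (gapConst s s))) refl

  0<η₀ : 0ℚ < η₀
  0<η₀ = from-yes (0ℚ ℚ.<? η₀)

  -- Since `lam` may be tiny, 3 ΔW = lam Δτ does not by itself say which differences of W vanish.
  -- Integrality decides it for all of the upper half at once. One nonzero difference forces lam ≥ 1
  -- / K₂; then each gap, at least 1 / K₁, makes lam Δτ ≥ 1 / (K₁ K₂), which exceeds the error δ, so
  -- that no difference vanishes.
  module Rigid (K₁ K₂ : ℚ) (1≤K₁ : 1ℚ ≤ K₁) (1≤K₂ : 1ℚ ≤ K₂) (δ : ℚ) (δ≡ : δ ≡ η₀ * inv (K₁ * K₂))
               (c : Config s) (0≤lam : 0ℚ ≤ Config.lam c) (integral : Integral c) (F : Facts K₁ K₂ δ c) where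
    open Config c using (lam; lam≤1)
    open Facts F

    0<K₁K₂ : 0ℚ < K₁ * K₂
    0<K₁K₂ = 0<* (ℚ.<-≤-trans 0<1 1≤K₁) (ℚ.<-≤-trans 0<1 1≤K₂)

    δ≤inv : δ ≤ inv (K₁ * K₂)
    δ≤inv = ≡≤ δ≡ (≤≡ (*-monoʳ (ℚ.<⇒≤ (0<inv 0<K₁K₂)) (from-yes (η₀ ℚ.≤? 1ℚ))) (ℚ.*-identityˡ (inv (K₁ * K₂))))

    K₂≤K₁K₂ : K₂ ≤ K₁ * K₂
    K₂≤K₁K₂ = ≡≤ (sym (ℚ.*-identityˡ K₂)) (*-monoʳ (ℚ.≤-trans 0≤1 1≤K₂) 1≤K₁)

    δ≤invK₂ : δ ≤ inv K₂
    δ≤invK₂ = ℚ.≤-trans δ≤inv (inv-antimono (ℚ.<-≤-trans 0<1 1≤K₂) K₂≤K₁K₂)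

    δ≤η₀ : δ ≤ η₀
    δ≤η₀ = ≡≤ δ≡ (≤≡ (*-monoˡ (ℚ.<⇒≤ 0<η₀) (inv-≤ {b = 1ℚ} 0<K₁K₂ (≤≡ (ℚ.≤-trans 1≤K₂ K₂≤K₁K₂) (sym (ℚ.*-identityˡ (K₁ * K₂)))))) (ℚ.*-identityʳ η₀))

    W-eq : ∀ i j → i ℕ.< s → j ℕ.< s → ∣ ι 3 * (W c j - W c i) - lam * (τ c j - τ c i) ∣ ≤ δ
    W-eq i j i<s j<s = ≡≤ (cong ∣_∣ (trans (cong (λ x → x - lam * (τ c j - τ c i)) (W-τ c j i j<s i<s)) (eq (lam * (τ c j - τ c i)) (ε-of c * r₃ c j i)))) (err₃ j i j<s i<s)
      where
      eq : ∀ a b → a + b - a ≡ b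
      eq = solve-∀ ℚ-ring

    -- As lam ≥ 0 and τ increases on the upper half, W can decrease by a fraction of 1 at most; an
    -- integral W then cannot decrease.
    sign : ∀ i j → m ℕ.≤ i → i ℕ.< j → j ℕ.< s → (W c j - W c i ≡ 0ℚ) ⊎ (∃ λ k → 1 ℕ.≤ k × W c j - W c i ≡ ι k)
    sign i j m≤i i<j j<s =
      let (a , b , e) = integral j i j<s (ℕ.<-trans i<j j<s) in
      subst (λ x → (x ≡ 0ℚ) ⊎ (∃ λ k → 1 ℕ.≤ k × x ≡ ι k)) (sym e) (int-sign a b (subst (- 1ℚ <_) e
        (ℚ.*-cancelˡ-<-nonNeg (ι 3) {{nonNegative (0≤ι 3)}} (<-by (0<+ (from-yes (0ℚ ℚ.<? ι 3 - η₀)) (0≤+ (0≤+ (0≤- (ℚ.≤-trans (-x≤∣x∣ _) (W-eq i j (ℕ.<-trans i<j j<s) j<s)))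
          (0≤* 0≤lam (0≤- (ℚ.<⇒≤ (τ-mono c m≤i i<j j<s))))) (0≤- δ≤η₀))) (eq (W c j - W c i) (lam) (τ c j - τ c i) η₀ δ)))))
      where
      eq : ∀ w l t e d → ι 3 * w ≡ ι 3 * - 1ℚ + (ι 3 - e + (d - - (ι 3 * w - l * t) + l * t + (e - d)))
      eq = solve-∀ ℚ-ring

    far : ∀ {i j k} → i ℕ.< s → j ℕ.< s → 1 ℕ.≤ k → W c j - W c i ≡ ι k → ι 3 - δ ≤ lam * (τ c j - τ c i)
    far {i} {j} {k} i<s j<s 1≤k e = ≤-by (0≤+ (0≤- (ℚ.≤-trans (x≤∣x∣ _) (W-eq i j i<s j<s))) (0≤* (0≤ι 3) (0≤- (≤≡ (ι-mono 1≤k) (sym e)))))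
      (eq (W c j - W c i) (lam * (τ c j - τ c i)) δ)
      where
      eq : ∀ w l d → l ≡ ι 3 - d + (d - (ι 3 * w - l) + ι 3 * (w - ι 1))
      eq = solve-∀ ℚ-ring

    module Unequal {i₀ j₀ k₀} (i₀<j₀ : i₀ ℕ.< j₀) (j₀<s : j₀ ℕ.< s) (1≤k₀ : 1 ℕ.≤ k₀) (e₀ : W c j₀ - W c i₀ ≡ ι k₀) where

      1≤lamK₂ : 1ℚ ≤ lam * K₂
      1≤lamK₂ = ≤-by (0≤+ (0≤+ (0≤+ (0≤- (far (ℕ.<-trans i₀<j₀ j₀<s) j₀<s 1≤k₀ e₀)) (0≤- δ≤η₀)) (from-yes (0ℚ ℚ.≤? ι 2 - η₀)))
          (0≤* 0≤lam (0≤+ (0≤- (top j₀ j₀<s)) (0≤τ c i₀)))) (eq lam K₂ (τ c i₀) (τ c j₀) δ η₀)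
        where
        eq : ∀ l K p q d e → l * K ≡ 1ℚ + (l * (q - p) - (ι 3 - d) + (e - d) + (ι 2 - e) + l * (K - q + p))
        eq = solve-∀ ℚ-ring

      0<lam : 0ℚ < lam
      0<lam = ≤∧≢⇒< 0≤lam (λ h → ≤⇒≯ (ℚ.≤-trans 1≤lamK₂ (ℚ.≤-reflexive (trans (cong (_* K₂) (sym h)) (ℚ.*-zeroˡ K₂)))) 0<1)

      ≢0 : ∀ i j → m ℕ.≤ i → i ℕ.< j → j ℕ.< s → W c j - W c i ≡ 0ℚ → ⊥
      ≢0 i j m≤i i<j j<s e = absurd
          (0≤+ (0≤- (ℚ.≤-trans (-x≤∣x∣ _) (W-eq i j (ℕ.<-trans i<j j<s) j<s))) (0≤* (ℚ.<⇒≤ (0<inv 0<K₁K₂)) (0≤+ (0≤* (ℚ.≤-trans 0≤1 1≤lamK₂) (0≤- (gap i j m≤i i<j j<s))) (0≤- 1≤lamK₂))))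
          (0<* (from-yes (0ℚ ℚ.<? 1ℚ - η₀)) (0<inv 0<K₁K₂))
          (trans (cong (λ d → d - - (ι 3 * (W c j - W c i) - lam * (τ c j - τ c i)) + inv (K₁ * K₂) * (lam * K₂ * (K₁ * (τ c j - τ c i) - 1ℚ) + (lam * K₂ - 1ℚ)) + (1ℚ - η₀) * inv (K₁ * K₂)) δ≡)
            (trans (eq (W c j - W c i) lam (τ c j - τ c i) K₁ K₂ η₀ (inv (K₁ * K₂))) (trans (cong₂ (λ x y → ι 3 * x + lam * (τ c j - τ c i) * (y - 1ℚ)) e (*-inv⁺ 0<K₁K₂)) (eq′ (lam * (τ c j - τ c i))))))
        where
        eq : ∀ w l t K L e i → e * i - - (ι 3 * w - l * t) + i * (l * L * (K * t - 1ℚ) + (l * L - 1ℚ)) + (1ℚ - e) * i ≡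
          ι 3 * w + l * t * (K * L * i - 1ℚ)
        eq = solve-∀ ℚ-ring
        eq′ : ∀ t → ι 3 * 0ℚ + t * (1ℚ - 1ℚ) ≡ 0ℚ
        eq′ = solve-∀ ℚ-ring

      all-far : ∀ i j → m ℕ.≤ i → i ℕ.< j → j ℕ.< s → ∃ λ k → 1 ℕ.≤ k × W c j - W c i ≡ ι k
      all-far i j m≤i i<j j<s = [ (λ e → ⊥-elim (≢0 i j m≤i i<j j<s e)) , id ]′ (sign i j m≤i i<j j<s)

      -- It is lam ≤ 1 that turns the bound 3 - δ for lam Δτ into a spacing of the squares
      -- themselves.
      spacing : ∀ i j → m ℕ.≤ i → i ℕ.< j → j ℕ.< s → ι 3 - δ ≤ τ c j - τ c i
      spacing i j m≤i i<j j<s = let (k , 1≤k , e) = all-far i j m≤i i<j j<s in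
        ℚ.≤-trans (far (ℕ.<-trans i<j j<s) j<s 1≤k e)
          (≤≡ (*-monoʳ (0≤- (ℚ.<⇒≤ (τ-mono c m≤i i<j j<s))) lam≤1) (ℚ.*-identityˡ _))

    all-equal : (∀ {i j k} → i ℕ.< j → j ℕ.< s → 1 ℕ.≤ k → W c j - W c i ≡ ι k → ⊥) → ∀ i → i ℕ.< s → W c i ≡ W c m
    all-equal ⊥′ i i<s = [ upper , lower ]′ (ℕ.≤-<-connex m i)
      where
      above : ∀ j → j ℕ.< s → m ℕ.≤ j → W c j ≡ W c m
      above j j<s m≤j = [ (λ m<j → [ -≡0⇒≡ (W c j) (W c m) , (λ { (k , 1≤k , e) → ⊥-elim (⊥′ m<j j<s 1≤k e) }) ]′ (sign m j ℕ.≤-refl m<j j<s))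
                        , (λ m≡j → cong (W c) (sym m≡j)) ]′ (ℕ.m≤n⇒m<n∨m≡n m≤j)
      upper : m ℕ.≤ i → W c i ≡ W c m
      upper = above i i<s
      lower : i ℕ.< m → W c i ≡ W c m
      lower i<m = trans (sym (trans (cong (λ k → Config.y c (opp s i) + Config.y c k) (opp-opp i<s)) (ℚ.+-comm (Config.y c (opp s i)) (Config.y c i))))
        (above (opp s i) (opp< i<s) (ℕ.m+n≤o⇒m≤o∸n m (ℕ.+-monoʳ-≤ m (ℕ.≤-trans i<m m≤n))))

module OddCase (m : ℕ) (2≤m : 2 ℕ.≤ m) where
  open UpperHalf m (suc m) (ℕ.n≤1+n m) ℕ.≤-refl public

  private
    s≡ : s ≡ suc m ℕ.+ m
    s≡ = ℕ.+-comm m (suc m)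

    index< : ∀ {r} → r ℕ.< m → suc m ℕ.+ r ℕ.< s
    index< {r} r<m = subst (suc m ℕ.+ r ℕ.<_) (sym s≡) (ℕ.+-monoʳ-< (suc m) r<m)

    strict : ∀ {r} → r ℕ.< m → opp s (suc m ℕ.+ r) ℕ.< suc m ℕ.+ r
    strict {r} r<m = ℕ.m<n+o⇒m∸n<o s (suc (suc m ℕ.+ r)) (subst (ℕ._< suc (suc m ℕ.+ r) ℕ.+ (suc m ℕ.+ r)) (sym s≡)
      (ℕ.+-mono-<-≤ (s≤s (s≤s (ℕ.m≤m+n m r))) (ℕ.≤-trans (ℕ.n≤1+n m) (s≤s (ℕ.m≤m+n m r)))))

    τm≡0 : ∀ c → τ c m ≡ 0ℚ
    τm≡0 c = trans (cong (λ k → ι 2 * κ c * (½ * (Y c m - Y c k) * (½ * (Y c m - Y c k)))) opp-m) (eq (κ c) (Y c m))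
      where
      opp-m : opp s m ≡ m
      opp-m = trans (cong (ℕ._∸ suc m) s≡) (ℕ.m+n∸m≡n (suc m) m)
      eq : ∀ k y → ι 2 * k * (½ * (y - y) * (½ * (y - y))) ≡ 0ℚ
      eq = solve-∀ ℚ-ring

  t : Config s → ℕ → ℚ
  t c r = τ c (suc m ℕ.+ r)

  -- The middle node has square 0 and adds one reciprocal of t to the ½ present in `τ-relation`.
  -- After doubling, the coefficient is 1 + 2 = 3.
  stieltjes-t : ∀ c r → r ℕ.< m → ι 4 * Σ< m (λ l → inv (t c r - t c l)) ≡ 1ℚ - ι 3 * inv (t c r) + ι 2 * (ε-of c * r₂ c (suc m ℕ.+ r))
  stieltjes-t c r r<m = trans (eq (Σ< m (λ l → inv (t c r - t c l))) (inv (t c r)) )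
    (trans (cong (λ x → ι 2 * (x - inv (t c r))) (trans (sym half) (τ-relation c i i<s (λ e → ℕ.<-irrefl (sym e) (strict r<m)))))
      (eq′ (inv (t c r)) (ε-of c * r₂ c i)))
    where
    i = suc m ℕ.+ r
    i<s = index< r<m
    f : ℕ → ℚ
    f j = inv (τ c i - τ c j)
    half : Σ< s f ≡ Σ< m (λ l → inv (t c r - t c l)) + (inv (t c r) + Σ< m (λ l → inv (t c r - t c l)))
    half = trans (Σ-symmetric m (suc m) f (λ j j<s → cong (λ x → inv (τ c i - x)) (τ-opp c j<s)))
      (cong (Σ< m (λ l → inv (t c r - t c l)) +_) (trans (Σ-head m (λ l → f (m ℕ.+ l)))
        (cong₂ _+_ (trans (cong (λ k → f k) (ℕ.+-identityʳ m)) (cong inv (trans (cong (λ x → τ c i - x) (τm≡0 c)) (ℚ.+-identityʳ (τ c i)))))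
                   (Σ-cong m (λ l _ → cong f (ℕ.+-suc m l))))))
    eq : ∀ S u → ι 4 * S ≡ ι 2 * (S + (u + S) - u)
    eq = solve-∀ ℚ-ring
    eq′ : ∀ u e → ι 2 * (½ - ½ * u + e - u) ≡ 1ℚ - ι 3 * u + ι 2 * e
    eq′ = solve-∀ ℚ-ring

  module _ {K₁ K₂ : ℚ} (1≤K₁ : 1ℚ ≤ K₁) (1≤K₂ : 1ℚ ≤ K₂) {δ : ℚ} (δ≡ : δ ≡ η₀ * inv (K₁ * K₂))
           (c : Config s) (0≤lam : 0ℚ ≤ Config.lam c) (integral : Integral c) (F : Facts K₁ K₂ δ c) where
    open Rigid K₁ K₂ 1≤K₁ 1≤K₂ δ δ≡ c 0≤lam integral F

    spread : Spread m (t c) (ι 3) (inv K₂)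
    spread = record
      { mono = λ i j i<j j<m → τ-mono c (ℕ.≤-trans (ℕ.n≤1+n m) (ℕ.m≤m+n (suc m) i)) (ℕ.+-monoʳ-< (suc m) i<j) (index< j<m)
      ; pos  = λ i i<m → 0<τ c (strict i<m) (index< i<m)
      ; lo   = λ r r<m → ≤-by (0≤+ (0≤* (0≤ι 2) (0≤- (ℚ.≤-trans (-x≤∣x∣ _) (Facts.err₂ F _ _ (index< r<m) (index< r<m))))) (0≤- δ≤invK₂))
          (trans (stieltjes-t c r r<m) (eq₁ (ι 3 * inv (t c r)) (ε-of c * r₂ c (suc m ℕ.+ r)) δ (inv K₂)))
      ; hi   = λ r r<m → ≤-by (0≤+ (0≤* (0≤ι 2) (0≤- (ℚ.≤-trans (x≤∣x∣ _) (Facts.err₂ F _ _ (index< r<m) (index< r<m))))) (0≤- δ≤invK₂))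
          (trans (eq₂ (ι 3 * inv (t c r)) (ε-of c * r₂ c (suc m ℕ.+ r)) δ (inv K₂)) (cong (_+ (ι 2 * (½ * δ - ε-of c * r₂ c (suc m ℕ.+ r)) + (inv K₂ - δ))) (sym (stieltjes-t c r r<m))))
      }
      where
      eq₁ : ∀ u e d i → 1ℚ - u + ι 2 * e ≡ 1ℚ - u - i + (ι 2 * (½ * d - - e) + (i - d))
      eq₁ = solve-∀ ℚ-ring
      eq₂ : ∀ u e d i → 1ℚ - u + i ≡ 1ℚ - u + ι 2 * e + (ι 2 * (½ * d - e) + (i - d))
      eq₂ = solve-∀ ℚ-ring

    -- The upper half starts at the middle node, whose square is 0, so the first spacing is a lower
    -- bound for the least positive square itself.
    odd-⊥ : ∀ {i j k} → i ℕ.< j → j ℕ.< s → 1 ℕ.≤ k → W c j - W c i ≡ ι k → ⊥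
    odd-⊥ i<j j<s 1≤k e = odd-contradiction 1≤K₂ spread 2≤m (Facts.top F _ (index< 2≤m))
      (≤-by (0≤+ (0≤+ (0≤- (Unequal.spacing i<j j<s 1≤k e m (suc m ℕ.+ 0) ℕ.≤-refl (s≤s (ℕ.m≤m+n m 0)) (index< (ℕ.<⇒≤ 2≤m)))) (0≤- δ≤invK₂)) (0≤τ c m))
        (eq (τ c m) (t c 0) δ (inv K₂)))
      where
      eq : ∀ a b d i → b ≡ ι 3 - i + (b - a - (ι 3 - d) + (i - d) + a)
      eq = solve-∀ ℚ-ring

module EvenCase (m : ℕ) (3≤m : 3 ℕ.≤ m) where
  open UpperHalf m m ℕ.≤-refl (ℕ.n≤1+n m) public

  private
    index< : ∀ {r} → r ℕ.< m → m ℕ.+ r ℕ.< s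
    index< r<m = ℕ.+-monoʳ-< m r<m

    strict : ∀ {r} → r ℕ.< m → opp s (m ℕ.+ r) ℕ.< m ℕ.+ r
    strict {r} r<m = ℕ.m<n+o⇒m∸n<o s (suc (m ℕ.+ r)) {{ℕ.>-nonZero (ℕ.≤-trans (ℕ.≤-trans (s≤s z≤n) 3≤m) (ℕ.m≤m+n m r))}}
      (ℕ.+-mono-<-≤ (s≤s (ℕ.m≤m+n m r)) (ℕ.m≤m+n m r))

  t : Config s → ℕ → ℚ
  t c r = τ c (m ℕ.+ r)

  stieltjes-t : ∀ c r → r ℕ.< m → ι 4 * Σ< m (λ l → inv (t c r - t c l)) ≡ 1ℚ - 1ℚ * inv (t c r) + ι 2 * (ε-of c * r₂ c (m ℕ.+ r))
  stieltjes-t c r r<m = trans (eq (Σ< m (λ l → inv (t c r - t c l))))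
    (trans (cong (ι 2 *_) (trans (sym (Σ-symmetric m m f (λ j j<s → cong (λ x → inv (τ c i - x)) (τ-opp c j<s))))
        (τ-relation c i (index< r<m) (λ e → ℕ.<-irrefl (sym e) (strict r<m)))))
      (eq′ (inv (t c r)) (ε-of c * r₂ c i)))
    where
    i = m ℕ.+ r
    f : ℕ → ℚ
    f j = inv (τ c i - τ c j)
    eq : ∀ S → ι 4 * S ≡ ι 2 * (S + S)
    eq = solve-∀ ℚ-ring
    eq′ : ∀ u e → ι 2 * (½ - ½ * u + e) ≡ 1ℚ - 1ℚ * u + ι 2 * e
    eq′ = solve-∀ ℚ-ring

  module _ {K₁ K₂ : ℚ} (1≤K₁ : 1ℚ ≤ K₁) (1≤K₂ : 1ℚ ≤ K₂) {δ : ℚ} (δ≡ : δ ≡ η₀ * inv (K₁ * K₂))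
           (c : Config s) (0≤lam : 0ℚ ≤ Config.lam c) (integral : Integral c) (F : Facts K₁ K₂ δ c) where
    open Rigid K₁ K₂ 1≤K₁ 1≤K₂ δ δ≡ c 0≤lam integral F

    spread : Spread m (t c) 1ℚ η₀
    spread = record
      { mono = λ i j i<j j<m → τ-mono c (ℕ.m≤m+n m i) (ℕ.+-monoʳ-< m i<j) (index< j<m)
      ; pos  = λ i i<m → 0<τ c (strict i<m) (index< i<m)
      ; lo   = λ r r<m → ≤-by (0≤+ (0≤* (0≤ι 2) (0≤- (ℚ.≤-trans (-x≤∣x∣ _) (Facts.err₂ F _ _ (index< r<m) (index< r<m))))) (0≤- δ≤η₀))
          (trans (stieltjes-t c r r<m) (eq₁ (1ℚ * inv (t c r)) (ε-of c * r₂ c (m ℕ.+ r)) δ η₀))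
      ; hi   = λ r r<m → ≤-by (0≤+ (0≤* (0≤ι 2) (0≤- (ℚ.≤-trans (x≤∣x∣ _) (Facts.err₂ F _ _ (index< r<m) (index< r<m))))) (0≤- δ≤η₀))
          (trans (eq₂ (1ℚ * inv (t c r)) (ε-of c * r₂ c (m ℕ.+ r)) δ η₀) (cong (_+ (ι 2 * (½ * δ - ε-of c * r₂ c (m ℕ.+ r)) + (η₀ - δ))) (sym (stieltjes-t c r r<m))))
      }
      where
      eq₁ : ∀ u e d i → 1ℚ - u + ι 2 * e ≡ 1ℚ - u - i + (ι 2 * (½ * d - - e) + (i - d))
      eq₁ = solve-∀ ℚ-ring
      eq₂ : ∀ u e d i → 1ℚ - u + i ≡ 1ℚ - u + ι 2 * e + (ι 2 * (½ * d - e) + (i - d))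
      eq₂ = solve-∀ ℚ-ring

    module _ {i₀ j₀ k₀} (i₀<j₀ : i₀ ℕ.< j₀) (j₀<s : j₀ ℕ.< s) (1≤k₀ : 1 ℕ.≤ k₀) (e₀ : W c j₀ - W c i₀ ≡ ι k₀) where
      open Unequal i₀<j₀ j₀<s 1≤k₀ e₀
      open Config c using (lam; lam≤1)

      private
        consecutive : ∀ r → suc r ℕ.< m → m ℕ.+ r ℕ.< m ℕ.+ suc r
        consecutive r _ = ℕ.+-monoʳ-< m (ℕ.n<1+n r)

        step-t : ∀ r → suc r ℕ.< m → ι 3 - η₀ ≤ t c (suc r) - t c r
        step-t r r<m = ℚ.≤-trans (≤-by (0≤- δ≤η₀) (eq δ η₀)) (spacing (m ℕ.+ r) (m ℕ.+ suc r) (ℕ.m≤m+n m r) (consecutive r r<m) (index< r<m))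
          where
          eq : ∀ d e → ι 3 - d ≡ ι 3 - e + (e - d)
          eq = solve-∀ ℚ-ring

        ⅓ : ℚ
        ⅓ = ℤ.+ 1 ℚ./ 3

        near : ∀ r k → suc r ℕ.< m → W c (m ℕ.+ suc r) - W c (m ℕ.+ r) ≡ ι k → ∣ ⅓ * lam * (t c (suc r) - t c r) - ι k ∣ ≤ η₀
        near r k r<m e =
          ≡≤ (trans (cong ∣_∣ (trans (cong (λ x → ⅓ * lam * (t c (suc r) - t c r) - x) (sym e)) (eq lam (t c (suc r) - t c r) (W c (m ℕ.+ suc r) - W c (m ℕ.+ r)))))
               (trans (ℚ.∣-p∣≡∣p∣ (⅓ * (ι 3 * (W c (m ℕ.+ suc r) - W c (m ℕ.+ r)) - lam * (t c (suc r) - t c r))))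
                      (ℚ.∣p*q∣≡∣p∣*∣q∣ ⅓ (ι 3 * (W c (m ℕ.+ suc r) - W c (m ℕ.+ r)) - lam * (t c (suc r) - t c r)))))
             (ℚ.≤-trans (*-monoˡ (from-yes (0ℚ ℚ.≤? ⅓)) (W-eq (m ℕ.+ r) (m ℕ.+ suc r) (ℕ.<-trans (consecutive r r<m) (index< r<m)) (index< r<m)))
               (ℚ.≤-trans (≤≡ (*-monoʳ 0≤δ (from-yes (⅓ ℚ.≤? 1ℚ))) (ℚ.*-identityˡ δ)) δ≤η₀))
          where
          0≤δ : 0ℚ ≤ δ
          0≤δ = ≤≡ (0≤* (ℚ.<⇒≤ 0<η₀) (ℚ.<⇒≤ (0<inv 0<K₁K₂))) (sym δ≡)
          eq : ∀ l t w → ⅓ * l * t - w ≡ - (⅓ * (ι 3 * w - l * t))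
          eq = solve-∀ ℚ-ring

        1<m : 1 ℕ.< m
        1<m = ℕ.<⇒≤ 3≤m

      even-⊥′ : ⊥
      even-⊥′ = [ (λ 4≤m → even-large spread 4≤m step-t) , (λ 3≡m →
          let (k₁ , 1≤k₁ , e₁) = all-far (m ℕ.+ 0) (m ℕ.+ 1) (ℕ.m≤m+n m 0) (consecutive 0 1<m) (index< 1<m)
              (k₂ , 1≤k₂ , e₂) = all-far (m ℕ.+ 1) (m ℕ.+ 2) (ℕ.m≤m+n m 1) (consecutive 1 3≤m) (index< 3≤m)
          in even-small spread (sym 3≡m) (⅓ * lam) k₁ k₂
          (0<* (from-yes (0ℚ ℚ.<? ⅓)) 0<lam) (≡≤ (eq lam) lam≤1) 1≤k₁ 1≤k₂ (near 0 k₁ 1<m e₁) (near 1 k₂ 3≤m e₂)) ]′ (ℕ.m≤n⇒m<n∨m≡n 3≤m)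
        where
        eq : ∀ l → ι 3 * (⅓ * l) ≡ l
        eq = solve-∀ ℚ-ring

    even-⊥ : ∀ {i j k} → i ℕ.< j → j ℕ.< s → 1 ℕ.≤ k → W c j - W c i ≡ ι k → ⊥
    even-⊥ i<j j<s 1≤k e = even-⊥′ i<j j<s 1≤k e

halve : ∀ s → ∃ λ m → (s ≡ m ℕ.+ m) ⊎ (s ≡ m ℕ.+ suc m)
halve zero = 0 , inj₁ refl
halve (suc s) with halve s
... | m , inj₁ refl = m , inj₂ (sym (ℕ.+-suc m m))
... | m , inj₂ refl = suc m , inj₁ refl

-- Integrality is required of differences only: for a design, W itself is an integer minus twice the
-- centre of the nodes.
Rigidity : ℕ → Set
Rigidity s = ∃ λ K → ∀ (c : Config s) → K ≤ Config.R c → 0ℚ ≤ Config.lam c →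
  (∀ i j → i ℕ.< s → j ℕ.< s → ∃ λ a → ∃ λ b → Pairing.W s c i - Pairing.W s c j ≡ ι a - ι b) →
  ∀ i j → i ℕ.< s → j ℕ.< s → Pairing.W s c i ≡ Pairing.W s c j

odd-rigidity : ∀ m → 2 ℕ.≤ m → Rigidity (m ℕ.+ suc m)
odd-rigidity m 2≤m = proj₁ facts-δ , λ c h 0≤lam integral i j i<s j<s →
  let F   = proj₂ (proj₂ facts-δ) c h
      bad = λ {i} {j} {k} → odd-⊥ 1≤K₁-of 1≤K₂-of refl c 0≤lam integral F {i} {j} {k}
      eq  = Rigid.all-equal K₁-of K₂-of 1≤K₁-of 1≤K₂-of _ refl c 0≤lam integral F bad
  in trans (eq i i<s) (sym (eq j j<s))
  where
  open OddCase m 2≤m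
  0<K₁K₂ : 0ℚ < K₁-of * K₂-of
  0<K₁K₂ = 0<* (ℚ.<-≤-trans 0<1 1≤K₁-of) (ℚ.<-≤-trans 0<1 1≤K₂-of)
  facts-δ = facts (0<* 0<η₀ (0<inv 0<K₁K₂))

even-rigidity : ∀ m → 3 ℕ.≤ m → Rigidity (m ℕ.+ m)
even-rigidity m 3≤m = proj₁ facts-δ , λ c h 0≤lam integral i j i<s j<s →
  let F   = proj₂ (proj₂ facts-δ) c h
      bad = λ {i} {j} {k} → even-⊥ 1≤K₁-of 1≤K₂-of refl c 0≤lam integral F {i} {j} {k}
      eq  = Rigid.all-equal K₁-of K₂-of 1≤K₁-of 1≤K₂-of _ refl c 0≤lam integral F bad
  in trans (eq i i<s) (sym (eq j j<s))
  where
  open EvenCase m 3≤m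
  0<K₁K₂ : 0ℚ < K₁-of * K₂-of
  0<K₁K₂ = 0<* (ℚ.<-≤-trans 0<1 1≤K₁-of) (ℚ.<-≤-trans 0<1 1≤K₂-of)
  facts-δ = facts (0<* 0<η₀ (0<inv 0<K₁K₂))

rigidity : ∀ s → 5 ℕ.≤ s → Rigidity s
rigidity s 5≤s with halve s
... | m , inj₂ refl = odd-rigidity m (ℕ.≮⇒≥ (λ m<2 → contradiction (ℕ.≤-trans 5≤s (ℕ.+-mono-≤ (ℕ.≤-pred m<2) m<2)) λ { (s≤s (s≤s (s≤s ()))) }))
... | m , inj₁ refl = even-rigidity m (ℕ.≮⇒≥ (λ m<3 → contradiction (ℕ.≤-trans 5≤s (ℕ.+-mono-≤ (ℕ.≤-pred m<3) (ℕ.≤-pred m<3))) λ { (s≤s (s≤s (s≤s (s≤s ())))) }))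

-- Newton expansions and alternating sums

sumOver : ∀ {A : Set} → List A → (A → ℚ) → ℚ
sumOver []       f = 0ℚ
sumOver (x ∷ xs) f = f x + sumOver xs f

module _ {A : Set} where

  sumOver-cong : ∀ xs {f g : A → ℚ} → (∀ x → f x ≡ g x) → sumOver xs f ≡ sumOver xs g
  sumOver-cong []       h = refl
  sumOver-cong (x ∷ xs) h = cong₂ _+_ (h x) (sumOver-cong xs h)

  sumOver-+ : ∀ xs (f g : A → ℚ) → sumOver xs (λ x → f x + g x) ≡ sumOver xs f + sumOver xs g
  sumOver-+ []       f g = refl
  sumOver-+ (x ∷ xs) f g = trans (cong (f x + g x +_) (sumOver-+ xs f g)) (+-swap₄ (f x) (g x) (sumOver xs f) (sumOver xs g))

  sumOver-*ˡ : ∀ xs c (f : A → ℚ) → sumOver xs (λ x → c * f x) ≡ c * sumOver xs f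
  sumOver-*ˡ []       c f = sym (ℚ.*-zeroʳ c)
  sumOver-*ˡ (x ∷ xs) c f = trans (cong (c * f x +_) (sumOver-*ˡ xs c f)) (sym (ℚ.*-distribˡ-+ c (f x) (sumOver xs f)))

  sumOver-- : ∀ xs (f g : A → ℚ) → sumOver xs (λ x → f x - g x) ≡ sumOver xs f - sumOver xs g
  sumOver-- []       f g = refl
  sumOver-- (x ∷ xs) f g = trans (cong (f x - g x +_) (sumOver-- xs f g)) (eq (f x) (g x) (sumOver xs f) (sumOver xs g))
    where
    eq : ∀ a b c d → a - b + (c - d) ≡ a + c - (b + d)
    eq = solve-∀ ℚ-ring

  sumOver-Σ< : ∀ xs n (f : A → ℕ → ℚ) → sumOver xs (λ x → Σ< n (f x)) ≡ Σ< n (λ i → sumOver xs (λ x → f x i))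
  sumOver-Σ< []       n f = sym (Σ-zero n (λ _ _ → refl))
  sumOver-Σ< (x ∷ xs) n f = trans (cong (Σ< n (f x) +_) (sumOver-Σ< xs n f)) (sym (Σ-+ n (f x) (λ i → sumOver xs (λ y → f y i))))

  sumOver-0≤ : ∀ xs {f : A → ℚ} → (∀ x → 0ℚ ≤ f x) → 0ℚ ≤ sumOver xs f
  sumOver-0≤ []       h = ℚ.≤-refl
  sumOver-0≤ (x ∷ xs) h = 0≤+ (h x) (sumOver-0≤ xs h)

  sumOver-≡0 : ∀ {xs} {f : A → ℚ} → (∀ x → 0ℚ ≤ f x) → sumOver xs f ≡ 0ℚ → ∀ {x} → x ∈ xs → f x ≡ 0ℚ
  sumOver-≡0 {y ∷ xs} {f} h e (here refl) = ℚ.≤-antisym (≡≤ (eq (f y) (sumOver xs f)) (≤-by (sumOver-0≤ xs h) (sym (trans (cong (λ z → z - sumOver xs f + sumOver xs f) e) (eq′ (sumOver xs f)))))) (h y)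
    where
    eq : ∀ a b → a ≡ a + b - b
    eq = solve-∀ ℚ-ring
    eq′ : ∀ b → 0ℚ - b + b ≡ 0ℚ
    eq′ = solve-∀ ℚ-ring
  sumOver-≡0 {y ∷ xs} {f} h e (there x∈xs) = sumOver-≡0 h (ℚ.≤-antisym (≤≡ (≤-by (h y) (ℚ.+-comm (f y) _)) e) (sumOver-0≤ xs h)) x∈xs

newton : (ℕ → ℚ) → ℕ → ℚ → ℚ
newton r i x = Π< i (λ j → x - r j)

-- Polynomials of degree at most d in the Newton basis of a free sequence r: 0, 1, 2, ... for
-- factorial moments, k, k - 1, ... for the kernel polynomial, the intersection numbers for counting
-- zeros. As the coefficients above d vanish, one coefficient sequence serves every larger bound.
Poly : (ℕ → ℚ) → ℕ → (ℚ → ℚ) → Set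
Poly r d f = ∃ λ (a : ℕ → ℚ) → (∀ i → d ℕ.< i → a i ≡ 0ℚ) × (∀ x → f x ≡ Σ< (suc d) (λ i → a i * newton r i x))

module _ {r : ℕ → ℚ} where

  poly-ext : ∀ {d f g} → (∀ x → g x ≡ f x) → Poly r d f → Poly r d g
  poly-ext e (a , z , h) = a , z , λ x → trans (e x) (h x)

  poly-const : ∀ c → Poly r 0 (λ _ → c)
  poly-const c = (λ { zero → c ; (suc _) → 0ℚ }) , (λ { (suc _) _ → refl }) , λ x → eq c
    where
    eq : ∀ c → c ≡ 0ℚ + c * 1ℚ
    eq = solve-∀ ℚ-ring

  poly-weaken : ∀ {d f} → Poly r d f → Poly r (suc d) f
  poly-weaken {d} (a , z , h) = a , (λ i d<i → z i (ℕ.<-trans (ℕ.n<1+n d) d<i)) , λ x →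
    trans (h x) (sym (trans (cong (λ y → Σ< (suc d) (λ i → a i * newton r i x) + y * newton r (suc d) x) (z (suc d) (ℕ.n<1+n d)))
      (eq (Σ< (suc d) (λ i → a i * newton r i x)) (newton r (suc d) x))))
    where
    eq : ∀ a b → a + 0ℚ * b ≡ a
    eq = solve-∀ ℚ-ring

  poly-≤ : ∀ {d e f} → d ℕ.≤ e → Poly r d f → Poly r e f
  poly-≤ {d} {e} {f} d≤e p = subst (λ k → Poly r k f) (ℕ.m∸n+n≡m d≤e) (go (e ℕ.∸ d))
    where
    go : ∀ k → Poly r (k ℕ.+ d) f
    go zero    = p
    go (suc k) = poly-weaken (go k)

  poly-+ : ∀ {d f g} → Poly r d f → Poly r d g → Poly r d (λ x → f x + g x)
  poly-+ {d} (a , z , h) (b , y , k) = (λ i → a i + b i) , (λ i d<i → cong₂ _+_ (z i d<i) (y i d<i)) , λ x →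
    trans (cong₂ _+_ (h x) (k x)) (sym (trans (Σ-cong (suc d) (λ i _ → ℚ.*-distribʳ-+ (newton r i x) (a i) (b i))) (Σ-+ (suc d) _ _)))

  poly-*ˡ : ∀ {d f} c → Poly r d f → Poly r d (λ x → c * f x)
  poly-*ˡ {d} c (a , z , h) = (λ i → c * a i) , (λ i d<i → trans (cong (c *_) (z i d<i)) (ℚ.*-zeroʳ c)) , λ x →
    trans (cong (c *_) (h x)) (sym (trans (Σ-cong (suc d) (λ i _ → ℚ.*-assoc c (a i) (newton r i x))) (Σ-*ˡ (suc d) c _)))

  -- Writing x - c = (x - r i) + (r i - c), multiplication passes each coefficient to the next place
  -- and leaves a multiple behind.
  poly-linear : ∀ {d f} c → Poly r d f → Poly r (suc d) (λ x → (x - c) * f x)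
  poly-linear {d} {f} c (a , z , h) = a′ , z′ , λ x → sym (begin
    Σ< (2 ℕ.+ d) (λ i → a′ i * newton r i x)
      ≡⟨ trans (Σ-head (suc d) _) (cong ((r 0 - c) * a 0 * 1ℚ +_) (trans (Σ-cong (suc d) (λ i _ → split x i)) (Σ-+ (suc d) (λ i → a i * newton r (suc i) x) (λ i → t x (suc i))))) ⟩
    (r 0 - c) * a 0 * 1ℚ + (Σ< (suc d) (λ i → a i * newton r (suc i) x) + Σ< (suc d) (t x ∘ suc))
      ≡⟨ eq₁ ((r 0 - c) * a 0 * 1ℚ) (Σ< (suc d) (λ i → a i * newton r (suc i) x)) (Σ< (suc d) (t x ∘ suc)) ⟩
    Σ< (suc d) (λ i → a i * newton r (suc i) x) + (t x 0 + Σ< (suc d) (t x ∘ suc))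
      ≡⟨ cong (Σ< (suc d) (λ i → a i * newton r (suc i) x) +_) (trans (sym (Σ-head (suc d) (t x)))
           (trans (cong (Σ< (suc d) (t x) +_) (trans (cong (λ y → (r (suc d) - c) * y * newton r (suc d) x) (z (suc d) (ℕ.n<1+n d))) (eq₂ (r (suc d) - c) (newton r (suc d) x))))
             (ℚ.+-identityʳ _))) ⟩
    Σ< (suc d) (λ i → a i * newton r (suc i) x) + Σ< (suc d) (t x)
      ≡⟨ trans (sym (Σ-+ (suc d) _ _)) (Σ-cong (suc d) (λ i _ → eq₃ (a i) (newton r i x) x (r i) c)) ⟩
    Σ< (suc d) (λ i → (x - c) * (a i * newton r i x))
      ≡⟨ Σ-*ˡ (suc d) (x - c) _ ⟩
    (x - c) * Σ< (suc d) (λ i → a i * newton r i x)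
      ≡⟨ cong ((x - c) *_) (h x) ⟨
    (x - c) * f x ∎)
    where
    open ≡-Reasoning
    a′ : ℕ → ℚ
    a′ zero    = (r 0 - c) * a 0
    a′ (suc i) = a i + (r (suc i) - c) * a (suc i)
    z′ : ∀ i → suc d ℕ.< i → a′ i ≡ 0ℚ
    z′ (suc i) (s≤s d<i) = trans (cong₂ (λ p q → p + (r (suc i) - c) * q) (z i d<i) (z (suc i) (ℕ.m<n⇒m<1+n d<i))) (eq (r (suc i) - c))
      where
      eq : ∀ a → 0ℚ + a * 0ℚ ≡ 0ℚ
      eq = solve-∀ ℚ-ring
    t : ℚ → ℕ → ℚ
    t x i = (r i - c) * a i * newton r i x
    split : ∀ x i → a′ (suc i) * newton r (suc i) x ≡ a i * newton r (suc i) x + t x (suc i)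
    split x i = ℚ.*-distribʳ-+ (newton r (suc i) x) (a i) ((r (suc i) - c) * a (suc i))
    eq₁ : ∀ p q s → p + (q + s) ≡ q + (p + s)
    eq₁ = solve-∀ ℚ-ring
    eq₂ : ∀ p n → p * 0ℚ * n ≡ 0ℚ
    eq₂ = solve-∀ ℚ-ring
    eq₃ : ∀ a n x r c → a * (n * (x - r)) + (r - c) * a * n ≡ (x - c) * (a * n)
    eq₃ = solve-∀ ℚ-ring

  poly-Π : ∀ {d f} n (c : ℕ → ℚ) → Poly r d f → Poly r (n ℕ.+ d) (λ x → Π< n (λ j → x - c j) * f x)
  poly-Π zero    c p = poly-ext (λ x → ℚ.*-identityˡ _) p
  poly-Π {d} {f} (suc n) c p = poly-ext (λ x → eq (Π< n (λ j → x - c j)) (x - c n) (f x)) (poly-linear (c n) (poly-Π n c p))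
    where
    eq : ∀ a b f → a * b * f ≡ b * (a * f)
    eq = solve-∀ ℚ-ring

  poly-newton : ∀ n (c : ℕ → ℚ) → Poly r n (newton c n)
  poly-newton n c = subst (λ k → Poly r k (newton c n)) (ℕ.+-identityʳ n) (poly-ext (λ x → sym (ℚ.*-identityʳ _)) (poly-Π n c (poly-const 1ℚ)))

  newton-at : ∀ {d f} → ((a , _) : Poly r d f) → f (r 0) ≡ a 0
  newton-at {d} (a , z , h) = trans (h (r 0)) (trans (Σ-single (suc d) 0 (s≤s z≤n) (λ { zero _ 0≢0 → contradiction refl 0≢0
    ; (suc j) _ _ → trans (cong (a (suc j) *_) (Π-≡0 (suc j) 0 (s≤s z≤n) (ℚ.+-inverseʳ (r 0)))) (ℚ.*-zeroʳ (a (suc j))) })) (ℚ.*-identityʳ (a 0)))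

  -- The value at r i involves only the coefficients up to i, and the one of index i with a nonzero
  -- factor; so they vanish one after the other.
  poly-vanish : ∀ {d f} → Poly r d f → (∀ i j → i ℕ.≤ d → j ℕ.< i → r i ≢ r j) → (∀ i → i ℕ.≤ d → f (r i) ≡ 0ℚ) → ∀ x → f x ≡ 0ℚ
  poly-vanish {d} {f} (a , z , h) distinct root x = trans (h x) (Σ-zero (suc d) (λ i i≤d → trans (cong (_* newton r i x) (coeff i (ℕ.≤-pred i≤d) i ℕ.≤-refl)) (ℚ.*-zeroˡ (newton r i x))))
    where
    coeff : ∀ n → n ℕ.≤ d → ∀ i → i ℕ.≤ n → a i ≡ 0ℚ
    coeff n n≤d i i≤n with ℕ.m≤n⇒m<n∨m≡n i≤n
    coeff (suc n) n<d i i≤n | inj₁ i<1+n = coeff n (ℕ.<⇒≤ n<d) i (ℕ.≤-pred i<1+n)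
    coeff n n≤d i i≤n | inj₂ refl = *-cancel-≢0 {c = newton r i (r i)} {b = 0ℚ} (Π-≢0 i (λ j j<i e → distinct i j n≤d j<i (-≡0⇒≡ (r i) (r j) e)))
      (trans (ℚ.*-comm (newton r i (r i)) (a i)) (trans (sym (Σ-single (suc d) i (s≤s n≤d) others)) (trans (sym (h (r i))) (trans (root i n≤d) (sym (ℚ.*-zeroʳ (newton r i (r i))))))))
      where
      earlier : ∀ n i → n ≡ i → i ℕ.≤ d → ∀ j → j ℕ.< i → a j ≡ 0ℚ
      earlier (suc n) _ refl n<d j j<i = coeff n (ℕ.<⇒≤ n<d) j (ℕ.≤-pred j<i)
      others : ∀ j → j ℕ.< suc d → j ≢ i → a j * newton r j (r i) ≡ 0ℚ
      others j j≤d j≢i with ℕ.<-cmp j i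
      ... | tri< j<i _ _ = trans (cong (_* newton r j (r i)) (earlier i i refl n≤d j j<i)) (ℚ.*-zeroˡ (newton r j (r i)))
      ... | tri≈ _ j≡i _ = contradiction j≡i j≢i
      ... | tri> _ _ i<j = trans (cong (a j *_) (Π-≡0 j i i<j (ℚ.+-inverseʳ (r i)))) (ℚ.*-zeroʳ (a j))

  -- The functional φ x sees the whole function rather than its value at one point, because the
  -- moment identity involves both G(x) and G(x - 1).
  poly-functional : ∀ {A : Set} (xs : List A) (φ : A → (ℚ → ℚ) → ℚ) →
    (∀ x n (a : ℕ → ℚ) (e : ℕ → ℚ → ℚ) {f} → (∀ z → f z ≡ Σ< n (λ i → a i * e i z)) → φ x f ≡ Σ< n (λ i → a i * φ x (e i))) →
    ∀ {d f} → Poly r d f → (∀ i → i ℕ.≤ d → sumOver xs (λ x → φ x (newton r i)) ≡ 0ℚ) → sumOver xs (λ x → φ x f) ≡ 0ℚ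
  poly-functional xs φ lin {d} (a , z , h) kill = trans (sumOver-cong xs (λ x → lin x (suc d) a (newton r) h))
    (trans (sumOver-Σ< xs (suc d) (λ x i → a i * φ x (newton r i))) (Σ-zero (suc d) (λ i i≤d →
      trans (sumOver-*ˡ xs (a i) (λ x → φ x (newton r i))) (trans (cong (a i *_) (kill i (ℕ.≤-pred i≤d))) (ℚ.*-zeroʳ (a i))))))

ff : ℚ → ℕ → ℚ
ff x n = newton ι n x

ff-head : ∀ x n → ff x (suc n) ≡ x * ff (x - 1ℚ) n
ff-head x n = trans (Π-head n (λ j → x - ι j)) (cong₂ _*_ (eq x) (Π-cong n (λ j _ → eq′ x (ι j))))
  where
  eq : ∀ x → x - 0ℚ ≡ x
  eq = solve-∀ ℚ-ring
  eq′ : ∀ x j → x - (1ℚ + j) ≡ x - 1ℚ - j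
  eq′ = solve-∀ ℚ-ring

ff-+ : ∀ x m n → ff x (m ℕ.+ n) ≡ ff x m * ff (x - ι m) n
ff-+ x m zero    = trans (cong (ff x) (ℕ.+-identityʳ m)) (sym (ℚ.*-identityʳ (ff x m)))
ff-+ x m (suc n) = trans (cong (ff x) (ℕ.+-suc m n)) (trans (cong₂ _*_ (ff-+ x m n) (trans (cong (λ y → x - y) (ι-+ m n)) (eq x (ι m) (ι n)))) (ℚ.*-assoc (ff x m) (ff (x - ι m) n) (x - ι m - ι n)))
  where
  eq : ∀ x m n → x - (m + n) ≡ x - m - n
  eq = solve-∀ ℚ-ring

-- alternating binomial sums Σ (-1)^i C(s,i) f(i)
alt : ℕ → (ℕ → ℚ) → ℚ
alt zero    f = f 0
alt (suc s) f = alt s f - alt s (f ∘ suc)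

alt-cong : ∀ s {f g : ℕ → ℚ} → (∀ i → i ℕ.≤ s → f i ≡ g i) → alt s f ≡ alt s g
alt-cong zero    h = h 0 z≤n
alt-cong (suc s) h = cong₂ _-_ (alt-cong s (λ i i≤s → h i (ℕ.m≤n⇒m≤1+n i≤s))) (alt-cong s (λ i i≤s → h (suc i) (s≤s i≤s)))

alt-*ˡ : ∀ s c (f : ℕ → ℚ) → alt s (λ i → c * f i) ≡ c * alt s f
alt-*ˡ zero    c f = refl
alt-*ˡ (suc s) c f = trans (cong₂ _-_ (alt-*ˡ s c f) (alt-*ˡ s c (f ∘ suc))) (eq c (alt s f) (alt s (f ∘ suc)))
  where
  eq : ∀ c a b → c * a - c * b ≡ c * (a - b)
  eq = solve-∀ ℚ-ring

alt-+ : ∀ s (f g : ℕ → ℚ) → alt s (λ i → f i + g i) ≡ alt s f + alt s g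
alt-+ zero    f g = refl
alt-+ (suc s) f g = trans (cong₂ _-_ (alt-+ s f g) (alt-+ s (f ∘ suc) (g ∘ suc))) (eq (alt s f) (alt s g) (alt s (f ∘ suc)) (alt s (g ∘ suc)))
  where
  eq : ∀ a b c d → a + b - (c + d) ≡ a - c + (b - d)
  eq = solve-∀ ℚ-ring

alt-sumOver : ∀ {A : Set} s (xs : List A) (f : A → ℕ → ℚ) → sumOver xs (λ x → alt s (f x)) ≡ alt s (λ i → sumOver xs (λ x → f x i))
alt-sumOver zero    xs f = refl
alt-sumOver (suc s) xs f = trans (sumOver-- xs (λ x → alt s (f x)) (λ x → alt s (f x ∘ suc)))
  (cong₂ _-_ (alt-sumOver s xs f) (alt-sumOver s xs (λ x → f x ∘ suc)))

poly-alt : ∀ {r} s {d} (f : ℕ → ℚ → ℚ) → (∀ i → i ℕ.≤ s → Poly r d (f i)) → Poly r d (λ x → alt s (λ i → f i x))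
poly-alt zero    f h = h 0 z≤n
poly-alt (suc s) f h = poly-ext (λ x → eq (alt s (λ i → f i x)) (alt s (λ i → f (suc i) x))) (poly-+ (poly-alt s f (λ i i≤s → h i (ℕ.m≤n⇒m≤1+n i≤s)))
  (poly-*ˡ (- 1ℚ) (poly-alt s (f ∘ suc) (λ i i≤s → h (suc i) (s≤s i≤s)))))
  where
  eq : ∀ a b → a - b ≡ a + - 1ℚ * b
  eq = solve-∀ ℚ-ring

-- Polynomials in i presented by linear factors with leading coefficient - 1. The class is closed
-- under the shift of i, as the recursion of `alt` requires.
data Linears : ℕ → (ℕ → ℚ) → Set where
  none : ∀ {f} c → (∀ i → f i ≡ c) → Linears 0 f
  more : ∀ {n f g} c → Linears n f → (∀ i → g i ≡ (c - ι i) * f i) → Linears (suc n) g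

linears-suc : ∀ {n f} → Linears n f → Linears n (f ∘ suc)
linears-suc (none c h)   = none c (h ∘ suc)
linears-suc (more {f = f} c l h) = more (c - 1ℚ) (linears-suc l) (λ i → trans (h (suc i)) (cong (_* f (suc i)) (eq c (ι i))))
  where
  eq : ∀ c i → c - (1ℚ + i) ≡ c - 1ℚ - i
  eq = solve-∀ ℚ-ring

linears-ff : ∀ {n f} q c → Linears n f → Linears (q ℕ.+ n) (λ i → ff (c - ι i) q * f i)
linears-ff {f = f} zero    c (none d h) = none d (λ i → trans (ℚ.*-identityˡ (f i)) (h i))
linears-ff {f = f} zero    c (more d l h) = more d l (λ i → trans (ℚ.*-identityˡ (f i)) (h i))
linears-ff {f = f} (suc q) c l = more (c - ι q) (linears-ff q c l) (λ i → eq c (ι i) (ι q) (ff (c - ι i) q) (f i))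
  where
  eq : ∀ c i q p f → p * (c - i - q) * f ≡ (c - q - i) * (p * f)
  eq = solve-∀ ℚ-ring

-- From i C(s + 1, i) = (s + 1) C(s, i - 1): a factor i lowers the order of the alternating sum by
-- one. So fewer than s linear factors cannot survive a sum of order s.
alt-linear : ∀ s c (f : ℕ → ℚ) → alt (suc s) (λ i → (c - ι i) * f i) ≡ c * alt (suc s) f + ι (suc s) * alt s (f ∘ suc)
alt-linear zero    c f = eq c (f 0) (f 1)
  where
  eq : ∀ c a b → (c - 0ℚ) * a - (c - (1ℚ + 0ℚ)) * b ≡ c * (a - b) + (1ℚ + 0ℚ) * b
  eq = solve-∀ ℚ-ring
alt-linear (suc s) c f = trans (cong₂ _-_ (alt-linear s c f)
    (trans (alt-cong (suc s) (λ i _ → cong (_* f (suc i)) (eq c (ι i)))) (alt-linear s (c - 1ℚ) (f ∘ suc))))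
  (eq′ c (alt (suc s) f) (alt s (f ∘ suc)) (alt s (λ i → f (suc (suc i)))) (ι s))
  where
  eq : ∀ c i → c - (1ℚ + i) ≡ c - 1ℚ - i
  eq = solve-∀ ℚ-ring
  eq′ : ∀ c A p q s → c * A + (1ℚ + s) * p - ((c - 1ℚ) * (p - q) + (1ℚ + s) * q) ≡ c * (A - (p - q)) + (1ℚ + (1ℚ + s)) * (p - q)
  eq′ = solve-∀ ℚ-ring

alt-const : ∀ s c → alt (suc s) (λ _ → c) ≡ 0ℚ
alt-const zero    c = ℚ.+-inverseʳ c
alt-const (suc s) c = trans (cong₂ _-_ (alt-const s c) (alt-const s c)) refl

alt-linears : ∀ {n f} s → n ℕ.< s → Linears n f → alt s f ≡ 0ℚ
alt-linears (suc s) _ (none c h) = trans (alt-cong (suc s) (λ i _ → h i)) (alt-const s c)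
alt-linears (suc s) (s≤s n<s) (more {f = f} c l h) = trans (alt-cong (suc s) (λ i _ → h i)) (trans (alt-linear s c f)
  (trans (cong₂ (λ p q → c * p + ι (suc s) * q) (alt-linears (suc s) (ℕ.m<n⇒m<1+n n<s) l) (alt-linears s n<s (linears-suc l))) (eq c (ι (suc s)))))
  where
  eq : ∀ c s → c * 0ℚ + s * 0ℚ ≡ 0ℚ
  eq = solve-∀ ℚ-ring

-- Chu–Vandermonde, with A standing for the factorials (a ∸ i)!
alt-vandermonde : ∀ s a b (A : ℕ → ℚ) → (∀ i → i ℕ.< s → A i ≡ (a - ι i) * A (suc i)) →
                  alt s (λ i → ff b i * A i) ≡ ff (a - b) s * A s
alt-vandermonde zero    a b A h = refl
alt-vandermonde (suc s) a b A h = begin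
  alt s (λ i → ff b i * A i) - alt s (λ i → ff b (suc i) * A (suc i))
    ≡⟨ cong₂ _-_ (alt-vandermonde s a b A (λ i i<s → h i (ℕ.m<n⇒m<1+n i<s)))
         (trans (alt-cong s (λ i _ → trans (cong (_* A (suc i)) (ff-head b i)) (ℚ.*-assoc b (ff (b - 1ℚ) i) (A (suc i)))))
           (trans (alt-*ˡ s b (λ i → ff (b - 1ℚ) i * A (suc i))) (cong (b *_) (alt-vandermonde s (a - 1ℚ) (b - 1ℚ) (A ∘ suc)
             (λ i i<s → trans (h (suc i) (s≤s i<s)) (cong (_* A (suc (suc i))) (eq₁ a (ι i)))))))) ⟩
  ff (a - b) s * A s - b * (ff (a - 1ℚ - (b - 1ℚ)) s * A (suc s))
    ≡⟨ cong₂ (λ p q → ff (a - b) s * p - b * (ff q s * A (suc s))) (h s (ℕ.n<1+n s)) (eq₂ a b) ⟩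
  ff (a - b) s * ((a - ι s) * A (suc s)) - b * (ff (a - b) s * A (suc s))
    ≡⟨ eq₃ (ff (a - b) s) a b (ι s) (A (suc s)) ⟩
  ff (a - b) (suc s) * A (suc s) ∎
  where
  open ≡-Reasoning
  eq₁ : ∀ a i → a - (1ℚ + i) ≡ a - 1ℚ - i
  eq₁ = solve-∀ ℚ-ring
  eq₂ : ∀ a b → a - 1ℚ - (b - 1ℚ) ≡ a - b
  eq₂ = solve-∀ ℚ-ring
  eq₃ : ∀ f a b s A → f * ((a - s) * A) - b * (f * A) ≡ f * (a - b - s) * A
  eq₃ = solve-∀ ℚ-ring

-- Counting in designs

sumOver-cong∈ : ∀ {A : Set} xs {f g : A → ℚ} → (∀ {x} → x ∈ xs → f x ≡ g x) → sumOver xs f ≡ sumOver xs g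
sumOver-cong∈ []       h = refl
sumOver-cong∈ (x ∷ xs) h = cong₂ _+_ (h (here refl)) (sumOver-cong∈ xs (h ∘ there))

Σᶠ : ∀ {v} → (Fin v → ℚ) → ℚ
Σᶠ {zero}  f = 0ℚ
Σᶠ {suc v} f = f zero + Σᶠ (f ∘ suc)

Σᶠ-cong : ∀ {v} {f g : Fin v → ℚ} → (∀ p → f p ≡ g p) → Σᶠ f ≡ Σᶠ g
Σᶠ-cong {zero}  h = refl
Σᶠ-cong {suc v} h = cong₂ _+_ (h zero) (Σᶠ-cong (h ∘ suc))

Σᶠ-- : ∀ {v} (f g : Fin v → ℚ) → Σᶠ (λ p → f p - g p) ≡ Σᶠ f - Σᶠ g
Σᶠ-- {zero}  f g = refl
Σᶠ-- {suc v} f g = trans (cong (f zero - g zero +_) (Σᶠ-- (f ∘ suc) (g ∘ suc))) (eq (f zero) (g zero) (Σᶠ (f ∘ suc)) (Σᶠ (g ∘ suc)))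
  where
  eq : ∀ a b c d → a - b + (c - d) ≡ a + c - (b + d)
  eq = solve-∀ ℚ-ring

Σᶠ-*ʳ : ∀ {v} c (f : Fin v → ℚ) → Σᶠ (λ p → f p * c) ≡ Σᶠ f * c
Σᶠ-*ʳ {zero}  c f = sym (ℚ.*-zeroˡ c)
Σᶠ-*ʳ {suc v} c f = trans (cong (f zero * c +_) (Σᶠ-*ʳ c (f ∘ suc))) (sym (ℚ.*-distribʳ-+ c (f zero) (Σᶠ (f ∘ suc))))

Σᶠ-0≤ : ∀ {v} {f : Fin v → ℚ} → (∀ p → 0ℚ ≤ f p) → 0ℚ ≤ Σᶠ f
Σᶠ-0≤ {zero}  h = ℚ.≤-refl
Σᶠ-0≤ {suc v} h = 0≤+ (h zero) (Σᶠ-0≤ (h ∘ suc))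

Σᶠ-1 : ∀ v → Σᶠ {v} (λ _ → 1ℚ) ≡ ι v
Σᶠ-1 zero    = refl
Σᶠ-1 (suc v) = cong (1ℚ +_) (Σᶠ-1 v)

sumOver-Σᶠ : ∀ {A : Set} xs {v} (f : A → Fin v → ℚ) → sumOver xs (λ x → Σᶠ (f x)) ≡ Σᶠ (λ p → sumOver xs (λ x → f x p))
sumOver-Σᶠ xs {zero}  f = zeros xs
  where
  zeros : ∀ xs → sumOver xs (λ _ → 0ℚ) ≡ 0ℚ
  zeros []       = refl
  zeros (x ∷ xs) = cong (0ℚ +_) (zeros xs)
sumOver-Σᶠ xs {suc v} f = trans (sumOver-+ xs (λ x → f x zero) (λ x → Σᶠ (f x ∘ suc))) (cong (sumOver xs (λ x → f x zero) +_) (sumOver-Σᶠ xs (λ x → f x ∘ suc)))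

ind : Side → ℚ
ind inside  = 1ℚ
ind outside = 0ℚ

𝟙 : ∀ {v} → Subset v → Fin v → ℚ
𝟙 B p = ind (lookup B p)

-- the indicator of T ⊆ B
χ : ∀ {v} → Subset v → Subset v → ℚ
χ []            []      = 1ℚ
χ (outside ∷ T) (_ ∷ B) = χ T B
χ (inside  ∷ T) (b ∷ B) = ind b * χ T B

card-𝟙 : ∀ {v} (B : Subset v) → Σᶠ (𝟙 B) ≡ ι (card B)
card-𝟙 []            = refl
card-𝟙 (outside ∷ B) = trans (ℚ.+-identityˡ _) (card-𝟙 B)
card-𝟙 (inside  ∷ B) = cong (1ℚ +_) (card-𝟙 B)

card-∩ : ∀ {v} (A B : Subset v) → Σᶠ (λ p → 𝟙 A p * 𝟙 B p) ≡ ι (card (A ∩ B))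
card-∩ []            []            = refl
card-∩ (outside ∷ A) (b       ∷ B) = trans (cong₂ _+_ (ℚ.*-zeroˡ (ind b)) (card-∩ A B)) (ℚ.+-identityˡ (ι (card (A ∩ B))))
card-∩ (inside  ∷ A) (outside ∷ B) = trans (cong (0ℚ +_) (card-∩ A B)) (ℚ.+-identityˡ (ι (card (A ∩ B))))
card-∩ (inside  ∷ A) (inside  ∷ B) = cong (1ℚ +_) (card-∩ A B)

χ-⊆? : ∀ {v} (T B : Subset v) → χ T B ≡ (if does (T ⊆? B) then 1ℚ else 0ℚ)
χ-⊆? []            []            = refl
χ-⊆? (outside ∷ T) (b       ∷ B) = χ-⊆? T B
χ-⊆? (inside  ∷ T) (outside ∷ B) = ℚ.*-zeroˡ (χ T B)
χ-⊆? (inside  ∷ T) (inside  ∷ B) = trans (ℚ.*-identityˡ (χ T B)) (χ-⊆? T B)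

blocks-χ : ∀ {v} (T : Subset v) ℬ → ι (blocksContaining T ℬ) ≡ sumOver ℬ (χ T)
blocks-χ T []      = refl
blocks-χ T (B ∷ ℬ) with does (T ⊆? B) | χ-⊆? T B
... | true  | e = cong₂ _+_ (sym e) (blocks-χ T ℬ)
... | false | e = trans (sym (ℚ.+-identityˡ _)) (cong₂ _+_ (sym e) (blocks-χ T ℬ))

χ-empty : ∀ {v} (B : Subset v) → χ empty B ≡ 1ℚ
χ-empty []      = refl
χ-empty (_ ∷ B) = χ-empty B

χ-insert : ∀ {v} (T B : Subset v) p → lookup T p ≡ outside → χ (T [ p ]≔ inside) B ≡ 𝟙 B p * χ T B
χ-insert (outside ∷ T) (b ∷ B) zero    refl = refl
χ-insert (outside ∷ T) (b ∷ B) (suc p) e    = χ-insert T B p e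
χ-insert (inside  ∷ T) (b ∷ B) (suc p) e    = trans (cong (ind b *_) (χ-insert T B p e)) (eq (ind b) (𝟙 B p) (χ T B))
  where
  eq : ∀ a b c → a * (b * c) ≡ b * (a * c)
  eq = solve-∀ ℚ-ring

card-insert : ∀ {v} (T : Subset v) p → lookup T p ≡ outside → card (T [ p ]≔ inside) ≡ suc (card T)
card-insert (outside ∷ T) zero    refl = refl
card-insert (outside ∷ T) (suc p) e    = card-insert T p e
card-insert (inside  ∷ T) (suc p) e    = cong suc (card-insert T p e)

χ-absorb : ∀ {v} (T B : Subset v) p → 𝟙 T p * (𝟙 B p * χ T B) ≡ 𝟙 T p * χ T B
χ-absorb (outside ∷ T) (b ∷ B) zero    = trans (ℚ.*-zeroˡ (ind b * χ T B)) (sym (ℚ.*-zeroˡ (χ T B)))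
χ-absorb (inside  ∷ T) (outside ∷ B) zero = eq (χ T B)
  where
  eq : ∀ x → 1ℚ * (0ℚ * (0ℚ * x)) ≡ 1ℚ * (0ℚ * x)
  eq = solve-∀ ℚ-ring
χ-absorb (inside  ∷ T) (inside ∷ B) zero = eq (χ T B)
  where
  eq : ∀ x → 1ℚ * (1ℚ * (1ℚ * x)) ≡ 1ℚ * (1ℚ * x)
  eq = solve-∀ ℚ-ring
χ-absorb (outside ∷ T) (b ∷ B) (suc p) = χ-absorb T B p
χ-absorb (inside  ∷ T) (b ∷ B) (suc p) = trans (eq (𝟙 T p) (𝟙 B p) (ind b) (χ T B)) (trans (cong (ind b *_) (χ-absorb T B p)) (eq′ (𝟙 T p) (ind b) (χ T B)))
  where
  eq : ∀ t b c x → t * (b * (c * x)) ≡ c * (t * (b * x))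
  eq = solve-∀ ℚ-ring
  eq′ : ∀ t c x → c * (t * x) ≡ t * (c * x)
  eq′ = solve-∀ ℚ-ring

-- 1 - 𝟙 T selects the points outside T, where inserting is χ-multiplicative
χ-new : ∀ {v} (T B : Subset v) p → (1ℚ - 𝟙 T p) * χ (T [ p ]≔ inside) B ≡ 𝟙 B p * χ T B - 𝟙 T p * χ T B
χ-new T B p with lookup T p in e | χ-absorb T B p
... | outside | _ = trans (cong ((1ℚ - 0ℚ) *_) (χ-insert T B p e)) (eq (𝟙 B p) (χ T B))
  where
  eq : ∀ b x → (1ℚ - 0ℚ) * (b * x) ≡ b * x - 0ℚ * x
  eq = solve-∀ ℚ-ring
... | inside | a = trans (eq (χ (T [ p ]≔ inside) B) (χ T B)) (cong (_- 1ℚ * χ T B) (trans (sym a) (ℚ.*-identityˡ (𝟙 B p * χ T B))))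
  where
  eq : ∀ y x → (1ℚ - 1ℚ) * y ≡ 1ℚ * x - 1ℚ * x
  eq = solve-∀ ℚ-ring

-- If T lies in B, the points p that count are those of B outside T; if it does not, both sides
-- vanish.
Σ-new : ∀ {v} (T B : Subset v) → Σᶠ (λ p → (1ℚ - 𝟙 T p) * χ (T [ p ]≔ inside) B) ≡ (ι (card B) - ι (card T)) * χ T B
Σ-new T B = trans (Σᶠ-cong (χ-new T B)) (trans (Σᶠ-- (λ p → 𝟙 B p * χ T B) (λ p → 𝟙 T p * χ T B))
  (trans (cong₂ _-_ (trans (Σᶠ-*ʳ (χ T B) (𝟙 B)) (cong (_* χ T B) (card-𝟙 B))) (trans (Σᶠ-*ʳ (χ T B) (𝟙 T)) (cong (_* χ T B) (card-𝟙 T))))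
    (eq (ι (card B)) (ι (card T)) (χ T B))))
  where
  eq : ∀ a b x → a * x - b * x ≡ (a - b) * x
  eq = solve-∀ ℚ-ring

Σ-new-in : ∀ {v} (B₀ T B : Subset v) → χ T B₀ ≡ 1ℚ →
  Σᶠ (λ p → 𝟙 B₀ p * ((1ℚ - 𝟙 T p) * χ (T [ p ]≔ inside) B)) ≡ (ι (card (B₀ ∩ B)) - ι (card T)) * χ T B
Σ-new-in B₀ T B T⊆B₀ = trans (Σᶠ-cong (λ p → trans (cong (𝟙 B₀ p *_) (χ-new T B p)) (trans (eq₁ (𝟙 B₀ p) (𝟙 B p) (𝟙 T p) (χ T B)) (cong (λ x → 𝟙 B₀ p * 𝟙 B p * χ T B - x * χ T B) (inB₀ p)))))
  (trans (Σᶠ-- (λ p → 𝟙 B₀ p * 𝟙 B p * χ T B) (λ p → 𝟙 T p * χ T B))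
    (trans (cong₂ _-_ (trans (Σᶠ-*ʳ (χ T B) (λ p → 𝟙 B₀ p * 𝟙 B p)) (cong (_* χ T B) (card-∩ B₀ B))) (trans (Σᶠ-*ʳ (χ T B) (𝟙 T)) (cong (_* χ T B) (card-𝟙 T))))
      (eq (ι (card (B₀ ∩ B))) (ι (card T)) (χ T B))))
  where
  eq : ∀ a b x → a * x - b * x ≡ (a - b) * x
  eq = solve-∀ ℚ-ring
  eq₁ : ∀ b₀ b t x → b₀ * (b * x - t * x) ≡ b₀ * b * x - t * b₀ * x
  eq₁ = solve-∀ ℚ-ring
  inB₀ : ∀ p → 𝟙 T p * 𝟙 B₀ p ≡ 𝟙 T p
  inB₀ p = trans (eq₂ (𝟙 T p) (𝟙 B₀ p)) (trans (cong (λ x → 𝟙 T p * (𝟙 B₀ p * x)) (sym T⊆B₀)) (trans (χ-absorb T B₀ p) (trans (cong (𝟙 T p *_) T⊆B₀) (ℚ.*-identityʳ (𝟙 T p)))))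
    where
    eq₂ : ∀ t b → t * b ≡ t * (b * 1ℚ)
    eq₂ = solve-∀ ℚ-ring

only-new : ∀ (t : Side) {x y} → (t ≡ outside → x ≡ y) → (1ℚ - ind t) * x ≡ (1ℚ - ind t) * y
only-new outside h = cong ((1ℚ - 0ℚ) *_) (h refl)
only-new inside {x} {y} h = trans (ℚ.*-zeroˡ x) (sym (ℚ.*-zeroˡ y))

only-in : ∀ (b : Side) {x y} → (b ≡ inside → x ≡ y) → ind b * x ≡ ind b * y
only-in inside h = cong (1ℚ *_) (h refl)
only-in outside {x} {y} h = trans (ℚ.*-zeroˡ x) (sym (ℚ.*-zeroˡ y))

module Counting {t v k lam : ℕ} {ℬ : List (Subset v)} (D : IsDesign t v k lam ℬ) where
  open IsDesign D

  0<k- : ∀ {j} → j ℕ.< t → 0ℚ < ι k - ι j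
  0<k- j<t = 0<- (0<⇒ι< (ℕ.<-≤-trans j<t t≤k))

  -- Indexed by t minus the size of the set, because the counts are determined downwards from the
  -- t-subsets.
  level : ℕ → ℚ
  level zero    = ι lam
  level (suc d) = (ι v - ι (t ℕ.∸ suc d)) * inv (ι k - ι (t ℕ.∸ suc d)) * level d

  -- Double counting of the pairs (p, B) with p outside T and B containing both T and p.
  uniform : ∀ d → d ℕ.≤ t → ∀ T → card T ≡ t ℕ.∸ d → sumOver ℬ (χ T) ≡ level d
  uniform zero    _   T e = trans (sym (blocks-χ T ℬ)) (cong ι (balanced T e))
  uniform (suc d) d<t T e = trans (sym (*-cancel′ N)) (trans (cong (_* inv K) KN) (eq₂ (ι v - ι j) (level d) (inv K)))
    where
    j = t ℕ.∸ suc d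
    K = ι k - ι j
    N = sumOver ℬ (χ T)
    j<t : j ℕ.< t
    j<t = ℕ.∸-monoʳ-< {o = 0} (s≤s z≤n) d<t
    *-cancel′ : ∀ x → K * x * inv K ≡ x
    *-cancel′ x = trans (eq₁ K x (inv K)) (trans (cong (_* x) (*-inv⁺ (0<k- j<t))) (ℚ.*-identityˡ x))
      where
      eq₁ : ∀ K x i → K * x * i ≡ K * i * x
      eq₁ = solve-∀ ℚ-ring
    eq₂ : ∀ a l i → a * l * i ≡ a * i * l
    eq₂ = solve-∀ ℚ-ring
    size-new : ∀ p → lookup T p ≡ outside → card (T [ p ]≔ inside) ≡ t ℕ.∸ d
    size-new p h = trans (card-insert T p h) (trans (cong suc e) (sym (ℕ.+-∸-assoc 1 d<t)))
    KN : K * N ≡ (ι v - ι j) * level d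
    KN = begin
      K * N                                                                    ≡⟨ sumOver-*ˡ ℬ K (χ T) ⟨
      sumOver ℬ (λ B → K * χ T B)                                              ≡⟨ sumOver-cong∈ ℬ (λ {B} B∈ℬ → trans (cong₂ (λ a b → (ι a - ι b) * χ T B) (sym (blockSize B∈ℬ)) (sym e)) (sym (Σ-new T B))) ⟩
      sumOver ℬ (λ B → Σᶠ (λ p → (1ℚ - 𝟙 T p) * χ (T [ p ]≔ inside) B))         ≡⟨ sumOver-Σᶠ ℬ (λ B p → (1ℚ - 𝟙 T p) * χ (T [ p ]≔ inside) B) ⟩
      Σᶠ (λ p → sumOver ℬ (λ B → (1ℚ - 𝟙 T p) * χ (T [ p ]≔ inside) B))         ≡⟨ Σᶠ-cong (λ p → trans (sumOver-*ˡ ℬ (1ℚ - 𝟙 T p) _) (only-new (lookup T p) (λ h → uniform d (ℕ.<⇒≤ d<t) (T [ p ]≔ inside) (size-new p h)))) ⟩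
      Σᶠ (λ p → (1ℚ - 𝟙 T p) * level d)                                        ≡⟨ Σᶠ-*ʳ (level d) (λ p → 1ℚ - 𝟙 T p) ⟩
      Σᶠ (λ p → 1ℚ - 𝟙 T p) * level d                                          ≡⟨ cong (_* level d) (trans (Σᶠ-- (λ _ → 1ℚ) (𝟙 T)) (cong₂ _-_ (Σᶠ-1 v) (trans (card-𝟙 T) (cong ι e)))) ⟩
      (ι v - ι j) * level d ∎
      where open ≡-Reasoning

  -- number of blocks containing a given j-set
  lev : ℕ → ℚ
  lev j = level (t ℕ.∸ j)

  lev-step : ∀ j → j ℕ.< t → (ι k - ι j) * lev j ≡ (ι v - ι j) * lev (suc j)
  lev-step j j<t = trans (cong (λ d → (ι k - ι j) * level d) t∸j) (trans (cong (λ i → (ι k - ι j) * ((ι v - ι i) * inv (ι k - ι i) * level (t ℕ.∸ suc j))) back)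
    (trans (eq (ι k - ι j) (ι v - ι j) (inv (ι k - ι j)) (level (t ℕ.∸ suc j))) (trans (cong (_* ((ι v - ι j) * level (t ℕ.∸ suc j))) (*-inv⁺ (0<k- j<t))) (ℚ.*-identityˡ _))))
    where
    t∸j : t ℕ.∸ j ≡ suc (t ℕ.∸ suc j)
    t∸j = ℕ.+-∸-assoc 1 j<t
    back : t ℕ.∸ suc (t ℕ.∸ suc j) ≡ j
    back = trans (cong (t ℕ.∸_) (sym t∸j)) (ℕ.m∸[m∸n]≡n (ℕ.<⇒≤ j<t))
    eq : ∀ K V i l → K * (V * i * l) ≡ K * i * (V * l)
    eq = solve-∀ ℚ-ring

  module _ (B₀ : Subset v) (B₀-size : card B₀ ≡ k) where

    inter : Subset v → ℚ
    inter B = ι (card (B₀ ∩ B))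

    -- The sum counts the blocks B containing T together with a sequence of i distinct points of B₀
    -- ∩ B outside T. Moving the first point of the sequence into T lowers i, so the induction has
    -- to run over all T inside B₀.
    factorial-moment : ∀ i T → χ T B₀ ≡ 1ℚ → card T ℕ.+ i ℕ.≤ t →
      sumOver ℬ (λ B → χ T B * ff (inter B - ι (card T)) i) ≡ ff (ι k - ι (card T)) i * lev (card T ℕ.+ i)
    factorial-moment zero T T⊆B₀ h = trans (sumOver-cong ℬ (λ B → ℚ.*-identityʳ (χ T B)))
      (trans (uniform (t ℕ.∸ card T) (ℕ.m∸n≤m t (card T)) T (sym (ℕ.m∸[m∸n]≡n T≤t)))
        (trans (cong (λ j → level (t ℕ.∸ j)) (sym (ℕ.+-identityʳ (card T)))) (sym (ℚ.*-identityˡ _))))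
      where
      T≤t : card T ℕ.≤ t
      T≤t = ℕ.≤-trans (ℕ.m≤m+n (card T) 0) h
    factorial-moment (suc i) T T⊆B₀ h = begin
      sumOver ℬ (λ B → χ T B * ff (inter B - τ) (suc i))
        ≡⟨ sumOver-cong ℬ (λ B → trans (cong (χ T B *_) (ff-head (inter B - τ) i)) (trans (eq₁ (χ T B) (inter B - τ) (ff (inter B - τ - 1ℚ) i))
             (trans (cong₂ _*_ (sym (Σ-new-in B₀ T B T⊆B₀)) (cong (λ x → ff x i) (eq₂ (inter B) τ))) (sym (Σᶠ-*ʳ (F B) (λ p → 𝟙 B₀ p * ((1ℚ - 𝟙 T p) * χ (T [ p ]≔ inside) B))))))) ⟩
      sumOver ℬ (λ B → Σᶠ (λ p → 𝟙 B₀ p * ((1ℚ - 𝟙 T p) * χ (T [ p ]≔ inside) B) * F B))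
        ≡⟨ sumOver-Σᶠ ℬ (λ B p → 𝟙 B₀ p * ((1ℚ - 𝟙 T p) * χ (T [ p ]≔ inside) B) * F B) ⟩
      Σᶠ (λ p → sumOver ℬ (λ B → 𝟙 B₀ p * ((1ℚ - 𝟙 T p) * χ (T [ p ]≔ inside) B) * F B))
        ≡⟨ Σᶠ-cong (λ p → trans (sumOver-cong ℬ (λ B → eq₃ (𝟙 B₀ p) (1ℚ - 𝟙 T p) (χ (T [ p ]≔ inside) B) (F B)))
             (trans (sumOver-*ˡ ℬ (𝟙 B₀ p * (1ℚ - 𝟙 T p)) (λ B → χ (T [ p ]≔ inside) B * F B)) (trans (ℚ.*-assoc (𝟙 B₀ p) (1ℚ - 𝟙 T p) _)
               (trans (only-in (lookup B₀ p) (λ p∈B₀ → only-new (lookup T p) (λ p∉T → rec p p∈B₀ p∉T))) (sym (ℚ.*-assoc (𝟙 B₀ p) (1ℚ - 𝟙 T p) R)))))) ⟩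
      Σᶠ (λ p → 𝟙 B₀ p * (1ℚ - 𝟙 T p) * R)
        ≡⟨ Σᶠ-*ʳ R (λ p → 𝟙 B₀ p * (1ℚ - 𝟙 T p)) ⟩
      Σᶠ (λ p → 𝟙 B₀ p * (1ℚ - 𝟙 T p)) * R
        ≡⟨ cong (_* R) outside-T ⟩
      (ι k - τ) * R
        ≡⟨ eq₄ (ι k - τ) (ff (ι k - ι (suc (card T))) i) (lev (suc (card T) ℕ.+ i)) ⟩
      (ι k - τ) * ff (ι k - ι (suc (card T))) i * lev (suc (card T) ℕ.+ i)
        ≡⟨ cong₂ _*_ (trans (cong (λ x → (ι k - τ) * ff x i) (sym (eq₂ (ι k) τ))) (sym (ff-head (ι k - τ) i))) (cong lev (sym (ℕ.+-suc (card T) i))) ⟩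
      ff (ι k - τ) (suc i) * lev (card T ℕ.+ suc i) ∎
      where
      open ≡-Reasoning
      τ = ι (card T)
      F : Subset v → ℚ
      F B = ff (inter B - ι (suc (card T))) i
      R = ff (ι k - ι (suc (card T))) i * lev (suc (card T) ℕ.+ i)
      eq₁ : ∀ x a f → x * (a * f) ≡ a * x * f
      eq₁ = solve-∀ ℚ-ring
      eq₂ : ∀ a t → a - t - 1ℚ ≡ a - (1ℚ + t)
      eq₂ = solve-∀ ℚ-ring
      eq₃ : ∀ b t x f → b * (t * x) * f ≡ b * t * (x * f)
      eq₃ = solve-∀ ℚ-ring
      eq₄ : ∀ a f l → a * (f * l) ≡ a * f * l
      eq₄ = solve-∀ ℚ-ring
      rec : ∀ p → lookup B₀ p ≡ inside → lookup T p ≡ outside → sumOver ℬ (λ B → χ (T [ p ]≔ inside) B * F B) ≡ R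
      rec p p∈B₀ p∉T = trans (sumOver-cong ℬ (λ B → cong (λ c → χ (T [ p ]≔ inside) B * ff (inter B - ι c) i) (sym size)))
        (trans (factorial-moment i (T [ p ]≔ inside) (trans (χ-insert T B₀ p p∉T) (trans (cong₂ _*_ (cong ind p∈B₀) T⊆B₀) refl))
             (subst (λ c → c ℕ.+ i ℕ.≤ t) (sym size) (subst (ℕ._≤ t) (ℕ.+-suc (card T) i) h)))
           (cong (λ c → ff (ι k - ι c) i * lev (c ℕ.+ i)) size))
        where
        size = card-insert T p p∉T
      outside-T : Σᶠ (λ p → 𝟙 B₀ p * (1ℚ - 𝟙 T p)) ≡ ι k - τ
      outside-T = trans (Σᶠ-cong (λ p → trans (eq₅ (𝟙 B₀ p) (𝟙 T p)) (cong (λ x → 𝟙 B₀ p - x) (absorbed p)))) (trans (Σᶠ-- (𝟙 B₀) (𝟙 T)) (cong₂ _-_ (trans (card-𝟙 B₀) (cong ι B₀-size)) (card-𝟙 T)))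
        where
        eq₅ : ∀ b t → b * (1ℚ - t) ≡ b - t * (b * 1ℚ)
        eq₅ = solve-∀ ℚ-ring
        absorbed : ∀ p → 𝟙 T p * (𝟙 B₀ p * 1ℚ) ≡ 𝟙 T p
        absorbed p = trans (cong (λ x → 𝟙 T p * (𝟙 B₀ p * x)) (sym T⊆B₀)) (trans (χ-absorb T B₀ p) (trans (cong (𝟙 T p *_) T⊆B₀) (ℚ.*-identityʳ (𝟙 T p))))

    moment : ∀ i → i ℕ.≤ t → sumOver ℬ (λ B → ff (inter B) i) ≡ ff (ι k) i * lev i
    moment i i≤t = trans (sumOver-cong ℬ (λ B → trans (sym (ℚ.*-identityˡ _)) (cong₂ _*_ (sym (χ-empty B)) (cong (λ x → ff x i) (trans (eq (inter B)) (cong (λ c → inter B - ι c) (sym (∣⊥∣≡0 v))))))))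
      (trans (factorial-moment i empty (χ-empty B₀) (subst (λ c → c ℕ.+ i ℕ.≤ t) (sym (∣⊥∣≡0 v)) i≤t))
        (cong₂ _*_ (cong (λ x → ff x i) (trans (cong (λ c → ι k - ι c) (∣⊥∣≡0 v)) (sym (eq (ι k))))) (cong (λ c → lev (c ℕ.+ i)) (∣⊥∣≡0 v))))
      where
      eq : ∀ a → a ≡ a - 0ℚ
      eq = solve-∀ ℚ-ring

    -- The counts `lev` cancel between consecutive moments, which leaves the recurrence of the
    -- hypergeometric distribution, the same for every base block.
    moment-step : ∀ j → j ℕ.< t → (ι v - ι j) * sumOver ℬ (λ B → ff (inter B) (suc j)) ≡ (ι k - ι j) * (ι k - ι j) * sumOver ℬ (λ B → ff (inter B) j)
    moment-step j j<t = trans (cong ((ι v - ι j) *_) (moment (suc j) j<t)) (trans (eq (ι v - ι j) (ff (ι k) j) (ι k - ι j) (lev (suc j)))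
      (trans (cong (ff (ι k) j * (ι k - ι j) *_) (sym (lev-step j j<t))) (trans (eq′ (ff (ι k) j) (ι k - ι j) (lev j)) (cong ((ι k - ι j) * (ι k - ι j) *_) (sym (moment j (ℕ.<⇒≤ j<t)))))))
      where
      eq : ∀ v f k l → v * (f * k * l) ≡ f * k * (v * l)
      eq = solve-∀ ℚ-ring
      eq′ : ∀ f k l → f * k * (k * l) ≡ k * k * (f * l)
      eq′ = solve-∀ ℚ-ring

    moment-top : sumOver ℬ (λ B → ff (inter B) t) ≡ ff (ι k) t * ι lam
    moment-top = trans (moment t ℕ.≤-refl) (cong (λ d → ff (ι k) t * level d) (ℕ.n∸n≡0 t))

    inter-≤ : ∀ {B} → card (B₀ ∩ B) ℕ.≤ k
    inter-≤ {B} = subst (card (B₀ ∩ B) ℕ.≤_) B₀-size (∣p∩q∣≤∣p∣ B₀ B)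

    -- This is the number of points outside B₀ ∪ B.
    0≤v-2k+inter : ∀ {B} → B ∈ ℬ → 0ℚ ≤ ι v - ι 2 * ι k + inter B
    0≤v-2k+inter {B} B∈ℬ = ≤≡ (Σᶠ-0≤ {f = λ p → (1ℚ - 𝟙 B₀ p) - (𝟙 B p - 𝟙 B₀ p * 𝟙 B p)} (λ p → nonneg (lookup B₀ p) (lookup B p)))
      (trans (Σᶠ-- (λ p → 1ℚ - 𝟙 B₀ p) (λ p → 𝟙 B p - 𝟙 B₀ p * 𝟙 B p)) (trans (cong₂ _-_ (trans (Σᶠ-- (λ _ → 1ℚ) (𝟙 B₀)) (cong₂ _-_ (Σᶠ-1 v) (trans (card-𝟙 B₀) (cong ι B₀-size))))
        (trans (Σᶠ-- (𝟙 B) (λ p → 𝟙 B₀ p * 𝟙 B p)) (cong₂ _-_ (trans (card-𝟙 B) (cong ι (blockSize B∈ℬ))) (card-∩ B₀ B)))) (eq (ι v) (ι k) (inter B))))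
      where
      nonneg : ∀ a b → 0ℚ ≤ (1ℚ - ind a) - (ind b - ind a * ind b)
      nonneg inside  inside  = from-yes (0ℚ ℚ.≤? 0ℚ)
      nonneg inside  outside = from-yes (0ℚ ℚ.≤? 0ℚ)
      nonneg outside inside  = from-yes (0ℚ ℚ.≤? 0ℚ)
      nonneg outside outside = from-yes (0ℚ ℚ.≤? 1ℚ)
      eq : ∀ v k x → v - k - (k - x) ≡ v - ι 2 * k + x
      eq = solve-∀ ℚ-ring

-- Intersection numbers of a tight design

sgn : ℕ → ℚ
sgn n = Π< n (λ _ → - 1ℚ)

sgn≢0 : ∀ n → sgn n ≢ 0ℚ
sgn≢0 n = Π-≢0 n (λ _ _ ())

ff-neg : ∀ s x → ff (ι s - 1ℚ - x) s ≡ sgn s * ff x s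
ff-neg s x = trans (sym (Π-rev s (λ j → ι s - 1ℚ - x - ι j))) (trans (Π-cong s (λ j j<s → trans (cong (λ y → ι s - 1ℚ - x - y) (ι-∸ j<s)) (eq (ι s) x (ι j))))
  (Π-* s (λ _ → - 1ℚ) (λ j → x - ι j)))
  where
  eq : ∀ s x j → s - 1ℚ - x - (s - (1ℚ + j)) ≡ - 1ℚ * (x - j)
  eq = solve-∀ ℚ-ring

ff-0< : ∀ n {m} → n ℕ.≤ m → 0ℚ < ff (ι m) n
ff-0< n n≤m = Π-0< n (λ j j<n → 0<- (0<⇒ι< (ℕ.<-≤-trans j<n n≤m)))

ff-!  : ∀ n → ff (ι n) n ≡ ι (n !)
ff-! zero    = refl
ff-! (suc n) = trans (ff-head (ι (suc n)) n) (trans (cong (λ x → ι (suc n) * ff x n) (eq (ι n))) (trans (cong (ι (suc n) *_) (ff-! n)) (sym (ι-* (suc n) (n !)))))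
  where
  eq : ∀ n → 1ℚ + n - 1ℚ ≡ n
  eq = solve-∀ ℚ-ring

-- A family of values x whose factorial moments up to order t are those of the
-- hypergeometric distribution (v; k, k).
module Moments {I : Set} (xs : List I) (x : I → ℚ) (v k t : ℕ)
  (step : ∀ j → j ℕ.< t → (ι v - ι j) * sumOver xs (λ a → ff (x a) (suc j)) ≡ (ι k - ι j) * (ι k - ι j) * sumOver xs (λ a → ff (x a) j)) where

  M : ℕ → ℚ
  M i = sumOver xs (λ a → ff (x a) i)

  b : ℚ
  b = M 0

  V K : ℚ
  V = ι v
  K = ι k

  M-closed : ∀ i → i ℕ.≤ t → ff V i * M i ≡ b * (ff K i * ff K i)
  M-closed zero    _   = eq b
    where
    eq : ∀ b → 1ℚ * b ≡ b * (1ℚ * 1ℚ)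
    eq = solve-∀ ℚ-ring
  M-closed (suc i) i<t = trans (ℚ.*-assoc (ff V i) (V - ι i) (M (suc i))) (trans (cong (ff V i *_) (step i i<t))
    (trans (eq (ff V i) (K - ι i) (M i)) (trans (cong ((K - ι i) * (K - ι i) *_) (M-closed i (ℕ.<⇒≤ i<t))) (eq′ (K - ι i) b (ff K i)))))
    where
    eq : ∀ f k m → f * (k * k * m) ≡ k * k * (f * m)
    eq = solve-∀ ℚ-ring
    eq′ : ∀ k b f → k * k * (b * (f * f)) ≡ b * (f * k * (f * k))
    eq′ = solve-∀ ℚ-ring

  kNodes : ℕ → ℚ
  kNodes j = K - ι j

  N : ℕ → ℕ → ℚ
  N i l = sumOver xs (λ a → ff (x a) i * newton kNodes l (x a))

  -- The identity x - (k - l) = (x - i) - (k - i - l) expresses a moment with one more factor at the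
  -- end k by two with fewer such factors, and the closed forms of these two share all but simple
  -- factors.
  N-closed : ∀ l i → i ℕ.+ l ℕ.≤ t → ff V (i ℕ.+ l) * N i l ≡ sgn l * b * (ff K (i ℕ.+ l) * ff K i * ff (V - K) l)
  N-closed zero i h = trans (cong (λ m → ff V m * N i 0) (ℕ.+-identityʳ i)) (trans (cong (ff V i *_) (sumOver-cong xs (λ a → ℚ.*-identityʳ (ff (x a) i))))
    (trans (M-closed i (subst (ℕ._≤ t) (ℕ.+-identityʳ i) h)) (trans (eq b (ff K i)) (cong (λ m → 1ℚ * b * (ff K m * ff K i * 1ℚ)) (sym (ℕ.+-identityʳ i))))))
    where
    eq : ∀ b f → b * (f * f) ≡ 1ℚ * b * (f * f * 1ℚ)
    eq = solve-∀ ℚ-ring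
  N-closed (suc l) i h = begin
    ff V (i ℕ.+ suc l) * N i (suc l)
      ≡⟨ cong₂ _*_ (cong (ff V) (ℕ.+-suc i l)) recurrence ⟩
    ff V (suc (i ℕ.+ l)) * (N (suc i) l - (K - ι i - ι l) * N i l)
      ≡⟨ eq₁ (ff V (i ℕ.+ l)) (V - ι (i ℕ.+ l)) (N (suc i) l) (K - ι i - ι l) (N i l) ⟩
    ff V (suc i ℕ.+ l) * N (suc i) l - (V - ι (i ℕ.+ l)) * (K - ι i - ι l) * (ff V (i ℕ.+ l) * N i l)
      ≡⟨ cong₂ (λ p q → p - (V - ι (i ℕ.+ l)) * (K - ι i - ι l) * q) (N-closed l (suc i) h′) (N-closed l i (ℕ.<⇒≤ h′)) ⟩
    sgn l * b * (ff K (suc i ℕ.+ l) * ff K (suc i) * ff (V - K) l) - (V - ι (i ℕ.+ l)) * (K - ι i - ι l) * (sgn l * b * (ff K (i ℕ.+ l) * ff K i * ff (V - K) l))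
      ≡⟨ cong (λ z → sgn l * b * (ff K (i ℕ.+ l) * (K - z) * (ff K i * (K - ι i)) * ff (V - K) l) - (V - z) * (K - ι i - ι l) * (sgn l * b * (ff K (i ℕ.+ l) * ff K i * ff (V - K) l))) (ι-+ i l) ⟩
    sgn l * b * (ff K (i ℕ.+ l) * (K - (ι i + ι l)) * (ff K i * (K - ι i)) * ff (V - K) l) - (V - (ι i + ι l)) * (K - ι i - ι l) * (sgn l * b * (ff K (i ℕ.+ l) * ff K i * ff (V - K) l))
      ≡⟨ eq₂ (sgn l) b (ff K (i ℕ.+ l)) K V (ι i) (ι l) (ff K i) (ff (V - K) l) ⟩
    sgn (suc l) * b * (ff K (i ℕ.+ l) * (K - (ι i + ι l)) * ff K i * ff (V - K) (suc l))
      ≡⟨ cong (λ z → sgn (suc l) * b * (ff K (i ℕ.+ l) * (K - z) * ff K i * ff (V - K) (suc l))) (ι-+ i l) ⟨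
    sgn (suc l) * b * (ff K (suc (i ℕ.+ l)) * ff K i * ff (V - K) (suc l))
      ≡⟨ cong (λ m → sgn (suc l) * b * (ff K m * ff K i * ff (V - K) (suc l))) (ℕ.+-suc i l) ⟨
    sgn (suc l) * b * (ff K (i ℕ.+ suc l) * ff K i * ff (V - K) (suc l)) ∎
    where
    open ≡-Reasoning
    h′ : suc (i ℕ.+ l) ℕ.≤ t
    h′ = subst (ℕ._≤ t) (ℕ.+-suc i l) h
    recurrence : N i (suc l) ≡ N (suc i) l - (K - ι i - ι l) * N i l
    recurrence = trans (sumOver-cong xs (λ a → eq (ff (x a) i) (newton kNodes l (x a)) (x a) K (ι i) (ι l)))
      (trans (sumOver-- xs (λ a → ff (x a) (suc i) * newton kNodes l (x a)) (λ a → (K - ι i - ι l) * (ff (x a) i * newton kNodes l (x a))))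
        (cong (λ z → N (suc i) l - z) (sumOver-*ˡ xs (K - ι i - ι l) (λ a → ff (x a) i * newton kNodes l (x a)))))
      where
      eq : ∀ f n x k i l → f * (n * (x - (k - l))) ≡ f * (x - i) * n - (k - i - l) * (f * n)
      eq = solve-∀ ℚ-ring
    eq₁ : ∀ f w p q r → f * w * (p - q * r) ≡ f * w * p - w * q * (f * r)
    eq₁ = solve-∀ ℚ-ring
    eq₂ : ∀ s b f K V i l g h → s * b * (f * (K - (i + l)) * (g * (K - i)) * h) - (V - (i + l)) * (K - i - l) * (s * b * (f * g * h)) ≡
      s * - 1ℚ * b * (f * (K - (i + l)) * g * (h * (V - K - l)))
    eq₂ = solve-∀ ℚ-ring

  -- Summation by parts for the hypergeometric weights. On the basis x (x - 1) ⋯ (x - i + 1) it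
  -- reduces to `step`, since x times the basis element at x - 1 is the next basis element at x.
  stein : ∀ {d G} → suc d ℕ.≤ t → Poly ι d G →
    sumOver xs (λ a → (K - x a) * (K - x a) * G (x a) - x a * (V - ι 2 * K + x a) * G (x a - 1ℚ)) ≡ 0ℚ
  stein {d} d<t p = poly-functional xs (λ a f → (K - x a) * (K - x a) * f (x a) - x a * (V - ι 2 * K + x a) * f (x a - 1ℚ))
    (λ a n c e h → trans (cong₂ (λ y z → (K - x a) * (K - x a) * y - x a * (V - ι 2 * K + x a) * z) (h (x a)) (h (x a - 1ℚ)))
      (trans (cong₂ _-_ (sym (Σ-*ˡ n ((K - x a) * (K - x a)) (λ i → c i * e i (x a)))) (sym (Σ-*ˡ n (x a * (V - ι 2 * K + x a)) (λ i → c i * e i (x a - 1ℚ))))) (trans (sym (Σ-- n _ _))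
        (Σ-cong n (λ i _ → eq₁ ((K - x a) * (K - x a)) (x a * (V - ι 2 * K + x a)) (c i) (e i (x a)) (e i (x a - 1ℚ)))))))
    p kill
    where
    eq₁ : ∀ p q c e f → p * (c * e) - q * (c * f) ≡ c * (p * e - q * f)
    eq₁ = solve-∀ ℚ-ring
    kill : ∀ i → i ℕ.≤ d → sumOver xs (λ a → (K - x a) * (K - x a) * ff (x a) i - x a * (V - ι 2 * K + x a) * ff (x a - 1ℚ) i) ≡ 0ℚ
    kill i i≤d = trans (sumOver-cong xs (λ a → trans (eq₂ (K - x a) (x a) (V - ι 2 * K + x a) (ff (x a) i) (ff (x a - 1ℚ) i))
        (trans (cong (λ z → (K - x a) * (K - x a) * ff (x a) i - (V - ι 2 * K + x a) * z) (sym (ff-head (x a) i))) (eq₃ K V (x a) (ι i) (ff (x a) i)))))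
      (trans (sumOver-- xs (λ a → (K - ι i) * (K - ι i) * ff (x a) i) (λ a → (V - ι i) * ff (x a) (suc i)))
        (trans (cong₂ _-_ (sumOver-*ˡ xs ((K - ι i) * (K - ι i)) (λ a → ff (x a) i)) (trans (sumOver-*ˡ xs (V - ι i) (λ a → ff (x a) (suc i))) (step i (ℕ.<-≤-trans (s≤s i≤d) d<t))))
          (ℚ.+-inverseʳ ((K - ι i) * (K - ι i) * M i))))
      where
      eq₂ : ∀ k x w f g → k * k * f - x * w * g ≡ k * k * f - w * (x * g)
      eq₂ = solve-∀ ℚ-ring
      eq₃ : ∀ K V x i f → (K - x) * (K - x) * f - (V - ι 2 * K + x) * (f * (x - i)) ≡ (K - i) * (K - i) * f - (V - i) * (f * (x - i))
      eq₃ = solve-∀ ℚ-ring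

  -- Wilson's polynomial: the kernel polynomial of degree s for the value k
  module Kernel (s : ℕ) (2s≤t : s ℕ.+ s ℕ.≤ t) (s<k : s ℕ.< k) (k+s≤v : k ℕ.+ s ℕ.≤ v) (tight : b * ff (ι s) s ≡ ff V s) where

    α : ℕ → ℚ
    α i = ι ((k ℕ.∸ i) !)

    α-step : ∀ i → i ℕ.< k → α i ≡ (K - ι i) * α (suc i)
    α-step i i<k = trans (cong (λ n → ι (n !)) k∸i) (trans (ι-* (suc (k ℕ.∸ suc i)) ((k ℕ.∸ suc i) !)) (cong (_* α (suc i)) (trans (cong ι (sym k∸i)) (ι-∸ (ℕ.<⇒≤ i<k)))))
      where
      k∸i : k ℕ.∸ i ≡ suc (k ℕ.∸ suc i)
      k∸i = ℕ.+-∸-assoc 1 i<k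

    ff-α : ∀ i → i ℕ.≤ k → ff K i * α i ≡ α 0
    ff-α zero    _   = ℚ.*-identityˡ (α 0)
    ff-α (suc i) i<k = trans (ℚ.*-assoc (ff K i) (K - ι i) (α (suc i))) (trans (cong (ff K i *_) (sym (α-step i i<k))) (ff-α i (ℕ.<⇒≤ i<k)))

    α≢0 : ∀ i → α i ≢ 0ℚ
    α≢0 i e = <⇒≢ (0<⇒ι< {0} (ℕ.1≤n! (k ℕ.∸ i))) (sym e)

    -- The natural denominators are falling factorials of k. The factorials `α` replace their
    -- reciprocals up to a constant, by `ff-α`, and keep g free of division.
    coeff : ℕ → ℚ
    coeff i = ff (V - ι s) i * (α i * α (suc i))

    g : ℚ → ℚ
    g z = alt s (λ i → coeff i * ff z i)

    poly-g : ∀ {r} → Poly r s g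
    poly-g = poly-alt s (λ i z → coeff i * ff z i) (λ i i≤s → poly-*ˡ (coeff i) (poly-≤ i≤s (poly-newton i ι)))

    ffVs≢0 : ff V s ≢ 0ℚ
    ffVs≢0 e = <⇒≢ (ff-0< s (ℕ.≤-trans (ℕ.m≤n+m s k) k+s≤v)) (sym e)

    -- Once ff V s is multiplied in, the i-th term is a constant times q + l′ = s - 1 linear factors
    -- in i, and the alternating sum of order s kills it.
    orthogonal : ∀ l′ q → s ≡ suc l′ ℕ.+ q → sumOver xs (λ a → g (x a) * newton kNodes (suc l′) (x a)) ≡ 0ℚ
    orthogonal l′ q s≡ = *-cancel-≢0 {b = 0ℚ} ffVs≢0 (trans (cong (ff V s *_) toAlt) (trans (sym (alt-*ˡ s (ff V s) _))
      (trans (alt-cong s (λ i i≤s → term i i≤s)) (trans (alt-*ˡ s C _) (trans (cong (C *_) (alt-linears s lt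
        (linears-ff q (V - ι l) (linears-ff l′ (K - 1ℚ) (none 1ℚ (λ _ → refl)))))) (trans (ℚ.*-zeroʳ C) (sym (ℚ.*-zeroʳ (ff V s)))))))))
      where
      l = suc l′
      C = sgn l * b * (ff (V - K) l * (α 0 * α 0))
      lt : q ℕ.+ (l′ ℕ.+ 0) ℕ.< s
      lt = subst (q ℕ.+ (l′ ℕ.+ 0) ℕ.<_) (sym s≡) (s≤s (ℕ.≤-reflexive (trans (cong (q ℕ.+_) (ℕ.+-identityʳ l′)) (ℕ.+-comm q l′))))
      toAlt : sumOver xs (λ a → g (x a) * newton kNodes l (x a)) ≡ alt s (λ i → coeff i * N i l)
      toAlt = trans (sumOver-cong xs (λ a → trans (ℚ.*-comm (g (x a)) (newton kNodes l (x a))) (sym (alt-*ˡ s (newton kNodes l (x a)) (λ i → coeff i * ff (x a) i)))))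
        (trans (alt-sumOver s xs (λ a i → newton kNodes l (x a) * (coeff i * ff (x a) i)))
          (alt-cong s (λ i _ → trans (sumOver-cong xs (λ a → eq (newton kNodes l (x a)) (coeff i) (ff (x a) i))) (sumOver-*ˡ xs (coeff i) (λ a → ff (x a) i * newton kNodes l (x a))))))
        where
        eq : ∀ n c f → n * (c * f) ≡ c * (f * n)
        eq = solve-∀ ℚ-ring
      term : ∀ i → i ℕ.≤ s → ff V s * (coeff i * N i l) ≡ C * (ff (V - ι l - ι i) q * (ff (K - 1ℚ - ι i) l′ * 1ℚ))
      term i i≤s = begin
        ff V s * (ff (V - ι s) i * (α i * α (suc i)) * N i l)
          ≡⟨ eq₁ (ff V s) (ff (V - ι s) i) (α i) (α (suc i)) (N i l) ⟩
        ff V s * ff (V - ι s) i * (α i * α (suc i) * N i l)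
          ≡⟨ cong (_* (α i * α (suc i) * N i l)) (trans (sym (ff-+ V s i)) (trans (cong (ff V) s+i) (ff-+ V (i ℕ.+ l) q))) ⟩
        ff V (i ℕ.+ l) * ff (V - ι (i ℕ.+ l)) q * (α i * α (suc i) * N i l)
          ≡⟨ eq₂ (ff V (i ℕ.+ l)) (ff (V - ι (i ℕ.+ l)) q) (α i) (α (suc i)) (N i l) ⟩
        ff (V - ι (i ℕ.+ l)) q * (α i * α (suc i)) * (ff V (i ℕ.+ l) * N i l)
          ≡⟨ cong₂ (λ p r → ff p q * (α i * α (suc i)) * r) (trans (cong (λ y → V - y) (ι-+ i l)) (eq₃ V (ι i) (ι l))) (N-closed l i i+l≤t) ⟩
        ff (V - ι l - ι i) q * (α i * α (suc i)) * (sgn l * b * (ff K (i ℕ.+ l) * ff K i * ff (V - K) l))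
          ≡⟨ cong (λ p → ff (V - ι l - ι i) q * (α i * α (suc i)) * (sgn l * b * (p * ff K i * ff (V - K) l))) (trans (cong (ff K) (ℕ.+-suc i l′)) (trans (ff-+ K (suc i) l′) (cong (λ y → ff K (suc i) * ff y l′) (eq₄ K (ι i))))) ⟩
        ff (V - ι l - ι i) q * (α i * α (suc i)) * (sgn l * b * (ff K (suc i) * ff (K - 1ℚ - ι i) l′ * ff K i * ff (V - K) l))
          ≡⟨ eq₅ (ff (V - ι l - ι i) q) (α i) (α (suc i)) (sgn l * b) (ff K (suc i)) (ff (K - 1ℚ - ι i) l′) (ff K i) (ff (V - K) l) ⟩
        sgn l * b * (ff (V - K) l * (ff K i * α i * (ff K (suc i) * α (suc i)))) * (ff (V - ι l - ι i) q * (ff (K - 1ℚ - ι i) l′ * 1ℚ))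
          ≡⟨ cong₂ (λ p r → sgn l * b * (ff (V - K) l * (p * r)) * (ff (V - ι l - ι i) q * (ff (K - 1ℚ - ι i) l′ * 1ℚ))) (ff-α i (ℕ.<⇒≤ i<k)) (ff-α (suc i) i<k) ⟩
        C * (ff (V - ι l - ι i) q * (ff (K - 1ℚ - ι i) l′ * 1ℚ)) ∎
        where
        open ≡-Reasoning
        i<k : i ℕ.< k
        i<k = ℕ.≤-<-trans i≤s s<k
        l≤s : l ℕ.≤ s
        l≤s = subst (l ℕ.≤_) (sym s≡) (ℕ.m≤m+n l q)
        i+l≤t : i ℕ.+ l ℕ.≤ t
        i+l≤t = ℕ.≤-trans (ℕ.+-mono-≤ i≤s l≤s) 2s≤t
        s+i : s ℕ.+ i ≡ i ℕ.+ l ℕ.+ q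
        s+i = trans (ℕ.+-comm s i) (trans (cong (i ℕ.+_) s≡) (sym (ℕ.+-assoc i l q)))
        eq₁ : ∀ p q a b n → p * (q * (a * b) * n) ≡ p * q * (a * b * n)
        eq₁ = solve-∀ ℚ-ring
        eq₂ : ∀ p q a b n → p * q * (a * b * n) ≡ q * (a * b) * (p * n)
        eq₂ = solve-∀ ℚ-ring
        eq₃ : ∀ v i l → v - (i + l) ≡ v - l - i
        eq₃ = solve-∀ ℚ-ring
        eq₄ : ∀ k i → k - (1ℚ + i) ≡ k - 1ℚ - i
        eq₄ = solve-∀ ℚ-ring
        eq₅ : ∀ f a b s h m k w → f * (a * b) * (s * (h * m * k * w)) ≡ s * (w * (k * a * (h * b))) * (f * (m * 1ℚ))
        eq₅ = solve-∀ ℚ-ring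

    A : ℕ → ℚ
    A i = α (suc i)

    A-step : ∀ i → i ℕ.< s → A i ≡ (K - 1ℚ - ι i) * A (suc i)
    A-step i i<s = trans (α-step (suc i) (ℕ.≤-<-trans i<s s<k)) (cong (_* A (suc i)) (eq K (ι i)))
      where
      eq : ∀ k i → k - (1ℚ + i) ≡ k - 1ℚ - i
      eq = solve-∀ ℚ-ring

    g-at-k : g K ≡ α 0 * (sgn s * ff (V - K) s * A s)
    g-at-k = trans (alt-cong s (λ i i≤s → trans (eq (ff (V - ι s) i) (α i) (A i) (ff K i)) (cong (_* (ff (V - ι s) i * A i)) (ff-α i (ℕ.<⇒≤ (ℕ.≤-<-trans i≤s s<k))))))
      (trans (alt-*ˡ s (α 0) _) (cong (α 0 *_) (trans (alt-vandermonde s (K - 1ℚ) (V - ι s) A A-step)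
        (cong (_* A s) (trans (cong (λ y → ff y s) (eq′ K V (ι s))) (ff-neg s (V - K)))))))
      where
      eq : ∀ f a b k → f * (a * b) * k ≡ k * a * (f * b)
      eq = solve-∀ ℚ-ring
      eq′ : ∀ k v s → k - 1ℚ - (v - s) ≡ s - 1ℚ - (v - k)
      eq′ = solve-∀ ℚ-ring

    g-at-k≢0 : g K ≢ 0ℚ
    g-at-k≢0 e = *-≢0 (α≢0 0) (*-≢0 (*-≢0 (sgn≢0 s) (λ e → <⇒≢ (Π-0< s (λ j j<s → ≤∧≢⇒<′ j j<s)) (sym e))) (α≢0 (suc s))) (trans (sym g-at-k) e)
      where
      ≤∧≢⇒<′ : ∀ j → j ℕ.< s → 0ℚ < V - K - ι j
      ≤∧≢⇒<′ j j<s = subst (0ℚ <_) (eq V K (ι j)) (0<- (subst (_< V) (ι-+ k j) (0<⇒ι< (ℕ.<-≤-trans (ℕ.+-monoʳ-< k j<s) k+s≤v))))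
        where
        eq : ∀ v k j → v - (k + j) ≡ v - k - j
        eq = solve-∀ ℚ-ring

    -- Split the last factor as V - i - q = (K - i) + (V - K - q). The first part turns the term
    -- into q < s linear factors in i, which are killed; the second leads back to q. The base case
    -- is Vandermonde's.
    residual : ∀ q → q ℕ.≤ s → alt s (λ i → A i * ff K i * ff (V - ι i) q) ≡ ff (V - K) q * (sgn s * ff (ι s) s * A s)
    residual zero    _   = trans (alt-cong s (λ i _ → eq (A i) (ff K i))) (trans (alt-vandermonde s (K - 1ℚ) K A A-step)
      (trans (cong (_* A s) (trans (cong (λ y → ff y s) (eq′ K (ι s))) (ff-neg s (ι s)))) (sym (ℚ.*-identityˡ _))))
      where
      eq : ∀ a k → a * k * 1ℚ ≡ k * a
      eq = solve-∀ ℚ-ring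
      eq′ : ∀ k s → k - 1ℚ - k ≡ s - 1ℚ - s
      eq′ = solve-∀ ℚ-ring
    residual (suc q) q<s = trans (alt-cong s (λ i i≤s → trans (eq (A i) (ff K i) (ff (V - ι i) q) V (ι i) K (ι q))
        (cong (λ z → z * ff (V - ι i) q + (V - K - ι q) * (A i * ff K i * ff (V - ι i) q))
          (trans (ℚ.*-assoc (ff K i) (K - ι i) (A i)) (trans (cong (ff K i *_) (sym (α-step i (ℕ.≤-<-trans i≤s s<k)))) (ff-α i (ℕ.<⇒≤ (ℕ.≤-<-trans i≤s s<k))))))))
      (trans (alt-+ s (λ i → α 0 * ff (V - ι i) q) (λ i → (V - K - ι q) * (A i * ff K i * ff (V - ι i) q)))
        (trans (cong₂ _+_ (trans (alt-*ˡ s (α 0) (λ i → ff (V - ι i) q)) (trans (cong (α 0 *_) vanish) (ℚ.*-zeroʳ (α 0))))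
            (trans (alt-*ˡ s (V - K - ι q) (λ i → A i * ff K i * ff (V - ι i) q)) (cong ((V - K - ι q) *_) (residual q (ℕ.<⇒≤ q<s)))))
          (eq′ (V - K - ι q) (ff (V - K) q) (sgn s * ff (ι s) s * A s))))
      where
      vanish : alt s (λ i → ff (V - ι i) q) ≡ 0ℚ
      vanish = trans (alt-cong s (λ i _ → sym (ℚ.*-identityʳ (ff (V - ι i) q))))
        (alt-linears s (subst (ℕ._< s) (sym (ℕ.+-identityʳ q)) q<s) (linears-ff q V (none 1ℚ (λ _ → refl))))
      eq : ∀ a k f v i K q → a * k * (f * (v - i - q)) ≡ k * (K - i) * a * f + (v - K - q) * (a * k * f)
      eq = solve-∀ ℚ-ring
      eq′ : ∀ p f c → 0ℚ + p * (f * c) ≡ f * p * c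
      eq′ = solve-∀ ℚ-ring

    -- Here the number of blocks enters the kernel argument: `tight` makes the constant in the
    -- reproducing property of g equal to 1.
    g-mean : sumOver xs (λ a → g (x a)) ≡ g K
    g-mean = *-cancel-≢0 ffVs≢0 (begin
      ff V s * sumOver xs (λ a → g (x a))
        ≡⟨ cong (ff V s *_) (trans (alt-sumOver s xs (λ a i → coeff i * ff (x a) i)) (alt-cong s (λ i _ → sumOver-*ˡ xs (coeff i) (λ a → ff (x a) i)))) ⟩
      ff V s * alt s (λ i → coeff i * M i)
        ≡⟨ trans (sym (alt-*ˡ s (ff V s) _)) (alt-cong s term) ⟩
      alt s (λ i → b * α 0 * (A i * ff K i * ff (V - ι i) s))
        ≡⟨ trans (alt-*ˡ s (b * α 0) _) (cong (b * α 0 *_) (residual s ℕ.≤-refl)) ⟩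
      b * α 0 * (ff (V - K) s * (sgn s * ff (ι s) s * A s))
        ≡⟨ eq₁ b (α 0) (ff (V - K) s) (sgn s) (ff (ι s) s) (A s) ⟩
      b * ff (ι s) s * (α 0 * (sgn s * ff (V - K) s * A s))
        ≡⟨ cong₂ _*_ tight (sym g-at-k) ⟩
      ff V s * g K ∎)
      where
      open ≡-Reasoning
      eq₁ : ∀ b a f s h A → b * a * (f * (s * h * A)) ≡ b * h * (a * (s * f * A))
      eq₁ = solve-∀ ℚ-ring
      term : ∀ i → i ℕ.≤ s → ff V s * (coeff i * M i) ≡ b * α 0 * (A i * ff K i * ff (V - ι i) s)
      term i i≤s = trans (eq₂ (ff V s) (ff (V - ι s) i) (α i) (A i) (M i))
        (trans (cong (_* (α i * A i * M i)) (trans (sym (ff-+ V s i)) (trans (cong (ff V) (ℕ.+-comm s i)) (ff-+ V i s))))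
          (trans (eq₃ (ff V i) (ff (V - ι i) s) (α i) (A i) (M i)) (trans (cong (ff (V - ι i) s * (α i * A i) *_) (M-closed i (ℕ.≤-trans i≤s (ℕ.≤-trans (ℕ.m≤m+n s s) 2s≤t))))
            (trans (eq₄ (ff (V - ι i) s) (α i) (A i) b (ff K i)) (cong (λ z → b * z * (A i * ff K i * ff (V - ι i) s)) (ff-α i (ℕ.<⇒≤ (ℕ.≤-<-trans i≤s s<k))))))))
        where
        eq₂ : ∀ p q a b n → p * (q * (a * b) * n) ≡ p * q * (a * b * n)
        eq₂ = solve-∀ ℚ-ring
        eq₃ : ∀ p q a b n → p * q * (a * b * n) ≡ q * (a * b) * (p * n)
        eq₃ = solve-∀ ℚ-ring
        eq₄ : ∀ q a c b f → q * (a * c) * (b * (f * f)) ≡ b * (f * a) * (c * f * q)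
        eq₄ = solve-∀ ℚ-ring

    -- Expand one factor g at k, k - 1, ...: by `orthogonal` only its constant coefficient g(k)
    -- survives. The base block alone already accounts for the total, so g vanishes at all other
    -- blocks.
    g² : sumOver xs (λ a → g (x a) * g (x a)) ≡ g K * g K
    g² = trans (sumOver-cong xs (λ a → trans (cong (g (x a) *_) (expand (x a))) (trans (sym (Σ-*ˡ (suc s) (g (x a)) (λ l → c l * newton kNodes l (x a)))) (Σ-cong (suc s) (λ l _ → eq (g (x a)) (c l) (newton kNodes l (x a)))))))
      (trans (sumOver-Σ< xs (suc s) (λ a l → c l * (g (x a) * newton kNodes l (x a))))
        (trans (Σ-cong (suc s) (λ l _ → sumOver-*ˡ xs (c l) (λ a → g (x a) * newton kNodes l (x a))))
          (trans (Σ-single (suc s) 0 (s≤s z≤n) others)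
            (cong₂ _*_ (trans (sym (newton-at poly)) (cong g (eq₀ K))) (trans (sumOver-cong xs (λ a → ℚ.*-identityʳ (g (x a)))) g-mean)))))
      where
      poly = poly-g {kNodes}
      c = proj₁ poly
      expand = proj₂ (proj₂ poly)
      eq : ∀ g c n → g * (c * n) ≡ c * (g * n)
      eq = solve-∀ ℚ-ring
      eq₀ : ∀ k → k - 0ℚ ≡ k
      eq₀ = solve-∀ ℚ-ring
      others : ∀ l → l ℕ.< suc s → l ≢ 0 → c l * sumOver xs (λ a → g (x a) * newton kNodes l (x a)) ≡ 0ℚ
      others zero     _         l≢0 = contradiction refl l≢0
      others (suc l′) (s≤s l<s) _   = trans (cong (c (suc l′) *_) (orthogonal l′ (s ℕ.∸ suc l′) (sym (ℕ.m+[n∸m]≡n l<s)))) (ℚ.*-zeroʳ (c (suc l′)))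

-- Enumeration of the intersection numbers and the Bethe equation

punch : ℕ → ℕ → ℕ
punch i j with j ℕ.<? i
... | yes _ = j
... | no  _ = suc j

Π-punch : ∀ n (f : ℕ → ℚ) i → i ℕ.≤ n → Π< (suc n) f ≡ Π< n (f ∘ punch i) * f i
Π-punch n f i i≤n with ℕ.m≤n⇒m<n∨m≡n i≤n
... | inj₂ refl = cong (_* f n) (Π-cong n (λ j j<n → cong f (sym (below j j<n))))
  where
  below : ∀ j → j ℕ.< n → punch n j ≡ j
  below j j<n with j ℕ.<? n
  ... | yes _   = refl
  ... | no  j≮n = contradiction j<n j≮n
Π-punch (suc n) f i i≤n | inj₁ i<1+n = trans (cong (_* f (suc n)) (Π-punch n f i (ℕ.≤-pred i<1+n)))
  (trans (eq (Π< n (f ∘ punch i)) (f i) (f (suc n))) (cong (λ m → Π< n (f ∘ punch i) * f m * f i) (sym above)))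
  where
  eq : ∀ p a b → p * a * b ≡ p * b * a
  eq = solve-∀ ℚ-ring
  above : punch i n ≡ suc n
  above with n ℕ.<? i
  ... | yes n<i = contradiction (ℕ.≤-pred i<1+n) (ℕ.<⇒≱ n<i)
  ... | no  _   = refl

punch-surjective : ∀ {n} i j → i ℕ.≤ n → j ℕ.≤ n → j ≢ i → ∃ λ l → l ℕ.< n × punch i l ≡ j
punch-surjective i j i≤n j≤n j≢i with ℕ.<-cmp j i
... | tri≈ _ j≡i _ = contradiction j≡i j≢i
... | tri< j<i _ _ = j , ℕ.<-≤-trans j<i i≤n , below
  where
  below : punch i j ≡ j
  below with j ℕ.<? i
  ... | yes _   = refl
  ... | no  j≮i = contradiction j<i j≮i
punch-surjective i (suc j) i≤n j<n _ | tri> _ _ i<1+j = j , j<n , above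
  where
  above : punch i j ≡ suc j
  above with j ℕ.<? i
  ... | yes j<i = contradiction (ℕ.≤-pred i<1+j) (ℕ.<⇒≱ j<i)
  ... | no  _   = refl

punch-≢ : ∀ i j → punch i j ≢ i
punch-≢ i j e with j ℕ.<? i
... | yes j<i = ℕ.<-irrefl e j<i
... | no  j≮i = j≮i (ℕ.≤-reflexive e)

punch-< : ∀ {n} i {j} → j ℕ.< n → punch i j ℕ.< suc n
punch-< i {j} j<n with j ℕ.<? i
... | yes _ = ℕ.m<n⇒m<1+n j<n
... | no  _ = s≤s j<n

record Enumeration (P : ℕ → Set) (N : ℕ) : Set where
  field
    len      : ℕ
    r        : ℕ → ℕ
    increasing : ∀ i j → i ℕ.< j → j ℕ.< len → r i ℕ.< r j
    bounded  : ∀ i → i ℕ.< len → r i ℕ.< N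
    sound    : ∀ i → i ℕ.< len → P (r i)
    complete : ∀ m → m ℕ.< N → P m → ∃ λ i → i ℕ.< len × r i ≡ m

enumerate : ∀ {P : ℕ → Set} → (∀ m → Dec (P m)) → ∀ N → Enumeration P N
enumerate P? zero = record { len = 0 ; r = λ i → i ; increasing = λ _ _ _ () ; bounded = λ _ () ; sound = λ _ () ; complete = λ _ () }
enumerate {P} P? (suc N) with enumerate P? N | P? N
... | E | no ¬p = record
  { len = len ; r = r ; increasing = increasing ; bounded = λ i i<len → ℕ.m<n⇒m<1+n (bounded i i<len) ; sound = sound
  ; complete = λ m m≤N p → complete m (ℕ.≤∧≢⇒< (ℕ.≤-pred m≤N) (λ { refl → ¬p p })) p }
  where open Enumeration E
... | E | yes p = record
  { len = suc len ; r = r′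
  ; increasing = λ i j i<j j≤len → [ (λ j<len → subst₂ ℕ._<_ (sym (old (ℕ.<-trans i<j j<len))) (sym (old j<len)) (increasing i j i<j j<len))
      , (λ { refl → subst₂ ℕ._<_ (sym (old i<j)) (sym new) (bounded i i<j) }) ]′ (ℕ.m<1+n⇒m<n∨m≡n j≤len)
  ; bounded = λ i i≤len → [ (λ i<len → subst (ℕ._< suc N) (sym (old i<len)) (ℕ.m<n⇒m<1+n (bounded i i<len))) , (λ { refl → subst (ℕ._< suc N) (sym new) ℕ.≤-refl }) ]′ (ℕ.m<1+n⇒m<n∨m≡n i≤len)
  ; sound = λ i i≤len → [ (λ i<len → subst P (sym (old i<len)) (sound i i<len)) , (λ { refl → subst P (sym new) p }) ]′ (ℕ.m<1+n⇒m<n∨m≡n i≤len)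
  ; complete = λ m m≤N q → [ (λ m<N → let (i , i<len , e) = complete m m<N q in i , ℕ.m<n⇒m<1+n i<len , trans (old i<len) e) , (λ { refl → len , ℕ.≤-refl , new }) ]′ (ℕ.m<1+n⇒m<n∨m≡n m≤N)
  }
  where
  open Enumeration E
  r′ : ℕ → ℕ
  r′ i with i ℕ.<? len
  ... | yes _ = r i
  ... | no  _ = N
  old : ∀ {i} → i ℕ.< len → r′ i ≡ r i
  old {i} i<len with i ℕ.<? len
  ... | yes _   = refl
  ... | no  i≮l = contradiction i<len i≮l
  new : r′ len ≡ N
  new with len ℕ.<? len
  ... | yes l<l = contradiction l<l (ℕ.<-irrefl refl)
  ... | no  _   = refl

-- The total is F m times the number of entries with value m. This multiplicity is unknown, but only
-- its being positive matters.
isolate : ∀ {I : Set} (xs : List I) (n : I → ℕ) (F : ℕ → ℚ) m → Any (λ a → n a ≡ m) xs →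
          (∀ {a} → a ∈ xs → n a ≢ m → F (n a) ≡ 0ℚ) → sumOver xs (F ∘ n) ≡ 0ℚ → F m ≡ 0ℚ
isolate xs n F m m∈xs off total = *-cancel-≢0 {c = ι c} {b = 0ℚ} (λ e → <⇒≢ (ℚ.<-≤-trans 0<1 (ι-mono (proj₂ (proj₂ (multiplicity xs off)) m∈xs))) (sym e))
  (trans (sym (proj₁ (proj₂ (multiplicity xs off)))) (trans total (sym (ℚ.*-zeroʳ (ι c)))))
  where
  multiplicity : ∀ xs → (∀ {a} → a ∈ xs → n a ≢ m → F (n a) ≡ 0ℚ) → ∃ λ c → sumOver xs (F ∘ n) ≡ ι c * F m × (Any (λ a → n a ≡ m) xs → 1 ℕ.≤ c)
  multiplicity []       _ = 0 , sym (ℚ.*-zeroˡ (F m)) , λ ()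
  multiplicity (a ∷ xs) h with multiplicity xs (h ∘ there) | n a ℕ.≟ m
  ... | c , e , _ | yes refl = suc c , trans (cong (F (n a) +_) e) (eq (F (n a)) (ι c)) , λ _ → s≤s z≤n
    where
    eq : ∀ f c → f + c * f ≡ (1ℚ + c) * f
    eq = solve-∀ ℚ-ring
  ... | c , e , k | no na≢m = c , trans (cong₂ _+_ (h (here refl) na≢m) e) (ℚ.+-identityˡ (ι c * F m)) ,
    λ { (here na≡m) → contradiction na≡m na≢m ; (there p) → k p }
  c = proj₁ (multiplicity xs off)

module Nodes {I : Set} (a₀ : I) (xs : List I) (n : I → ℕ) (v k s : ℕ) (1≤s : 1 ℕ.≤ s) (2s≤k : s ℕ.+ s ℕ.≤ k) (k+s≤v : k ℕ.+ s ℕ.≤ v)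
  (head≡k : n a₀ ≡ k) (tail≤k : ∀ {a} → a ∈ xs → n a ℕ.≤ k)
  (step : ∀ j → j ℕ.< s ℕ.+ s → (ι v - ι j) * sumOver (a₀ ∷ xs) (λ a → ff (ι (n a)) (suc j)) ≡
                                (ι k - ι j) * (ι k - ι j) * sumOver (a₀ ∷ xs) (λ a → ff (ι (n a)) j))
  (tight : sumOver (a₀ ∷ xs) (λ a → ff (ι (n a)) 0) * ff (ι s) s ≡ ff (ι v) s) where

  private
    s<k : s ℕ.< k
    s<k = ℕ.<-≤-trans (ℕ.m<m+n s 1≤s) 2s≤k

  open Moments (a₀ ∷ xs) (ι ∘ n) v k (s ℕ.+ s) step
  open Kernel s ℕ.≤-refl s<k k+s≤v tight

  g-tail : ∀ {a} → a ∈ xs → g (ι (n a)) ≡ 0ℚ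
  g-tail {a} a∈xs = square (g (ι (n a))) (sumOver-≡0 {f = λ a → g (ι (n a)) * g (ι (n a))} (λ a → 0≤² (g (ι (n a))))
    (trans (eq (g (ι (n a₀)) * g (ι (n a₀))) (sumOver xs (λ a → g (ι (n a)) * g (ι (n a)))))
      (trans (cong₂ _-_ g² (cong (λ m → g (ι m) * g (ι m)) head≡k)) (ℚ.+-inverseʳ (g K * g K)))) a∈xs)
    where
    eq : ∀ a b → b ≡ a + b - a
    eq = solve-∀ ℚ-ring
    square : ∀ z → z * z ≡ 0ℚ → z ≡ 0ℚ
    square z e with z ℚ.≟ 0ℚ
    ... | yes z≡0 = z≡0
    ... | no  z≢0 = contradiction e (*-≢0 z≢0 z≢0)

  -- An intersection number k would mean that B₀ is listed again; as g(k) is not 0, this cannot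
  -- happen.
  tail<k : ∀ {a} → a ∈ xs → n a ℕ.< k
  tail<k a∈xs = ℕ.≤∧≢⇒< (tail≤k a∈xs) (λ e → g-at-k≢0 (trans (cong (g ∘ ι) (sym e)) (g-tail a∈xs)))

  E : Enumeration (λ m → Any (λ a → n a ≡ m) xs) k
  E = enumerate (λ m → any? (λ a → n a ℕ.≟ m) xs) k

  open Enumeration E public

  ρ : ℕ → ℚ
  ρ i = ι (r i)

  ρ-mono : ∀ {i j} → i ℕ.< j → j ℕ.< len → ρ i < ρ j
  ρ-mono i<j j<len = 0<⇒ι< (increasing _ _ i<j j<len)

  ρ-injective : ∀ {i j} → i ℕ.< len → j ℕ.< len → i ≢ j → ρ i ≢ ρ j
  ρ-injective {i} {j} i<len j<len i≢j e with ℕ.<-cmp i j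
  ... | tri< i<j _ _ = <⇒≢ (ρ-mono i<j j<len) e
  ... | tri≈ _ i≡j _ = i≢j i≡j
  ... | tri> _ _ j<i = <⇒≢ (ρ-mono j<i i<len) (sym e)

  ρ<K : ∀ {i} → i ℕ.< len → ρ i < K
  ρ<K i<len = 0<⇒ι< (bounded _ i<len)

  node : ∀ {a} → a ∈ xs → ∃ λ i → i ℕ.< len × r i ≡ n a
  node {a} a∈xs = complete (n a) (tail<k a∈xs) (lose a∈xs refl)

  g-node : ∀ i → i ℕ.< len → g (ρ i) ≡ 0ℚ
  g-node i i<len = at (sound i i<len) g-tail
    where
    at : ∀ {m ys} → Any (λ a → n a ≡ m) ys → (∀ {a} → a ∈ ys → g (ι (n a)) ≡ 0ℚ) → g (ι m) ≡ 0ℚ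
    at (here refl) h = h (here refl)
    at (there p)   h = at p (h ∘ there)

  len≤s : len ℕ.≤ s
  len≤s = ℕ.≮⇒≥ (λ s<len → g-at-k≢0 (poly-vanish (poly-g {ρ})
    (λ i j i≤s j<i → λ e → <⇒≢ (ρ-mono j<i (ℕ.≤-<-trans i≤s s<len)) (sym e))
    (λ i i≤s → g-node i (ℕ.≤-<-trans i≤s s<len)) K))

  F : (ℚ → ℚ) → ℚ → ℚ
  F G z = (K - z) * (K - z) * G z - z * (V - ι 2 * K + z) * G (z - 1ℚ)

  -- the factor z - (k - 1) of the test function removes the base block
  at-node : ∀ {d H} → 2 ℕ.+ d ℕ.≤ s ℕ.+ s → Poly ι d H → ∀ i → i ℕ.< len →
            (∀ j → j ℕ.< len → j ≢ i → F (λ z → (z - (K - 1ℚ)) * H z) (ρ j) ≡ 0ℚ) → F (λ z → (z - (K - 1ℚ)) * H z) (ρ i) ≡ 0ℚ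
  at-node {d} {H} h p i i<len off = isolate xs n (F G ∘ ι) (r i) (sound i i<len)
    (λ {a} a∈xs na≢ → let (j , j<len , e) = node a∈xs in trans (cong (F G ∘ ι) (sym e)) (off j j<len (λ { refl → na≢ (sym e) })))
    (trans (eq (F G (ι (n a₀))) (sumOver xs (F G ∘ ι ∘ n))) (trans (cong₂ _-_ (stein h (poly-linear (K - 1ℚ) p)) (trans (cong (F G ∘ ι) head≡k) (eq′ K (V - ι 2 * K + K) (H K) (H (K - 1ℚ))))) refl))
    where
    G = λ z → (z - (K - 1ℚ)) * H z
    eq : ∀ a b → b ≡ a + b - a
    eq = solve-∀ ℚ-ring
    eq′ : ∀ K w h h′ → (K - K) * (K - K) * ((K - (K - 1ℚ)) * h) - K * w * ((K - 1ℚ - (K - 1ℚ)) * h′) ≡ 0ℚ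
    eq′ = solve-∀ ℚ-ring

  shift : (ℕ → ℚ) → ℕ → ℚ
  shift c j = c j - 1ℚ

  newton-shift : ∀ c m z → newton (shift c) m z ≡ newton c m (z + 1ℚ)
  newton-shift c m z = Π-cong m (λ j _ → eq z (c j))
    where
    eq : ∀ z c → z - (c - 1ℚ) ≡ z + 1ℚ - c
    eq = solve-∀ ℚ-ring

  module _ (L : ℕ) (len≡ : len ≡ suc L) where

    private
      <len : ∀ {i} → i ℕ.≤ L → i ℕ.< len
      <len i≤L = subst (_ ℕ.<_) (sym len≡) (s≤s i≤L)

      ≤L : ∀ {i} → i ℕ.< len → i ℕ.≤ L
      ≤L i<len = ℕ.≤-pred (subst (_ ℕ.<_) len≡ i<len)

    -- `f i` is the polynomial p of all nodes with the root ρ i taken out, and `h` is p itself.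
    f : ℕ → ℚ → ℚ
    f i = newton (ρ ∘ punch i) L

    h : ℚ → ℚ
    h = newton ρ (suc L)

    f-other : ∀ i j → i ℕ.< len → j ℕ.< len → j ≢ i → f i (ρ j) ≡ 0ℚ
    f-other i j i<len j<len j≢i = let (l , l<L , e) = punch-surjective i j (≤L i<len) (≤L j<len) j≢i in
      Π-≡0 L l l<L (trans (cong (λ m → ρ j - ρ m) e) (ℚ.+-inverseʳ (ρ j)))

    f-self : ∀ i → i ℕ.< len → f i (ρ i) ≢ 0ℚ
    f-self i i<len = Π-≢0 L (λ l l<L e → ρ-injective i<len (subst (punch i l ℕ.<_) (sym len≡) (punch-< i l<L)) (λ i≡ → punch-≢ i l (sym i≡)) (-≡0⇒≡ (ρ i) (ρ (punch i l)) e))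

    h-node : ∀ j → j ℕ.< len → h (ρ j) ≡ 0ℚ
    h-node j j<len = Π-≡0 (suc L) j (subst (j ℕ.<_) len≡ j<len) (ℚ.+-inverseʳ (ρ j))

    K-ρ≢0 : ∀ {i} → i ℕ.< len → K - ρ i ≢ 0ℚ
    K-ρ≢0 i<len e = <⇒≢ (0<- (ρ<K i<len)) (sym e)

    private
      z-1+1 : ∀ z → z - 1ℚ + 1ℚ ≡ z
      z-1+1 = solve-∀ ℚ-ring

      double : ∀ {m} → suc L ℕ.≤ m → 2 ℕ.+ (L ℕ.+ L) ℕ.≤ m ℕ.+ m
      double {m} h = ℕ.≤-trans (ℕ.≤-reflexive (cong suc (sym (ℕ.+-suc L L)))) (ℕ.+-mono-≤ h h)

    -- B(ρ) p(ρ + 1) + D(ρ) p(ρ - 1) = 0, divided by the vanishing factor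
    bethe-node : ∀ i → i ℕ.< len → (K - ρ i) * (K - 1ℚ - ρ i) * f i (ρ i + 1ℚ) ≡ ρ i * (V - ι 2 * K + ρ i) * f i (ρ i - 1ℚ)
    bethe-node i i<len = *-cancel-≢0 {c = (K - ρ i) * f i (ρ i)} (*-≢0 (K-ρ≢0 i<len) (f-self i i<len))
      (trans (eq K V (ρ i) (f i (ρ i)) (f i (ρ i + 1ℚ)) (f i (ρ i - 1ℚ)))
        (trans (cong (λ w → (K - ρ i) * f i (ρ i) * (ρ i * (V - ι 2 * K + ρ i) * f i (ρ i - 1ℚ)) - w) (trans (sym F≡) zeroed)) (ℚ.+-identityʳ _)))
      where
      -- At any other node ρ j the first factor vanishes in G(ρ j) and the second, being shifted, in
      -- G(ρ j - 1). So node i alone survives in the moment identity, and there both terms contain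
      -- the common factor f i (ρ i).
      H : ℚ → ℚ
      H z = newton (ρ ∘ punch i) L z * newton (shift (ρ ∘ punch i)) L z
      F≡ : F (λ z → (z - (K - 1ℚ)) * H z) (ρ i) ≡
        (K - ρ i) * (K - ρ i) * ((ρ i - (K - 1ℚ)) * (f i (ρ i) * f i (ρ i + 1ℚ))) - ρ i * (V - ι 2 * K + ρ i) * ((ρ i - 1ℚ - (K - 1ℚ)) * (f i (ρ i - 1ℚ) * f i (ρ i)))
      F≡ = cong₂ (λ p q → (K - ρ i) * (K - ρ i) * ((ρ i - (K - 1ℚ)) * (f i (ρ i) * p)) - ρ i * (V - ι 2 * K + ρ i) * ((ρ i - 1ℚ - (K - 1ℚ)) * (f i (ρ i - 1ℚ) * q)))
        (newton-shift (ρ ∘ punch i) L (ρ i)) (trans (newton-shift (ρ ∘ punch i) L (ρ i - 1ℚ)) (cong (f i) (z-1+1 (ρ i))))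
      zeroed : F (λ z → (z - (K - 1ℚ)) * H z) (ρ i) ≡ 0ℚ
      zeroed = at-node {H = H} (double (subst (ℕ._≤ s) len≡ len≤s)) (poly-Π L (ρ ∘ punch i) (poly-newton L (shift (ρ ∘ punch i)))) i i<len
        (λ j j<len j≢i → trans (cong₂ (λ p q → (K - ρ j) * (K - ρ j) * ((ρ j - (K - 1ℚ)) * (p * newton (shift (ρ ∘ punch i)) L (ρ j))) - ρ j * (V - ι 2 * K + ρ j) * ((ρ j - 1ℚ - (K - 1ℚ)) * (newton (ρ ∘ punch i) L (ρ j - 1ℚ) * q)))
            (f-other i j i<len j<len j≢i) (trans (newton-shift (ρ ∘ punch i) L (ρ j - 1ℚ)) (trans (cong (f i) (z-1+1 (ρ j))) (f-other i j i<len j<len j≢i))))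
          (eq₀ ((K - ρ j) * (K - ρ j)) (ρ j - (K - 1ℚ)) (newton (shift (ρ ∘ punch i)) L (ρ j)) (ρ j * (V - ι 2 * K + ρ j)) (ρ j - 1ℚ - (K - 1ℚ)) (newton (ρ ∘ punch i) L (ρ j - 1ℚ))))
        where
        eq₀ : ∀ a b c d e g → a * (b * (0ℚ * c)) - d * (e * (g * 0ℚ)) ≡ 0ℚ
        eq₀ = solve-∀ ℚ-ring
      eq : ∀ K V z f p q → (K - z) * f * ((K - z) * (K - 1ℚ - z) * p) ≡ (K - z) * f * (z * (V - ι 2 * K + z) * q) -
        ((K - z) * (K - z) * ((z - (K - 1ℚ)) * (f * p)) - z * (V - ι 2 * K + z) * ((z - 1ℚ - (K - 1ℚ)) * (q * f)))
      eq = solve-∀ ℚ-ring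

    -- Fewer than s nodes leave room for one more factor in the test function, so
    -- the two sides of the Bethe equation vanish separately; then the nodes form
    -- an interval ending at k - 1.
    module Few (len<s : suc L ℕ.< s) where

      private
        deg : 2 ℕ.+ (suc L ℕ.+ L) ℕ.≤ s ℕ.+ s
        deg = ℕ.≤-trans (ℕ.≤-reflexive (cong suc (sym (ℕ.+-suc (suc L) L)))) (ℕ.+-mono-≤ len<s (ℕ.<⇒≤ len<s))

        deg′ : 2 ℕ.+ (L ℕ.+ suc L) ℕ.≤ s ℕ.+ s
        deg′ = subst (λ m → 2 ℕ.+ m ℕ.≤ s ℕ.+ s) (ℕ.+-comm (suc L) L) deg

      -- With the root ρ i restored in the first product, G(ρ i) vanishes too and only the term with
      -- G(ρ i - 1) is left. For `upper` the root is restored in the shifted product, which leaves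
      -- the other term.
      lower : ∀ i → i ℕ.< len → ρ i * (V - ι 2 * K + ρ i) * h (ρ i - 1ℚ) ≡ 0ℚ
      lower i i<len = *-cancel-≢0 {c = (K - ρ i) * f i (ρ i)} {b = 0ℚ} (*-≢0 (K-ρ≢0 i<len) (f-self i i<len))
        (trans (eq K V (ρ i) (f i (ρ i)) (h (ρ i - 1ℚ)) (f i (ρ i + 1ℚ))) (trans (sym F≡) (trans zeroed (sym (ℚ.*-zeroʳ ((K - ρ i) * f i (ρ i)))))))
        where
        H : ℚ → ℚ
        H z = newton ρ (suc L) z * newton (shift (ρ ∘ punch i)) L z
        F≡ : F (λ z → (z - (K - 1ℚ)) * H z) (ρ i) ≡
          (K - ρ i) * (K - ρ i) * ((ρ i - (K - 1ℚ)) * (0ℚ * f i (ρ i + 1ℚ))) - ρ i * (V - ι 2 * K + ρ i) * ((ρ i - 1ℚ - (K - 1ℚ)) * (h (ρ i - 1ℚ) * f i (ρ i)))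
        F≡ = trans (cong (λ u → (K - ρ i) * (K - ρ i) * ((ρ i - (K - 1ℚ)) * (u * newton (shift (ρ ∘ punch i)) L (ρ i))) - ρ i * (V - ι 2 * K + ρ i) * ((ρ i - 1ℚ - (K - 1ℚ)) * H (ρ i - 1ℚ))) (h-node i i<len))
          (cong₂ (λ p q → (K - ρ i) * (K - ρ i) * ((ρ i - (K - 1ℚ)) * (0ℚ * p)) - ρ i * (V - ι 2 * K + ρ i) * ((ρ i - 1ℚ - (K - 1ℚ)) * (h (ρ i - 1ℚ) * q)))
          (newton-shift (ρ ∘ punch i) L (ρ i)) (trans (newton-shift (ρ ∘ punch i) L (ρ i - 1ℚ)) (cong (f i) (z-1+1 (ρ i)))))
        zeroed : F (λ z → (z - (K - 1ℚ)) * H z) (ρ i) ≡ 0ℚ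
        zeroed = at-node {H = H} deg (poly-Π (suc L) ρ (poly-newton L (shift (ρ ∘ punch i)))) i i<len
          (λ j j<len j≢i → trans (cong₂ (λ p q → (K - ρ j) * (K - ρ j) * ((ρ j - (K - 1ℚ)) * (p * newton (shift (ρ ∘ punch i)) L (ρ j))) - ρ j * (V - ι 2 * K + ρ j) * ((ρ j - 1ℚ - (K - 1ℚ)) * (h (ρ j - 1ℚ) * q)))
              (h-node j j<len) (trans (newton-shift (ρ ∘ punch i) L (ρ j - 1ℚ)) (trans (cong (f i) (z-1+1 (ρ j))) (f-other i j i<len j<len j≢i))))
            (eq₀ ((K - ρ j) * (K - ρ j)) (ρ j - (K - 1ℚ)) (newton (shift (ρ ∘ punch i)) L (ρ j)) (ρ j * (V - ι 2 * K + ρ j)) (ρ j - 1ℚ - (K - 1ℚ)) (h (ρ j - 1ℚ))))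
          where
          eq₀ : ∀ a b c d e g → a * (b * (0ℚ * c)) - d * (e * (g * 0ℚ)) ≡ 0ℚ
          eq₀ = solve-∀ ℚ-ring
        eq : ∀ K V z f q p → (K - z) * f * (z * (V - ι 2 * K + z) * q) ≡
          (K - z) * (K - z) * ((z - (K - 1ℚ)) * (0ℚ * p)) - z * (V - ι 2 * K + z) * ((z - 1ℚ - (K - 1ℚ)) * (q * f))
        eq = solve-∀ ℚ-ring

      upper : ∀ i → i ℕ.< len → (K - 1ℚ - ρ i) * h (ρ i + 1ℚ) ≡ 0ℚ
      upper i i<len = *-cancel-≢0 {c = (K - ρ i) * ((K - ρ i) * f i (ρ i))} {b = 0ℚ} (*-≢0 (K-ρ≢0 i<len) (*-≢0 (K-ρ≢0 i<len) (f-self i i<len)))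
        (trans (eq K V (ρ i) (f i (ρ i)) (h (ρ i + 1ℚ)) (f i (ρ i - 1ℚ))) (trans (cong -_ (trans (sym F≡) zeroed)) (sym (ℚ.*-zeroʳ ((K - ρ i) * ((K - ρ i) * f i (ρ i)))))))
        where
        H : ℚ → ℚ
        H z = newton (ρ ∘ punch i) L z * newton (shift ρ) (suc L) z
        F≡ : F (λ z → (z - (K - 1ℚ)) * H z) (ρ i) ≡
          (K - ρ i) * (K - ρ i) * ((ρ i - (K - 1ℚ)) * (f i (ρ i) * h (ρ i + 1ℚ))) - ρ i * (V - ι 2 * K + ρ i) * ((ρ i - 1ℚ - (K - 1ℚ)) * (f i (ρ i - 1ℚ) * 0ℚ))
        F≡ = cong₂ (λ p q → (K - ρ i) * (K - ρ i) * ((ρ i - (K - 1ℚ)) * (f i (ρ i) * p)) - ρ i * (V - ι 2 * K + ρ i) * ((ρ i - 1ℚ - (K - 1ℚ)) * (f i (ρ i - 1ℚ) * q)))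
          (newton-shift ρ (suc L) (ρ i)) (trans (newton-shift ρ (suc L) (ρ i - 1ℚ)) (trans (cong h (z-1+1 (ρ i))) (h-node i i<len)))
        zeroed : F (λ z → (z - (K - 1ℚ)) * H z) (ρ i) ≡ 0ℚ
        zeroed = at-node {H = H} deg′ (poly-Π L (ρ ∘ punch i) (poly-newton (suc L) (shift ρ))) i i<len
          (λ j j<len j≢i → trans (cong₂ (λ p q → (K - ρ j) * (K - ρ j) * ((ρ j - (K - 1ℚ)) * (p * newton (shift ρ) (suc L) (ρ j))) - ρ j * (V - ι 2 * K + ρ j) * ((ρ j - 1ℚ - (K - 1ℚ)) * (f i (ρ j - 1ℚ) * q)))
              (f-other i j i<len j<len j≢i) (trans (newton-shift ρ (suc L) (ρ j - 1ℚ)) (trans (cong h (z-1+1 (ρ j))) (h-node j j<len))))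
            (eq₀ ((K - ρ j) * (K - ρ j)) (ρ j - (K - 1ℚ)) (newton (shift ρ) (suc L) (ρ j)) (ρ j * (V - ι 2 * K + ρ j)) (ρ j - 1ℚ - (K - 1ℚ)) (f i (ρ j - 1ℚ))))
          where
          eq₀ : ∀ a b c d e g → a * (b * (0ℚ * c)) - d * (e * (g * 0ℚ)) ≡ 0ℚ
          eq₀ = solve-∀ ℚ-ring
        eq : ∀ K V z f p q → (K - z) * ((K - z) * f) * ((K - 1ℚ - z) * p) ≡
          - ((K - z) * (K - z) * ((z - (K - 1ℚ)) * (f * p)) - z * (V - ι 2 * K + z) * ((z - 1ℚ - (K - 1ℚ)) * (q * 0ℚ)))
        eq = solve-∀ ℚ-ring

      private
        zero-product : ∀ {a b} → a * b ≡ 0ℚ → b ≢ 0ℚ → a ≡ 0ℚ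
        zero-product {a} {b} e b≢0 = *-cancel-≢0 {c = b} {b = 0ℚ} b≢0 (trans (ℚ.*-comm b a) (trans e (sym (ℚ.*-zeroʳ b))))

      last-or-next : ∀ i → i ℕ.< len → (∀ j → j ℕ.< len → r j ≢ suc (r i)) → suc (r i) ≡ k
      last-or-next i i<len no-next = ι-injective (trans (eq (ρ i) K) (trans (cong (λ z → K - z) (zero-product (upper i i<len) nonzero)) (ℚ.+-identityʳ K)))
        where
        eq : ∀ z K → 1ℚ + z ≡ K - (K - 1ℚ - z)
        eq = solve-∀ ℚ-ring
        nonzero : h (ρ i + 1ℚ) ≢ 0ℚ
        nonzero = Π-≢0 (suc L) (λ j j≤L e → no-next j (subst (j ℕ.<_) (sym len≡) j≤L) (sym (ι-injective (trans (eq′ (ρ i) (ρ j)) (trans (cong (_+ ρ j) e) (ℚ.+-identityˡ (ρ j)))))))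
          where
          eq′ : ∀ a b → 1ℚ + a ≡ a + 1ℚ - b + b
          eq′ = solve-∀ ℚ-ring

      consecutive : ∀ i → i ℕ.≤ L → r i ≡ r 0 ℕ.+ i
      consecutive zero    _   = sym (ℕ.+-identityʳ (r 0))
      consecutive (suc i) i<L = trans next (trans (cong suc (consecutive i (ℕ.<⇒≤ i<L))) (sym (ℕ.+-suc (r 0) i)))
        where
        lt : r i ℕ.< r (suc i)
        lt = increasing i (suc i) (ℕ.n<1+n i) (<len i<L)
        next : r (suc i) ≡ suc (r i)
        next with r (suc i) ℕ.≟ suc (r i)
        ... | yes e = e
        ... | no ne = ⊥-elim (ℕ.<⇒≱ (bounded (suc i) (<len i<L)) (subst (ℕ._≤ r (suc i)) (last-or-next i (<len (ℕ.<⇒≤ i<L)) no-next) lt))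
          where
          no-next : ∀ j → j ℕ.< len → r j ≢ suc (r i)
          no-next j j<len e with ℕ.<-cmp j (suc i)
          ... | tri< j≤i _ _ = [ (λ j<i → ℕ.<-irrefl e (ℕ.m<n⇒m<1+n (increasing j i j<i (<len (ℕ.<⇒≤ i<L))))) , (λ { refl → ℕ.<-irrefl e (ℕ.n<1+n (r j)) }) ]′ (ℕ.m<1+n⇒m<n∨m≡n j≤i)
          ... | tri≈ _ refl _ = ne e
          ... | tri> _ _ i<j = ℕ.<⇒≱ (increasing (suc i) j i<j j<len) (subst (ℕ._≤ r (suc i)) (sym e) lt)

      k≡ : k ≡ r 0 ℕ.+ suc L
      k≡ = trans (sym (last-or-next L (<len ℕ.≤-refl) (λ j j<len e → [ (λ j<L → ℕ.<-irrefl e (ℕ.m<n⇒m<1+n (increasing j L j<L (<len ℕ.≤-refl)))) , (λ { refl → ℕ.<-irrefl e (ℕ.n<1+n (r j)) }) ]′ (ℕ.m≤n⇒m<n∨m≡n (≤L j<len)))))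
        (trans (cong suc (consecutive L ℕ.≤-refl)) (sym (ℕ.+-suc (r 0) L)))

      first : ρ 0 * (V - ι 2 * K + ρ 0) ≡ 0ℚ
      first = zero-product (lower 0 (<len z≤n)) (Π-≢0 (suc L) (λ j j≤L e → <⇒≢ (0<- (lt j j≤L)) (sym (trans (eq (ρ j) (ρ 0)) (cong -_ e)))))
        where
        eq : ∀ a b → a - (b - 1ℚ) ≡ - (b - 1ℚ - a)
        eq = solve-∀ ℚ-ring
        lt : ∀ j → j ℕ.< suc L → ρ 0 - 1ℚ < ρ j
        lt zero    _   = <-by 0<1 (eq′ (ρ 0))
          where
          eq′ : ∀ a → a ≡ a - 1ℚ + 1ℚ
          eq′ = solve-∀ ℚ-ring
        lt (suc j) j≤L = ℚ.<-trans (<-by 0<1 (eq′ (ρ 0))) (ρ-mono (s≤s z≤n) (subst (suc j ℕ.<_) (sym len≡) j≤L))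
          where
          eq′ : ∀ a → a ≡ a - 1ℚ + 1ℚ
          eq′ = solve-∀ ℚ-ring

      -- The least node has no node at distance 1 below it, so D vanishes there. Either ρ 0 = 0, and
      -- then k is the number of nodes, which is below s; or v = 2 k - ρ 0 = k + len, which is below
      -- k + s.
      impossible : ⊥
      impossible with ρ 0 ℚ.≟ 0ℚ
      ... | yes e = ℕ.<⇒≱ s<k (subst (ℕ._≤ s) (sym (trans k≡ (cong (ℕ._+ suc L) (ι-injective {n = 0} e)))) (ℕ.<⇒≤ len<s))
      ... | no ne = ℕ.<⇒≱ len<s (ℕ.+-cancelˡ-≤ k s (suc L) (subst (k ℕ.+ s ℕ.≤_) v≡ k+s≤v))
        where
        v≡ : v ≡ k ℕ.+ suc L
        v≡ = ι-injective (trans (eq V K (ρ 0)) (trans (cong₂ (λ a b → b - ρ 0 + a) (trans (ℚ.*-comm (V - ι 2 * K + ρ 0) 1ℚ) (trans (ℚ.*-identityˡ (V - ι 2 * K + ρ 0)) (zero-product {a = V - ι 2 * K + ρ 0} {b = ρ 0} (trans (ℚ.*-comm (V - ι 2 * K + ρ 0) (ρ 0)) first) ne))) (cong (λ m → K + ι m) k≡))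
          (trans (cong (λ z → K + z - ρ 0 + 0ℚ) (ι-+ (r 0) (suc L))) (trans (eq′ K (ρ 0) (ι (suc L))) (sym (ι-+ k (suc L)))))))
          where
          eq : ∀ V K z → V ≡ K + K - z + (V - ι 2 * K + z) * 1ℚ
          eq = solve-∀ ℚ-ring
          eq′ : ∀ K z l → K + (z + l) - z + 0ℚ ≡ K + l
          eq′ = solve-∀ ℚ-ring

  -- With a single block, the first two moments force v = k.
  len≢0 : len ≢ 0
  len≢0 len≡0 = ℕ.<⇒≢ (ℕ.<-≤-trans (ℕ.m<m+n k 1≤s) k+s≤v) (sym (v≡k xs no-tail refl))
    where
    no-tail : ∀ {a} → a ∈ xs → ⊥
    no-tail a∈xs = let (i , i<len , _) = node a∈xs in ℕ.n≮0 (subst (i ℕ.<_) len≡0 i<len)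
    v≡k : ∀ ys → (∀ {a} → a ∈ ys → ⊥) → ys ≡ xs → v ≡ k
    v≡k (a ∷ ys) h _    = ⊥-elim (h (here refl))
    v≡k []       _ refl = ι-injective (*-cancel-≢0 {c = K} (λ e → <⇒≢ (0<⇒ι< {0} (ℕ.≤-<-trans z≤n s<k)) (sym e))
      (trans (eq V K) (trans (cong (λ m → (V - 0ℚ) * (1ℚ * (ι m - 0ℚ) + 0ℚ)) (sym head≡k)) (trans (step 0 (ℕ.<-≤-trans 1≤s (ℕ.m≤m+n s s))) (eq′ K)))))
      where
      eq : ∀ V K → K * V ≡ (V - 0ℚ) * (1ℚ * (K - 0ℚ) + 0ℚ)
      eq = solve-∀ ℚ-ring
      eq′ : ∀ K → (K - 0ℚ) * (K - 0ℚ) * (1ℚ + 0ℚ) ≡ K * K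
      eq′ = solve-∀ ℚ-ring

  len≡s : len ≡ s
  len≡s = from-cases len refl
    where
    from-cases : ∀ l → len ≡ l → len ≡ s
    from-cases zero    e = ⊥-elim (len≢0 e)
    from-cases (suc L) e = [ (λ l<s → ⊥-elim (Few.impossible L e (subst (ℕ._< s) e l<s))) , id ]′ (ℕ.m≤n⇒m<n∨m≡n len≤s)

-- From intersection numbers to configurations

record NodeData (v k s : ℕ) : Set where
  field
    r          : ℕ → ℕ
    L          : ℕ
    s≡1+L      : s ≡ suc L
    1≤k        : 1 ℕ.≤ k
    k<v        : k ℕ.< v
    increasing : ∀ i j → i ℕ.< j → j ℕ.< s → r i ℕ.< r j
    bounded    : ∀ i → i ℕ.< s → r i ℕ.< k
    0≤D        : ∀ i → i ℕ.< s → 0ℚ ≤ ι v - ι 2 * ι k + ι (r i)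
    node-eq    : ∀ i → i ℕ.< s → let K = ι k ; ρ = ι ∘ r ; f = newton (ρ ∘ punch i) L in
                 (K - ρ i) * (K - 1ℚ - ρ i) * f (ρ i + 1ℚ) ≡ ρ i * (ι v - ι 2 * K + ρ i) * f (ρ i - 1ℚ)

-- Integer square root by downward search; it supplies the rational scale R of a configuration.
isqrt : ∀ m (x : ℚ) → 0ℚ ≤ x → x < ι (suc m) * ι (suc m) → ∃ λ n → ι n * ι n ≤ x × x < ι (suc n) * ι (suc n)
isqrt zero    x 0≤x h = 0 , 0≤x , h
isqrt (suc m) x 0≤x h with ι (suc m) * ι (suc m) ℚ.≤? x
... | yes le = suc m , le , h
... | no  gt = isqrt m x 0≤x (ℚ.≰⇒> gt)

module FromNodes {v k s : ℕ} (nodes : NodeData v k s) where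
  open NodeData nodes

  -- `c₀` is the point where the weights B and D balance. Their difference D - B = S (x - c₀) is
  -- exactly linear, so after centring there q - y and q + y are exact multiples of B and D.
  V K S z c₀ : ℚ
  V  = ι v
  K  = ι k
  S  = V - 1ℚ
  z  = inv S
  c₀ = K * (K - 1ℚ) * z

  ρ y : ℕ → ℚ
  ρ i = ι (r i)
  y i = ρ i - c₀

  -- Read off from (B + D) / S as a quadratic polynomial in y: half of its constant term, and its
  -- linear coefficient. The skewness vanishes exactly when |v - 2k| = 1.
  variance skewness : ℚ
  variance = c₀ * (c₀ + V - ι 2 * K) * z
  skewness = ((V - ι 2 * K) * (V - ι 2 * K) - 1ℚ) * (z * z)

  B D q : ℕ → ℚ
  B i = (K - ρ i) * (K - 1ℚ - ρ i)
  D i = ρ i * (V - ι 2 * K + ρ i)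
  q i = ι 2 * variance + skewness * y i + ι 2 * (y i * y i * z)

  1≤K : 1ℚ ≤ K
  1≤K = ι-mono 1≤k

  K≤S : K ≤ S
  K≤S = ≤-by (0≤- (ι-mono-< k<v)) (eq K V)
    where
    eq : ∀ K V → V - 1ℚ ≡ K + (V - (K + 1ℚ))
    eq = solve-∀ ℚ-ring

  0<S : 0ℚ < S
  0<S = ℚ.<-≤-trans 0<1 (ℚ.≤-trans 1≤K K≤S)

  0≤K = 0≤ι k
  0≤S = ℚ.<⇒≤ 0<S
  0≤z = 0≤inv 0≤S

  Sz≡1 : S * z ≡ 1ℚ
  Sz≡1 = *-inv⁺ 0<S

  c₀S : c₀ * S ≡ K * (K - 1ℚ)
  c₀S = trans (eq (K * (K - 1ℚ)) z S) (trans (cong (K * (K - 1ℚ) *_) Sz≡1) (ℚ.*-identityʳ (K * (K - 1ℚ))))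
    where
    eq : ∀ a z S → a * z * S ≡ a * (S * z)
    eq = solve-∀ ℚ-ring

  c₁ : ℚ
  c₁ = c₀ + V - ι 2 * K

  c₁S : c₁ * S ≡ (V - K) * (V - K - 1ℚ)
  c₁S = trans (eq c₀ V K) (trans (cong (_+ (V - ι 2 * K) * (V - 1ℚ)) c₀S) (eq′ V K))
    where
    eq : ∀ c V K → (c + V - ι 2 * K) * (V - 1ℚ) ≡ c * (V - 1ℚ) + (V - ι 2 * K) * (V - 1ℚ)
    eq = solve-∀ ℚ-ring
    eq′ : ∀ V K → K * (K - 1ℚ) + (V - ι 2 * K) * (V - 1ℚ) ≡ (V - K) * (V - K - 1ℚ)
    eq′ = solve-∀ ℚ-ring

  S*q : ∀ i → S * q i ≡ ι 2 * (c₀ * c₁) + (V - ι 4 * K + 1ℚ + ι 4 * c₀) * y i + ι 2 * (y i * y i)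
  S*q i = trans (eq S z c₀ c₁ (V - ι 4 * K + 1ℚ + ι 4 * c₀) ((V - ι 2 * K) * (V - ι 2 * K) - 1ℚ) (y i))
    (trans (cong₂ (λ a b → ι 2 * (c₀ * c₁) * a + b * a * y i + ι 2 * (y i * y i) * a) Sz≡1 skew)
      (eq₁ (c₀ * c₁) (V - ι 4 * K + 1ℚ + ι 4 * c₀) (y i)))
    where
    eq : ∀ S z c d w X y → S * (ι 2 * (c * d * z) + X * (z * z) * y + ι 2 * (y * y * z)) ≡ ι 2 * (c * d) * (S * z) + X * z * (S * z) * y + ι 2 * (y * y) * (S * z)
    eq = solve-∀ ℚ-ring
    eq₁ : ∀ a w y → ι 2 * a * 1ℚ + w * 1ℚ * y + ι 2 * (y * y) * 1ℚ ≡ ι 2 * a + w * y + ι 2 * (y * y)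
    eq₁ = solve-∀ ℚ-ring
    skew : ((V - ι 2 * K) * (V - ι 2 * K) - 1ℚ) * z ≡ V - ι 4 * K + 1ℚ + ι 4 * c₀
    skew = trans (eq₂ V K z) (drop₁ (V - ι 4 * K + 1ℚ + ι 4 * c₀) (V - ι 4 * K + 1ℚ) Sz≡1)
      where
      eq₂ : ∀ V K z → ((V - ι 2 * K) * (V - ι 2 * K) - 1ℚ) * z ≡ V - ι 4 * K + 1ℚ + ι 4 * (K * (K - 1ℚ) * z) + (V - ι 4 * K + 1ℚ) * ((V - 1ℚ) * z - 1ℚ)
      eq₂ = solve-∀ ℚ-ring

  S*[q-y] : ∀ i → S * (q i - y i) ≡ ι 2 * B i
  S*[q-y] i = trans (eq S (q i) (y i)) (trans (cong (_- S * y i) (S*q i)) (trans (eq₁ V K c₀ (ρ i)) (trans (cong (λ x → ι 2 * B i + (x - K * (K - 1ℚ)) * ι 2) c₀S) (eq₂ (B i) (K * (K - 1ℚ))))))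
    where
    eq : ∀ S q y → S * (q - y) ≡ S * q - S * y
    eq = solve-∀ ℚ-ring
    eq₁ : ∀ V K c x → ι 2 * (c * (c + V - ι 2 * K)) + (V - ι 4 * K + 1ℚ + ι 4 * c) * (x - c) + ι 2 * ((x - c) * (x - c)) - (V - 1ℚ) * (x - c) ≡
      ι 2 * ((K - x) * (K - 1ℚ - x)) + (c * (V - 1ℚ) - K * (K - 1ℚ)) * ι 2
    eq₁ = solve-∀ ℚ-ring
    eq₂ : ∀ B k → ι 2 * B + (k - k) * ι 2 ≡ ι 2 * B
    eq₂ = solve-∀ ℚ-ring

  S*[q+y] : ∀ i → S * (q i + y i) ≡ ι 2 * D i
  S*[q+y] i = trans (eq S (q i) (y i)) (trans (cong (_+ S * y i) (S*q i)) (eq₁ V K c₀ (ρ i)))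
    where
    eq : ∀ S q y → S * (q + y) ≡ S * q + S * y
    eq = solve-∀ ℚ-ring
    eq₁ : ∀ V K c x → ι 2 * (c * (c + V - ι 2 * K)) + (V - ι 4 * K + 1ℚ + ι 4 * c) * (x - c) + ι 2 * ((x - c) * (x - c)) + (V - 1ℚ) * (x - c) ≡
      ι 2 * (x * (V - ι 2 * K + x))
    eq₁ = solve-∀ ℚ-ring

  0≤B : ∀ i → i ℕ.< s → 0ℚ ≤ B i
  0≤B i i<s = 0≤* (0≤- (ι-mono (ℕ.<⇒≤ (bounded i i<s)))) (≤≡ (0≤- (ι-mono-< (bounded i i<s))) (eq K (ρ i)))
    where
    eq : ∀ K x → K - (x + 1ℚ) ≡ K - 1ℚ - x
    eq = solve-∀ ℚ-ring

  private
    cancelS : ∀ {a b} → S * a ≡ ι 2 * b → 0ℚ ≤ b → 0ℚ ≤ a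
    cancelS {a} e h = *-cancelˡ 0<S (≡≤ (ℚ.*-zeroʳ S) (≤≡ (0≤* (0≤ι 2) h) (sym e)))

  ρ<V : ∀ i → i ℕ.< s → ρ i + 1ℚ ≤ K
  ρ<V i i<s = ι-mono-< (bounded i i<s)

  0≤c₀ : 0ℚ ≤ c₀
  0≤c₀ = 0≤* (0≤* 0≤K (0≤- 1≤K)) 0≤z

  c₀≤S : c₀ ≤ S
  c₀≤S = *-cancelˡ 0<S (≡≤ (trans (ℚ.*-comm S c₀) c₀S) (*-mono 0≤K 0≤S K≤S (ℚ.≤-trans (≤-by 0≤1 (eq K)) K≤S)))
    where
    eq : ∀ K → K ≡ K - 1ℚ + 1ℚ
    eq = solve-∀ ℚ-ring

  1≤V-K : 1ℚ ≤ V - K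
  1≤V-K = ≤-by (0≤- (ι-mono-< k<v)) (eq V K)
    where
    eq : ∀ V K → V - K ≡ 1ℚ + (V - (K + 1ℚ))
    eq = solve-∀ ℚ-ring

  0≤c₁ : 0ℚ ≤ c₁
  0≤c₁ = *-cancelˡ 0<S (≡≤ (ℚ.*-zeroʳ S) (≤≡ (0≤* (ℚ.≤-trans 0≤1 1≤V-K) (0≤- 1≤V-K)) (sym (trans (ℚ.*-comm S c₁) c₁S))))

  c₁≤S : c₁ ≤ S
  c₁≤S = *-cancelˡ 0<S (≡≤ (trans (ℚ.*-comm S c₁) c₁S) (*-mono (ℚ.≤-trans 0≤1 1≤V-K) 0≤S (≤-by (0≤- 1≤K) (eq V K)) (≤-by 0≤K (eq′ V K))))
    where
    eq : ∀ V K → V - 1ℚ ≡ V - K + (K - 1ℚ)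
    eq = solve-∀ ℚ-ring
    eq′ : ∀ V K → V - 1ℚ ≡ V - K - 1ℚ + K
    eq′ = solve-∀ ℚ-ring

  variance≤S : variance ≤ S
  variance≤S = ≤≡ (*-monoʳ 0≤z (*-mono 0≤c₀ 0≤S c₀≤S c₁≤S)) (trans (ℚ.*-assoc S S z) (trans (cong (S *_) Sz≡1) (ℚ.*-identityʳ S)))

  0≤variance : 0ℚ ≤ variance
  0≤variance = 0≤* (0≤* 0≤c₀ 0≤c₁) 0≤z

  S²zz≡1 : S * S * (z * z) ≡ 1ℚ
  S²zz≡1 = trans (eq S z) (trans (cong₂ _*_ Sz≡1 Sz≡1) refl)
    where
    eq : ∀ S z → S * S * (z * z) ≡ (S * z) * (S * z)
    eq = solve-∀ ℚ-ring

  skewness≤1 : skewness ≤ 1ℚ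
  skewness≤1 = ≤≡ (*-monoʳ {a = (V - ι 2 * K) * (V - ι 2 * K) - 1ℚ} (0≤² z) (≤-by (0≤+ (0≤* (0≤+ (0≤- 1≤K) 0≤K) (0≤+ (0≤- 1≤V-K) (ℚ.≤-trans 0≤1 1≤V-K))) 0≤1) (eq V K))) S²zz≡1
    where
    eq : ∀ V K → (V - 1ℚ) * (V - 1ℚ) ≡ (V - ι 2 * K) * (V - ι 2 * K) - 1ℚ + ((K - 1ℚ + K) * (V - K - 1ℚ + (V - K)) + 1ℚ)
    eq = solve-∀ ℚ-ring

  -skewness≤1 : - skewness ≤ 1ℚ
  -skewness≤1 = ≡≤ (ℚ.neg-distribˡ-* ((V - ι 2 * K) * (V - ι 2 * K) - 1ℚ) (z * z))
    (≤≡ (*-monoʳ {a = - ((V - ι 2 * K) * (V - ι 2 * K) - 1ℚ)} (0≤² z) (≤-by (0≤+ (0≤² (V - ι 2 * K)) (0≤* (0≤+ (0≤- 1≤S) (0≤ι 2)) (0≤- 1≤S))) (eq V (V - ι 2 * K)))) S²zz≡1)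
    where
    1≤S = ℚ.≤-trans 1≤K K≤S
    eq : ∀ V w → (V - 1ℚ) * (V - 1ℚ) ≡ - (w * w - 1ℚ) + (w * w + (V - 1ℚ - 1ℚ + ι 2) * (V - 1ℚ - 1ℚ))
    eq = solve-∀ ℚ-ring

  y-diff : ∀ i j → y i - y j ≡ ρ i - ρ j
  y-diff i j = eq (ρ i) (ρ j) c₀
    where
    eq : ∀ a b c → a - c - (b - c) ≡ a - b
    eq = solve-∀ ℚ-ring

  ρ-≢ : ∀ i j → i ℕ.< s → j ℕ.< s → i ≢ j → ρ i - ρ j ≢ 0ℚ
  ρ-≢ i j i<s j<s i≢j e with ℕ.<-cmp i j
  ... | tri< i<j _ _ = <⇒≢ (0<- (0<⇒ι< (increasing i j i<j j<s))) (trans (cong -_ (sym e)) (eq (ρ i) (ρ j)))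
    where
    eq : ∀ a b → - (a - b) ≡ b - a
    eq = solve-∀ ℚ-ring
  ... | tri≈ _ i≡j _ = i≢j i≡j
  ... | tri> _ _ j<i = <⇒≢ (0<- (0<⇒ι< (increasing j i j<i i<s))) (sym e)

  -- the diagonal factor of the product over all nodes is 1
  shifted : ∀ σ i → i ℕ.< s → newton (ρ ∘ punch i) L (ρ i + σ) ≡
            newton (ρ ∘ punch i) L (ρ i) * Π< s (λ j → 1ℚ + σ * inv (y i - y j))
  shifted σ i i<s = trans (Π-cong L factor) (trans (Π-* L (λ l → ρ i - ρ (punch i l)) (λ l → 1ℚ + σ * inv (y i - y (punch i l))))
    (cong (newton (ρ ∘ punch i) L (ρ i) *_) (sym (trans (cong (λ m → Π< m F) s≡1+L) (trans (Π-punch L F i (ℕ.≤-pred (subst (i ℕ.<_) s≡1+L i<s)))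
      (trans (cong (Π< L (F ∘ punch i) *_) (trans (cong (λ w → 1ℚ + σ * w) (trans (cong inv (ℚ.+-inverseʳ (y i))) inv-0)) (eq σ))) (ℚ.*-identityʳ _)))))))
    where
    F : ℕ → ℚ
    F j = 1ℚ + σ * inv (y i - y j)
    eq : ∀ σ → 1ℚ + σ * 0ℚ ≡ 1ℚ
    eq = solve-∀ ℚ-ring
    factor : ∀ l → l ℕ.< L → ρ i + σ - ρ (punch i l) ≡ (ρ i - ρ (punch i l)) * (1ℚ + σ * inv (y i - y (punch i l)))
    factor l l<L = trans (trans (eq₁ (ρ i) σ (ρ (punch i l))) (cong (λ w → ρ i - ρ (punch i l) + σ * w) (sym (*-inv (ρ-≢ i (punch i l) i<s (subst (punch i l ℕ.<_) (sym s≡1+L) (punch-< i l<L)) (λ e → punch-≢ i l (sym e)))))))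
      (trans (eq₂ (ρ i - ρ (punch i l)) σ (inv (ρ i - ρ (punch i l)))) (cong (λ w → (ρ i - ρ (punch i l)) * (1ℚ + σ * inv w)) (sym (y-diff i (punch i l)))))
      where
      eq₁ : ∀ a s b → a + s - b ≡ a - b + s * 1ℚ
      eq₁ = solve-∀ ℚ-ring
      eq₂ : ∀ d s w → d + s * (d * w) ≡ d * (1ℚ + s * w)
      eq₂ = solve-∀ ℚ-ring

  self≢0 : ∀ i → i ℕ.< s → newton (ρ ∘ punch i) L (ρ i) ≢ 0ℚ
  self≢0 i i<s = Π-≢0 L (λ l l<L → ρ-≢ i (punch i l) i<s (subst (punch i l ℕ.<_) (sym s≡1+L) (punch-< i l<L)) (λ e → punch-≢ i l (sym e)))

  B-D : ∀ i → i ℕ.< s → B i * Π< s (λ j → 1ℚ + inv (y i - y j)) ≡ D i * Π< s (λ j → 1ℚ - inv (y i - y j))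
  B-D i i<s = *-cancel-≢0 (self≢0 i i<s) (trans (eq₁ (B i) N _) (trans (cong (B i *_) (sym plus)) (trans (node-eq i i<s) (trans (cong (D i *_) minus) (sym (eq₁ (D i) N _))))))
    where
    N = newton (ρ ∘ punch i) L (ρ i)
    eq₁ : ∀ b n p → n * (b * p) ≡ b * (n * p)
    eq₁ = solve-∀ ℚ-ring
    plus : newton (ρ ∘ punch i) L (ρ i + 1ℚ) ≡ N * Π< s (λ j → 1ℚ + inv (y i - y j))
    plus = trans (shifted 1ℚ i i<s) (cong (N *_) (Π-cong s (λ j _ → cong (1ℚ +_) (ℚ.*-identityˡ (inv (y i - y j))))))
    minus : newton (ρ ∘ punch i) L (ρ i - 1ℚ) ≡ N * Π< s (λ j → 1ℚ - inv (y i - y j))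
    minus = trans (shifted (- 1ℚ) i i<s) (cong (N *_) (Π-cong s (λ j _ → cong (1ℚ +_) (eq (inv (y i - y j))))))
      where
      eq : ∀ a → - 1ℚ * a ≡ - a
      eq = solve-∀ ℚ-ring

  config : ∀ n → 1 ℕ.≤ n → ι n * ι n ≤ variance → variance < ι (suc n) * ι (suc n) → Config s
  config n 1≤n lo hi = record
    { S = S ; V = variance ; lam = skewness ; R = ι n ; y = y
    ; 1≤s = subst (1 ℕ.≤_) (sym s≡1+L) (s≤s z≤n)
    ; step = λ i j i<j j<s → ≤-by (0≤- (ι-mono-< (increasing i j i<j j<s))) (eq₁ (ρ i) (ρ j) c₀)
    ; lam≤1 = skewness≤1 ; -lam≤1 = -skewness≤1
    ; 1≤R = ι-mono 1≤n
    ; R²≤V = lo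
    ; V≤4R² = ≤-by (0≤+ (0≤- (ℚ.<⇒≤ hi)) (0≤* (0≤- (ι-mono 1≤n)) (0≤+ (0≤* (0≤ι 3) (0≤ι n)) 0≤1))) (eq₂ (ι n) variance)
    ; V≤S = variance≤S
    ; y≤S = λ i i<s → ≤-by (0≤+ (0≤+ (0≤- (ρ<V i i<s)) 0≤1) (0≤+ (0≤- K≤S) 0≤c₀)) (eq₃ (ρ i) K S c₀)
    ; -y≤S = λ i i<s → ≤-by (0≤+ (0≤- c₀≤S) (0≤ι (r i))) (eq₄ (ρ i) S c₀)
    ; y≤q = λ i i<s → ≤-by (cancelS (S*[q-y] i) (0≤B i i<s)) (eq₅ (q i) (y i))
    ; -y≤q = λ i i<s → ≤-by (cancelS (S*[q+y] i) (0≤* (0≤ι (r i)) (0≤D i i<s))) (eq₆ (q i) (y i))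
    ; bethe = λ i i<s → *-cancel-≢0 {c = S} (λ e → <⇒≢ 0<S (sym e))
        (trans (sym (ℚ.*-assoc S (q i - y i) (Π< s (λ j → 1ℚ + inv (y i - y j))))) (trans (cong (_* Π< s (λ j → 1ℚ + inv (y i - y j))) (S*[q-y] i)) (trans (ℚ.*-assoc (ι 2) (B i) (Π< s (λ j → 1ℚ + inv (y i - y j))))
          (trans (cong (ι 2 *_) (B-D i i<s)) (trans (sym (ℚ.*-assoc (ι 2) (D i) (Π< s (λ j → 1ℚ - inv (y i - y j))))) (trans (cong (_* Π< s (λ j → 1ℚ - inv (y i - y j))) (sym (S*[q+y] i)))
            (ℚ.*-assoc S (q i + y i) (Π< s (λ j → 1ℚ - inv (y i - y j))))))))))
    }
    where
    eq₁ : ∀ a b c → b - c ≡ a - c + 1ℚ + (b - (a + 1ℚ))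
    eq₁ = solve-∀ ℚ-ring
    eq₂ : ∀ n v → ι 4 * (n * n) ≡ v + ((1ℚ + n) * (1ℚ + n) - v + (n - ι 1) * (ι 3 * n + 1ℚ))
    eq₂ = solve-∀ ℚ-ring
    eq₃ : ∀ x K S c → S ≡ x - c + (K - (x + 1ℚ) + 1ℚ + (S - K + c))
    eq₃ = solve-∀ ℚ-ring
    eq₄ : ∀ x S c → S ≡ - (x - c) + (S - c + x)
    eq₄ = solve-∀ ℚ-ring
    eq₅ : ∀ q y → q ≡ y + (q - y)
    eq₅ = solve-∀ ℚ-ring
    eq₆ : ∀ q y → q ≡ - y + (q + y)
    eq₆ = solve-∀ ℚ-ring

  -- If the nodes are symmetric about ω / 2, then B(x) B(ω - x) and D(x) D(ω - x)
  -- agree at the nodes, hence identically.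
  module Symmetric (5≤s : 5 ℕ.≤ s) (2≤k : 2 ℕ.≤ k) (1+k<v : suc k ℕ.< v) (ω : ℚ)
                   (sym-nodes : ∀ i → i ℕ.< s → ρ i + ρ (opp s i) ≡ ω)
                   (spread : ∀ i j → i ℕ.< j → j ℕ.< s → 1ℚ < ρ j - ρ i) where

    private
      1+σinv≢0 : ∀ σ d → d ≢ 0ℚ → d + σ ≢ 0ℚ → 1ℚ + σ * inv d ≢ 0ℚ
      1+σinv≢0 σ d d≢0 h e = h (trans (sym (drop₁ (d + σ) σ (*-inv d≢0))) (trans (eq d σ (inv d)) (trans (cong (d *_) e) (ℚ.*-zeroʳ d))))
        where
        eq : ∀ d s w → d + s + s * (d * w - 1ℚ) ≡ d * (1ℚ + s * w)
        eq = solve-∀ ℚ-ring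

      separated : ∀ i j → i ℕ.< s → j ℕ.< s → i ≢ j → (1ℚ < ρ i - ρ j) ⊎ (ρ i - ρ j < - 1ℚ)
      separated i j i<s j<s i≢j with ℕ.<-cmp i j
      ... | tri< i<j _ _ = inj₂ (subst (_< - 1ℚ) (eq (ρ i) (ρ j)) (ℚ.neg-antimono-< (spread i j i<j j<s)))
        where
        eq : ∀ a b → - (b - a) ≡ a - b
        eq = solve-∀ ℚ-ring
      ... | tri≈ _ i≡j _ = contradiction i≡j i≢j
      ... | tri> _ _ j<i = inj₁ (spread j i j<i i<s)

      factor≢0 : ∀ σ → - 1ℚ ≤ σ → σ ≤ 1ℚ → ∀ i j → i ℕ.< s → j ℕ.< s → 1ℚ + σ * inv (y i - y j) ≢ 0ℚ
      factor≢0 σ lo hi i j i<s j<s with i ℕ.≟ j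
      ... | yes refl = λ e → <⇒≢ 0<1 (sym (trans (sym (trans (cong (λ w → 1ℚ + σ * w) (trans (cong inv (ℚ.+-inverseʳ (y i))) inv-0)) (eq σ))) e))
        where
        eq : ∀ σ → 1ℚ + σ * 0ℚ ≡ 1ℚ
        eq = solve-∀ ℚ-ring
      ... | no i≢j = subst (λ w → 1ℚ + σ * inv w ≢ 0ℚ) (sym (y-diff i j)) (1+σinv≢0 σ (ρ i - ρ j) (ρ-≢ i j i<s j<s i≢j)
          ([ (λ h e → <⇒≢ (ℚ.+-mono-<-≤ h lo) (sym e)) , (λ h e → <⇒≢ (ℚ.+-mono-<-≤ h hi) e) ]′ (separated i j i<s j<s i≢j)))

      P⁺ P⁻ : ℕ → ℚ
      P⁺ i = Π< s (λ j → 1ℚ + inv (y i - y j))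
      P⁻ i = Π< s (λ j → 1ℚ - inv (y i - y j))

      P⁺≢0 : ∀ i → i ℕ.< s → P⁺ i ≢ 0ℚ
      P⁺≢0 i i<s = Π-≢0 s (λ j j<s → subst (_≢ 0ℚ) (cong (1ℚ +_) (ℚ.*-identityˡ (inv (y i - y j)))) (factor≢0 1ℚ (from-yes (- 1ℚ ℚ.≤? 1ℚ)) ℚ.≤-refl i j i<s j<s))

      P⁻≢0 : ∀ i → i ℕ.< s → P⁻ i ≢ 0ℚ
      P⁻≢0 i i<s = Π-≢0 s (λ j j<s → subst (_≢ 0ℚ) (cong (1ℚ +_) (eq (inv (y i - y j)))) (factor≢0 (- 1ℚ) ℚ.≤-refl (from-yes (- 1ℚ ℚ.≤? 1ℚ)) i j i<s j<s))
        where
        eq : ∀ a → - 1ℚ * a ≡ - a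
        eq = solve-∀ ℚ-ring

      inv-opp : ∀ i j → i ℕ.< s → j ℕ.< s → inv (y (opp s i) - y (opp s j)) ≡ - inv (y i - y j)
      inv-opp i j i<s j<s = trans (cong inv (trans (y-diff (opp s i) (opp s j)) (trans (eq (ρ i) (ρ (opp s i)) (ρ j) (ρ (opp s j))) (trans (cong₂ (λ a b → a - b - (ρ i - ρ j)) (sym-nodes i i<s) (sym-nodes j j<s))
          (trans (eq′ ω (ρ i - ρ j)) (cong -_ (sym (y-diff i j)))))))) (inv-neg (y i - y j))
        where
        eq : ∀ a a′ b b′ → a′ - b′ ≡ (a + a′) - (b + b′) - (a - b)
        eq = solve-∀ ℚ-ring
        eq′ : ∀ w d → w - w - d ≡ - d
        eq′ = solve-∀ ℚ-ring

      P⁺-opp : ∀ i → i ℕ.< s → P⁺ (opp s i) ≡ P⁻ i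
      P⁺-opp i i<s = trans (sym (Π-rev s (λ j → 1ℚ + inv (y (opp s i) - y j)))) (Π-cong s (λ j j<s → cong (1ℚ +_) (inv-opp i j i<s j<s)))

      P⁻-opp : ∀ i → i ℕ.< s → P⁻ (opp s i) ≡ P⁺ i
      P⁻-opp i i<s = trans (sym (Π-rev s (λ j → 1ℚ - inv (y (opp s i) - y j)))) (Π-cong s (λ j j<s → trans (cong (λ w → 1ℚ - w) (inv-opp i j i<s j<s)) (eq (inv (y i - y j)))))
        where
        eq : ∀ a → 1ℚ - - a ≡ 1ℚ + a
        eq = solve-∀ ℚ-ring

      -- At opposite nodes the two products of the Bethe equation change places. Multiplying the two
      -- equations and cancelling the products leaves the weights; the cancellation is legitimate
      -- because no two nodes differ by 1, by `spread`.
      BB≡DD : ∀ i → i ℕ.< s → B i * B (opp s i) ≡ D i * D (opp s i)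
      BB≡DD i i<s = *-cancel-≢0 (*-≢0 (P⁺≢0 i i<s) (P⁻≢0 i i<s)) (trans (eq (P⁺ i) (P⁻ i) (B i) (B (opp s i)))
        (trans (cong₂ _*_ (B-D i i<s) (trans (cong (B (opp s i) *_) (sym (P⁺-opp i i<s))) (trans (B-D (opp s i) (opp< i<s)) (cong (D (opp s i) *_) (P⁻-opp i i<s)))))
          (eq′ (P⁺ i) (P⁻ i) (D i) (D (opp s i)))))
        where
        eq : ∀ p m a b → p * m * (a * b) ≡ a * p * (b * m)
        eq = solve-∀ ℚ-ring
        eq′ : ∀ p m a b → a * m * (b * p) ≡ p * m * (a * b)
        eq′ = solve-∀ ℚ-ring

      zerosB zerosD : ℕ → ℚ
      zerosB 0 = K
      zerosB 1 = K - 1ℚ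
      zerosB 2 = ω - K
      zerosB _ = ω - (K - 1ℚ)
      zerosD 0 = 0ℚ
      zerosD 1 = ι 2 * K - V
      zerosD 2 = ω
      zerosD _ = ω + V - ι 2 * K

      -- The two quartics agree at five distinct nodes.
      identity : ∀ x → newton zerosB 4 x + - 1ℚ * newton zerosD 4 x ≡ 0ℚ
      identity = poly-vanish {r = ρ} (poly-+ {r = ρ} (poly-newton {r = ρ} 4 zerosB) (poly-*ˡ {r = ρ} (- 1ℚ) (poly-newton {r = ρ} 4 zerosD)))
        (λ i j i≤4 j<i e → ρ-≢ i j (<s i≤4) (ℕ.<-trans j<i (<s i≤4)) (λ { refl → ℕ.<-irrefl refl j<i }) (trans (cong (_- ρ j) e) (ℚ.+-inverseʳ (ρ j))))
        (λ i i≤4 → trans (cong₂ (λ a b → a + - 1ℚ * b)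
            (trans (eqB K (ρ i) ω) (cong (λ w → B i * ((K - w) * (K - 1ℚ - w))) (ω- i (<s i≤4))))
            (trans (eqD K V (ρ i) ω) (cong (λ w → D i * (w * (V - ι 2 * K + w))) (ω- i (<s i≤4)))))
          (trans (cong (λ a → a + - 1ℚ * (D i * D (opp s i))) (BB≡DD i (<s i≤4))) (eq (D i * D (opp s i)))))
        where
        <s : ∀ {i} → i ℕ.≤ 4 → i ℕ.< s
        <s i≤4 = ℕ.<-≤-trans (s≤s i≤4) 5≤s
        ω- : ∀ i → i ℕ.< s → ω - ρ i ≡ ρ (opp s i)
        ω- i i<s = trans (cong (_- ρ i) (sym (sym-nodes i i<s))) (eq₁ (ρ i) (ρ (opp s i)))
          where
          eq₁ : ∀ a b → a + b - a ≡ b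
          eq₁ = solve-∀ ℚ-ring
        eqB : ∀ K x w → 1ℚ * (x - K) * (x - (K - 1ℚ)) * (x - (w - K)) * (x - (w - (K - 1ℚ))) ≡ (K - x) * (K - 1ℚ - x) * ((K - (w - x)) * (K - 1ℚ - (w - x)))
        eqB = solve-∀ ℚ-ring
        eqD : ∀ K V x w → 1ℚ * (x - 0ℚ) * (x - (ι 2 * K - V)) * (x - w) * (x - (w + V - ι 2 * K)) ≡ x * (V - ι 2 * K + x) * ((w - x) * (V - ι 2 * K + (w - x)))
        eqD = solve-∀ ℚ-ring
        eq : ∀ d → d + - 1ℚ * d ≡ 0ℚ
        eq = solve-∀ ℚ-ring

      zero-product : ∀ a b → a * b ≡ 0ℚ → (a ≡ 0ℚ) ⊎ (b ≡ 0ℚ)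
      zero-product a b e with a ℚ.≟ 0ℚ
      ... | yes a≡0 = inj₁ a≡0
      ... | no  a≢0 = inj₂ (*-cancel-≢0 a≢0 (trans e (sym (ℚ.*-zeroʳ a))))

      zeroD : ∀ x → newton zerosB 4 x ≡ 0ℚ → x ≢ 0ℚ → x - (ι 2 * K - V) ≢ 0ℚ → (x - ω ≡ 0ℚ) ⊎ (x - (ω + V - ι 2 * K) ≡ 0ℚ)
      zeroD x e x≢0 x≢ = zero-product (x - ω) (x - (ω + V - ι 2 * K)) (*-cancel-≢0 (*-≢0 x≢0 x≢) (trans (eq₁ x (ι 2 * K - V) ω (ω + V - ι 2 * K) (newton zerosB 4 x))
        (trans (cong₂ (λ a b → a - b) e (identity x)) (sym (trans (ℚ.*-zeroʳ (x * (x - (ι 2 * K - V)))) refl)))))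
        where
        eq₁ : ∀ x a b c N → x * (x - a) * ((x - b) * (x - c)) ≡ N - (N + - 1ℚ * (1ℚ * (x - 0ℚ) * (x - a) * (x - b) * (x - c)))
        eq₁ = solve-∀ ℚ-ring

      0<K-1 : 0ℚ < K - 1ℚ
      0<K-1 = 0<- (0<⇒ι< {1} 2≤k)

      0<V-K-1 : 0ℚ < V - K - 1ℚ
      0<V-K-1 = subst (0ℚ <_) (eq V K) (0<- (0<⇒ι< 1+k<v))
        where
        eq : ∀ V K → V - (1ℚ + K) ≡ V - K - 1ℚ
        eq = solve-∀ ℚ-ring

      at-K : (K - ω ≡ 0ℚ) ⊎ (K - (ω + V - ι 2 * K) ≡ 0ℚ)
      at-K = zeroD K (Π-≡0 4 {λ j → K - zerosB j} 0 (s≤s z≤n) (ℚ.+-inverseʳ K)) (λ e → <⇒≢ (ℚ.<-≤-trans 0<1 1≤K) (sym e))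
        (λ e → <⇒≢ (ℚ.<-≤-trans 0<1 1≤V-K) (sym (trans (eq V K) e)))
        where
        eq : ∀ V K → V - K ≡ K - (ι 2 * K - V)
        eq = solve-∀ ℚ-ring

      at-K-1 : (K - 1ℚ - ω ≡ 0ℚ) ⊎ (K - 1ℚ - (ω + V - ι 2 * K) ≡ 0ℚ)
      at-K-1 = zeroD (K - 1ℚ) (Π-≡0 4 {λ j → K - 1ℚ - zerosB j} 1 (s≤s (s≤s z≤n)) (ℚ.+-inverseʳ (K - 1ℚ))) (λ e → <⇒≢ 0<K-1 (sym e))
        (λ e → <⇒≢ 0<V-K-1 (sym (trans (eq V K) e)))
        where
        eq : ∀ V K → V - K - 1ℚ ≡ K - 1ℚ - (ι 2 * K - V)
        eq = solve-∀ ℚ-ring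

      clash : ∀ c → K - c ≡ 0ℚ → K - 1ℚ - c ≡ 0ℚ → ⊥
      clash c e e′ = <⇒≢ 0<1 (sym (trans (eq K c) (cong₂ _-_ e e′)))
        where
        eq : ∀ K c → 1ℚ ≡ K - c - (K - 1ℚ - c)
        eq = solve-∀ ℚ-ring

    -- K and K - 1 are zeros of the quartic formed from B. By 2 ≤ k and k + 1 < v they are neither 0
    -- nor 2 K - V, so they are the other two zeros ω and ω + V - 2 K of the quartic formed from D,
    -- in some order.
    balanced-parameters : (V - ι 2 * K) * (V - ι 2 * K) ≡ 1ℚ
    balanced-parameters = combine at-K at-K-1
      where
      combine : (K - ω ≡ 0ℚ) ⊎ (K - (ω + V - ι 2 * K) ≡ 0ℚ) → (K - 1ℚ - ω ≡ 0ℚ) ⊎ (K - 1ℚ - (ω + V - ι 2 * K) ≡ 0ℚ) → (V - ι 2 * K) * (V - ι 2 * K) ≡ 1ℚ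
      combine (inj₁ e) (inj₁ e′) = ⊥-elim (clash ω e e′)
      combine (inj₂ e) (inj₂ e′) = ⊥-elim (clash (ω + V - ι 2 * K) e e′)
      combine (inj₁ e) (inj₂ e′) = trans (eq V K ω) (cong₂ (λ a b → (a - b - 1ℚ) * (a - b - 1ℚ)) e e′)
        where
        eq : ∀ V K w → (V - ι 2 * K) * (V - ι 2 * K) ≡ (K - w - (K - 1ℚ - (w + V - ι 2 * K)) - 1ℚ) * (K - w - (K - 1ℚ - (w + V - ι 2 * K)) - 1ℚ)
        eq = solve-∀ ℚ-ring
      combine (inj₂ e) (inj₁ e′) = trans (eq V K ω) (cong₂ (λ a b → (b - a + 1ℚ) * (b - a + 1ℚ)) e e′)
        where
        eq : ∀ V K w → (V - ι 2 * K) * (V - ι 2 * K) ≡ (K - 1ℚ - w - (K - (w + V - ι 2 * K)) + 1ℚ) * (K - 1ℚ - w - (K - (w + V - ι 2 * K)) + 1ℚ)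
        eq = solve-∀ ℚ-ring

-- A bound for the variance when |v - 2k| > 1

∃-ι-upper : ∀ p → ∃ λ n → p ≤ ι n
∃-ι-upper p = ℤ.∣ ℚ.↥ p ∣ , ℚ.≤-trans (x≤∣x∣ p) (bound p)
  where
  ι-toℚᵘ : ∀ n → ℚ.toℚᵘ (ι n) ℚᵘ.≃ ℚᵘ.mkℚᵘ (ℤ.+ n) 0
  ι-toℚᵘ zero    = ℚᵘ.≃-refl
  ι-toℚᵘ (suc n) = ℚᵘ.≃-trans (ℚ.toℚᵘ-homo-+ 1ℚ (ι n)) (ℚᵘ.≃-trans (ℚᵘ.+-congʳ (ℚ.toℚᵘ 1ℚ) (ι-toℚᵘ n))
    (ℚᵘ.*≡* (cong (ℤ._* ℤ.+ 1) (eq (ℤ.+ n)))))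
    where
    eq : ∀ n → ℤ.+ 1 ℤ.* ℤ.+ 1 ℤ.+ n ℤ.* ℤ.+ 1 ≡ ℤ.+ 1 ℤ.+ n
    eq = ℤ-Solver.solve-∀
  bound : ∀ p → ∣ p ∣ ≤ ι ℤ.∣ ℚ.↥ p ∣
  bound (ℚ.mkℚ a d _) = ℚ.toℚᵘ-cancel-≤ (ℚᵘ.≤-trans
    (ℚᵘ.*≤* (ℤ.*-monoˡ-≤-nonNeg (ℤ.+ ℤ.∣ a ∣) (ℤ.+≤+ (s≤s (z≤n {d})))))
    (ℚᵘ.≤-reflexive (ℚᵘ.≃-sym (ι-toℚᵘ ℤ.∣ a ∣))))

unbalanced-bounded : ∀ s → 5 ℕ.≤ s → ∃ λ T → ∀ {v k} (nodes : NodeData v k s) → 2 ℕ.≤ k → suc k ℕ.< v →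
  1ℚ < (ι v - ι 2 * ι k) * (ι v - ι 2 * ι k) → T ≤ FromNodes.variance nodes → ⊥
unbalanced-bounded s 5≤s = T , contradictory
  where
  Kʳ Kᵍ T₀ T : ℚ
  Kʳ = proj₁ (rigidity s 5≤s)
  Kᵍ = gapConst s s
  -- R has to reach the threshold of rigidity, and to exceed the constant of the gap estimate R ≤ Kᵍ
  -- d, so that the nodes are more than 1 apart. The variance bound T is (1 + T₀)² because R is an
  -- integer part.
  T₀ = ∣ Kʳ ∣ + (Kᵍ + 1ℚ)
  T  = (1ℚ + T₀) * (1ℚ + T₀)
  0≤Kᵍ = 0≤gapConst s s
  contradictory : ∀ {v k} (nodes : NodeData v k s) → 2 ℕ.≤ k → suc k ℕ.< v →
    1ℚ < (ι v - ι 2 * ι k) * (ι v - ι 2 * ι k) → T ≤ FromNodes.variance nodes → ⊥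
  contradictory {v} {k} nodes 2≤k 1+k<v unbalanced T≤V = <⇒≢ unbalanced
    (sym (FromNodes.Symmetric.balanced-parameters nodes 5≤s 2≤k 1+k<v (ρ 0 + ρ (opp s 0)) nodes-symmetric spread))
    where
    open FromNodes nodes using (ρ; y; variance; 0≤variance; variance≤S; skewness; config; y-diff; c₀; z)
    root = isqrt v variance 0≤variance (ℚ.≤-<-trans variance≤S (<-by (0<+ 0<1 (0≤+ 0≤1 (0≤+ (0≤ι v) (0≤² (ι v))))) (eq (ι v))))
      where
      eq : ∀ v → (1ℚ + v) * (1ℚ + v) ≡ v - 1ℚ + (1ℚ + (1ℚ + (v + v * v)))
      eq = solve-∀ ℚ-ring
    n  = proj₁ root
    lo = proj₁ (proj₂ root)
    hi = proj₂ (proj₂ root)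
    0≤T₀ : 0ℚ ≤ T₀
    0≤T₀ = 0≤+ (ℚ.0≤∣p∣ Kʳ) (0≤+ 0≤Kᵍ 0≤1)
    T₀≤n : T₀ ≤ ι n
    T₀≤n = ℚ.≮⇒≥ (λ n<T₀ → ≤⇒≯ (ℚ.≤-trans (*-mono (0≤ι (suc n)) (0≤+ 0≤1 0≤T₀) (ℚ.+-monoʳ-≤ 1ℚ (ℚ.<⇒≤ n<T₀)) (ℚ.+-monoʳ-≤ 1ℚ (ℚ.<⇒≤ n<T₀))) T≤V) hi)
    Kᵍ+1≤n : Kᵍ + 1ℚ ≤ ι n
    Kᵍ+1≤n = ℚ.≤-trans (≤-by (ℚ.0≤∣p∣ Kʳ) (ℚ.+-comm ∣ Kʳ ∣ (Kᵍ + 1ℚ))) T₀≤n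
    1≤n : 1 ℕ.≤ n
    1≤n = ι-cancel-≤ {1} {n} (ℚ.≤-trans (≤-by 0≤Kᵍ (ℚ.+-comm Kᵍ 1ℚ)) Kᵍ+1≤n)
    c : Config s
    c = config n 1≤n lo hi
    Kʳ≤R : Kʳ ≤ Config.R c
    Kʳ≤R = ℚ.≤-trans (x≤∣x∣ Kʳ) (ℚ.≤-trans (≤-by (0≤+ 0≤Kᵍ 0≤1) refl) T₀≤n)
    0≤lam : 0ℚ ≤ Config.lam c
    0≤lam = 0≤* (0≤- (ℚ.<⇒≤ unbalanced)) (0≤² z)
    r = NodeData.r nodes
    W-sum : ∀ i → y i + y (opp s i) ≡ ρ i + ρ (opp s i) - ι 2 * c₀
    W-sum i = eq (ρ i) (ρ (opp s i)) c₀
      where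
      eq : ∀ a b c → a - c + (b - c) ≡ a + b - ι 2 * c
      eq = solve-∀ ℚ-ring
    integral : ∀ i j → i ℕ.< s → j ℕ.< s → ∃ λ a → ∃ λ b → y i + y (opp s i) - (y j + y (opp s j)) ≡ ι a - ι b
    integral i j _ _ = r i ℕ.+ r (opp s i) , r j ℕ.+ r (opp s j) , trans (cong₂ _-_ (W-sum i) (W-sum j))
      (trans (eq (ρ i + ρ (opp s i)) (ρ j + ρ (opp s j)) (ι 2 * c₀)) (sym (cong₂ _-_ (ι-+ (r i) (r (opp s i))) (ι-+ (r j) (r (opp s j))))))
      where
      eq : ∀ a b c → a - c - (b - c) ≡ a - b
      eq = solve-∀ ℚ-ring
    0<s : 0 ℕ.< s
    0<s = ℕ.≤-trans (s≤s z≤n) 5≤s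
    nodes-symmetric : ∀ i → i ℕ.< s → ρ i + ρ (opp s i) ≡ ρ 0 + ρ (opp s 0)
    nodes-symmetric i i<s = trans (eq (ρ i + ρ (opp s i)) (ι 2 * c₀)) (trans (cong (_+ ι 2 * c₀) (trans (sym (W-sum i)) (trans (proj₂ (rigidity s 5≤s) c Kʳ≤R 0≤lam integral i 0 i<s 0<s) (W-sum 0))))
      (sym (eq (ρ 0 + ρ (opp s 0)) (ι 2 * c₀))))
      where
      eq : ∀ a c → a ≡ a - c + c
      eq = solve-∀ ℚ-ring
    spread : ∀ i j → i ℕ.< j → j ℕ.< s → 1ℚ < ρ j - ρ i
    spread i j i<j j<s = ℚ.≰⇒> (λ d≤1 → ≤⇒≯ (ℚ.≤-trans Kᵍ+1≤n (ℚ.≤-trans (Gap.gap c (ℚ.≤-trans (≤-by 0≤1 refl) Kᵍ+1≤n) i j i<j j<s)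
      (≡≤ (cong (Kᵍ *_) (y-diff j i)) (≤≡ (*-monoˡ 0≤Kᵍ d≤1) (ℚ.*-identityʳ Kᵍ))))) (<-by 0<1 refl))

-- Parameters with v close to 2k

ff-P′ : ∀ n k → k ℕ.≤ n → ff (ι n) k ≡ ι (n P′ k)
ff-P′ n zero    _   = refl
ff-P′ n (suc k) k<n = trans (cong₂ _*_ (ff-P′ n k (ℕ.<⇒≤ k<n)) (sym (ι-∸ (ℕ.<⇒≤ k<n)))) (trans (ℚ.*-comm (ι (n P′ k)) (ι (n ℕ.∸ k))) (sym (ι-* (n ℕ.∸ k) (n P′ k))))

ff-factorial : ∀ n k → k ℕ.≤ n → ff (ι n) k * ι ((n ℕ.∸ k) !) ≡ ι (n !)
ff-factorial n zero    _   = ℚ.*-identityˡ (ι (n !))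
ff-factorial n (suc k) k<n = trans (ℚ.*-assoc (ff (ι n) k) (ι n - ι k) (ι ((n ℕ.∸ suc k) !))) (trans (cong (ff (ι n) k *_)
    (trans (cong (_* ι ((n ℕ.∸ suc k) !)) (trans (sym (ι-∸ (ℕ.<⇒≤ k<n))) (cong ι n∸k))) (trans (sym (ι-* (suc (n ℕ.∸ suc k)) ((n ℕ.∸ suc k) !))) (cong (λ m → ι (m !)) (sym n∸k)))))
  (ff-factorial n k (ℕ.<⇒≤ k<n)))
  where
  n∸k : n ℕ.∸ k ≡ suc (n ℕ.∸ suc k)
  n∸k = ℕ.+-∸-assoc 1 k<n

choose : ∀ v s → s ℕ.≤ v → ι (v ℕ.C s) * ff (ι s) s ≡ ff (ι v) s
choose v s s≤v = *-cancel-≢0 {c = ι ((v ℕ.∸ s) !)} (λ e → <⇒≢ (0<⇒ι< {0} (ℕ.1≤n! (v ℕ.∸ s))) (sym e)) (begin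
  ι ((v ℕ.∸ s) !) * (ι (v ℕ.C s) * ff (ι s) s)   ≡⟨ cong (λ x → ι ((v ℕ.∸ s) !) * (ι (v ℕ.C s) * x)) (ff-! s) ⟩
  ι ((v ℕ.∸ s) !) * (ι (v ℕ.C s) * ι (s !))      ≡⟨ eq (ι ((v ℕ.∸ s) !)) (ι (v ℕ.C s)) (ι (s !)) ⟩
  ι (v ℕ.C s) * (ι (s !) * ι ((v ℕ.∸ s) !))      ≡⟨ cong (ι (v ℕ.C s) *_) (ι-* (s !) ((v ℕ.∸ s) !)) ⟨
  ι (v ℕ.C s) * ι (s ! ℕ.* (v ℕ.∸ s) !)          ≡⟨ ι-* (v ℕ.C s) (s ! ℕ.* (v ℕ.∸ s) !) ⟨
  ι ((v ℕ.C s) ℕ.* (s ! ℕ.* (v ℕ.∸ s) !))          ≡⟨ cong ι (trans (cong (ℕ._* (s ! ℕ.* (v ℕ.∸ s) !)) (nCk≡n!/k![n-k]! s≤v)) (m/n*n≡m {{s ℕ.!* (v ℕ.∸ s) !≢0}} (k![n∸k]!∣n! s≤v))) ⟩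
  ι (v !)                                      ≡⟨ trans (ℚ.*-comm (ι ((v ℕ.∸ s) !)) (ff (ι v) s)) (ff-factorial v s s≤v) ⟨
  ι ((v ℕ.∸ s) !) * ff (ι v) s                 ∎)
  where
  open ≡-Reasoning
  eq : ∀ a c s → a * (c * s) ≡ c * (s * a)
  eq = solve-∀ ℚ-ring

-- Doubling every factor k - l avoids the inverse of 2 modulo q: 2 (k - l) is congruent to e - 2 l.
module Residue (q e k : ℤ.ℤ) (2k≡q+e : ℤ.+ 2 ℤ.* k ≡ q ℤ.+ e) where

  twice reduced : ℕ → ℤ.ℤ
  twice zero      = ℤ.+ 1
  twice (suc n)   = twice n ℤ.* (ℤ.+ 2 ℤ.* (k ℤ.- ℤ.+ n))
  reduced zero    = ℤ.+ 1
  reduced (suc n) = reduced n ℤ.* (e ℤ.- ℤ.+ 2 ℤ.* ℤ.+ n)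

  congruent : ∀ n → ∃ λ t → twice n ≡ reduced n ℤ.+ t ℤ.* q
  congruent zero    = ℤ.+ 0 , refl
  congruent (suc n) = let (t , h) = congruent n in twice n ℤ.+ t ℤ.* (e ℤ.- ℤ.+ 2 ℤ.* ℤ.+ n) ,
    trans (cong (twice n ℤ.*_) (trans (eq₁ k (ℤ.+ n)) (cong (ℤ._- ℤ.+ 2 ℤ.* ℤ.+ n) 2k≡q+e)))
      (trans (eq₂ (twice n) q e (ℤ.+ 2 ℤ.* ℤ.+ n)) (trans (cong (λ x → twice n ℤ.* q ℤ.+ x ℤ.* (e ℤ.- ℤ.+ 2 ℤ.* ℤ.+ n)) h) (eq₃ (twice n) q (reduced n) t (e ℤ.- ℤ.+ 2 ℤ.* ℤ.+ n))))
    where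
    eq₁ : ∀ k n → ℤ.+ 2 ℤ.* (k ℤ.- n) ≡ ℤ.+ 2 ℤ.* k ℤ.- ℤ.+ 2 ℤ.* n
    eq₁ = ℤ-Solver.solve-∀
    eq₂ : ∀ a q e n → a ℤ.* (q ℤ.+ e ℤ.- n) ≡ a ℤ.* q ℤ.+ a ℤ.* (e ℤ.- n)
    eq₂ = ℤ-Solver.solve-∀
    eq₃ : ∀ a q r t e → a ℤ.* q ℤ.+ (r ℤ.+ t ℤ.* q) ℤ.* e ≡ r ℤ.* e ℤ.+ (a ℤ.+ t ℤ.* e) ℤ.* q
    eq₃ = ℤ-Solver.solve-∀

oddProduct : ℕ → ℕ → ℤ.ℤ
oddProduct e zero    = ℤ.+ 1
oddProduct e (suc n) = oddProduct e n ℤ.* (ℤ.+ e ℤ.- ℤ.+ 2 ℤ.* ℤ.+ n)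

module _ (q e k : ℕ) (2k≡q+e : 2 ℕ.* k ≡ q ℕ.+ e) where
  open Residue (ℤ.+ q) (ℤ.+ e) (ℤ.+ k) (trans (sym (ℤ.pos-* 2 k)) (trans (cong ℤ.+_ 2k≡q+e) (ℤ.pos-+ q e)))

  reduced≡ : ∀ n → reduced n ≡ oddProduct e n
  reduced≡ zero    = refl
  reduced≡ (suc n) = cong (ℤ._* (ℤ.+ e ℤ.- ℤ.+ 2 ℤ.* ℤ.+ n)) (reduced≡ n)

  twice-P′ : ∀ n → n ℕ.≤ k → ∃ λ u → twice n ≡ u ℤ.* ℤ.+ (k P′ n)
  twice-P′ zero    _   = ℤ.+ 1 , refl
  twice-P′ (suc n) n<k = let (u , h) = twice-P′ n (ℕ.<⇒≤ n<k) in ℤ.+ 2 ℤ.* u ,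
    trans (cong₂ (λ a b → a ℤ.* (ℤ.+ 2 ℤ.* b)) h (trans (ℤ.m-n≡m⊖n k n) (ℤ.⊖-≥ (ℕ.<⇒≤ n<k)))) (trans (eq u (ℤ.+ (k P′ n)) (ℤ.+ (k ℕ.∸ n))) (cong (ℤ.+ 2 ℤ.* u ℤ.*_) (sym (ℤ.pos-* (k ℕ.∸ n) (k P′ n)))))
    where
    eq : ∀ u p m → u ℤ.* p ℤ.* (ℤ.+ 2 ℤ.* m) ≡ ℤ.+ 2 ℤ.* u ℤ.* (m ℤ.* p)
    eq = ℤ-Solver.solve-∀

  -- modulo q each factor k - l is half of e - 2 l, and these are odd
  divides-oddProduct : ∀ n → n ℕ.≤ k → q ∣ k P′ n → q ∣ ℤ.∣ oddProduct e n ∣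
  divides-oddProduct n n≤k (divides c eqc) =
    let (t , h) = congruent n ; (u , h′) = twice-P′ n n≤k in
    divides ℤ.∣ u ℤ.* ℤ.+ c ℤ.- t ∣ (trans (cong ℤ.∣_∣ (trans (sym (reduced≡ n)) (trans (eq₁ (reduced n) t (ℤ.+ q)) (trans (cong (ℤ._- t ℤ.* ℤ.+ q) (trans (sym h) (trans h′ (cong (u ℤ.*_) (trans (cong ℤ.+_ eqc) (ℤ.pos-* c q))))))
      (eq₂ u (ℤ.+ c) (ℤ.+ q) t))))) (ℤ.abs-* (u ℤ.* ℤ.+ c ℤ.- t) (ℤ.+ q)))
    where
    eq₁ : ∀ r t q → r ≡ r ℤ.+ t ℤ.* q ℤ.- t ℤ.* q
    eq₁ = ℤ-Solver.solve-∀
    eq₂ : ∀ u c q t → u ℤ.* (c ℤ.* q) ℤ.- t ℤ.* q ≡ (u ℤ.* c ℤ.- t) ℤ.* q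
    eq₂ = ℤ-Solver.solve-∀

odd≢even : ∀ a b → a ℕ.+ suc a ≢ b ℕ.+ b
odd≢even zero    (suc b) e = contradiction (trans (ℕ.suc-injective e) (ℕ.+-suc b b)) (λ ())
odd≢even (suc a) (suc b) e = odd≢even a b (ℕ.suc-injective (trans (sym (ℕ.+-suc a (suc a))) (trans (ℕ.suc-injective e) (ℕ.+-suc b b))))

oddProduct≢0 : ∀ e n → (∀ l → e ≢ 2 ℕ.* l) → ℤ.∣ oddProduct e n ∣ ≢ 0
oddProduct≢0 e zero    _   ()
oddProduct≢0 e (suc n) odd h = [ oddProduct≢0 e n odd , (λ h′ → odd n (ℤ.+-injective (trans (ℤ.i-j≡0⇒i≡j (ℤ.+ e) (ℤ.+ 2 ℤ.* ℤ.+ n) (ℤ.∣i∣≡0⇒i≡0 h′)) (sym (ℤ.pos-* 2 n))))) ]′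
  (ℕ.m*n≡0⇒m≡0∨n≡0 ℤ.∣ oddProduct e n ∣ (trans (sym (ℤ.abs-* (oddProduct e n) (ℤ.+ e ℤ.- ℤ.+ 2 ℤ.* ℤ.+ n))) h))

P′-factor : ∀ n k i → i ℕ.< k → (n ℕ.∸ i) ∣ n P′ k
P′-factor n (suc k) i i<1+k with ℕ.m<1+n⇒m<n∨m≡n i<1+k
... | inj₁ i<k  = ∣-trans (P′-factor n k i i<k) (n∣m*n (n ℕ.∸ k))
... | inj₂ refl = m∣m*n (n P′ k)

-- The odd number e = 2 k - q depends on the design but stays below s + 3. Summing over all
-- candidates gives a bound in terms of s alone.
oddBound : ℕ → ℕ → ℕ
oddBound zero    n = 0
oddBound (suc e) n = ℤ.∣ oddProduct e n ∣ ℕ.+ oddBound e n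

oddBound-≥ : ∀ {e m} n → e ℕ.< m → ℤ.∣ oddProduct e n ∣ ℕ.≤ oddBound m n
oddBound-≥ {e} {suc m} n e<1+m with ℕ.m<1+n⇒m<n∨m≡n e<1+m
... | inj₁ e<m  = ℕ.≤-trans (oddBound-≥ n e<m) (ℕ.m≤n+m (oddBound m n) ℤ.∣ oddProduct m n ∣)
... | inj₂ refl = ℕ.m≤m+n ℤ.∣ oddProduct m n ∣ (oddBound m n)

-- One of v - s and v - s - 1 is odd; it divides the falling factorial of k,
-- and it is 2k up to a bounded odd number.
balanced-bounded : ∀ s v k → 2 ℕ.≤ s → s ℕ.+ s ℕ.≤ k → v ℕ.≤ 2 ℕ.* k ℕ.+ 1 → 2 ℕ.* k ℕ.≤ v ℕ.+ 1 →
  (∀ i → i ℕ.< s → (v ℕ.∸ s ℕ.∸ i) ∣ k P′ (s ℕ.+ s)) → v ℕ.≤ oddBound (s ℕ.+ 3) (s ℕ.+ s) ℕ.+ (s ℕ.+ 1)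
balanced-bounded s v k 2≤s 2s≤k v≤ ≤v div with halve (v ℕ.∸ s)
... | m , parity = [ even-case m , odd-case ]′ parity
  where
  s≤v : s ℕ.≤ v
  s≤v = ℕ.+-cancelʳ-≤ 1 s v (ℕ.≤-trans (ℕ.+-mono-≤ (ℕ.m≤m+n s s) (ℕ.≤-trans (ℕ.≤-trans (ℕ.<⇒≤ 2≤s) (ℕ.m≤m+n s s)) 2s≤k)) (ℕ.≤-trans (ℕ.+-mono-≤ 2s≤k (ℕ.m≤m+n k 0)) ≤v))
  core : ∀ i j → i ℕ.≤ 1 → v ℕ.∸ s ≡ (j ℕ.+ suc j) ℕ.+ i → v ℕ.≤ oddBound (s ℕ.+ 3) (s ℕ.+ s) ℕ.+ (s ℕ.+ 1)
  core i j i≤1 e = ℕ.≤-trans (ℕ.≤-reflexive v≡) (ℕ.≤-trans (ℕ.+-mono-≤ q≤ (ℕ.+-monoʳ-≤ s i≤1)) ℕ.≤-refl)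
    where
    q = j ℕ.+ suc j
    v≡ : v ≡ q ℕ.+ (s ℕ.+ i)
    v≡ = trans (sym (ℕ.m∸n+n≡m s≤v)) (trans (cong (ℕ._+ s) e) (trans (ℕ.+-assoc q i s) (cong (q ℕ.+_) (ℕ.+-comm i s))))
    q≤2k : q ℕ.≤ 2 ℕ.* k
    q≤2k = ℕ.+-cancelʳ-≤ 1 q (2 ℕ.* k) (ℕ.≤-trans (ℕ.+-monoʳ-≤ q (ℕ.≤-trans (ℕ.<⇒≤ 2≤s) (ℕ.m≤m+n s i))) (ℕ.≤-trans (ℕ.≤-reflexive (sym v≡)) v≤))
    ε = 2 ℕ.* k ℕ.∸ q
    2k≡ : 2 ℕ.* k ≡ q ℕ.+ ε
    2k≡ = sym (ℕ.m+[n∸m]≡n q≤2k)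
    -- From 2 k ≤ v + 1 = q + s + i + 1 and i ≤ 1.
    ε< : ε ℕ.< s ℕ.+ 3
    ε< = ℕ.≤-trans (s≤s (ℕ.m≤n+o⇒m∸n≤o (2 ℕ.* k) q (ℕ.≤-trans ≤v (ℕ.≤-reflexive (trans (cong (ℕ._+ 1) v≡) (ℕ.+-assoc q (s ℕ.+ i) 1))))))
      (ℕ.≤-trans (s≤s (ℕ.+-monoˡ-≤ 1 (ℕ.+-monoʳ-≤ s i≤1))) (ℕ.≤-reflexive (eq s)))
      where
      eq : ∀ s → suc (s ℕ.+ 1 ℕ.+ 1) ≡ s ℕ.+ 3
      eq s = trans (cong suc (ℕ.+-assoc s 1 1)) (sym (ℕ.+-suc s 2))
    odd : ∀ l → ε ≢ 2 ℕ.* l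
    odd l ε≡ = even≢ (l ℕ.+ j) k (trans (eq j l) (sym (trans 2k≡ (cong (q ℕ.+_) ε≡))))
      where
      even≢ : ∀ a k → a ℕ.+ suc a ≢ 2 ℕ.* k
      even≢ a k h = odd≢even a k (trans h (cong (k ℕ.+_) (ℕ.+-identityʳ k)))
      eq : ∀ j l → l ℕ.+ j ℕ.+ suc (l ℕ.+ j) ≡ j ℕ.+ suc j ℕ.+ 2 ℕ.* l
      eq = ℕ-Solver.solve-∀
    v∸s∸i : v ℕ.∸ s ℕ.∸ i ≡ q
    v∸s∸i = trans (cong (ℕ._∸ i) e) (ℕ.m+n∸n≡m q i)
    q∣ : q ∣ ℤ.∣ oddProduct ε (s ℕ.+ s) ∣
    q∣ = divides-oddProduct q ε k 2k≡ (s ℕ.+ s) 2s≤k (subst (_∣ k P′ (s ℕ.+ s)) v∸s∸i (div i (ℕ.≤-<-trans i≤1 2≤s)))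
    q≤ : q ℕ.≤ oddBound (s ℕ.+ 3) (s ℕ.+ s)
    q≤ = ℕ.≤-trans (∣⇒≤ {{ℕ.≢-nonZero (oddProduct≢0 ε (s ℕ.+ s) odd)}} q∣) (oddBound-≥ (s ℕ.+ s) ε<)
  odd-case : v ℕ.∸ s ≡ m ℕ.+ suc m → v ℕ.≤ oddBound (s ℕ.+ 3) (s ℕ.+ s) ℕ.+ (s ℕ.+ 1)
  odd-case e = core 0 m z≤n (trans e (sym (ℕ.+-identityʳ (m ℕ.+ suc m))))
  even-case : ∀ m → v ℕ.∸ s ≡ m ℕ.+ m → v ℕ.≤ oddBound (s ℕ.+ 3) (s ℕ.+ s) ℕ.+ (s ℕ.+ 1)
  even-case zero    e = ℕ.≤-trans (ℕ.m∸n≡0⇒m≤n e) (ℕ.≤-trans (ℕ.m≤m+n s 1) (ℕ.m≤n+m (s ℕ.+ 1) (oddBound (s ℕ.+ 3) (s ℕ.+ s))))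
  even-case (suc j) e = core 1 j (s≤s z≤n) (trans e (sym (ℕ.+-comm (j ℕ.+ suc j) 1)))

-- Tight designs with large variance

sumOver-1 : ∀ {A : Set} (xs : List A) → sumOver xs (λ _ → 1ℚ) ≡ ι (length xs)
sumOver-1 []       = refl
sumOver-1 (_ ∷ xs) = cong (1ℚ +_) (sumOver-1 xs)

module TightDesign {s v k lam : ℕ} {B₀ : Subset v} {ℬ : List (Subset v)} (design : IsDesign (s ℕ.+ s) v k lam (B₀ ∷ ℬ))
  (k+s≤v : k ℕ.+ s ℕ.≤ v) (size : length (B₀ ∷ ℬ) ≡ v ℕ.C s) (1≤s : 1 ℕ.≤ s) where

  open IsDesign design using (blockSize) renaming (t≤k to 2s≤k)
  open Counting design

  private
    B₀-size : card B₀ ≡ k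
    B₀-size = blockSize (here refl)

    s≤v : s ℕ.≤ v
    s≤v = ℕ.≤-trans (ℕ.m≤n+m s k) k+s≤v

    2s≤v : s ℕ.+ s ℕ.≤ v
    2s≤v = ℕ.≤-trans 2s≤k (ℕ.≤-trans (ℕ.m≤m+n k s) k+s≤v)

    n : Subset v → ℕ
    n B = card (B₀ ∩ B)

    b : ℚ
    b = sumOver (B₀ ∷ ℬ) (λ B → ff (ι (n B)) 0)

    tight : b * ff (ι s) s ≡ ff (ι v) s
    tight = trans (cong (_* ff (ι s) s) (trans (sumOver-1 (B₀ ∷ ℬ)) (cong ι size))) (choose v s s≤v)

    open module Intersections = Nodes B₀ ℬ n v k s 1≤s 2s≤k k+s≤v (trans (cong card (∩-idem B₀)) B₀-size)
      (λ _ → inter-≤ B₀ B₀-size) (moment-step B₀ B₀-size) tight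
      using (r; len≡s; increasing; bounded; sound; bethe-node)

    <len : ∀ {i} → i ℕ.< s → i ℕ.< Intersections.len
    <len = subst (_ ℕ.<_) (sym len≡s)

  nodes : ∀ L → s ≡ suc L → NodeData v k s
  nodes L s≡1+L = record
    { r = r ; L = L ; s≡1+L = s≡1+L
    ; 1≤k = ℕ.≤-trans 1≤s (ℕ.≤-trans (ℕ.m≤m+n s s) 2s≤k)
    ; k<v = ℕ.<-≤-trans (ℕ.m<m+n k 1≤s) k+s≤v
    ; increasing = λ i j i<j j<s → increasing i j i<j (<len j<s)
    ; bounded = λ i i<s → bounded i (<len i<s)
    ; 0≤D = λ i i<s → let (B , B∈ℬ , e) = find (sound i (<len i<s)) in
        subst (λ m → 0ℚ ≤ ι v - ι 2 * ι k + ι m) e (0≤v-2k+inter B₀ B₀-size (there B∈ℬ))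
    ; node-eq = λ i i<s → bethe-node L (trans len≡s s≡1+L) i (<len i<s)
    }

  -- The moment of order 2 s is known in two ways, through λ and through the closed form. With the
  -- number of blocks inserted, this becomes λ s! (v - s) ⋯ (v - 2s + 1) = k (k - 1) ⋯ (k - 2s + 1).
  divisibility : ∀ i → i ℕ.< s → (v ℕ.∸ s ℕ.∸ i) ∣ k P′ (s ℕ.+ s)
  divisibility i i<s = ∣-trans (P′-factor (v ℕ.∸ s) s i i<s) (divides (lam ℕ.* (s P′ s)) (ι-injective (sym (begin
    ι (lam ℕ.* (s P′ s) ℕ.* ((v ℕ.∸ s) P′ s))
      ≡⟨ trans (ι-* (lam ℕ.* (s P′ s)) ((v ℕ.∸ s) P′ s)) (cong (_* ι ((v ℕ.∸ s) P′ s)) (ι-* lam (s P′ s))) ⟩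
    ι lam * ι (s P′ s) * ι ((v ℕ.∸ s) P′ s)
      ≡⟨ cong₂ (λ x y → ι lam * x * y) (sym (ff-P′ s s ℕ.≤-refl)) (trans (sym (ff-P′ (v ℕ.∸ s) s (ℕ.m+n≤o⇒m≤o∸n s 2s≤v))) (cong (λ x → ff x s) (ι-∸ s≤v))) ⟩
    ι lam * ff (ι s) s * W
      ≡⟨ *-cancel-≢0 {c = ff (ι v) s} ffVs≢0 ratio ⟩
    ff (ι k) (s ℕ.+ s)
      ≡⟨ ff-P′ k (s ℕ.+ s) 2s≤k ⟩
    ι (k P′ (s ℕ.+ s)) ∎))))
    where
    open ≡-Reasoning
    W F : ℚ
    W = ff (ι v - ι s) s
    F = ff (ι k) (s ℕ.+ s)
    ffVs≢0 : ff (ι v) s ≢ 0ℚ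
    ffVs≢0 e = <⇒≢ (ff-0< s s≤v) (sym e)
    F≢0 : F ≢ 0ℚ
    F≢0 e = <⇒≢ (ff-0< (s ℕ.+ s) 2s≤k) (sym e)
    top : ff (ι v) s * W * (F * ι lam) ≡ b * (F * F)
    top = trans (cong₂ _*_ (sym (ff-+ (ι v) s s)) (sym (moment-top B₀ B₀-size)))
      (Moments.M-closed (B₀ ∷ ℬ) (ι ∘ n) v k (s ℕ.+ s) (moment-step B₀ B₀-size) (s ℕ.+ s) ℕ.≤-refl)
    ratio : ff (ι v) s * (ι lam * ff (ι s) s * W) ≡ ff (ι v) s * F
    ratio = *-cancel-≢0 {c = F} F≢0 (trans (eq₁ F (ff (ι v) s) (ι lam) (ff (ι s) s) W) (trans (cong (_* ff (ι s) s) top)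
      (trans (eq₂ b F (ff (ι s) s)) (cong (λ x → F * (x * F)) tight))))
      where
      eq₁ : ∀ F V l σ W → F * (V * (l * σ * W)) ≡ V * W * (F * l) * σ
      eq₁ = solve-∀ ℚ-ring
      eq₂ : ∀ b F σ → b * (F * F) * σ ≡ F * (b * σ * F)
      eq₂ = solve-∀ ℚ-ring

variance-S³ : ∀ {v k s} (nodes : NodeData v k s) → FromNodes.variance nodes * ((ι v - 1ℚ) * (ι v - 1ℚ) * (ι v - 1ℚ)) ≡
  ι k * (ι k - 1ℚ) * ((ι v - ι k) * (ι v - ι k - 1ℚ))
variance-S³ nodes = trans (eq c₀ c₁ z S) (trans (cong (c₀ * S * (c₁ * S) *_) Sz≡1) (trans (ℚ.*-identityʳ (c₀ * S * (c₁ * S))) (cong₂ _*_ c₀S c₁S)))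
  where
  open FromNodes nodes
  eq : ∀ c d z S → c * d * z * (S * S * S) ≡ c * S * (d * S) * (S * z)
  eq = solve-∀ ℚ-ring

-- S = v - 1 is at most 2s (v - 2s + 1), so β² is at most (2s)³ times the variance.
variance-lower : ∀ {v k s} (nodes : NodeData v k s) N → 1 ℕ.≤ s → s ℕ.+ s ℕ.≤ k → k ℕ.+ s ℕ.≤ v →
  βExceeds (2 ℕ.* s ℕ.* (2 ℕ.* s) ℕ.* (2 ℕ.* s) ℕ.* suc N) s v k → ι (suc N) ≤ FromNodes.variance nodes
variance-lower {v} {k} {s} nodes N 1≤s 2s≤k k+s≤v ex = ℚ.≤-trans (ι-mono N≤Nb) (*-cancelˡ 0<cn³ (≡≤ (trans (sym (ι-* (c ℕ.* n³) (suc N ℕ.* b))) (cong ι (eq₁ c (suc N) n)))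
  (ℚ.≤-trans (ι-mono (ℕ.≤-trans (ℕ.<⇒≤ ex) parts)) (≡≤ parts≡ (≤≡ (*-monoˡ 0≤variance S³≤) (eq₂ variance (ι (c ℕ.* n³))))))))
  where
  open FromNodes nodes using (variance; 0≤variance; 0≤S)
  w n c n³ b : ℕ
  w  = 2 ℕ.* s
  n  = v ℕ.∸ w ℕ.+ 1
  c  = w ℕ.* w ℕ.* w
  n³ = n ℕ.^ 3
  -- After squaring, one factor c pays for (v - 1)³ ≤ c n³. What is left, c (N + 1)², is still at
  -- least N + 1.
  b  = c ℕ.* suc N
  w≡ : w ≡ s ℕ.+ s
  w≡ = cong (s ℕ.+_) (ℕ.+-identityʳ s)
  1≤w : 1 ℕ.≤ w
  1≤w = ℕ.≤-trans 1≤s (ℕ.m≤m+n s (s ℕ.+ 0))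
  1≤n : 1 ℕ.≤ n
  1≤n = ℕ.m≤n+m 1 (v ℕ.∸ w)
  1≤c : 1 ℕ.≤ c
  1≤c = ℕ.*-mono-≤ (ℕ.*-mono-≤ 1≤w 1≤w) 1≤w
  N≤Nb : suc N ℕ.≤ suc N ℕ.* b
  N≤Nb = ℕ.≤-trans (ℕ.≤-reflexive (sym (ℕ.*-identityʳ (suc N)))) (ℕ.*-monoʳ-≤ (suc N) (ℕ.*-mono-≤ 1≤c (s≤s z≤n)))
  0<cn³ : 0ℚ < ι (c ℕ.* n³)
  0<cn³ = 0<⇒ι< {0} (ℕ.*-mono-≤ 1≤c (ℕ.*-mono-≤ 1≤n (ℕ.*-mono-≤ 1≤n (ℕ.*-mono-≤ 1≤n (s≤s (z≤n {0}))))))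
  k≤v : k ℕ.≤ v
  k≤v = ℕ.≤-trans (ℕ.m≤m+n k s) k+s≤v
  s≤k : s ℕ.≤ k
  s≤k = ℕ.≤-trans (ℕ.m≤m+n s s) 2s≤k
  w≤v : w ℕ.≤ v
  w≤v = ℕ.≤-trans (ℕ.≤-reflexive w≡) (ℕ.≤-trans 2s≤k k≤v)
  1≤k : 1 ℕ.≤ k
  1≤k = ℕ.≤-trans 1≤s s≤k
  1≤v∸k : 1 ℕ.≤ v ℕ.∸ k
  1≤v∸k = ℕ.≤-trans 1≤s (ℕ.m+n≤o⇒m≤o∸n s (ℕ.≤-trans (ℕ.≤-reflexive (ℕ.+-comm s k)) k+s≤v))
  parts : (v ℕ.∸ k ℕ.∸ s) ℕ.* (v ℕ.∸ k ℕ.∸ s) ℕ.* ((k ℕ.∸ s ℕ.+ 1) ℕ.* (k ℕ.∸ s)) ℕ.≤ (k ℕ.* (k ℕ.∸ 1)) ℕ.* ((v ℕ.∸ k) ℕ.* (v ℕ.∸ k ℕ.∸ 1))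
  parts = ℕ.≤-trans (ℕ.*-mono-≤ (ℕ.*-mono-≤ (ℕ.m∸n≤m (v ℕ.∸ k) s) (ℕ.∸-monoʳ-≤ (v ℕ.∸ k) 1≤s))
      (ℕ.*-mono-≤ (ℕ.≤-trans (ℕ.+-monoʳ-≤ (k ℕ.∸ s) 1≤s) (ℕ.≤-reflexive (ℕ.m∸n+n≡m s≤k))) (ℕ.∸-monoʳ-≤ k 1≤s)))
    (ℕ.≤-reflexive (ℕ.*-comm ((v ℕ.∸ k) ℕ.* (v ℕ.∸ k ℕ.∸ 1)) (k ℕ.* (k ℕ.∸ 1))))
  parts≡ : ι ((k ℕ.* (k ℕ.∸ 1)) ℕ.* ((v ℕ.∸ k) ℕ.* (v ℕ.∸ k ℕ.∸ 1))) ≡ variance * ((ι v - 1ℚ) * (ι v - 1ℚ) * (ι v - 1ℚ))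
  parts≡ = trans (ι-* (k ℕ.* (k ℕ.∸ 1)) ((v ℕ.∸ k) ℕ.* (v ℕ.∸ k ℕ.∸ 1))) (trans (cong₂ _*_
      (trans (ι-* k (k ℕ.∸ 1)) (cong (ι k *_) (ι-∸ 1≤k)))
      (trans (ι-* (v ℕ.∸ k) (v ℕ.∸ k ℕ.∸ 1)) (cong₂ _*_ (ι-∸ k≤v) (trans (ι-∸ 1≤v∸k) (cong (_- 1ℚ) (ι-∸ k≤v))))))
    (sym (variance-S³ nodes)))
  S≤wn : ι v - 1ℚ ≤ ι (w ℕ.* n)
  S≤wn = ≡≤ (sym (ι-∸ (ℕ.≤-trans 1≤k k≤v))) (ι-mono (ℕ.≤-trans (ℕ.m∸n≤m v 1) (ℕ.≤-trans (ℕ.≤-reflexive (sym (ℕ.m∸n+n≡m w≤v)))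
    (ℕ.≤-trans (ℕ.≤-reflexive (cong (ℕ._+ w) (sym (ℕ.*-identityˡ (v ℕ.∸ w))))) (ℕ.≤-trans (ℕ.+-monoˡ-≤ w (ℕ.*-monoˡ-≤ (v ℕ.∸ w) 1≤w)) (ℕ.≤-reflexive (eq w (v ℕ.∸ w))))))))
    where
    eq : ∀ w m → w ℕ.* m ℕ.+ w ≡ w ℕ.* (m ℕ.+ 1)
    eq = ℕ-Solver.solve-∀
  S³≤ : (ι v - 1ℚ) * (ι v - 1ℚ) * (ι v - 1ℚ) ≤ ι (c ℕ.* n³)
  S³≤ = ≤≡ (*-mono (0≤* 0≤S 0≤S) (0≤ι (w ℕ.* n)) (*-mono 0≤S (0≤ι (w ℕ.* n)) S≤wn S≤wn) S≤wn)
    (trans (cong (_* ι (w ℕ.* n)) (sym (ι-* (w ℕ.* n) (w ℕ.* n)))) (trans (sym (ι-* (w ℕ.* n ℕ.* (w ℕ.* n)) (w ℕ.* n))) (cong ι (eq w n))))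
    where
    eq : ∀ w n → w ℕ.* n ℕ.* (w ℕ.* n) ℕ.* (w ℕ.* n) ≡ w ℕ.* w ℕ.* w ℕ.* (n ℕ.* (n ℕ.* (n ℕ.* 1)))
    eq = ℕ-Solver.solve-∀
  eq₁ : ∀ c N n → c ℕ.* (n ℕ.* (n ℕ.* (n ℕ.* 1))) ℕ.* (N ℕ.* (c ℕ.* N)) ≡ c ℕ.* N ℕ.* (c ℕ.* N) ℕ.* (n ℕ.* (n ℕ.* (n ℕ.* 1)))
  eq₁ = ℕ-Solver.solve-∀
  eq₂ : ∀ a b → a * b ≡ b * a
  eq₂ = ℚ.*-comm

1<² : ∀ x → (1ℚ < x) ⊎ (1ℚ < - x) → 1ℚ < x * x
1<² x (inj₁ 1<x)  = <-by (0<* (0<- 1<x) (0<+ (0<- 1<x) (0≤ι 2))) (eq x)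
  where
  eq : ∀ x → x * x ≡ 1ℚ + (x - 1ℚ) * (x - 1ℚ + ι 2)
  eq = solve-∀ ℚ-ring
1<² x (inj₂ 1<-x) = subst (1ℚ <_) (eq x) (1<² (- x) (inj₁ 1<-x))
  where
  eq : ∀ x → - x * - x ≡ x * x
  eq = solve-∀ ℚ-ring

unbalanced-parameters : ∀ v k → ¬ (v ℕ.≤ 2 ℕ.* k ℕ.+ 1 × 2 ℕ.* k ℕ.≤ v ℕ.+ 1) → 1ℚ < (ι v - ι 2 * ι k) * (ι v - ι 2 * ι k)
unbalanced-parameters v k h with v ℕ.≤? 2 ℕ.* k ℕ.+ 1 | 2 ℕ.* k ℕ.≤? v ℕ.+ 1
... | yes p | yes q = contradiction (p , q) h
... | no ¬p | _     = 1<² (ι v - ι 2 * ι k) (inj₁ (<-by (0<- (0<⇒ι< (ℕ.≰⇒> ¬p))) (trans (eq (ι v) (ι k)) (cong (λ x → 1ℚ + (ι v - x)) (sym (trans (ι-+ (2 ℕ.* k) 1) (cong (_+ ι 1) (ι-* 2 k))))))))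
  where
  eq : ∀ v k → v - ι 2 * k ≡ 1ℚ + (v - (ι 2 * k + ι 1))
  eq = solve-∀ ℚ-ring
... | _     | no ¬q = 1<² (ι v - ι 2 * ι k) (inj₂ (<-by (0<- (0<⇒ι< (ℕ.≰⇒> ¬q))) (trans (eq (ι v) (ι k)) (cong₂ (λ x y → 1ℚ + (x - y)) (sym (ι-* 2 k)) (sym (ι-+ v 1))))))
  where
  eq : ∀ v k → - (v - ι 2 * k) ≡ 1ℚ + (ι 2 * k - (v + ι 1))
  eq = solve-∀ ℚ-ring

theorem3p4 : ∀ (s : ℕ) → 5 ℕ.≤ s →
    ∃ λ (β₀ : ℕ) → ∀ (v k λ′ : ℕ) (ℬ : List (Subset v)) →
    IsTightDesign s v k λ′ ℬ → ¬ βExceeds β₀ s v k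
theorem3p4 s 5≤s = 2 ℕ.* s ℕ.* (2 ℕ.* s) ℕ.* (2 ℕ.* s) ℕ.* suc N , no-design
  where
  -- The variance is bounded by T if |v - 2k| > 1. Otherwise v is bounded by Q, and with it the
  -- variance, which is at most v - 1. N dominates both.
  T Q : ℚ
  T = proj₁ (unbalanced-bounded s 5≤s)
  Q = ι (oddBound (s ℕ.+ 3) (s ℕ.+ s) ℕ.+ (s ℕ.+ 1))
  N = proj₁ (∃-ι-upper (∣ T ∣ + Q))
  T+Q≤N : ∣ T ∣ + Q ≤ ι N
  T+Q≤N = proj₂ (∃-ι-upper (∣ T ∣ + Q))
  T≤N : T ≤ ι N
  T≤N = ℚ.≤-trans (x≤∣x∣ T) (ℚ.≤-trans (≤-by (0≤ι (oddBound (s ℕ.+ 3) (s ℕ.+ s) ℕ.+ (s ℕ.+ 1))) refl) T+Q≤N)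
  Q≤N : Q ≤ ι N
  Q≤N = ℚ.≤-trans (≤-by (ℚ.0≤∣p∣ T) (ℚ.+-comm ∣ T ∣ Q)) T+Q≤N
  1≤s : 1 ℕ.≤ s
  1≤s = ℕ.≤-trans (s≤s z≤n) 5≤s
  2s≡s+s : 2 ℕ.* s ≡ s ℕ.+ s
  2s≡s+s = cong (s ℕ.+_) (ℕ.+-identityʳ s)
  no-design : ∀ v k λ′ ℬ → IsTightDesign s v k λ′ ℬ → ¬ βExceeds (2 ℕ.* s ℕ.* (2 ℕ.* s) ℕ.* (2 ℕ.* s) ℕ.* suc N) s v k
  -- There is no base block to fix in an empty list, but v C s is not 0.
  no-design v k λ′ [] D _ = <⇒≢ (ff-0< s s≤v) (trans (sym (ℚ.*-zeroˡ (ff (ι s) s))) (trans (cong (λ m → ι m * ff (ι s) s) (IsTightDesign.size D)) (choose v s s≤v)))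
    where
    s≤v = ℕ.≤-trans (ℕ.m≤n+m s k) (IsTightDesign.v≥k+s D)
  no-design v k λ′ (B₀ ∷ ℬ) D ex = cases (v ℕ.≤? 2 ℕ.* k ℕ.+ 1) (2 ℕ.* k ℕ.≤? v ℕ.+ 1)
    where
    open IsTightDesign D using (size) renaming (v≥k+s to k+s≤v)
    design : IsDesign (s ℕ.+ s) v k λ′ (B₀ ∷ ℬ)
    design = subst (λ t → IsDesign t v k λ′ (B₀ ∷ ℬ)) 2s≡s+s (IsTightDesign.design D)
    2s≤k : s ℕ.+ s ℕ.≤ k
    2s≤k = IsDesign.t≤k design
    module TD = TightDesign design k+s≤v size 1≤s
    nodes : NodeData v k s
    nodes = TD.nodes (ℕ.pred s) (sym (ℕ.suc-pred s {{ℕ.>-nonZero 1≤s}}))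
    open FromNodes nodes using (variance; variance≤S)
    N<variance : ι (suc N) ≤ variance
    N<variance = variance-lower nodes N 1≤s 2s≤k k+s≤v ex
    N≤variance : ι N ≤ variance
    N≤variance = ℚ.≤-trans (ι-mono (ℕ.n≤1+n N)) N<variance
    2≤s : 2 ℕ.≤ s
    2≤s = ℕ.≤-trans (s≤s (s≤s z≤n)) 5≤s
    balanced : v ℕ.≤ 2 ℕ.* k ℕ.+ 1 → 2 ℕ.* k ℕ.≤ v ℕ.+ 1 → ⊥
    balanced v≤ ≤v = ≤⇒≯ (ℚ.≤-trans N≤variance variance≤S) (ℚ.<-≤-trans (<-by 0<1 (eq (ι v))) (ℚ.≤-trans (ι-mono (balanced-bounded s v k 2≤s 2s≤k v≤ ≤v TD.divisibility)) Q≤N))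
      where
      eq : ∀ v → v ≡ v - 1ℚ + 1ℚ
      eq = solve-∀ ℚ-ring
    unbalanced : ¬ (v ℕ.≤ 2 ℕ.* k ℕ.+ 1 × 2 ℕ.* k ℕ.≤ v ℕ.+ 1) → ⊥
    unbalanced h = proj₂ (unbalanced-bounded s 5≤s) nodes (ℕ.≤-trans 2≤s (ℕ.≤-trans (ℕ.m≤m+n s s) 2s≤k))
      (ℕ.≤-trans (ℕ.≤-reflexive (ℕ.+-comm 2 k)) (ℕ.≤-trans (ℕ.+-monoʳ-≤ k 2≤s) k+s≤v)) (unbalanced-parameters v k h) (ℚ.≤-trans T≤N N≤variance)
    cases : Dec (v ℕ.≤ 2 ℕ.* k ℕ.+ 1) → Dec (2 ℕ.* k ℕ.≤ v ℕ.+ 1) → ⊥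
    cases (yes p) (yes q) = balanced p q
    cases (no ¬p) _       = unbalanced (¬p ∘ proj₁)
    cases _       (no ¬q) = unbalanced (¬q ∘ proj₂)
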